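{- Let $k$ be a fixed positive integer. Let $p,q,c^*\in[0,1]$ and $a,b\ge 1$ be such that $\frac{q}{b}=1-\frac{c^*}{2}$. Suppose there is a (randomized) algorithm $\mathcal{A}$ that runs in time $a^n 2^{o(n)}$ and that, for every satisfiable $(\le k)$-CNF formula $F$ with $c(F)\ge c^*$, finds a satisfying assignment of $F$ with probability at least $p^n\left(\frac12\right)^{o(n)}$. Then there exists a (randomized) algorithm $\mathcal{A}'$ that runs in time $\max\{a,b\}^n 2^{o(n)}$ and that, for every satisfiable $(\le k)$-CNF formula $F$, finds a satisfying assignment of $F$ with probability at least $\min\{p,q\}^n\left(\frac12\right)^{o(n)}$. Here $n$ denotes the number of variables of the input formula.
   Context: A literal is a propositional variable $x$ or its complement $\bar x$. A clause is a finite set of literals over pairwise distinct variables; a CNF formula is a finite set of clauses. $\mathrm{vbl}(F)$ is the set of variables occurring in $F$ and $n=|\mathrm{vbl}(F)|$. A $(\le k)$-CNF formula is a CNF formula in which every clause has at most $k$ literals. An assignment is a function $\alpha:\mathrm{vbl}(F)\to\{0,1\}$; it satisfies a literal $x$ (resp. $\bar x$) if $\alpha(x)=1$ (resp. $\alpha(x)=0$), satisfies a clause if it satisfies at least one of its literals, and satisfies $F$ if it satisfies every clause of $F$. $F$ is satisfiable if it has a satisfying assignment. For a satisfiable CNF formula $F$, a variable $x$ of $F$ is critical if all satisfying assignments of $F$ agree on $x$. $c(F)$ denotes the number of critical variables of $F$ divided by the number $n$ of variables of $F$; if $n=0$, then $c(F):=1$. The $o(n)$ terms are functions of $n$ only.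 Algorithms may be randomized, and probabilities are over the algorithm's internal randomness. -}

module Defs where

open import Algebra.Bundles using (CommutativeRing)
import Algebra.Construct.NaturalChoice.Max as Max
import Algebra.Construct.NaturalChoice.Min as Min
import Algebra.Properties.Semiring.Exp as Exp
import Algebra.Properties.Semiring.Mult as Mult
open import Data.Bool.Base using (Bool; true; false; if_then_else_)
import Data.Bool.Properties as Bool
open import Data.Fin.Base using (Fin)
open import Data.Fin.Properties using (any?)
open import Data.Fin.Subset.Properties using (anySubset?)
open import Data.List.Base as List using (List; []; _∷_; filter; length; cartesianProductWith; allFin)
open import Data.List.Relation.Unary.All as All using (All)
open import Data.List.Relation.Unary.Any using (Any)
open import Data.List.Relation.Unary.Unique.Propositional using (Unique)
open import Data.Maybe using (Maybe; just; nothing; Is-just; is-just)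
import Data.Maybe.Properties as Maybe
open import Data.Nat.Base as ℕ using (ℕ; zero; suc)
open import Data.Nat.DivMod using (_%_)
open import Data.Product.Base using (∃; ∃-syntax; _×_; _,_; proj₁; proj₂)
open import Data.Vec.Base as Vec using (Vec; []; _∷_; lookup; countᵇ)
open import Function.Base using (_∘_)
open import Level using (_⊔_) renaming (suc to lsuc)
open import Relation.Binary.Bundles using (TotalOrder)
open import Relation.Binary.Definitions using (DecidableEquality)
open import Relation.Binary.PropositionalEquality using (_≡_; refl; cong₂)
open import Relation.Binary.Structures using (IsDecTotalOrder)
open import Relation.Nullary using (¬_; Dec; yes; no)
open import Relation.Nullary.Decidable using (map′; ¬?; _×-dec_; _→-dec_; decidable-stable; ⌊_⌋)
open import Relation.Unary using (Pred; Decidable)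

------------------------------------------------------------------------
-- Numbers

-- Classical ℝ is an instance.  Completeness is not required, so ℚ is one too.
-- The value of 0# ⁻¹ is left unspecified.
record ArchimedeanOrderedField c ℓ₁ ℓ₂ : Set (lsuc (c ⊔ ℓ₁ ⊔ ℓ₂)) where
  infix  8 _⁻¹
  infix  4 _≤_
  field
    commutativeRing : CommutativeRing c ℓ₁
  open CommutativeRing commutativeRing public
    using (Carrier; _≈_; _+_; _*_; _-_; 0#; 1#; semiring)
  open Exp semiring public using (_^_)
  open Mult semiring public
    using () renaming (_×_ to _·_)
  field
    _≤_             : Carrier → Carrier → Set ℓ₂
    _⁻¹             : Carrier → Carrier
    isDecTotalOrder : IsDecTotalOrder _≈_ _≤_
    0≉1             : ¬ (0# ≈ 1#)
    ⁻¹-inverse      : ∀ {x} → ¬ (x ≈ 0#) → x * x ⁻¹ ≈ 1#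
    +-monoˡ-≤       : ∀ {x y} z → x ≤ y → x + z ≤ y + z
    *-nonNegative   : ∀ {x y} → 0# ≤ x → 0# ≤ y → 0# ≤ x * y
    archimedean     : ∀ x → ∃[ n ] x ≤ n · 1#

  open IsDecTotalOrder isDecTotalOrder public using (isTotalOrder; _≤?_)

  totalOrder : TotalOrder c ℓ₁ ℓ₂
  totalOrder = record { isTotalOrder = isTotalOrder }

  open Min totalOrder public
    using () renaming (_⊓_ to min)
  open Max totalOrder public
    using () renaming (_⊔_ to max)

  infixl 7 _/_
  _/_ : Carrier → Carrier → Carrier
  x / y = x * y ⁻¹

  fromℕ : ℕ → Carrier
  fromℕ n = n · 1#

  2# ½ : Carrier
  2# = fromℕ 2
  ½  = 1# / 2#

  -- The largest m ≤ n with m ≤ x, or 0 if there is none.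
  floorUpTo : ℕ → Carrier → ℕ
  floorUpTo zero    x = zero
  floorUpTo (suc n) x = if ⌊ fromℕ (suc n) ≤? x ⌋ then suc n else floorUpTo n x

  -- max(0, ⌊x⌋)
  floor : Carrier → ℕ
  floor x = floorUpTo (proj₁ (archimedean x)) x

  -- For 0 ≤ x: bit 0 is the parity of ⌊x⌋, and bit i ≥ 1 is the i-th digit
  -- after the binary point.
  binaryDigit : Carrier → ℕ → Bool
  binaryDigit x i = (floor (2# ^ i * x) % 2) ℕ.≡ᵇ 1

-- f(n) = o(n).  A natural-valued f loses no generality in bounds of the form
-- … ≤ xⁿ 2^o(n) and … ≥ xⁿ (1/2)^o(n), as ⌈|f|⌉ is o(n) whenever f is.
LittleO : (ℕ → ℕ) → Set
LittleO f = ∀ m → ∃[ N ] (∀ n → N ℕ.≤ n → m ℕ.* f n ℕ.≤ n)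

------------------------------------------------------------------------
-- CNF formulas

-- A set of literals over pairwise distinct variables is a partial map from
-- variables to signs: just true for x, just false for its complement.
Clause : ℕ → Set
Clause n = Vec (Maybe Bool) n

width : ∀ {n} → Clause n → ℕ
width = countᵇ is-just

-- Formulas whose set vbl(F) of occurring variables is exactly Fin n, i.e. with
-- the variables numbered 0, …, n - 1.  With arbitrary names the input could not
-- even be read in time bounded by a function of n.
record CNF (n : ℕ) : Set where
  field
    clauses  : List (Clause n)
    distinct : Unique clauses
    occurs   : ∀ (x : Fin n) → Any (λ C → Is-just (lookup C x)) clauses
open CNF public

WidthAtMost : ∀ {n} → ℕ → CNF n → Set
WidthAtMost k F = All (λ C → width C ℕ.≤ k) (clauses F)

Assignment : ℕ → Set
Assignment n = Vec Bool n

SatisfiesClause : ∀ {n} → Assignment n → Clause n → Set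
SatisfiesClause α C = ∃[ x ] lookup C x ≡ just (lookup α x)

infix 4 _⊨_
_⊨_ : ∀ {n} → Assignment n → CNF n → Set
α ⊨ F = All (SatisfiesClause α) (clauses F)

_⊨?_ : ∀ {n} (α : Assignment n) (F : CNF n) → Dec (α ⊨ F)
α ⊨? F = All.all?
  (λ C → any? (λ x → Maybe.≡-dec Bool._≟_ (lookup C x) (just (lookup α x))))
  (clauses F)

Satisfiable : ∀ {n} → CNF n → Set
Satisfiable F = ∃[ α ] α ⊨ F

Critical : ∀ {n} → CNF n → Fin n → Set
Critical F x = ∀ α β → α ⊨ F → β ⊨ F → lookup α x ≡ lookup β x

allAssignments? : ∀ {n p} {P : Pred (Assignment n) p} → Decidable P → Dec (∀ α → P α)
allAssignments? P? = map′
  (λ ¬∃¬ α → decidable-stable (P? α) (λ ¬p → ¬∃¬ (α , ¬p)))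
  (λ ∀p (α , ¬p) → ¬p (∀p α))
  (¬? (anySubset? (¬? ∘ P?)))

critical? : ∀ {n} (F : CNF n) → Decidable (Critical F)
critical? F x = allAssignments? λ α → allAssignments? λ β →
  (α ⊨? F) →-dec ((β ⊨? F) →-dec (lookup α x Bool.≟ lookup β x))

#critical : ∀ {n} → CNF n → ℕ
#critical F = length (filter (critical? F) (allFin _))

------------------------------------------------------------------------
-- Randomised algorithms: Jones's WHILE language over binary trees, with fair
-- coin tosses and read access to the binary digits of m fixed constants.  The
-- constants are for parameters such as growth rates: an arbitrary real need not
-- be computable, yet an algorithm may have to repeat something about bⁿ times.

data Tree : Set where
  nil  : Tree
  cons : Tree → Tree → Tree

_≟ᵀ_ : DecidableEquality Tree
nil      ≟ᵀ nil        = yes refl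
nil      ≟ᵀ cons _ _   = no λ ()
cons _ _ ≟ᵀ nil        = no λ ()
cons s t ≟ᵀ cons s′ t′ = map′
  (λ (p , q) → cong₂ cons p q)
  (λ { refl → refl , refl })
  ((s ≟ᵀ s′) ×-dec (t ≟ᵀ t′))

head tail : Tree → Tree
head nil        = nil
head (cons s _) = s
tail nil        = nil
tail (cons _ t) = t

spine : Tree → ℕ
spine nil        = 0
spine (cons _ t) = suc (spine t)

encodeBool : Bool → Tree
encodeBool false = nil
encodeBool true  = cons nil nil

encodeMaybe : Maybe Bool → Tree
encodeMaybe nothing  = nil
encodeMaybe (just b) = cons nil (encodeBool b)

encodeList : List Tree → Tree
encodeList = List.foldr cons nil

encodeVec : ∀ {n} {A : Set} → (A → Tree) → Vec A n → Tree
encodeVec f v = encodeList (List.map f (Vec.toList v))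

encodeAssignment : ∀ {n} → Assignment n → Tree
encodeAssignment = encodeVec encodeBool

-- The size is polynomial in n for every fixed clause width, so the order of
-- the clauses and the n entries per clause only affect 2^o(n) factors.
encodeCNF : ∀ {n} → CNF n → Tree
encodeCNF F = encodeList (List.map (encodeVec encodeMaybe) (clauses F))

Register : Set
Register = ℕ

data Expr : Set where
  reg     : Register → Expr
  nilᵉ    : Expr
  consᵉ   : Expr → Expr → Expr
  hdᵉ tlᵉ : Expr → Expr

infixr 5 _⨾_
infix  6 _≔_
data Program (m : ℕ) : Set where
  skip  : Program m
  _≔_   : Register → Expr → Program m
  _⨾_   : Program m → Program m → Program m
  ifnil : Expr → Program m → Program m → Program m
  while : Expr → Program m → Program m
  toss  : Register → Program m
  -- digit r j e: store in r the digit of constant j at the position given in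
  -- unary by the spine of e.
  digit : Register → Fin m → Expr → Program m

Store : Set
Store = Register → Tree

⟦_⟧ : Expr → Store → Tree
⟦ reg r ⟧       σ = σ r
⟦ nilᵉ ⟧        σ = nil
⟦ consᵉ e₁ e₂ ⟧ σ = cons (⟦ e₁ ⟧ σ) (⟦ e₂ ⟧ σ)
⟦ hdᵉ e ⟧       σ = head (⟦ e ⟧ σ)
⟦ tlᵉ e ⟧       σ = tail (⟦ e ⟧ σ)

_[_↦_] : Store → Register → Tree → Store
(σ [ r ↦ t ]) s = if r ℕ.≡ᵇ s then t else σ s

-- The commands still to be executed, and the current store.
Config : ℕ → Set
Config m = List (Program m) × Store

Halted : ∀ {m} → Config m → Set
Halted (K , _) = K ≡ []

halted? : ∀ {m} (cfg : Config m) → Dec (Halted cfg)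
halted? ([]    , _) = yes refl
halted? (_ ∷ _ , _) = no λ ()

Digits : ℕ → Set
Digits m = Fin m → ℕ → Bool

branch : ∀ {m} → Tree → List (Program m) → List (Program m) → List (Program m)
branch nil        K₁ K₂ = K₁
branch (cons _ _) K₁ K₂ = K₂

-- One unit of time.  A fresh fair coin is supplied to every step, but only
-- toss looks at it.
step : ∀ {m} → Digits m → Bool → Config m → Config m
step δ coin ([]                , σ) = [] , σ
step δ coin (skip          ∷ K , σ) = K , σ
step δ coin ((r ≔ e)       ∷ K , σ) = K , σ [ r ↦ ⟦ e ⟧ σ ]
step δ coin ((P ⨾ Q)       ∷ K , σ) = P ∷ Q ∷ K , σ
step δ coin (ifnil e P Q   ∷ K , σ) = branch (⟦ e ⟧ σ) (P ∷ K) (Q ∷ K) , σ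
step δ coin (while e P     ∷ K , σ) = branch (⟦ e ⟧ σ) K (P ∷ while e P ∷ K) , σ
step δ coin (toss r        ∷ K , σ) = K , σ [ r ↦ encodeBool coin ]
step δ coin (digit r j e   ∷ K , σ) = K , σ [ r ↦ encodeBool (δ j (spine (⟦ e ⟧ σ))) ]

run : ∀ {m T} → Digits m → Vec Bool T → Config m → Config m
run δ []       cfg = cfg
run δ (c ∷ cs) cfg = run δ cs (step δ c cfg)

-- Input and output are in register 0; all other registers start as nil.
initial : ∀ {m} → Program m → Tree → Config m
initial P t = P ∷ [] , λ { zero → t ; (suc _) → nil }

execute : ∀ {m n T} → Digits m → Program m → CNF n → Vec Bool T → Config m
execute δ P F ω = run δ ω (initial P (encodeCNF F))

HaltsWithin : ∀ {m n} → Digits m → Program m → CNF n → ℕ → Set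
HaltsWithin δ P F T = ∀ (ω : Vec Bool T) → Halted (execute δ P F ω)

FindsSolution : ∀ {m n T} → Digits m → Program m → CNF n → Vec Bool T → Set
FindsSolution δ P F ω =
  Halted (execute δ P F ω) ×
  ∃[ α ] (α ⊨ F × proj₂ (execute δ P F ω) 0 ≡ encodeAssignment α)

findsSolution? : ∀ {m n T} (δ : Digits m) (P : Program m) (F : CNF n) →
                 Decidable (FindsSolution {T = T} δ P F)
findsSolution? δ P F ω =
  halted? (execute δ P F ω) ×-dec
  anySubset? λ α → (α ⊨? F) ×-dec (proj₂ (execute δ P F ω) 0 ≟ᵀ encodeAssignment α)

bitVectors : ∀ T → List (Vec Bool T)
bitVectors zero    = [] ∷ []
bitVectors (suc T) = cartesianProductWith _∷_ (true ∷ false ∷ []) (bitVectors T)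

------------------------------------------------------------------------
-- Quantitative notions

module Quantities {c ℓ₁ ℓ₂} (R : ArchimedeanOrderedField c ℓ₁ ℓ₂) where
  open ArchimedeanOrderedField R

  criticalFraction : ∀ {n} → CNF n → Carrier
  criticalFraction {zero}  F = 1#
  criticalFraction {suc n} F = fromℕ (#critical F) / fromℕ (suc n)

  -- Probability of an event under the uniform distribution on {0,1}ᵀ.
  Pr : ∀ {T p} {E : Pred (Vec Bool T) p} → Decidable E → Carrier
  Pr {T} E? = fromℕ (length (filter E? (bitVectors T))) / (2# ^ T)

  digitsOf : ∀ {m} → Vec Carrier m → Digits m
  digitsOf xs j = binaryDigit (lookup xs j)

  -- Time is worst-case over inputs and coin tosses, on all (≤ k)-CNF inputs
  -- whether satisfiable or not.
  RunsInTime : ∀ {m} → Vec Carrier m → ℕ → Program m → Carrier → Set ℓ₂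
  RunsInTime xs k P t =
    ∃[ f ] (LittleO f ×
      (∀ {n} (F : CNF n) → WidthAtMost k F →
       ∃[ T ] (HaltsWithin (digitsOf xs) P F T × fromℕ T ≤ t ^ n * 2# ^ f n)))

  -- The probability does not depend on T once every run halts within T steps.
  SucceedsWithProbability : ∀ {m ℓ} → Vec Carrier m → ℕ → Program m →
    (∀ {n} → CNF n → Set ℓ) → Carrier → Set (ℓ ⊔ ℓ₂)
  SucceedsWithProbability xs k P Φ s =
    ∃[ f ] (LittleO f ×
      (∀ {n} (F : CNF n) → WidthAtMost k F → Satisfiable F → Φ F →
       ∀ T → HaltsWithin (digitsOf xs) P F T →
       s ^ n * ½ ^ f n ≤ Pr (findsSolution? {T = T} (digitsOf xs) P F)))

module Submission where

open import Algebra.Bundles using (CommutativeRing)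
import Algebra.Construct.NaturalChoice.Max as Max
import Algebra.Construct.NaturalChoice.Min as Min
import Algebra.Properties.Ring as RingProperties
import Algebra.Properties.Semiring.Exp as Exp
import Algebra.Properties.Semiring.Mult as Mult
import Algebra.Solver.Ring.NaturalCoefficients.Default as SemiringSolver
open import Data.Bool.Base using (Bool; true; false; if_then_else_; not)
import Data.Bool.Properties as Bool
open import Data.Empty using (⊥-elim)
open import Data.Fin.Base as Fin using (Fin; zero; suc)
import Data.Fin.Properties as Fin
open import Data.Fin.Subset.Properties using (anySubset?)
open import Data.List.Base as List using (List; []; _∷_; _++_; filter; length)
open import Data.List.Membership.Propositional using (_∈_; lose)
open import Data.List.Membership.Propositional.Properties as Mem using (∈-map⁺; ∈-map⁻; ∈-∃++)
import Data.List.Properties as List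
open import Data.List.Relation.Unary.All as All using (All; []; _∷_)
open import Data.List.Relation.Unary.AllPairs using ([]; _∷_)
open import Data.List.Relation.Unary.Any using (Any; here; there)
open import Data.List.Relation.Unary.Unique.Propositional using (Unique)
open import Data.Maybe using (Maybe; just; nothing; Is-just; is-just)
import Data.Maybe.Relation.Unary.Any as Maybe
open import Data.Nat.Base as ℕ using (ℕ; zero; suc)
import Data.Nat.DivMod as ℕ
import Data.Nat.Properties as ℕ
open import Data.Nat.Tactic.RingSolver using (solve-∀)
open import Data.Product.Base using (∃-syntax; _×_; _,_; proj₁; proj₂)
open import Data.Sum.Base using (_⊎_; inj₁; inj₂)
open import Data.Unit.Base using (⊤; tt)
open import Data.Vec.Base as Vec using (Vec; []; _∷_; lookup; zipWith; replicate; _[_]≔_)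
import Data.Vec.Properties as Vec
open import Function.Base using (_∘_; id; case_of_)
open import Level using (_⊔_)
open import Relation.Binary.Bundles using (TotalOrder)
open import Relation.Binary.PropositionalEquality as ≡ using (_≡_; _≢_; refl; cong; cong₂; subst; sym; trans)
import Relation.Binary.Reasoning.PartialOrder as PosetReasoning
open import Relation.Binary.Structures using (IsDecTotalOrder)
open import Relation.Nullary using (¬_; Dec; yes; no)
open import Relation.Nullary.Decidable using (⌊_⌋; _×-dec_)
open import Relation.Unary using (Pred; Decidable)
open import Defs

-- If fewer than a c*-fraction of the variables of a satisfiable formula are
-- critical, then giving a random variable a random value keeps the formula
-- satisfiable with probability at least 1 - c*/2 = q/b.  So after some number i
-- of such steps (at the latest when no variable is left) the formula has at
-- least a c*-fraction of critical variables, and 𝒜 solves it with probability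
-- about p^(n - i).  The number i is not known, so 𝒜′ repeats, for every i ≤ n, about
-- bⁱ times the trial "i random steps, then 𝒜".
--
-- Let valᵢ(π) be the success probability of the trial with i steps from the partial
-- assignment π.  The expected number Σᵢ bⁱ valᵢ(π) of successful trials is bounded
-- below by induction on the number N of unassigned variables: either 𝒜 may be
-- called at once, or one step multiplies the sum by b · q/b = q.  This gives
-- Y = Ω(min(p,q)ⁿ 2^-o(n)), and independent trials with Y expected successes all
-- fail with probability at most 1 / (1 + Y).
--
-- The number of trials is kept in unary: Xᵢ₊₁ = B ⌈Xᵢ/D⌉ with D = 2^(1 + l), where l is
-- the length of n in binary, and B = ⌊bD⌋ + 1, so that bⁱ ≤ Xᵢ ≤ bⁱ poly(n).  A random one
-- of N variables is chosen by a number of 2 + 2l random bits modulo N, which is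
-- close enough to uniform.

-- Subexponential bounds

-- Whether enough variables are critical cannot be tested, so the stopping time of the random walk
-- lives in the analysis alone. Three obstacles shape the rest. The formula handed to 𝒜 must have
-- exactly its occurring variables, so a restriction is cleaned, renumbered and deduplicated; a
-- variable that vanishes leaves both its values good, which only helps the count. The o(n) terms of
-- 𝒜 need not be monotone although 𝒜 runs on formulas of all sizes up to n, so running maxima
-- replace them. The field has neither exponentials nor logarithms: the failure bound 1 / (1 + Y)
-- stands in for exp(-Y) because it follows by induction over the trials, and the two rounding
-- errors, (1 + 1/D)ⁿ ≤ 2 for the numbers of trials and (1 - n/4^(1+l))ⁿ ≥ 1/2 for the random
-- choices, both come from Bernoulli's inequality. Routines are written in a functional language
-- whose folds are polynomial by construction. The other programs are handled by a backward calculus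
-- in which a state carries a lower bound on the expected pay-off, so that correctness, probability
-- and time are proved in one pass.

module Asymptotics where
  open ℕ.≤-Reasoning

  infixl 6 _⊕_
  infixl 7 _⊗_
  -- A syntax instead of functions: bounds can be composed, and being subexponential is proved by
  -- induction on it.
  data Poly : Set where
    con : ℕ → Poly
    X   : Poly
    _⊕_ _⊗_ : Poly → Poly → Poly

  eval : Poly → ℕ → ℕ
  eval (con c) n = c
  eval X       n = n
  eval (p ⊕ q) n = eval p n ℕ.+ eval q n
  eval (p ⊗ q) n = eval p n ℕ.* eval q n

  eval-mono : ∀ p {m n} → m ℕ.≤ n → eval p m ℕ.≤ eval p n
  eval-mono (con c) m≤n = ℕ.≤-refl
  eval-mono X       m≤n = m≤n
  eval-mono (p ⊕ q) m≤n = ℕ.+-mono-≤ (eval-mono p m≤n) (eval-mono q m≤n)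
  eval-mono (p ⊗ q) m≤n = ℕ.*-mono-≤ (eval-mono p m≤n) (eval-mono q m≤n)

  infixr 8 _⊚_
  _⊚_ : Poly → Poly → Poly
  con c   ⊚ q = con c
  X       ⊚ q = q
  (p ⊕ r) ⊚ q = (p ⊚ q) ⊕ (r ⊚ q)
  (p ⊗ r) ⊚ q = (p ⊚ q) ⊗ (r ⊚ q)

  eval-⊚ : ∀ p q n → eval (p ⊚ q) n ≡ eval p (eval q n)
  eval-⊚ (con c) q n = refl
  eval-⊚ X       q n = refl
  eval-⊚ (p ⊕ r) q n = cong₂ ℕ._+_ (eval-⊚ p q n) (eval-⊚ r q n)
  eval-⊚ (p ⊗ r) q n = cong₂ ℕ._*_ (eval-⊚ p q n) (eval-⊚ r q n)

  eval-⊚-≤ : ∀ p q {m} n → m ℕ.≤ eval q n → eval p m ℕ.≤ eval (p ⊚ q) n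
  eval-⊚-≤ p q n m≤ = ℕ.≤-trans (eval-mono p m≤) (ℕ.≤-reflexive (sym (eval-⊚ p q n)))

  power : ℕ → Poly → Poly
  power zero    p = con 1
  power (suc k) p = p ⊗ power k p

  eval-power : ∀ k p n → eval (power k p) n ≡ eval p n ℕ.^ k
  eval-power zero    p n = refl
  eval-power (suc k) p n = cong (eval p n ℕ.*_) (eval-power k p n)

  littleO-const : ∀ c → LittleO (λ _ → c)
  littleO-const c m = m ℕ.* c , λ n N≤n → N≤n

  littleO-+ : ∀ {f g} → LittleO f → LittleO g → LittleO (λ n → f n ℕ.+ g n)
  littleO-+ {f} {g} of og m with of (2 ℕ.* m) | og (2 ℕ.* m)
  ... | N₁ , h₁ | N₂ , h₂ = N₁ ℕ.+ N₂ , λ n N≤n → ℕ.*-cancelˡ-≤ 2 (begin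
    2 ℕ.* (m ℕ.* (f n ℕ.+ g n))              ≡⟨ lem m (f n) (g n) ⟩
    2 ℕ.* m ℕ.* f n ℕ.+ 2 ℕ.* m ℕ.* g n      ≤⟨ ℕ.+-mono-≤ (h₁ n (ℕ.m+n≤o⇒m≤o N₁ N≤n)) (h₂ n (ℕ.m+n≤o⇒n≤o N₁ N≤n)) ⟩
    n ℕ.+ n                                  ≡⟨ lem₂ n ⟩
    2 ℕ.* n                                  ∎)
    where
    lem : ∀ m a b → 2 ℕ.* (m ℕ.* (a ℕ.+ b)) ≡ 2 ℕ.* m ℕ.* a ℕ.+ 2 ℕ.* m ℕ.* b
    lem = solve-∀
    lem₂ : ∀ n → n ℕ.+ n ≡ 2 ℕ.* n
    lem₂ = solve-∀

  -- The bounds assumed for 𝒜 are applied to restrictions with fewer variables; a monotone majorant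
  -- makes them uniform in the number n of variables of the input.
  runningMax : (ℕ → ℕ) → ℕ → ℕ
  runningMax f zero    = f zero
  runningMax f (suc n) = f (suc n) ℕ.⊔ runningMax f n

  ≤-runningMax : ∀ f {m n} → m ℕ.≤ n → f m ℕ.≤ runningMax f n
  ≤-runningMax f {m} {n} m≤n = go (ℕ.≤⇒≤′ m≤n)
    where
    go : ∀ {n} → m ℕ.≤′ n → f m ℕ.≤ runningMax f n
    go {zero}  ℕ.≤′-refl     = ℕ.≤-refl
    go {suc n} ℕ.≤′-refl     = ℕ.m≤m⊔n _ _
    go         (ℕ.≤′-step p) = ℕ.≤-trans (go p) (ℕ.m≤n⊔m _ _)

  -- Beyond N the m-fold values stay below n; before N they are at most m · runningMax f N.
  littleO-runningMax : ∀ {f} → LittleO f → LittleO (runningMax f)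
  littleO-runningMax {f} of m with of m
  ... | N , h = N ℕ.+ m ℕ.* runningMax f N , λ n N≤n →
    ℕ.≤-trans (bound n) (ℕ.⊔-lub ℕ.≤-refl (ℕ.≤-trans (ℕ.m≤n+m _ N) N≤n))
    where
    bound : ∀ n → m ℕ.* runningMax f n ℕ.≤ n ℕ.⊔ (m ℕ.* runningMax f N)
    bound n with ℕ.≤-total n N
    ... | inj₁ n≤N = ℕ.≤-trans (ℕ.*-monoʳ-≤ m (mono (ℕ.≤⇒≤′ n≤N))) (ℕ.m≤n⊔m n _)
      where
      mono : ∀ {n k} → n ℕ.≤′ k → runningMax f n ℕ.≤ runningMax f k
      mono ℕ.≤′-refl     = ℕ.≤-refl
      mono (ℕ.≤′-step p) = ℕ.≤-trans (mono p) (ℕ.m≤n⊔m _ _)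
    ... | inj₂ N≤n = go (ℕ.≤⇒≤′ N≤n)
      where
      go : ∀ {n} → N ℕ.≤′ n → m ℕ.* runningMax f n ℕ.≤ n ℕ.⊔ (m ℕ.* runningMax f N)
      go ℕ.≤′-refl = ℕ.m≤n⊔m N _
      go {suc n} (ℕ.≤′-step p) = begin
        m ℕ.* (f (suc n) ℕ.⊔ runningMax f n)            ≡⟨ ℕ.*-distribˡ-⊔ m (f (suc n)) _ ⟩
        m ℕ.* f (suc n) ℕ.⊔ m ℕ.* runningMax f n        ≤⟨ ℕ.⊔-mono-≤ (h (suc n) (ℕ.≤-trans (ℕ.≤′⇒≤ p) (ℕ.n≤1+n n))) (go p) ⟩
        suc n ℕ.⊔ (n ℕ.⊔ m ℕ.* runningMax f N)          ≤⟨ ℕ.⊔-lub (ℕ.m≤m⊔n (suc n) (m ℕ.* runningMax f N)) (ℕ.⊔-lub (ℕ.≤-trans (ℕ.n≤1+n n) (ℕ.m≤m⊔n (suc n) (m ℕ.* runningMax f N))) (ℕ.m≤n⊔m (suc n) (m ℕ.* runningMax f N))) ⟩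
        suc n ℕ.⊔ m ℕ.* runningMax f N                  ∎

  n<2^n : ∀ n → n ℕ.< 2 ℕ.^ n
  n<2^n zero    = ℕ.s≤s ℕ.z≤n
  n<2^n (suc n) = begin
    2 ℕ.+ n                 ≡⟨ ℕ.+-comm 1 (suc n) ⟩
    suc n ℕ.+ 1             ≤⟨ ℕ.+-mono-≤ (n<2^n n) (ℕ.m^n>0 2 n) ⟩
    2 ℕ.^ n ℕ.+ 2 ℕ.^ n     ≡⟨ lem (2 ℕ.^ n) ⟩
    2 ℕ.* 2 ℕ.^ n           ∎
    where
    lem : ∀ x → x ℕ.+ x ≡ 2 ℕ.* x
    lem = solve-∀

  n²≤2·2^n : ∀ n → n ℕ.* n ℕ.≤ 2 ℕ.* 2 ℕ.^ n
  n²≤2·2^n 0 = ℕ.z≤n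
  n²≤2·2^n 1 = ℕ.s≤s ℕ.z≤n
  n²≤2·2^n 2 = ℕ.m≤m+n 4 4
  n²≤2·2^n 3 = ℕ.m≤m+n 9 7
  -- 2n² reaches (n + 1)² only from n = 3 on, hence the four base cases; the added summand is 2n² -
  -- (n + 1)² at n = 3 + k.
  n²≤2·2^n (suc n@(suc (suc (suc k)))) = begin
    suc n ℕ.* suc n                                           ≤⟨ ℕ.m≤m+n _ _ ⟩
    suc n ℕ.* suc n ℕ.+ (k ℕ.* k ℕ.+ 4 ℕ.* k ℕ.+ 2)           ≡⟨ lem k ⟩
    2 ℕ.* (n ℕ.* n)                                           ≤⟨ ℕ.*-monoʳ-≤ 2 (n²≤2·2^n n) ⟩
    2 ℕ.* (2 ℕ.* 2 ℕ.^ n)                                     ∎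
    where
    lem : ∀ k → (4 ℕ.+ k) ℕ.* (4 ℕ.+ k) ℕ.+ (k ℕ.* k ℕ.+ 4 ℕ.* k ℕ.+ 2) ≡ 2 ℕ.* ((3 ℕ.+ k) ℕ.* (3 ℕ.+ k))
    lem = solve-∀

  -- The first argument is fuel, sufficient as soon as it is at least the second. The set-up loop of
  -- the program has the same shape: n rounds, idle once the number is 0.
  halvings : ℕ → ℕ → ℕ
  halvings zero    x       = 0
  halvings (suc f) zero    = 0
  halvings (suc f) (suc x) = suc (halvings f ℕ.⌊ suc x /2⌋)

  bitLength : ℕ → ℕ
  bitLength n = halvings n n

  ⌊n/2⌋-sandwich : ∀ n → 2 ℕ.* ℕ.⌊ n /2⌋ ℕ.≤ n × n ℕ.≤ suc (2 ℕ.* ℕ.⌊ n /2⌋)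
  ⌊n/2⌋-sandwich zero = ℕ.z≤n , ℕ.z≤n
  ⌊n/2⌋-sandwich (suc zero) = ℕ.z≤n , ℕ.≤-refl
  ⌊n/2⌋-sandwich (suc (suc n)) with ⌊n/2⌋-sandwich n
  ... | l , u = subst (ℕ._≤ suc (suc n)) (sym (lem ℕ.⌊ n /2⌋)) (ℕ.s≤s (ℕ.s≤s l))
              , subst (λ z → suc (suc n) ℕ.≤ suc z) (sym (lem ℕ.⌊ n /2⌋)) (ℕ.s≤s (ℕ.s≤s u))
    where
    lem : ∀ h → 2 ℕ.* (1 ℕ.+ h) ≡ 2 ℕ.+ 2 ℕ.* h
    lem = solve-∀

  ⌊1+x/2⌋≤x : ∀ x → ℕ.⌊ suc x /2⌋ ℕ.≤ x
  ⌊1+x/2⌋≤x x = ℕ.≤-pred (ℕ.⌊n/2⌋<n x)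

  n<2^halvings : ∀ f x → x ℕ.≤ f → x ℕ.< 2 ℕ.^ halvings f x
  n<2^halvings zero    zero    _ = ℕ.≤-refl
  n<2^halvings (suc f) zero    _ = ℕ.≤-refl
  n<2^halvings (suc f) (suc x) (ℕ.s≤s x≤f) = begin
    suc (suc x)                           ≤⟨ ℕ.s≤s (proj₂ (⌊n/2⌋-sandwich (suc x))) ⟩
    suc (suc (2 ℕ.* h))                   ≡⟨ lem h ⟩
    2 ℕ.* suc h                           ≤⟨ ℕ.*-monoʳ-≤ 2 (n<2^halvings f h (ℕ.≤-trans (⌊1+x/2⌋≤x x) x≤f)) ⟩
    2 ℕ.* 2 ℕ.^ halvings f h              ∎
    where
    h = ℕ.⌊ suc x /2⌋
    lem : ∀ h → 2 ℕ.+ 2 ℕ.* h ≡ 2 ℕ.* (1 ℕ.+ h)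
    lem = solve-∀

  2^halvings≤ : ∀ f x → 2 ℕ.^ halvings f (suc x) ℕ.≤ 2 ℕ.* suc x
  2^halvings≤ zero    x       = ℕ.s≤s ℕ.z≤n
  2^halvings≤ (suc f) zero    = go f
    where
    go : ∀ f → 2 ℕ.* 2 ℕ.^ halvings f 0 ℕ.≤ 2
    go zero    = ℕ.≤-refl
    go (suc f) = ℕ.≤-refl
  2^halvings≤ (suc f) (suc x) = begin
    2 ℕ.* 2 ℕ.^ halvings f (suc ℕ.⌊ x /2⌋)   ≤⟨ ℕ.*-monoʳ-≤ 2 (2^halvings≤ f ℕ.⌊ x /2⌋) ⟩
    2 ℕ.* (2 ℕ.* suc ℕ.⌊ x /2⌋)              ≤⟨ ℕ.*-monoʳ-≤ 2 (proj₁ (⌊n/2⌋-sandwich (suc (suc x)))) ⟩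
    2 ℕ.* suc (suc x)                        ∎

  2^bitLength≤ : ∀ n → 2 ℕ.^ bitLength n ℕ.≤ 2 ℕ.* n ℕ.+ 1
  2^bitLength≤ zero    = ℕ.≤-refl
  2^bitLength≤ (suc n) = ℕ.≤-trans (2^halvings≤ (suc n) n) (ℕ.m≤m+n _ 1)

  n<2^bitLength : ∀ n → n ℕ.< 2 ℕ.^ bitLength n
  n<2^bitLength n = n<2^halvings n n ℕ.≤-refl

  bitLength≤ : ∀ n → bitLength n ℕ.≤ n
  bitLength≤ n = go n n
    where
    go : ∀ f x → halvings f x ℕ.≤ f
    go zero    x       = ℕ.z≤n
    go (suc f) zero    = ℕ.z≤n
    go (suc f) (suc x) = ℕ.s≤s (go f _)

  -- With l = bitLength n: either l ≤ 8m and n ≥ 8m² decides, or 8ml ≤ l² ≤ 2·2ˡ ≤ 2(2n + 1).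
  littleO-bitLength : LittleO bitLength
  littleO-bitLength m = 2 ℕ.+ (4 ℕ.* m ℕ.* (4 ℕ.* m)) , λ n N≤n → ℕ.*-cancelˡ-≤ 8 (go n N≤n)
    where
    go : ∀ n → 2 ℕ.+ (4 ℕ.* m ℕ.* (4 ℕ.* m)) ℕ.≤ n → 8 ℕ.* (m ℕ.* bitLength n) ℕ.≤ 8 ℕ.* n
    go n N≤n with ℕ.≤-total (8 ℕ.* m) (bitLength n)
    ... | inj₁ 8m≤l = begin
      8 ℕ.* (m ℕ.* l)                ≡⟨ lem₁ m l ⟩
      8 ℕ.* m ℕ.* l                  ≤⟨ ℕ.*-monoˡ-≤ l 8m≤l ⟩
      l ℕ.* l                        ≤⟨ n²≤2·2^n l ⟩
      2 ℕ.* 2 ℕ.^ l                  ≤⟨ ℕ.*-monoʳ-≤ 2 (2^bitLength≤ n) ⟩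
      2 ℕ.* (2 ℕ.* n ℕ.+ 1)          ≡⟨ lem₂ n ⟩
      4 ℕ.* n ℕ.+ 2                  ≤⟨ ℕ.+-monoʳ-≤ (4 ℕ.* n) (ℕ.≤-trans (ℕ.m+n≤o⇒m≤o 2 N≤n) (ℕ.m≤m+n n _)) ⟩
      4 ℕ.* n ℕ.+ 4 ℕ.* n            ≡⟨ lem₃ n ⟩
      8 ℕ.* n                        ∎
      where
      l = bitLength n
      lem₁ : ∀ m l → 8 ℕ.* (m ℕ.* l) ≡ 8 ℕ.* m ℕ.* l
      lem₁ = solve-∀
      lem₂ : ∀ n → 2 ℕ.* (2 ℕ.* n ℕ.+ 1) ≡ 4 ℕ.* n ℕ.+ 2
      lem₂ = solve-∀
      lem₃ : ∀ n → 4 ℕ.* n ℕ.+ 4 ℕ.* n ≡ 8 ℕ.* n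
      lem₃ = solve-∀
    ... | inj₂ l≤8m = ℕ.*-monoʳ-≤ 8 (begin
      m ℕ.* bitLength n                            ≤⟨ ℕ.*-monoʳ-≤ m l≤8m ⟩
      m ℕ.* (8 ℕ.* m)                              ≤⟨ ℕ.m≤m+n _ (8 ℕ.* m ℕ.* m ℕ.+ 2) ⟩
      m ℕ.* (8 ℕ.* m) ℕ.+ (8 ℕ.* m ℕ.* m ℕ.+ 2)    ≡⟨ lem m ⟩
      2 ℕ.+ (4 ℕ.* m ℕ.* (4 ℕ.* m))                ≤⟨ N≤n ⟩
      n                                            ∎)
      where
      lem : ∀ m → m ℕ.* (8 ℕ.* m) ℕ.+ (8 ℕ.* m ℕ.* m ℕ.+ 2) ≡ 2 ℕ.+ (4 ℕ.* m ℕ.* (4 ℕ.* m))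
      lem = solve-∀

  -- Only the variable needs an argument: 2 to the power `bitLength n` exceeds n, and the bit length
  -- is o(n). Sums and products add exponents, up to a constant.
  poly-subexponential : ∀ p → ∃[ f ] (LittleO f × ∀ n → eval p n ℕ.≤ 2 ℕ.^ f n)
  poly-subexponential (con c) = (λ _ → c) , littleO-const c , λ _ → ℕ.<⇒≤ (n<2^n c)
  poly-subexponential X = bitLength , littleO-bitLength , λ n → ℕ.<⇒≤ (n<2^bitLength n)
  poly-subexponential (p ⊕ q) with poly-subexponential p | poly-subexponential q
  ... | f , of , hf | g , og , hg =
    (λ n → 1 ℕ.+ (f n ℕ.+ g n)) , littleO-+ (littleO-const 1) (littleO-+ of og) , λ n → begin
      eval p n ℕ.+ eval q n                                        ≤⟨ ℕ.+-mono-≤ (hf n) (hg n) ⟩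
      2 ℕ.^ f n ℕ.+ 2 ℕ.^ g n                                      ≤⟨ ℕ.+-mono-≤ (ℕ.^-monoʳ-≤ 2 (ℕ.m≤m+n (f n) (g n))) (ℕ.^-monoʳ-≤ 2 (ℕ.m≤n+m (g n) (f n))) ⟩
      2 ℕ.^ (f n ℕ.+ g n) ℕ.+ 2 ℕ.^ (f n ℕ.+ g n)                  ≡⟨ lem (2 ℕ.^ (f n ℕ.+ g n)) ⟩
      2 ℕ.* 2 ℕ.^ (f n ℕ.+ g n)                                    ∎
    where
    lem : ∀ x → x ℕ.+ x ≡ 2 ℕ.* x
    lem = solve-∀
  poly-subexponential (p ⊗ q) with poly-subexponential p | poly-subexponential q
  ... | f , of , hf | g , og , hg =
    (λ n → f n ℕ.+ g n) , littleO-+ of og , λ n →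
      ℕ.≤-trans (ℕ.*-mono-≤ (hf n) (hg n)) (ℕ.≤-reflexive (sym (ℕ.^-distribˡ-+-* 2 (f n) (g n))))

open Asymptotics

-- Trees and polynomial-time functional programs

module TreePrograms where
  open ℕ.≤-Reasoning

  size : Tree → ℕ
  size nil        = 0
  size (cons s t) = suc (size s ℕ.+ size t)

  head+tail≤ : ∀ t → size (head t) ℕ.+ size (tail t) ℕ.≤ size t
  head+tail≤ nil        = ℕ.z≤n
  head+tail≤ (cons s t) = ℕ.n≤1+n _

  size-head : ∀ t → size (head t) ℕ.≤ size t
  size-head t = ℕ.m+n≤o⇒m≤o _ (head+tail≤ t)

  size-tail : ∀ t → size (tail t) ℕ.≤ size t
  size-tail t = ℕ.m+n≤o⇒n≤o _ (head+tail≤ t)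

  spine≤size : ∀ t → spine t ℕ.≤ size t
  spine≤size nil        = ℕ.z≤n
  spine≤size (cons s t) = ℕ.s≤s (ℕ.≤-trans (spine≤size t) (ℕ.m≤n+m _ _))

  caseT : ∀ {a} {A : Set a} → Tree → A → A → A
  caseT nil        x y = x
  caseT (cons _ _) x y = y

  -- Folding from the left; the body sees cons x (cons s e) for an element x, the
  -- accumulator s and the environment e.
  foldT : (Tree → Tree) → Tree → Tree → Tree → Tree
  foldT f nil        s e = s
  foldT f (cons x l) s e = foldT f l (f (cons x (cons s e))) e

  module Language {m : ℕ} (δ : Digits m) where

    -- Functional programs on trees.  The body of a fold must come with a bound
    -- making its result larger than the accumulator by at most a polynomial in
    -- the sizes of element and environment; this keeps all programs polynomial.
    data Fn : Set
    ⟦_⟧ᶠ : Fn → Tree → Tree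
    Linear : Fn → Set

    infixr 9 _∘ᶠ_
    data Fn where
      idᶠ nilᶠ : Fn
      consᶠ    : Fn → Fn → Fn
      hdᶠ tlᶠ  : Fn → Fn
      _∘ᶠ_     : Fn → Fn → Fn
      ifᶠ      : Fn → Fn → Fn → Fn
      digitᶠ   : Fin m → Fn → Fn
      foldᶠ    : (l s b : Fn) → Linear b → Fn

    ⟦ idᶠ ⟧ᶠ         t = t
    ⟦ nilᶠ ⟧ᶠ        t = nil
    ⟦ consᶠ f g ⟧ᶠ   t = cons (⟦ f ⟧ᶠ t) (⟦ g ⟧ᶠ t)
    ⟦ hdᶠ f ⟧ᶠ       t = head (⟦ f ⟧ᶠ t)
    ⟦ tlᶠ f ⟧ᶠ       t = tail (⟦ f ⟧ᶠ t)
    ⟦ f ∘ᶠ g ⟧ᶠ      t = ⟦ f ⟧ᶠ (⟦ g ⟧ᶠ t)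
    ⟦ ifᶠ c f g ⟧ᶠ   t = caseT (⟦ c ⟧ᶠ t) (⟦ f ⟧ᶠ t) (⟦ g ⟧ᶠ t)
    ⟦ digitᶠ j f ⟧ᶠ  t = encodeBool (δ j (spine (⟦ f ⟧ᶠ t)))
    ⟦ foldᶠ l s b _ ⟧ᶠ t = foldT ⟦ b ⟧ᶠ (⟦ l ⟧ᶠ t) (⟦ s ⟧ᶠ t) t

    Linear b = ∃[ q ] (∀ x s e → size (⟦ b ⟧ᶠ (cons x (cons s e))) ℕ.≤ size s ℕ.+ eval q (size x ℕ.+ size e))

    -- The accumulator enters its own bound with factor 1, so a round adds at most Q and growth is
    -- linear in the number of rounds; a larger factor would allow exponential growth.
    foldT-size : ∀ b ((q , h) : Linear b) l s e {z} → size l ℕ.+ size e ℕ.≤ z →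
                 size (foldT ⟦ b ⟧ᶠ l s e) ℕ.≤ size s ℕ.+ size l ℕ.* eval q z
    foldT-size b lin nil s e l+e≤z = ℕ.m≤m+n (size s) 0
    foldT-size b lin@(q , h) (cons x l) s e {z} l+e≤z = begin
      size (foldT ⟦ b ⟧ᶠ l _ e)                              ≤⟨ foldT-size b lin l _ e (ℕ.≤-trans (ℕ.+-monoˡ-≤ (size e) (ℕ.≤-trans (ℕ.m≤n+m (size l) (size x)) (ℕ.n≤1+n _))) l+e≤z) ⟩
      size (⟦ b ⟧ᶠ (cons x (cons s e))) ℕ.+ size l ℕ.* Q     ≤⟨ ℕ.+-monoˡ-≤ _ (h x s e) ⟩
      size s ℕ.+ eval q (size x ℕ.+ size e) ℕ.+ size l ℕ.* Q ≤⟨ ℕ.+-monoˡ-≤ _ (ℕ.+-monoʳ-≤ (size s) (eval-mono q (ℕ.≤-trans (ℕ.+-monoˡ-≤ (size e) (ℕ.≤-trans (ℕ.m≤m+n (size x) (size l)) (ℕ.n≤1+n _))) l+e≤z))) ⟩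
      size s ℕ.+ Q ℕ.+ size l ℕ.* Q                          ≡⟨ ℕ.+-assoc (size s) Q _ ⟩
      size s ℕ.+ (1 ℕ.+ size l) ℕ.* Q                        ≤⟨ ℕ.+-monoʳ-≤ (size s) (ℕ.*-monoˡ-≤ Q (ℕ.s≤s (ℕ.m≤n+m (size l) (size x)))) ⟩
      size s ℕ.+ size (cons x l) ℕ.* Q                       ∎
      where Q = eval q z

    sizePoly : Fn → Poly
    sizePoly idᶠ          = X
    sizePoly nilᶠ         = con 0
    sizePoly (consᶠ f g)  = con 1 ⊕ (sizePoly f ⊕ sizePoly g)
    sizePoly (hdᶠ f)      = sizePoly f
    sizePoly (tlᶠ f)      = sizePoly f
    sizePoly (f ∘ᶠ g)     = sizePoly f ⊚ sizePoly g
    sizePoly (ifᶠ c f g)  = sizePoly f ⊕ sizePoly g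
    sizePoly (digitᶠ j f) = con 1
    sizePoly (foldᶠ l s b (q , _)) = sizePoly s ⊕ sizePoly l ⊗ (q ⊚ (sizePoly l ⊕ X))

    size-⟦⟧ : ∀ f t → size (⟦ f ⟧ᶠ t) ℕ.≤ eval (sizePoly f) (size t)
    size-⟦⟧ idᶠ         t = ℕ.≤-refl
    size-⟦⟧ nilᶠ        t = ℕ.z≤n
    size-⟦⟧ (consᶠ f g) t = ℕ.s≤s (ℕ.+-mono-≤ (size-⟦⟧ f t) (size-⟦⟧ g t))
    size-⟦⟧ (hdᶠ f)     t = ℕ.≤-trans (size-head (⟦ f ⟧ᶠ t)) (size-⟦⟧ f t)
    size-⟦⟧ (tlᶠ f)     t = ℕ.≤-trans (size-tail (⟦ f ⟧ᶠ t)) (size-⟦⟧ f t)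
    size-⟦⟧ (f ∘ᶠ g)    t = ℕ.≤-trans (size-⟦⟧ f _) (eval-⊚-≤ (sizePoly f) (sizePoly g) (size t) (size-⟦⟧ g t))
    size-⟦⟧ (ifᶠ c f g) t with ⟦ c ⟧ᶠ t
    ... | nil      = ℕ.≤-trans (size-⟦⟧ f t) (ℕ.m≤m+n _ _)
    ... | cons _ _ = ℕ.≤-trans (size-⟦⟧ g t) (ℕ.m≤n+m _ _)
    size-⟦⟧ (digitᶠ j f) t with δ j (spine (⟦ f ⟧ᶠ t))
    ... | false = ℕ.z≤n
    ... | true  = ℕ.≤-refl
    size-⟦⟧ (foldᶠ l s b lin@(q , _)) t = begin
      size (foldT ⟦ b ⟧ᶠ (⟦ l ⟧ᶠ t) (⟦ s ⟧ᶠ t) t)        ≤⟨ foldT-size b lin (⟦ l ⟧ᶠ t) _ t ℕ.≤-refl ⟩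
      size (⟦ s ⟧ᶠ t) ℕ.+ size (⟦ l ⟧ᶠ t) ℕ.* eval q (size (⟦ l ⟧ᶠ t) ℕ.+ size t)
        ≤⟨ ℕ.+-mono-≤ (size-⟦⟧ s t) (ℕ.*-mono-≤ (size-⟦⟧ l t)
             (eval-⊚-≤ q (sizePoly l ⊕ X) (size t) (ℕ.+-monoˡ-≤ (size t) (size-⟦⟧ l t)))) ⟩
      eval (sizePoly (foldᶠ l s b lin)) (size t)          ∎

    -- The constants count, with slack for folds, the steps of the compiled program. The body of a
    -- fold is charged at a bound on the whole triple of element, accumulator and environment that
    -- is valid in every round.
    timePoly : Fn → Poly
    timePoly idᶠ          = con 1
    timePoly nilᶠ         = con 1
    timePoly (consᶠ f g)  = con 7 ⊕ timePoly f ⊕ timePoly g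
    timePoly (hdᶠ f)      = con 2 ⊕ timePoly f
    timePoly (tlᶠ f)      = con 2 ⊕ timePoly f
    timePoly (f ∘ᶠ g)     = con 1 ⊕ timePoly g ⊕ (timePoly f ⊚ sizePoly g)
    timePoly (ifᶠ c f g)  = con 6 ⊕ timePoly c ⊕ timePoly f ⊕ timePoly g
    timePoly (digitᶠ j f) = con 8 ⊕ timePoly f
    timePoly (foldᶠ l s b (q , _)) =
      con 30 ⊕ timePoly l ⊕ timePoly s ⊕
      sizePoly l ⊗ (con 20 ⊕ (timePoly b ⊚
        (con 2 ⊕ sizePoly l ⊕ (sizePoly s ⊕ sizePoly l ⊗ (q ⊚ (sizePoly l ⊕ X))) ⊕ X)))

    -- Opaque, as the polynomials of larger programs are too big to be computed.
    opaque
      timeBound : Fn → Poly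
      timeBound = timePoly

      timePoly≤timeBound : ∀ f n → eval (timePoly f) n ℕ.≤ eval (timeBound f) n
      timePoly≤timeBound f n = ℕ.≤-refl

    -- Size independent of the accumulator: such a result may be put onto an accumulator without
    -- losing `Linear`.
    Free : Fn → Set
    Free f = ∃[ q ] (∀ x s e → size (⟦ f ⟧ᶠ (cons x (cons s e))) ℕ.≤ eval q (size x ℕ.+ size e))

open TreePrograms

-- Ordered fields

module FieldProperties {c ℓ₁ ℓ₂} (R : ArchimedeanOrderedField c ℓ₁ ℓ₂) where
  open ArchimedeanOrderedField R public
  open CommutativeRing commutativeRing public
    using (-_; +-cong; +-congˡ; +-congʳ; *-cong; *-congˡ; *-congʳ; +-assoc; +-comm; *-assoc; *-comm;
           +-identityˡ; +-identityʳ; *-identityˡ; *-identityʳ; zeroˡ; zeroʳ; distribˡ; distribʳ;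
           -‿inverseˡ; -‿inverseʳ; -‿cong; commutativeSemiring; ring)
    renaming (refl to ≈-refl; sym to ≈-sym; trans to ≈-trans; reflexive to ≈-reflexive)
  open IsDecTotalOrder isDecTotalOrder public
    using (antisym) renaming (total to ≤-total; refl to ≤-refl; trans to ≤-trans; reflexive to ≤-reflexive)
  open SemiringSolver commutativeSemiring public
    using (solve; _:=_; _:+_; _:*_)
    renaming (con to :con)
  open TotalOrder totalOrder public using (poset)
  open Exp semiring public using (^-congˡ; ^-homo-*)
  open Mult semiring using (×-homo-+; ×1-homo-*)

  open PosetReasoning poset

  +-monoʳ-≤ : ∀ {x y} z → x ≤ y → z + x ≤ z + y
  +-monoʳ-≤ {x} {y} z x≤y = begin
    z + x ≈⟨ +-comm z x ⟩ x + z ≤⟨ +-monoˡ-≤ z x≤y ⟩ y + z ≈⟨ +-comm y z ⟩ z + y ∎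

  +-mono-≤ : ∀ {x y u v} → x ≤ y → u ≤ v → x + u ≤ y + v
  +-mono-≤ {y = y} {u = u} x≤y u≤v = ≤-trans (+-monoˡ-≤ u x≤y) (+-monoʳ-≤ y u≤v)

  +-cancelʳ : ∀ x z → x + z + - z ≈ x
  +-cancelʳ x z = ≈-trans (+-assoc x z (- z)) (≈-trans (+-congˡ (-‿inverseʳ z)) (+-identityʳ x))

  -‿cancelʳ : ∀ x z → x + - z + z ≈ x
  -‿cancelʳ x z = ≈-trans (+-assoc x (- z) z) (≈-trans (+-congˡ (-‿inverseˡ z)) (+-identityʳ x))

  +-cancelʳ-≤ : ∀ z {x y} → x + z ≤ y + z → x ≤ y
  +-cancelʳ-≤ z {x} {y} h = begin
    x           ≈⟨ +-cancelʳ x z ⟨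
    x + z + - z ≤⟨ +-monoˡ-≤ (- z) h ⟩
    y + z + - z ≈⟨ +-cancelʳ y z ⟩
    y           ∎

  x≤x+y : ∀ {x y} → 0# ≤ y → x ≤ x + y
  x≤x+y {x} {y} 0≤y = begin x ≈⟨ +-identityʳ x ⟨ x + 0# ≤⟨ +-monoʳ-≤ x 0≤y ⟩ x + y ∎

  x≤y+x : ∀ {x y} → 0# ≤ y → x ≤ y + x
  x≤y+x {x} {y} 0≤y = ≤-trans (x≤x+y 0≤y) (≤-reflexive (+-comm x y))

  +-nonNegative : ∀ {x y} → 0# ≤ x → 0# ≤ y → 0# ≤ x + y
  +-nonNegative 0≤x 0≤y = ≤-trans 0≤x (x≤x+y 0≤y)

  0≤y-x : ∀ {x y} → x ≤ y → 0# ≤ y - x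
  0≤y-x {x} {y} x≤y = begin 0# ≈⟨ -‿inverseʳ x ⟨ x + - x ≤⟨ +-monoˡ-≤ (- x) x≤y ⟩ y + - x ∎

  *-monoʳ-≤ : ∀ {x y z} → 0# ≤ z → x ≤ y → z * x ≤ z * y
  *-monoʳ-≤ {x} {y} {z} 0≤z x≤y = begin
    z * x                 ≤⟨ x≤x+y (*-nonNegative 0≤z (0≤y-x x≤y)) ⟩
    z * x + z * (y - x)   ≈⟨ distribˡ z x (y - x) ⟨
    z * (x + (y - x))     ≈⟨ *-congˡ (+-comm x (y - x)) ⟩
    z * (y - x + x)       ≈⟨ *-congˡ (-‿cancelʳ y x) ⟩
    z * y                 ∎

  *-monoˡ-≤ : ∀ {x y z} → 0# ≤ z → x ≤ y → x * z ≤ y * z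
  *-monoˡ-≤ {x} {y} {z} 0≤z x≤y = begin
    x * z ≈⟨ *-comm x z ⟩ z * x ≤⟨ *-monoʳ-≤ 0≤z x≤y ⟩ z * y ≈⟨ *-comm z y ⟩ y * z ∎

  *-mono-≤ : ∀ {x y u v} → 0# ≤ x → 0# ≤ v → x ≤ y → u ≤ v → x * u ≤ y * v
  *-mono-≤ 0≤x 0≤v x≤y u≤v = ≤-trans (*-monoʳ-≤ 0≤x u≤v) (*-monoˡ-≤ 0≤v x≤y)

  0≤1 : 0# ≤ 1#
  0≤1 with ≤-total 0# 1#
  ... | inj₁ h = h
  ... | inj₂ h = begin
    0#            ≤⟨ *-nonNegative 0≤-1 0≤-1 ⟩
    - 1# * - 1#   ≈⟨ ≈-trans (≈-sym (RingProperties.-‿distribˡ-* ring 1# (- 1#)))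
                    (≈-trans (-‿cong (≈-sym (RingProperties.-‿distribʳ-* ring 1# 1#))) (RingProperties.-‿involutive ring _)) ⟩
    1# * 1#       ≈⟨ *-identityˡ 1# ⟩
    1#            ∎
    where
    0≤-1 : 0# ≤ - 1#
    0≤-1 = ≤-trans (0≤y-x h) (≤-reflexive (+-identityˡ _))

  1≰0 : ¬ (1# ≤ 0#)
  1≰0 h = 0≉1 (antisym 0≤1 h)

  fromℕ-+ : ∀ m n → fromℕ (m ℕ.+ n) ≈ fromℕ m + fromℕ n
  fromℕ-+ m n = ×-homo-+ 1# m n

  fromℕ-* : ∀ m n → fromℕ (m ℕ.* n) ≈ fromℕ m * fromℕ n
  fromℕ-* = ×1-homo-*

  fromℕ-1 : fromℕ 1 ≈ 1#
  fromℕ-1 = +-identityʳ 1#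

  fromℕ-^ : ∀ m n → fromℕ (m ℕ.^ n) ≈ fromℕ m ^ n
  fromℕ-^ m zero    = fromℕ-1
  fromℕ-^ m (suc n) = ≈-trans (fromℕ-* m (m ℕ.^ n)) (*-congˡ (fromℕ-^ m n))

  0≤fromℕ : ∀ n → 0# ≤ fromℕ n
  0≤fromℕ zero    = ≤-refl
  0≤fromℕ (suc n) = +-nonNegative 0≤1 (0≤fromℕ n)

  fromℕ-mono : ∀ {m n} → m ℕ.≤ n → fromℕ m ≤ fromℕ n
  fromℕ-mono {n = n} ℕ.z≤n = 0≤fromℕ n
  fromℕ-mono (ℕ.s≤s h) = +-monoʳ-≤ 1# (fromℕ-mono h)

  fromℕ-cancel-≤ : ∀ m n → fromℕ m ≤ fromℕ n → m ℕ.≤ n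
  fromℕ-cancel-≤ zero    n       h = ℕ.z≤n
  fromℕ-cancel-≤ (suc m) zero    h = ⊥-elim (1≰0 (≤-trans (x≤x+y (0≤fromℕ m)) h))
  fromℕ-cancel-≤ (suc m) (suc n) h = ℕ.s≤s (fromℕ-cancel-≤ m n (+-cancelʳ-≤ 1#
    (≤-trans (≤-reflexive (+-comm _ 1#)) (≤-trans h (≤-reflexive (+-comm 1# _))))))

  1≤fromℕ : ∀ {n} → 1 ℕ.≤ n → 1# ≤ fromℕ n
  1≤fromℕ {n} h = ≤-trans (≤-reflexive (≈-sym fromℕ-1)) (fromℕ-mono {1} {n} h)

  1≤⇒≉0 : ∀ {x} → 1# ≤ x → ¬ (x ≈ 0#)
  1≤⇒≉0 1≤x x≈0 = 1≰0 (≤-trans 1≤x (≤-reflexive x≈0))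

  ⁻¹-nonNegative : ∀ {x} → 0# ≤ x → ¬ (x ≈ 0#) → 0# ≤ x ⁻¹
  ⁻¹-nonNegative {x} 0≤x x≉0 with ≤-total 0# (x ⁻¹)
  ... | inj₁ h = h
  ... | inj₂ h = ⊥-elim (1≰0 (begin
    1#         ≈⟨ ⁻¹-inverse x≉0 ⟨
    x * x ⁻¹   ≤⟨ *-monoʳ-≤ 0≤x h ⟩
    x * 0#     ≈⟨ zeroʳ x ⟩
    0#         ∎))

  x/y*y : ∀ x {y} → ¬ (y ≈ 0#) → x / y * y ≈ x
  x/y*y x {y} y≉0 = ≈-trans (*-assoc x (y ⁻¹) y)
    (≈-trans (*-congˡ (≈-trans (*-comm _ y) (⁻¹-inverse y≉0))) (*-identityʳ x))

  *-cancelʳ-≤ : ∀ {x y z} → 0# ≤ z → ¬ (z ≈ 0#) → x * z ≤ y * z → x ≤ y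
  *-cancelʳ-≤ {x} {y} {z} 0≤z z≉0 h = begin
    x              ≈⟨ lem x ⟨
    x * z * z ⁻¹   ≤⟨ *-monoˡ-≤ (⁻¹-nonNegative 0≤z z≉0) h ⟩
    y * z * z ⁻¹   ≈⟨ lem y ⟩
    y              ∎
    where
    lem : ∀ x → x * z * z ⁻¹ ≈ x
    lem x = ≈-trans (*-assoc x z _) (≈-trans (*-congˡ (⁻¹-inverse z≉0)) (*-identityʳ x))

  /-mono : ∀ {x y z} → 0# ≤ z → ¬ (z ≈ 0#) → x ≤ y * z → x / z ≤ y
  /-mono {x} {y} {z} 0≤z z≉0 h = *-cancelʳ-≤ 0≤z z≉0 (≤-trans (≤-reflexive (x/y*y x z≉0)) h)

  ≤-/ : ∀ {x y z} → 0# ≤ z → ¬ (z ≈ 0#) → x * z ≤ y → x ≤ y / z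
  ≤-/ {x} {y} {z} 0≤z z≉0 h = *-cancelʳ-≤ 0≤z z≉0 (≤-trans h (≤-reflexive (≈-sym (x/y*y y z≉0))))

  1≤2 : 1# ≤ 2#
  1≤2 = 1≤fromℕ {2} (ℕ.s≤s ℕ.z≤n)

  0≤2 : 0# ≤ 2#
  0≤2 = 0≤fromℕ 2

  2≉0 : ¬ (2# ≈ 0#)
  2≉0 = 1≤⇒≉0 1≤2

  ½*2 : ½ * 2# ≈ 1#
  ½*2 = x/y*y 1# 2≉0

  0≤½ : 0# ≤ ½
  0≤½ = ≤-/ 0≤2 2≉0 (≤-trans (≤-reflexive (zeroˡ 2#)) 0≤1)

  x+x≈2x : ∀ x → x + x ≈ 2# * x
  x+x≈2x x = begin-equality
    x + x                 ≈⟨ +-cong (*-identityˡ x) (≈-trans (*-congʳ fromℕ-1) (*-identityˡ x)) ⟨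
    1# * x + fromℕ 1 * x  ≈⟨ distribʳ x 1# (fromℕ 1) ⟨
    2# * x                ∎

  ½*[x+x] : ∀ x → ½ * (x + x) ≈ x
  ½*[x+x] x = begin-equality
    ½ * (x + x)    ≈⟨ *-congˡ (x+x≈2x x) ⟩
    ½ * (2# * x)   ≈⟨ *-assoc ½ 2# x ⟨
    ½ * 2# * x     ≈⟨ *-congʳ ½*2 ⟩
    1# * x         ≈⟨ *-identityˡ x ⟩
    x              ∎

  ^-nonNegative : ∀ {x} n → 0# ≤ x → 0# ≤ x ^ n
  ^-nonNegative zero    0≤x = 0≤1
  ^-nonNegative (suc n) 0≤x = *-nonNegative 0≤x (^-nonNegative n 0≤x)

  ^-mono-≤ : ∀ {x y} n → 0# ≤ x → x ≤ y → x ^ n ≤ y ^ n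
  ^-mono-≤ zero    0≤x x≤y = ≤-refl
  ^-mono-≤ (suc n) 0≤x x≤y = *-mono-≤ 0≤x (^-nonNegative n (≤-trans 0≤x x≤y)) x≤y (^-mono-≤ n 0≤x x≤y)

  1≤^ : ∀ {x} n → 1# ≤ x → 1# ≤ x ^ n
  1≤^ zero    1≤x = ≤-refl
  1≤^ {x} (suc n) 1≤x = begin
    1#          ≈⟨ *-identityˡ 1# ⟨
    1# * 1#     ≤⟨ *-mono-≤ 0≤1 (≤-trans 0≤1 (1≤^ n 1≤x)) 1≤x (1≤^ n 1≤x) ⟩
    x * x ^ n   ∎

  ^≤1 : ∀ {x} n → 0# ≤ x → x ≤ 1# → x ^ n ≤ 1#
  ^≤1 zero    0≤x x≤1 = ≤-refl
  ^≤1 {x} (suc n) 0≤x x≤1 = begin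
    x * x ^ n   ≤⟨ *-mono-≤ 0≤x 0≤1 x≤1 (^≤1 n 0≤x x≤1) ⟩
    1# * 1#     ≈⟨ *-identityˡ 1# ⟩
    1#          ∎

  ^-monoʳ-≤ : ∀ {x m n} → 1# ≤ x → m ℕ.≤ n → x ^ m ≤ x ^ n
  ^-monoʳ-≤ {n = n} 1≤x ℕ.z≤n     = 1≤^ n 1≤x
  ^-monoʳ-≤ 1≤x (ℕ.s≤s h) = *-monoʳ-≤ (≤-trans 0≤1 1≤x) (^-monoʳ-≤ 1≤x h)

  ^-antiʳ-≤ : ∀ {x m n} → 0# ≤ x → x ≤ 1# → m ℕ.≤ n → x ^ n ≤ x ^ m
  ^-antiʳ-≤ {n = n} 0≤x x≤1 ℕ.z≤n = ^≤1 n 0≤x x≤1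
  ^-antiʳ-≤ 0≤x x≤1 (ℕ.s≤s h) = *-monoʳ-≤ 0≤x (^-antiʳ-≤ 0≤x x≤1 h)

  ^-distrib-* : ∀ x y n → (x * y) ^ n ≈ x ^ n * y ^ n
  ^-distrib-* x y zero    = ≈-sym (*-identityˡ 1#)
  ^-distrib-* x y (suc n) = ≈-trans (*-congˡ (^-distrib-* x y n))
    (solve 4 (λ x y u v → x :* y :* (u :* v) := x :* u :* (y :* v)) ≈-refl x y (x ^ n) (y ^ n))

  1^n≈1 : ∀ n → 1# ^ n ≈ 1#
  1^n≈1 zero = ≈-refl
  1^n≈1 (suc n) = ≈-trans (*-identityˡ _) (1^n≈1 n)

  ½≤1 : ½ ≤ 1#
  ½≤1 = /-mono 0≤2 2≉0 (≤-trans 1≤2 (≤-reflexive (≈-sym (*-identityˡ 2#))))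

  2^-nonZero : ∀ n → ¬ (2# ^ n ≈ 0#)
  2^-nonZero n = 1≤⇒≉0 (1≤^ n 1≤2)

  -- xⁿ ≥ 1 - n(1 - x), written without subtraction. Both rounding errors of the algorithm are
  -- controlled by it.
  bernoulli : ∀ {x y} n → 0# ≤ x → 0# ≤ y → x + y ≈ 1# → 1# ≤ x ^ n + fromℕ n * y
  bernoulli {x} {y} zero 0≤x 0≤y x+y≈1 = x≤x+y (≤-reflexive (≈-sym (zeroˡ y)))
  bernoulli {x} {y} (suc n) 0≤x 0≤y x+y≈1 = begin
    1#                                          ≈⟨ x+y≈1 ⟨
    x + y                                       ≈⟨ +-congʳ (≈-sym (*-identityʳ x)) ⟩
    x * 1# + y                                  ≤⟨ +-monoˡ-≤ y (*-monoʳ-≤ 0≤x (bernoulli n 0≤x 0≤y x+y≈1)) ⟩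
    x * (x ^ n + fromℕ n * y) + y               ≈⟨ solve 4 (λ x y n z → x :* (z :+ n :* y) :+ y := x :* z :+ (x :* (n :* y) :+ y)) ≈-refl x y (fromℕ n) (x ^ n) ⟩
    x * x ^ n + (x * (fromℕ n * y) + y)         ≤⟨ +-monoʳ-≤ _ (+-monoˡ-≤ y (*-monoˡ-≤ (*-nonNegative (0≤fromℕ n) 0≤y) x≤1)) ⟩
    x * x ^ n + (1# * (fromℕ n * y) + y)        ≈⟨ +-congˡ (≈-trans (+-cong (*-identityˡ _) (≈-sym (*-identityˡ y))) (+-comm _ _)) ⟩
    x * x ^ n + (1# * y + fromℕ n * y)          ≈⟨ +-congˡ (distribʳ y 1# (fromℕ n)) ⟨
    x * x ^ n + fromℕ (suc n) * y               ∎
    where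
    x≤1 : x ≤ 1#
    x≤1 = ≤-trans (x≤x+y 0≤y) (≤-reflexive x+y≈1)

  floorUpTo-≤ : ∀ n x → 0# ≤ x → fromℕ (floorUpTo n x) ≤ x
  floorUpTo-≤ zero    x 0≤x = 0≤x
  floorUpTo-≤ (suc n) x 0≤x with fromℕ (suc n) ≤? x
  ... | yes h = h
  ... | no  _ = floorUpTo-≤ n x 0≤x

  ≤-floorUpTo : ∀ n x m → m ℕ.≤ n → fromℕ m ≤ x → m ℕ.≤ floorUpTo n x
  ≤-floorUpTo zero    x m m≤n h = m≤n
  ≤-floorUpTo (suc n) x m m≤n h with fromℕ (suc n) ≤? x
  ... | yes _ = m≤n
  ... | no ¬h with ℕ.m≤n⇒m<n∨m≡n m≤n
  ...   | inj₁ (ℕ.s≤s m≤n′) = ≤-floorUpTo n x m m≤n′ h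
  ...   | inj₂ ≡.refl       = ⊥-elim (¬h h)

  floor-≤ : ∀ x → 0# ≤ x → fromℕ (floor x) ≤ x
  floor-≤ x = floorUpTo-≤ (proj₁ (archimedean x)) x

  -- The search in `floor` starts at an Archimedean bound of x, which no natural number m ≤ x
  -- exceeds.
  ≤-floor : ∀ x m → fromℕ m ≤ x → m ℕ.≤ floor x
  ≤-floor x m h = ≤-floorUpTo (proj₁ (archimedean x)) x m
    (fromℕ-cancel-≤ m (proj₁ (archimedean x)) (≤-trans h (proj₂ (archimedean x)))) h

  <-1+floor : ∀ x → x ≤ fromℕ (suc (floor x))
  <-1+floor x with ≤-total x (fromℕ (suc (floor x)))
  ... | inj₁ h = h
  ... | inj₂ h = ⊥-elim (ℕ.1+n≰n (≤-floor x (suc (floor x)) h))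

-- Execution of programs

lookup-update : ∀ (σ : Store) r t → (σ [ r ↦ t ]) r ≡ t
lookup-update σ zero    t = refl
lookup-update σ (suc r) t = go r
  where
  go : ∀ r {x : Tree} → (if r ℕ.≡ᵇ r then t else x) ≡ t
  go zero    = refl
  go (suc r) = go r

lookup-update-≢ : ∀ (σ : Store) {r s} t → r ≢ s → (σ [ r ↦ t ]) s ≡ σ s
lookup-update-≢ σ {r} {s} t r≢s = go r s r≢s
  where
  go : ∀ r s → r ≢ s → {x : Tree} → (if r ℕ.≡ᵇ s then t else x) ≡ x
  go zero    zero    r≢s = ⊥-elim (r≢s refl)
  go zero    (suc s) r≢s = refl
  go (suc r) zero    r≢s = refl
  go (suc r) (suc s) r≢s = go r s (r≢s ∘ cong suc)

update-cong : ∀ {σ τ : Store} r {t t′} s → t ≡ t′ → σ s ≡ τ s → (σ [ r ↦ t ]) s ≡ (τ [ r ↦ t′ ]) s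
update-cong r s refl eq with r ℕ.≡ᵇ s
... | true  = refl
... | false = eq

boundᵉ : Expr → ℕ
boundᵉ (reg r)       = suc r
boundᵉ nilᵉ          = 0
boundᵉ (consᵉ e₁ e₂) = boundᵉ e₁ ℕ.⊔ boundᵉ e₂
boundᵉ (hdᵉ e)       = boundᵉ e
boundᵉ (tlᵉ e)       = boundᵉ e

module _ {m : ℕ} where

  -- Strictly above every register that is mentioned.
  bound : Program m → ℕ
  bound skip          = 0
  bound (r ≔ e)       = suc r ℕ.⊔ boundᵉ e
  bound (P ⨾ Q)       = bound P ℕ.⊔ bound Q
  bound (ifnil e P Q) = boundᵉ e ℕ.⊔ (bound P ℕ.⊔ bound Q)
  bound (while e P)   = boundᵉ e ℕ.⊔ bound P
  bound (toss r)      = suc r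
  bound (digit r j e) = suc r ℕ.⊔ boundᵉ e

  ⟦⟧-cong : ∀ e {S σ τ} → boundᵉ e ℕ.≤ S → (∀ r → r ℕ.< S → σ r ≡ τ r) → ⟦ e ⟧ σ ≡ ⟦ e ⟧ τ
  ⟦⟧-cong (reg r)       b eq = eq r b
  ⟦⟧-cong nilᵉ          b eq = refl
  ⟦⟧-cong (consᵉ e₁ e₂) b eq =
    cong₂ cons (⟦⟧-cong e₁ (ℕ.m⊔n≤o⇒m≤o _ _ b) eq) (⟦⟧-cong e₂ (ℕ.m⊔n≤o⇒n≤o _ _ b) eq)
  ⟦⟧-cong (hdᵉ e)       b eq = cong head (⟦⟧-cong e b eq)
  ⟦⟧-cong (tlᵉ e)       b eq = cong tail (⟦⟧-cong e b eq)

  -- The execution of K₁ from σ₁ inside a larger program with continuation K₂,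
  -- whose register S lies out of reach of K₁.
  record Embeds (S : ℕ) (t : Tree) (K₂ : List (Program m)) (cfg₁ cfg₂ : Config m) : Set where
    constructor embeds
    field
      code   : proj₁ cfg₂ ≡ proj₁ cfg₁ ++ K₂
      bounds : All (λ P → bound P ℕ.≤ S) (proj₁ cfg₁)
      low    : ∀ r → r ℕ.< S → proj₂ cfg₁ r ≡ proj₂ cfg₂ r
      top    : proj₂ cfg₂ S ≡ t

  -- The commands of the inner configuration read and write only registers below S, where both
  -- stores agree; with the same coin they take the same branches.
  step-embeds : ∀ (δ : Digits m) c {S t K₂ P K₁ σ₁ cfg₂} → Embeds S t K₂ (P ∷ K₁ , σ₁) cfg₂ →
                Embeds S t K₂ (step δ c (P ∷ K₁ , σ₁)) (step δ c cfg₂)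
  step-embeds δ c {S} {t} {K₂} {P} {K₁} {σ₁} {_ , σ₂} (embeds refl (bP ∷ bs) low top) = go P bP
    where
    assign : ∀ r {t₁ t₂} → suc r ℕ.≤ S → t₁ ≡ t₂ →
             Embeds S t K₂ (K₁ , σ₁ [ r ↦ t₁ ]) (K₁ ++ K₂ , σ₂ [ r ↦ t₂ ])
    assign r {t₁} {t₂} r<S t₁≡t₂ = embeds refl bs
      (λ s s<S → update-cong {σ₁} {σ₂} r s t₁≡t₂ (low s s<S))
      (≡.trans (lookup-update-≢ σ₂ t₂ (ℕ.<⇒≢ r<S)) top)
    go : ∀ P → bound P ℕ.≤ S → Embeds S t K₂ (step δ c (P ∷ K₁ , σ₁)) (step δ c (P ∷ K₁ ++ K₂ , σ₂))
    go skip          b = embeds refl bs low top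
    go (r ≔ e)       b = assign r (ℕ.m⊔n≤o⇒m≤o (suc r) (boundᵉ e) b) (⟦⟧-cong e (ℕ.m⊔n≤o⇒n≤o (suc r) _ b) low)
    go (P ⨾ Q)       b = embeds refl (ℕ.m⊔n≤o⇒m≤o _ _ b ∷ ℕ.m⊔n≤o⇒n≤o (bound P) _ b ∷ bs) low top
    go (ifnil e P Q) b with ⟦ e ⟧ σ₁ | ⟦ e ⟧ σ₂ | ⟦⟧-cong e (ℕ.m⊔n≤o⇒m≤o _ _ b) low
    ... | nil      | _ | refl = embeds refl (ℕ.m⊔n≤o⇒m≤o _ _ (ℕ.m⊔n≤o⇒n≤o (boundᵉ e) _ b) ∷ bs) low top
    ... | cons _ _ | _ | refl = embeds refl (ℕ.m⊔n≤o⇒n≤o (bound P) _ (ℕ.m⊔n≤o⇒n≤o (boundᵉ e) _ b) ∷ bs) low top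
    go (while e P)   b with ⟦ e ⟧ σ₁ | ⟦ e ⟧ σ₂ | ⟦⟧-cong e (ℕ.m⊔n≤o⇒m≤o _ _ b) low
    ... | nil      | _ | refl = embeds refl bs low top
    ... | cons _ _ | _ | refl = embeds refl (ℕ.m⊔n≤o⇒n≤o (boundᵉ e) _ b ∷ b ∷ bs) low top
    go (toss r)      b = assign r b refl
    go (digit r j e) b = assign r (ℕ.m⊔n≤o⇒m≤o (suc r) (boundᵉ e) b)
      (cong (encodeBool ∘ δ j ∘ spine) (⟦⟧-cong e (ℕ.m⊔n≤o⇒n≤o (suc r) _ b) low))

-- Expressions in one variable, the stack in register S. Their meaning is a function of a single
-- tree, so the store can be forgotten.
data Ex : Set where
  var  : Ex
  nilˣ : Ex
  consˣ : Ex → Ex → Ex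
  hdˣ tlˣ : Ex → Ex

evalˣ : Ex → Tree → Tree
evalˣ var         t = t
evalˣ nilˣ        t = nil
evalˣ (consˣ e f) t = cons (evalˣ e t) (evalˣ f t)
evalˣ (hdˣ e)     t = head (evalˣ e t)
evalˣ (tlˣ e)     t = tail (evalˣ e t)

exprˣ : Register → Ex → Expr
exprˣ S var         = reg S
exprˣ S nilˣ        = nilᵉ
exprˣ S (consˣ e f) = consᵉ (exprˣ S e) (exprˣ S f)
exprˣ S (hdˣ e)     = hdᵉ (exprˣ S e)
exprˣ S (tlˣ e)     = tlᵉ (exprˣ S e)

⟦exprˣ⟧ : ∀ S e σ {t} → σ S ≡ t → ⟦ exprˣ S e ⟧ σ ≡ evalˣ e t
⟦exprˣ⟧ S var         σ eq = eq
⟦exprˣ⟧ S nilˣ        σ eq = refl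
⟦exprˣ⟧ S (consˣ e f) σ eq = cong₂ cons (⟦exprˣ⟧ S e σ eq) (⟦exprˣ⟧ S f σ eq)
⟦exprˣ⟧ S (hdˣ e)     σ eq = cong head (⟦exprˣ⟧ S e σ eq)
⟦exprˣ⟧ S (tlˣ e)     σ eq = cong tail (⟦exprˣ⟧ S e σ eq)

-- Expectations over coin tosses

module Mean {c ℓ₁ ℓ₂} (R : ArchimedeanOrderedField c ℓ₁ ℓ₂) where
  open FieldProperties R
  open PosetReasoning poset

  mid : Carrier → Carrier → Carrier
  mid x y = ½ * (x + y)

  mid-mono : ∀ {x y u v} → x ≤ u → y ≤ v → mid x y ≤ mid u v
  mid-mono p q = *-monoʳ-≤ 0≤½ (+-mono-≤ p q)

  mid-affine : ∀ θ ψ x y → mid (θ + ψ * x) (θ + ψ * y) ≈ θ + ψ * mid x y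
  mid-affine θ ψ x y = begin-equality
    ½ * (θ + ψ * x + (θ + ψ * y))      ≈⟨ solve 5 (λ h t p x y → h :* (t :+ p :* x :+ (t :+ p :* y)) := h :* (t :+ t) :+ p :* (h :* (x :+ y))) ≈-refl ½ θ ψ x y ⟩
    ½ * (θ + θ) + ψ * mid x y          ≈⟨ +-congʳ (½*[x+x] θ) ⟩
    θ + ψ * mid x y                    ∎

  -- Iterated midpoints instead of a normalised sum: the recursion is that of `run`, one coin per
  -- step.
  mean : ∀ T → (Vec Bool T → Carrier) → Carrier
  mean zero    f = f []
  mean (suc T) f = mid (mean T (f ∘ (true ∷_))) (mean T (f ∘ (false ∷_)))

  mean-mono : ∀ T {f g} → (∀ ω → f ω ≤ g ω) → mean T f ≤ mean T g
  mean-mono zero    h = h []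
  mean-mono (suc T) h = mid-mono (mean-mono T (h ∘ (true ∷_))) (mean-mono T (h ∘ (false ∷_)))

  mean-≤ : ∀ T {f v} → (∀ ω → f ω ≤ v) → mean T f ≤ v
  mean-≤ zero    h = h []
  mean-≤ (suc T) h = ≤-trans (mid-mono (mean-≤ T (h ∘ (true ∷_))) (mean-≤ T (h ∘ (false ∷_)))) (≤-reflexive (½*[x+x] _))

  ≤-mean : ∀ T {f v} → (∀ ω → v ≤ f ω) → v ≤ mean T f
  ≤-mean zero    h = h []
  ≤-mean (suc T) h = ≤-trans (≤-reflexive (≈-sym (½*[x+x] _))) (mid-mono (≤-mean T (h ∘ (true ∷_))) (≤-mean T (h ∘ (false ∷_))))

  mean-affine : ∀ T θ ψ f → mean T (λ ω → θ + ψ * f ω) ≈ θ + ψ * mean T f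
  mean-affine zero    θ ψ f = ≈-refl
  mean-affine (suc T) θ ψ f = ≈-trans
    (*-congˡ (+-cong (mean-affine T θ ψ (f ∘ (true ∷_))) (mean-affine T θ ψ (f ∘ (false ∷_)))))
    (mid-affine θ ψ _ _)

-- Programs that keep their data in one register S, as a stack of trees, and leave
-- the registers below S to the called program A.
module Machine {m : ℕ} (δ : Digits m) (A : Program m) where
  open Language δ

  S : Register
  S = suc (bound A)

  set : Ex → Program m
  set e = S ≔ exprˣ S e

  -- Register 0 is cleared because all registers below S are kept `nil` between commands; `call`
  -- relies on this.
  push : Program m
  push = (S ≔ consᵉ (reg 0) (reg S)) ⨾ (0 ≔ nilᵉ)

  coin : Program m
  coin = toss 0 ⨾ push

  -- On `cons l (cons s rest)`: for every element x of l the body finds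
  -- `cons (cons x s) (cons l′ rest)`, with l′ the elements still to come, and leaves the new s in
  -- place of the pair. At the end the empty list is popped.
  loop : Program m → Program m
  loop P = while (exprˣ S (hdˣ var))
             (set (consˣ (consˣ (hdˣ (hdˣ var)) (hdˣ (tlˣ var))) (consˣ (tlˣ (hdˣ var)) (tlˣ (tlˣ var)))) ⨾
              P ⨾
              set (consˣ (hdˣ (tlˣ var)) (consˣ (hdˣ var) (tlˣ (tlˣ var))))) ⨾
           set (tlˣ var)

  clear : ℕ → Program m
  clear zero    = skip
  clear (suc r) = (r ≔ nilᵉ) ⨾ clear r

  -- 𝒜 has to start with its input in register 0 and `nil` elsewhere. Afterwards its output is moved
  -- to the stack and whatever it left below S is erased.
  call : Program m
  call = (0 ≔ exprˣ S (hdˣ var)) ⨾ A ⨾ (S ≔ consᵉ (reg 0) (exprˣ S (tlˣ var))) ⨾ clear S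

  callOverhead : ℕ
  callOverhead = 6 ℕ.+ 2 ℕ.* S

  -- Both programs run on a copy of the top of the stack, the second one above the result of the
  -- first; the results end up in one `cons`.
  pair : Program m → Program m → Program m
  pair P Q = set (consˣ (hdˣ var) var) ⨾ P ⨾
             set (consˣ (hdˣ (tlˣ var)) (consˣ (hdˣ var) (tlˣ (tlˣ var)))) ⨾ Q ⨾
             set (consˣ (consˣ (hdˣ (tlˣ var)) (hdˣ var)) (tlˣ (tlˣ var)))

  code : Fn → Program m
  code idᶠ           = skip
  code nilᶠ          = set (consˣ nilˣ (tlˣ var))
  code (consᶠ f g)   = pair (code f) (code g)
  code (hdᶠ f)       = code f ⨾ set (consˣ (hdˣ (hdˣ var)) (tlˣ var))
  code (tlᶠ f)       = code f ⨾ set (consˣ (tlˣ (hdˣ var)) (tlˣ var))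
  code (f ∘ᶠ g)      = code g ⨾ code f
  code (ifᶠ c f g)   = set (consˣ (hdˣ var) var) ⨾ code c ⨾
                       ifnil (exprˣ S (hdˣ var)) (set (tlˣ var) ⨾ code f) (set (tlˣ var) ⨾ code g)
  code (digitᶠ j f)  = code f ⨾ (digit 0 j (exprˣ S (hdˣ var)) ⨾ push) ⨾ set (consˣ (hdˣ var) (tlˣ (tlˣ var)))
  code (foldᶠ l s b _) =
    -- The loop carries accumulator and environment as one tree, since a loop body sees only the
    -- element and one more tree; the last `set` drops the environment.
    pair (code l) (pair (code s) skip) ⨾
    set (consˣ (hdˣ (hdˣ var)) (consˣ (tlˣ (hdˣ var)) (tlˣ var))) ⨾
    loop (pair (code b) (set (consˣ (tlˣ (tlˣ (hdˣ var))) (tlˣ var)))) ⨾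
    set (consˣ (hdˣ (hdˣ var)) (tlˣ var))

-- Judgements on executions with the fixed digits δ, the called program A, and
-- the pay-off χ of the final content of register 0.
module Execution {c ℓ₁ ℓ₂} (R : ArchimedeanOrderedField c ℓ₁ ℓ₂) {m : ℕ} (δ : Digits m) (A : Program m)
                 (χ : Tree → ArchimedeanOrderedField.Carrier R) where
  open FieldProperties R
  open Mean R
  open Language δ
  open Machine δ A

  -- The pay-off clause holds for every T at which all runs have halted, not only for T ≥ n, because
  -- the success probability to be bounded quantifies over all such T.
  record Reach (n : ℕ) (cfg : Config m) (v : Carrier) : Set ℓ₂ where
    field
      halts  : ∀ {T} → n ℕ.≤ T → ∀ (ω : Vec Bool T) → Halted (run δ ω cfg)
      payoff : ∀ T → (∀ (ω : Vec Bool T) → Halted (run δ ω cfg)) → v ≤ mean T (λ ω → χ (proj₂ (run δ ω cfg) 0))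
  open Reach public

  run-halted : ∀ {T} (ω : Vec Bool T) σ → run δ ω ([] , σ) ≡ ([] , σ)
  run-halted []      σ = refl
  run-halted (_ ∷ ω) σ = run-halted ω σ

  reach-halted : ∀ n {σ v} → v ≤ χ (σ 0) → Reach n ([] , σ) v
  reach-halted n {σ} v≤ = record
    { halts  = λ _ ω → cong proj₁ (run-halted ω σ)
    ; payoff = λ T _ → ≤-mean T λ ω → subst (λ cfg → _ ≤ χ (proj₂ cfg 0)) (≡.sym (run-halted ω σ)) v≤
    }

  reach-weaken : ∀ {n n′ cfg v v′} → n ℕ.≤ n′ → v′ ≤ v → Reach n cfg v → Reach n′ cfg v′
  reach-weaken n≤n′ v′≤v r = record
    { halts  = λ n′≤T → halts r (ℕ.≤-trans n≤n′ n′≤T)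
    ; payoff = λ T h → ≤-trans v′≤v (payoff r T h)
    }

  reach-toss : ∀ {n cfg v} (u : Bool → Carrier) → v ≤ mid (u true) (u false) →
               (∀ b → Reach n (step δ b cfg) (u b)) → Reach (suc n) cfg v
  reach-toss {n} {cfg} {v} u v≤ r = record
    { halts  = λ { (ℕ.s≤s n≤T) (b ∷ ω) → halts (r b) n≤T ω }
    ; payoff = pay
    }
    where
    stuck : ∀ cfg → Halted cfg → ∀ b → step δ b cfg ≡ cfg
    stuck ([] , _) refl b = refl
    pay : ∀ T → (∀ (ω : Vec Bool T) → Halted (run δ ω cfg)) → v ≤ mean T (λ ω → χ (proj₂ (run δ ω cfg) 0))
    pay (suc T) h = ≤-trans v≤ (mid-mono (payoff (r true) T (h ∘ (true ∷_))) (payoff (r false) T (h ∘ (false ∷_))))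
    -- No step is left, so the configuration has halted and one more step does not change it: both
    -- values are lower bounds of the same pay-off.
    pay zero    h = ≤-trans v≤ (≤-trans (mid-mono (one true) (one false)) (≤-reflexive (½*[x+x] _)))
      where
      one : ∀ b → u b ≤ χ (proj₂ cfg 0)
      one b = payoff (subst (λ cfg′ → Reach n cfg′ (u b)) (stuck cfg (h []) b) (r b)) zero h

  reach-step : ∀ {n cfg v} → (∀ b → Reach n (step δ b cfg) v) → Reach (suc n) cfg v
  reach-step {v = v} r = reach-toss (λ _ → v) (≤-reflexive (≈-sym (½*[x+x] v))) r

  At : Store → Tree → Set
  At σ t = σ S ≡ t × (∀ r → r ℕ.< S → σ r ≡ nil)

  -- From t, the program P leads within n steps to states t′ of a value u with
  -- Q t′ u, and v is at most the expected value.
  Tri : ∀ {ℓ} → Program m → Tree → ℕ → Carrier → (Tree → Carrier → Set ℓ) → Set (c ⊔ ℓ₂ ⊔ ℓ)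
  Tri P t n v Q = ∀ K σ n′ → At σ t → (∀ t′ u σ′ → Q t′ u → At σ′ t′ → Reach n′ (K , σ′) u) →
                  Reach (n ℕ.+ n′) (P ∷ K , σ) v

  -- Quantified over v: a deterministic program hands any expected value on unchanged.
  Det : Program m → Tree → ℕ → Tree → Set (c ⊔ ℓ₂)
  Det P t n t′ = ∀ v → Tri P t n v (λ s u → s ≡ t′ × u ≡ v)

  weaken : ∀ {ℓ ℓ′} {P t n n′ v v′} {Q : Tree → Carrier → Set ℓ} {Q′ : Tree → Carrier → Set ℓ′} →
           n ℕ.≤ n′ → v′ ≤ v → (∀ s u → Q s u → Q′ s u) → Tri P t n v Q → Tri P t n′ v′ Q′
  weaken n≤n′ v′≤v Q⊆Q′ p K σ k at cont = reach-weaken (ℕ.+-monoˡ-≤ k n≤n′) v′≤v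
    (p K σ k at λ t′ u σ′ q → cont t′ u σ′ (Q⊆Q′ t′ u q))

  det-weaken : ∀ {P t n n′ t′} → n ℕ.≤ n′ → Det P t n t′ → Det P t n′ t′
  det-weaken n≤n′ p v = weaken n≤n′ ≤-refl (λ _ _ q → q) (p v)

  infixr 4 _⟫_ _⟫ᵈ_
  _⟫_ : ∀ {ℓ ℓ′} {P P′ t n n′ v} {Q : Tree → Carrier → Set ℓ} {Q′ : Tree → Carrier → Set ℓ′} →
        Tri P t n v Q → (∀ s u → Q s u → Tri P′ s n′ u Q′) → Tri (P ⨾ P′) t (suc (n ℕ.+ n′)) v Q′
  _⟫_ {P′ = P′} {n = n} {n′} p q K σ k at cont = reach-step λ _ →
    reach-weaken (ℕ.≤-reflexive (≡.sym (ℕ.+-assoc n n′ k))) ≤-refl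
      (p (P′ ∷ K) σ (n′ ℕ.+ k) at λ t′ u σ′ q′ at′ → q t′ u q′ K σ′ k at′ cont)

  _⟫ᵈ_ : ∀ {ℓ′} {P P′ t n n′ t′ v} {Q′ : Tree → Carrier → Set ℓ′} →
        Det P t n t′ → Tri P′ t′ n′ v Q′ → Tri (P ⨾ P′) t (suc (n ℕ.+ n′)) v Q′
  p ⟫ᵈ q = p _ ⟫ λ { _ _ (refl , refl) → q }

  at-update : ∀ {σ t} t′ → At σ t → At (σ [ S ↦ t′ ]) t′
  at-update {σ} t′ (_ , low) = lookup-update σ S t′ ,
    λ r r<S → ≡.trans (lookup-update-≢ σ t′ (ℕ.>⇒≢ r<S)) (low r r<S)

  set-det : ∀ e t → Det (set e) t 1 (evalˣ e t)
  set-det e t v K σ k at cont = reach-step λ _ → cont _ v _ (refl , refl)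
    (subst (At _) (⟦exprˣ⟧ S e σ (proj₁ at)) (at-update _ at))

  skip-det : ∀ t → Det skip t 1 t
  skip-det t v K σ k at cont = reach-step λ _ → cont t v σ (refl , refl) at

  push-reach : ∀ {n K σ t s v} → At σ t →
               (∀ σ′ → At σ′ (cons s t) → Reach n (K , σ′) v) → Reach (3 ℕ.+ n) (push ∷ K , σ [ 0 ↦ s ]) v
  push-reach {σ = σ} {t} {s} (top , low) cont =
    reach-step λ _ → reach-step λ _ → reach-step λ _ → cont _
      ( ≡.trans (lookup-update (σ [ 0 ↦ s ]) S _) (cong (cons s) top)
      , λ { zero _ → refl
          ; (suc r) r<S → ≡.trans (lookup-update-≢ (σ [ 0 ↦ s ]) {S} {suc r} _ (ℕ.>⇒≢ r<S)) (low (suc r) r<S) } )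

  coin-tri : ∀ {ℓ} {t v} {Q : Tree → Carrier → Set ℓ} (u : Bool → Carrier) → v ≤ mid (u true) (u false) →
             (∀ b → Q (cons (encodeBool b) t) (u b)) → Tri coin t 5 v Q
  coin-tri {t = t} u v≤ q K σ k at cont = reach-step λ _ → reach-toss u v≤ λ b →
    push-reach {s = encodeBool b} at λ σ′ at′ → cont _ (u b) σ′ (q b) at′

  ifnil-tri : ∀ {ℓ} {P P′ t n v} {Q : Tree → Carrier → Set ℓ} e →
              (evalˣ e t ≡ nil → Tri P t n v Q) → (∀ {x y} → evalˣ e t ≡ cons x y → Tri P′ t n v Q) →
              Tri (ifnil (exprˣ S e) P P′) t (suc n) v Q
  ifnil-tri {P = P} {P′} {t} e p p′ K σ k at cont = reach-step λ _ → go (⟦ exprˣ S e ⟧ σ) (⟦exprˣ⟧ S e σ (proj₁ at))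
    where
    go : ∀ s → s ≡ evalˣ e t → Reach _ (branch s (P ∷ K) (P′ ∷ K) , σ) _
    go nil        eq = p (≡.sym eq) K σ k at cont
    go (cons _ _) eq = p′ (≡.sym eq) K σ k at cont

  -- The invariant mentions the remaining list, which lets the expected value depend on the number
  -- of rounds to come. A round costs five steps besides the body.
  loop-tri : ∀ {ℓ} {P N} (I : Tree → Tree → Carrier → Set ℓ) →
             (∀ x l s u rest → I (cons x l) s u → Tri P (cons (cons x s) (cons l rest)) N u
               (λ t w → ∃[ s′ ] (t ≡ cons s′ (cons l rest) × I l s′ w))) →
             ∀ l s u rest → I l s u →
             Tri (loop P) (cons l (cons s rest)) (spine l ℕ.* (5 ℕ.+ N) ℕ.+ 3) u (λ t w → ∃[ s′ ] (t ≡ cons s′ rest × I nil s′ w))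
  loop-tri {P = P} {N} I body l s u rest i K σ k at cont =
    reach-weaken (ℕ.≤-reflexive (lem (spine l ℕ.* (5 ℕ.+ N)) k)) ≤-refl (reach-step λ _ → go l s u i σ at)
    where
    lem : ∀ a k → suc (a ℕ.+ (2 ℕ.+ k)) ≡ a ℕ.+ 3 ℕ.+ k
    lem = solve-∀
    lem₂ : ∀ N a → 4 ℕ.+ (N ℕ.+ (1 ℕ.+ a)) ≡ 5 ℕ.+ N ℕ.+ a
    lem₂ = solve-∀
    go : ∀ l s u → I l s u → ∀ σ → At σ (cons l (cons s rest)) →
         Reach (spine l ℕ.* (5 ℕ.+ N) ℕ.+ (2 ℕ.+ k)) (while (exprˣ S (hdˣ var)) _ ∷ set (tlˣ var) ∷ K , σ) u
    go nil s u i σ at = reach-step λ _ → subst (λ h → Reach _ (branch (head h) _ _ , σ) u) (≡.sym (proj₁ at))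
      (set-det (tlˣ var) _ u K σ k at λ { t′ _ σ′ (refl , refl) at′ → cont _ u σ′ (s , refl , i) at′ })
    go (cons x l) s u i σ at =
      reach-weaken (ℕ.≤-reflexive (≡.trans (lem₂ N _) (≡.sym (ℕ.+-assoc (5 ℕ.+ N) (spine l ℕ.* (5 ℕ.+ N)) (2 ℕ.+ k))))) ≤-refl
      (reach-step λ _ → subst (λ h → Reach _ (branch (head h) _ _ , σ) u) (≡.sym (proj₁ at))
        (reach-step λ _ → set-det _ _ u _ σ _ at λ { _ _ σ₁ (refl , refl) at₁ →
         reach-step λ _ → body x l s u rest i _ σ₁ _ at₁ λ { _ w σ₂ (s′ , refl , i′) at₂ →
         set-det _ _ w _ σ₂ _ at₂ λ { _ _ σ₃ (refl , refl) at₃ →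
         go l s′ w i′ σ₃ at₃ }}}))

  -- Both executions consume the same coins until the inner one halts. Coins that the inner run
  -- would still receive average over a constant, so halting early does no harm.
  run-embedded : ∀ {t K₂} T cfg₁ cfg₂ → Embeds S t K₂ cfg₁ cfg₂ →
    (∀ (ω : Vec Bool T) → Halted (run δ ω cfg₁)) → ∀ (u : Tree → Carrier) n →
    (∀ {σ₁ σ₂} → Embeds S t K₂ ([] , σ₁) (K₂ , σ₂) → Reach n (K₂ , σ₂) (u (σ₁ 0))) →
    Reach (T ℕ.+ n) cfg₂ (mean T (λ ω → u (proj₂ (run δ ω cfg₁) 0)))
  run-embedded T ([] , σ₁) (_ , σ₂) em@(embeds refl _ _ _) h u n cont =
    reach-weaken (ℕ.m≤n+m n T) (mean-≤ T λ ω → ≤-reflexive (≈-reflexive (cong (λ cfg → u (proj₂ cfg 0)) (run-halted ω σ₁)))) (cont em)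
  run-embedded zero    (P ∷ K₁ , σ₁) cfg₂ em h u n cont with h []
  ... | ()
  run-embedded (suc T) cfg₁@(P ∷ K₁ , σ₁) cfg₂ em h u n cont =
    reach-toss (λ b → mean T (λ ω → u (proj₂ (run δ (b ∷ ω) cfg₁) 0))) ≤-refl
      λ b → run-embedded T (step δ b cfg₁) (step δ b cfg₂) (step-embeds δ b em) (h ∘ (b ∷_)) u n cont

  clear-reach : ∀ {t K n v} r σ → r ℕ.≤ S → σ S ≡ t → (∀ s → r ℕ.≤ s → s ℕ.< S → σ s ≡ nil) →
                (∀ σ′ → At σ′ t → Reach n (K , σ′) v) → Reach (suc (2 ℕ.* r ℕ.+ n)) (clear r ∷ K , σ) v
  clear-reach zero σ r≤S top low cont = reach-step λ _ → cont σ (top , λ s → low s ℕ.z≤n)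
  clear-reach {n = n} (suc r) σ r<S top low cont = reach-weaken (ℕ.≤-reflexive (lem r n)) ≤-refl
    (reach-step λ _ → reach-step λ _ → clear-reach r (σ [ r ↦ nil ]) (ℕ.<⇒≤ r<S)
      (≡.trans (lookup-update-≢ σ nil (ℕ.<⇒≢ r<S)) top) low′ cont)
    where
    lem : ∀ r n → 2 ℕ.+ (1 ℕ.+ (2 ℕ.* r ℕ.+ n)) ≡ 1 ℕ.+ (2 ℕ.* (1 ℕ.+ r) ℕ.+ n)
    lem = solve-∀
    low′ : ∀ s → r ℕ.≤ s → s ℕ.< S → (σ [ r ↦ nil ]) s ≡ nil
    low′ s r≤s s<S with ℕ.m≤n⇒m<n∨m≡n r≤s
    ... | inj₁ r<s  = ≡.trans (lookup-update-≢ σ nil (ℕ.<⇒≢ r<s)) (low s r<s s<S)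
    ... | inj₂ refl = lookup-update σ r nil

  -- The time T of the called program depends on its input g, whereas U is a bound that all inputs
  -- of a phase can share.
  call-tri : ∀ {ℓ} {g rest v T U} {Q : Tree → Carrier → Set ℓ} (u : Tree → Carrier) →
    (∀ (ω : Vec Bool T) → Halted (run δ ω (initial A g))) → T ℕ.≤ U →
    v ≤ mean T (λ ω → u (proj₂ (run δ ω (initial A g)) 0)) →
    (∀ out → Q (cons out rest) (u out)) → Tri call (cons g rest) (U ℕ.+ callOverhead) v Q
  call-tri {g = g} {rest} {v} {T} {U} u h T≤U v≤ q K σ k at = λ cont →
    reach-weaken (arith (ℕ.≤-reflexive (lem T S k))) v≤ (reach-step λ _ → reach-step λ _ → reach-step λ _ →
      run-embedded T (initial A g) _
        (embeds refl (ℕ.n≤1+n _ ∷ [])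
          (λ { zero _ → cong head (≡.sym (eval-hd)) ; (suc r) r<S → ≡.sym (proj₂ at (suc r) r<S) })
          (≡.trans (lookup-update-≢ σ {0} {S} (⟦ exprˣ S (hdˣ var) ⟧ σ) (λ ())) (proj₁ at)))
        h u (3 ℕ.+ (2 ℕ.* S ℕ.+ k)) λ {σ₁} {σ₂} em → reach-step λ _ → reach-step λ _ →
          clear-reach S _ ℕ.≤-refl
            (≡.trans (lookup-update σ₂ S _) (cong₂ cons (≡.sym (Embeds.low em 0 (ℕ.s≤s ℕ.z≤n))) (⟦exprˣ⟧ S (tlˣ var) σ₂ (Embeds.top em))))
            (λ s S≤s s<S → ⊥-elim (ℕ.<⇒≱ s<S S≤s))
            (λ σ′ at′ → cont _ (u (σ₁ 0)) σ′ (q (σ₁ 0)) at′))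
    where
    eval-hd : cons (⟦ exprˣ S (hdˣ var) ⟧ σ) nil ≡ cons g nil
    eval-hd = cong (λ x → cons x nil) (⟦exprˣ⟧ S (hdˣ var) σ (proj₁ at))
    lem : ∀ T S k → 3 ℕ.+ (T ℕ.+ (2 ℕ.+ (1 ℕ.+ (2 ℕ.* S ℕ.+ k)))) ≡ T ℕ.+ (6 ℕ.+ 2 ℕ.* S) ℕ.+ k
    lem = solve-∀
    arith : ∀ {a} → a ℕ.≤ T ℕ.+ callOverhead ℕ.+ k → a ℕ.≤ U ℕ.+ callOverhead ℕ.+ k
    arith a≤ = ℕ.≤-trans a≤ (ℕ.+-monoˡ-≤ k (ℕ.+-monoˡ-≤ callOverhead T≤U))

  Fun : Program m → Tree → ℕ → Tree → Set (c ⊔ ℓ₂)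
  Fun P t n t′ = ∀ rest → Det P (cons t rest) n (cons t′ rest)

  pair-fun : ∀ {P Q t n₁ n₂ t₁ t₂} → Fun P t n₁ t₁ → Fun Q t n₂ t₂ → Fun (pair P Q) t (7 ℕ.+ (n₁ ℕ.+ n₂)) (cons t₁ t₂)
  pair-fun {n₁ = n₁} {n₂} p q rest v = weaken (ℕ.≤-reflexive (lem n₁ n₂)) ≤-refl (λ _ _ h → h)
    (set-det _ _ ⟫ᵈ p _ ⟫ᵈ set-det _ _ ⟫ᵈ q _ ⟫ᵈ set-det _ _ v)
    where
    lem : ∀ a b → suc (1 ℕ.+ suc (a ℕ.+ suc (1 ℕ.+ suc (b ℕ.+ 1)))) ≡ 7 ℕ.+ (a ℕ.+ b)
    lem = solve-∀

  fun-weaken : ∀ {P t n n′ t′} → n ℕ.≤ n′ → Fun P t n t′ → Fun P t n′ t′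
  fun-weaken n≤n′ p rest = det-weaken n≤n′ (p rest)

  digit-det : ∀ j x rest → Det (digit 0 j (exprˣ S (hdˣ var)) ⨾ push) (cons x rest) 5
                               (cons (encodeBool (δ j (spine x))) (cons x rest))
  digit-det j x rest v K σ k at cont = reach-step λ _ → reach-step λ _ →
    subst (λ e → Reach _ (push ∷ K , σ [ 0 ↦ encodeBool (δ j (spine e)) ]) v)
      (≡.sym (⟦exprˣ⟧ S (hdˣ var) σ (proj₁ at)))
      (push-reach at λ σ′ at′ → cont _ v σ′ (refl , refl) at′)

  if-fun : ∀ {P Q t n₁ n₂ t₁ t₂} x → Fun P t n₁ t₁ → Fun Q t n₂ t₂ → ∀ rest →
           Det (ifnil (exprˣ S (hdˣ var)) (set (tlˣ var) ⨾ P) (set (tlˣ var) ⨾ Q))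
               (cons x (cons t rest)) (3 ℕ.+ (n₁ ℕ.+ n₂)) (cons (caseT x t₁ t₂) rest)
  if-fun {n₁ = n₁} {n₂} nil        p q rest v = ifnil-tri (hdˣ var)
    (λ _ → weaken (ℕ.+-monoʳ-≤ 2 (ℕ.m≤m+n n₁ n₂)) ≤-refl (λ _ _ h → h) (set-det _ _ ⟫ᵈ p rest v)) λ ()
  if-fun {n₁ = n₁} {n₂} (cons _ _) p q rest v = ifnil-tri (hdˣ var)
    (λ ()) (λ _ → weaken (ℕ.+-monoʳ-≤ 2 (ℕ.m≤n+m n₂ n₁)) ≤-refl (λ _ _ h → h) (set-det _ _ ⟫ᵈ q rest v))

  -- Z has to bound the arguments of the body in all rounds. The quantity |l| + |s| + |l| Q + |e|
  -- never increases, because a round removes an element from l and adds at most Q to s.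
  fold-fun : ∀ {P f l s e} Z N (q : Poly) →
             (∀ x s → size (cons x (cons s e)) ℕ.≤ Z → Fun P (cons x (cons s e)) N (f (cons x (cons s e)))) →
             (∀ x s → size (f (cons x (cons s e))) ℕ.≤ size s ℕ.+ eval q (size x ℕ.+ size e)) →
             2 ℕ.+ size l ℕ.+ (size s ℕ.+ size l ℕ.* eval q (size l ℕ.+ size e)) ℕ.+ size e ℕ.≤ Z →
             ∀ rest → Det (loop (pair P (set (consˣ (tlˣ (tlˣ (hdˣ var))) (tlˣ var)))))
               (cons l (cons (cons s e) rest)) (spine l ℕ.* (5 ℕ.+ (7 ℕ.+ (N ℕ.+ 1))) ℕ.+ 3) (cons (cons (foldT f l s e) e) rest)
  fold-fun {P} {f} {l₀} {s₀} {e} Z N q p growth fits rest v =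
    weaken ℕ.≤-refl ≤-refl (λ { _ _ (_ , refl , s , refl , refl , _ , _ , refl) → refl , refl })
      (loop-tri I body l₀ _ v rest (s₀ , refl , refl , ℕ.≤-refl , fits , refl))
    where
    Q = eval q (size l₀ ℕ.+ size e)
    I : Tree → Tree → Carrier → Set c
    I l t u = ∃[ s ] (t ≡ cons s e × foldT f l s e ≡ foldT f l₀ s₀ e × size l ℕ.≤ size l₀ ×
      2 ℕ.+ size l ℕ.+ (size s ℕ.+ size l ℕ.* Q) ℕ.+ size e ℕ.≤ Z × u ≡ v)
    body : ∀ x l t u rest → I (cons x l) t u →
           Tri (pair P _) (cons (cons x t) (cons l rest)) (7 ℕ.+ (N ℕ.+ 1)) u (λ t w → ∃[ s′ ] (t ≡ cons s′ (cons l rest) × I l s′ w))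
    body x l _ _ rest (s , refl , eq , l≤ , fit , refl) = weaken ℕ.≤-refl ≤-refl post
      (pair-fun {n₁ = N} {1} (p x s small)
        (λ rest′ → set-det _ _) (cons l rest) v)
      where
      s′ = f (cons x (cons s e))
      l≤′ : size l ℕ.≤ size l₀
      l≤′ = ℕ.≤-trans (ℕ.≤-trans (ℕ.m≤n+m (size l) (size x)) (ℕ.n≤1+n _)) l≤
      x≤l₀ : size x ℕ.≤ size l₀
      x≤l₀ = ℕ.≤-trans (ℕ.≤-trans (ℕ.m≤m+n (size x) (size l)) (ℕ.n≤1+n _)) l≤
      lem₁ : ∀ x s e l Q → (1 ℕ.+ (x ℕ.+ (1 ℕ.+ (s ℕ.+ e)))) ℕ.+ (1 ℕ.+ l ℕ.+ (1 ℕ.+ (x ℕ.+ l)) ℕ.* Q) ≡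
             2 ℕ.+ (1 ℕ.+ (x ℕ.+ l)) ℕ.+ (s ℕ.+ (1 ℕ.+ (x ℕ.+ l)) ℕ.* Q) ℕ.+ e
      lem₁ = solve-∀
      lem₂ : ∀ x s e l Q → 2 ℕ.+ l ℕ.+ (s ℕ.+ Q ℕ.+ l ℕ.* Q) ℕ.+ e ℕ.+ (1 ℕ.+ x ℕ.+ x ℕ.* Q) ≡
             2 ℕ.+ (1 ℕ.+ (x ℕ.+ l)) ℕ.+ (s ℕ.+ (1 ℕ.+ (x ℕ.+ l)) ℕ.* Q) ℕ.+ e
      lem₂ = solve-∀
      small : size (cons x (cons s e)) ℕ.≤ Z
      small = begin
        size (cons x (cons s e))
          ≤⟨ ℕ.m≤m+n (size (cons x (cons s e))) (1 ℕ.+ size l ℕ.+ (1 ℕ.+ (size x ℕ.+ size l)) ℕ.* Q) ⟩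
        size (cons x (cons s e)) ℕ.+ (1 ℕ.+ size l ℕ.+ (1 ℕ.+ (size x ℕ.+ size l)) ℕ.* Q)
          ≡⟨ lem₁ (size x) (size s) (size e) (size l) Q ⟩
        2 ℕ.+ (1 ℕ.+ (size x ℕ.+ size l)) ℕ.+ (size s ℕ.+ (1 ℕ.+ (size x ℕ.+ size l)) ℕ.* Q) ℕ.+ size e
          ≤⟨ fit ⟩
        Z ∎
        where open ℕ.≤-Reasoning
      fit′ : 2 ℕ.+ size l ℕ.+ (size s′ ℕ.+ size l ℕ.* Q) ℕ.+ size e ℕ.≤ Z
      fit′ = begin
        2 ℕ.+ size l ℕ.+ (size s′ ℕ.+ size l ℕ.* Q) ℕ.+ size e
          ≤⟨ ℕ.+-monoˡ-≤ (size e) (ℕ.+-monoʳ-≤ (2 ℕ.+ size l) (ℕ.+-monoˡ-≤ (size l ℕ.* Q)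
               (ℕ.≤-trans (growth x s) (ℕ.+-monoʳ-≤ (size s) (eval-mono q (ℕ.+-monoˡ-≤ (size e) x≤l₀)))))) ⟩
        2 ℕ.+ size l ℕ.+ (size s ℕ.+ Q ℕ.+ size l ℕ.* Q) ℕ.+ size e
          ≤⟨ ℕ.m≤m+n _ _ ⟩
        2 ℕ.+ size l ℕ.+ (size s ℕ.+ Q ℕ.+ size l ℕ.* Q) ℕ.+ size e ℕ.+ (1 ℕ.+ size x ℕ.+ size x ℕ.* Q)
          ≡⟨ lem₂ (size x) (size s) (size e) (size l) Q ⟩
        2 ℕ.+ size (cons x l) ℕ.+ (size s ℕ.+ size (cons x l) ℕ.* Q) ℕ.+ size e
          ≤⟨ fit ⟩
        Z ∎
        where open ℕ.≤-Reasoning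
      post : ∀ t w → t ≡ cons (cons s′ e) (cons l rest) × w ≡ v → ∃[ t′ ] (t ≡ cons t′ (cons l rest) × I l t′ w)
      post _ _ (refl , refl) = cons s′ e , refl , s′ , refl , eq , l≤′ , fit′ , refl

  code-fun : ∀ f t → Fun (code f) t (eval (timePoly f) (size t)) (⟦ f ⟧ᶠ t)
  code-fun idᶠ t rest = skip-det _
  code-fun nilᶠ t rest = set-det _ _
  code-fun (consᶠ f g) t rest = det-weaken (ℕ.≤-reflexive (≡.sym (ℕ.+-assoc 7 (eval (timePoly f) (size t)) _)))
    (pair-fun (code-fun f t) (code-fun g t) rest)
  code-fun (hdᶠ f) t rest v = weaken (ℕ.≤-reflexive (cong suc (ℕ.+-comm _ 1))) ≤-refl (λ _ _ h → h)
    (code-fun f t rest ⟫ᵈ set-det _ _ v)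
  code-fun (tlᶠ f) t rest v = weaken (ℕ.≤-reflexive (cong suc (ℕ.+-comm _ 1))) ≤-refl (λ _ _ h → h)
    (code-fun f t rest ⟫ᵈ set-det _ _ v)
  code-fun (f ∘ᶠ g) t rest v = weaken
    (ℕ.s≤s (ℕ.+-monoʳ-≤ (eval (timePoly g) (size t)) (eval-⊚-≤ (timePoly f) (sizePoly g) (size t) (size-⟦⟧ g t))))
    ≤-refl (λ _ _ h → h) (code-fun g t rest ⟫ᵈ code-fun f _ rest v)
  code-fun (ifᶠ c f g) t rest v = weaken
    (ℕ.≤-reflexive (lem (eval (timePoly c) (size t)) (eval (timePoly f) (size t)) (eval (timePoly g) (size t))))
    ≤-refl (λ _ _ h → h) (set-det _ _ ⟫ᵈ code-fun c t _ ⟫ᵈ if-fun (⟦ c ⟧ᶠ t) (code-fun f t) (code-fun g t) rest v)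
    where
    lem : ∀ a b c → 2 ℕ.+ suc (a ℕ.+ (3 ℕ.+ (b ℕ.+ c))) ≡ 6 ℕ.+ a ℕ.+ b ℕ.+ c
    lem = solve-∀
  code-fun (digitᶠ j f) t rest v = weaken (ℕ.≤-reflexive (lem (eval (timePoly f) (size t)))) ≤-refl (λ _ _ h → h)
    (code-fun f t rest ⟫ᵈ digit-det j _ rest ⟫ᵈ set-det _ _ v)
    where
    lem : ∀ a → suc (a ℕ.+ suc (5 ℕ.+ 1)) ≡ 8 ℕ.+ a
    lem = solve-∀
  code-fun (foldᶠ l s b (q , growth)) t rest v = weaken time ≤-refl (λ _ _ h → h)
    (pair-fun (code-fun l t) (pair-fun (code-fun s t) (λ _ → skip-det _)) rest ⟫ᵈ set-det _ _ ⟫ᵈ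
     fold-fun (eval Zp n) (eval (timePoly b) (eval Zp n)) q
       (λ x a fits → fun-weaken (eval-mono (timePoly b) fits) (code-fun b _)) (λ x a → growth x a t) fit rest ⟫ᵈ
     set-det _ _ v)
    where
    n = size t
    L = eval (sizePoly l) n
    Zp = con 2 ⊕ sizePoly l ⊕ (sizePoly s ⊕ sizePoly l ⊗ (q ⊚ (sizePoly l ⊕ X))) ⊕ X
    fit : 2 ℕ.+ size (⟦ l ⟧ᶠ t) ℕ.+ (size (⟦ s ⟧ᶠ t) ℕ.+ size (⟦ l ⟧ᶠ t) ℕ.* eval q (size (⟦ l ⟧ᶠ t) ℕ.+ n)) ℕ.+ n ℕ.≤ eval Zp n
    fit = ℕ.+-monoˡ-≤ n (ℕ.+-mono-≤ (ℕ.+-monoʳ-≤ 2 (size-⟦⟧ l t)) (ℕ.+-mono-≤ (size-⟦⟧ s t)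
            (ℕ.*-mono-≤ (size-⟦⟧ l t) (eval-⊚-≤ q (sizePoly l ⊕ X) n (ℕ.+-monoˡ-≤ n (size-⟦⟧ l t))))))
    lem : ∀ a b c d → suc (7 ℕ.+ (a ℕ.+ (7 ℕ.+ (b ℕ.+ 1))) ℕ.+ suc (1 ℕ.+ suc (c ℕ.* (5 ℕ.+ (7 ℕ.+ (d ℕ.+ 1))) ℕ.+ 3 ℕ.+ 1))) ℕ.+ (7 ℕ.+ c ℕ.* 7) ≡
          30 ℕ.+ a ℕ.+ b ℕ.+ c ℕ.* (20 ℕ.+ d)
    lem = solve-∀
    A₁ = eval (timePoly l) n
    B₁ = eval (timePoly s) n
    D₁ = eval (timePoly b) (eval Zp n)
    c₁ = spine (⟦ l ⟧ᶠ t)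
    time : suc (7 ℕ.+ (A₁ ℕ.+ (7 ℕ.+ (B₁ ℕ.+ 1))) ℕ.+ suc (1 ℕ.+ suc (c₁ ℕ.* (5 ℕ.+ (7 ℕ.+ (D₁ ℕ.+ 1))) ℕ.+ 3 ℕ.+ 1))) ℕ.≤
           eval (timePoly (foldᶠ l s b (q , growth))) n
    -- The constants 30 and 20 are rounded up; the summand added first is the slack 7 + 7c₁.
    time = ℕ.≤-trans (ℕ.m≤m+n _ _) (ℕ.≤-trans (ℕ.≤-reflexive (lem A₁ B₁ c₁ D₁))
      (ℕ.+-monoʳ-≤ (30 ℕ.+ A₁ ℕ.+ B₁) (ℕ.*-mono-≤ (ℕ.≤-trans (spine≤size (⟦ l ⟧ᶠ t)) (size-⟦⟧ l t))
        (ℕ.+-monoʳ-≤ 20 (eval-⊚-≤ (timePoly b) Zp n ℕ.≤-refl)))))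

  code-run : ∀ f t rest → Det (code f) (cons t rest) (eval (timeBound f) (size t)) (cons (⟦ f ⟧ᶠ t) rest)
  code-run f t rest = det-weaken (timePoly≤timeBound f (size t)) (code-fun f t rest)

-- Restrictions of formulas

true≢false : true ≢ false
true≢false ()

Partial : ℕ → Set
Partial n = Vec (Maybe Bool) n

sameBool : Bool → Bool → Bool
sameBool true  b = b
sameBool false b = not b

sameBool-sound : ∀ a b → sameBool a b ≡ true → a ≡ b
sameBool-sound true  true  _ = refl
sameBool-sound false false _ = refl

sameBool-refl : ∀ a → sameBool a a ≡ true
sameBool-refl true  = refl
sameBool-refl false = refl

meets : Maybe Bool → Maybe Bool → Bool
meets nothing  _        = false
meets (just a) nothing  = false
meets (just a) (just b) = sameBool a b

-- Tells whether the partial assignment already satisfies the clause.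
hits : ∀ {n} → Clause n → Partial n → Bool
hits []      []      = false
hits (x ∷ C) (y ∷ π) = if meets x y then true else hits C π

hits-sound : ∀ {n} (C : Clause n) π → hits C π ≡ true → ∃[ x ] ∃[ b ] (lookup C x ≡ just b × lookup π x ≡ just b)
hits-sound []      []      ()
hits-sound (x ∷ C) (y ∷ π) h with meets x y in eq
... | true  = zero , meets-sound x y eq
  where
  meets-sound : ∀ x y → meets x y ≡ true → ∃[ b ] (x ≡ just b × y ≡ just b)
  meets-sound (just a) (just b) h = a , refl , cong just (sym (sameBool-sound a b h))
... | false with hits-sound C π h
...   | i , b , p , q = suc i , b , p , q

hits-complete : ∀ {n} (C : Clause n) π x {b} → lookup C x ≡ just b → lookup π x ≡ just b → hits C π ≡ true
hits-complete (_ ∷ C) (_ ∷ π) zero {b} refl refl rewrite sameBool-refl b = refl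
hits-complete (x ∷ C) (y ∷ π) (suc i) p q with meets x y
... | true  = refl
... | false = hits-complete C π i p q

total : ∀ {n} → Assignment n → Partial n
total = Vec.map just

hits-total : ∀ {n} (C : Clause n) α → hits C (total α) ≡ true → SatisfiesClause α C
hits-total C α h with hits-sound C (total α) h
... | x , b , p , q with trans (sym q) (Vec.lookup-map x just α)
...   | refl = x , p

total-hits : ∀ {n} (C : Clause n) α → SatisfiesClause α C → hits C (total α) ≡ true
total-hits C α (x , p) = hits-complete C (total α) x p (Vec.lookup-map x just α)

Agrees : Maybe Bool → Bool → Set
Agrees nothing  _ = ⊤
Agrees (just b) a = b ≡ a

agrees? : ∀ y a → Dec (Agrees y a)
agrees? nothing  a = yes tt
agrees? (just b) a = b Bool.≟ a

Extends : ∀ {n} → Partial n → Assignment n → Set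
Extends π α = ∀ x → Agrees (lookup π x) (lookup α x)

Sat : ∀ {n} → CNF n → Partial n → Set
Sat F π = ∃[ α ] (α ⊨ F × Extends π α)

sat? : ∀ {n} (F : CNF n) π → Dec (Sat F π)
sat? F π = anySubset? λ α → (α ⊨? F) ×-dec Fin.all? (λ x → agrees? (lookup π x) (lookup α x))

extends-≔ : ∀ {n} (π : Partial n) {α} x → Extends π α → Extends (π [ x ]≔ just (lookup α x)) α
extends-≔ π {α} x ext y with x Fin.≟ y
... | yes refl rewrite Vec.lookup∘updateAt x {λ _ → just (lookup α x)} π = refl
... | no x≢y  rewrite Vec.lookup∘updateAt′ y x {λ _ → just (lookup α x)} (x≢y ∘ sym) π = ext y

blank : ∀ n → Partial n
blank n = replicate n nothing

extends-blank : ∀ {n} (α : Assignment n) → Extends (blank n) α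
extends-blank {n} α x rewrite Vec.lookup-replicate x (nothing {A = Bool}) = tt

-- Vectors cut down to the coordinates selected by a mask: the variables of a restricted formula
-- have to be renumbered so that exactly the occurring ones remain.
cnt : ∀ {n} → Vec Bool n → ℕ
cnt []          = 0
cnt (true ∷ m)  = suc (cnt m)
cnt (false ∷ m) = cnt m

project : ∀ {A : Set} {n} (m : Vec Bool n) → Vec A n → Vec A (cnt m)
project []          []      = []
project (true ∷ m)  (x ∷ v) = x ∷ project m v
project (false ∷ m) (x ∷ v) = project m v

merge : ∀ {A : Set} {n} (m : Vec Bool n) → Vec A n → Vec A (cnt m) → Vec A n
merge []          []      []      = []
merge (true ∷ m)  (_ ∷ γ) (b ∷ β) = b ∷ merge m γ β
merge (false ∷ m) (c ∷ γ) β       = c ∷ merge m γ β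

pos : ∀ {n} (m : Vec Bool n) → Fin (cnt m) → Fin n
pos (true ∷ m)  zero    = zero
pos (true ∷ m)  (suc y) = suc (pos m y)
pos (false ∷ m) y       = suc (pos m y)

lookup-pos : ∀ {n} (m : Vec Bool n) y → lookup m (pos m y) ≡ true
lookup-pos (true ∷ m)  zero    = refl
lookup-pos (true ∷ m)  (suc y) = lookup-pos m y
lookup-pos (false ∷ m) y       = lookup-pos m y

lookup-project : ∀ {A : Set} {n} (m : Vec Bool n) (v : Vec A n) y → lookup (project m v) y ≡ lookup v (pos m y)
lookup-project (true ∷ m)  (x ∷ v) zero    = refl
lookup-project (true ∷ m)  (x ∷ v) (suc y) = lookup-project m v y
lookup-project (false ∷ m) (x ∷ v) y       = lookup-project m v y

lookup-merge : ∀ {A : Set} {n} (m : Vec Bool n) (γ : Vec A n) β y → lookup (merge m γ β) (pos m y) ≡ lookup β y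
lookup-merge (true ∷ m)  (_ ∷ γ) (b ∷ β) zero    = refl
lookup-merge (true ∷ m)  (_ ∷ γ) (b ∷ β) (suc y) = lookup-merge m γ β y
lookup-merge (false ∷ m) (_ ∷ γ) β       y       = lookup-merge m γ β y

lookup-merge-false : ∀ {A : Set} {n} (m : Vec Bool n) (γ : Vec A n) β x → lookup m x ≡ false →
                     lookup (merge m γ β) x ≡ lookup γ x
lookup-merge-false (true ∷ m)  (_ ∷ γ) (_ ∷ β) (suc x) h = lookup-merge-false m γ β x h
lookup-merge-false (false ∷ m) (_ ∷ γ) β       zero    h = refl
lookup-merge-false (false ∷ m) (_ ∷ γ) β       (suc x) h = lookup-merge-false m γ β x h

pos-or-false : ∀ {n} (m : Vec Bool n) x → (∃[ y ] x ≡ pos m y) ⊎ lookup m x ≡ false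
pos-or-false (true ∷ m)  zero    = inj₁ (zero , refl)
pos-or-false (false ∷ m) zero    = inj₂ refl
pos-or-false (true ∷ m)  (suc x) with pos-or-false m x
... | inj₁ (y , eq) = inj₁ (suc y , cong suc eq)
... | inj₂ eq       = inj₂ eq
pos-or-false (false ∷ m) (suc x) with pos-or-false m x
... | inj₁ (y , eq) = inj₁ (y , cong suc eq)
... | inj₂ eq       = inj₂ eq

width-project : ∀ {n} (m : Vec Bool n) (C : Clause n) → width (project m C) ℕ.≤ width C
width-project []          []            = ℕ.z≤n
width-project (true ∷ m)  (just _ ∷ C)  = ℕ.s≤s (width-project m C)
width-project (true ∷ m)  (nothing ∷ C) = width-project m C
width-project (false ∷ m) (just _ ∷ C)  = ℕ.≤-trans (width-project m C) (ℕ.n≤1+n _)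
width-project (false ∷ m) (nothing ∷ C) = width-project m C

-- A right fold with a Boolean test, like the functions below, so that a functional program for it
-- can be verified round by round.
survivors : ∀ {n} → Partial n → List (Clause n) → List (Clause n)
survivors π = List.foldr (λ C s → if hits C π then s else C ∷ s) []

∈-survivors⁻ : ∀ {n} (π : Partial n) L {C} → C ∈ survivors π L → C ∈ L
∈-survivors⁻ π (D ∷ L) C∈ with hits D π
∈-survivors⁻ π (D ∷ L) C∈         | true  = there (∈-survivors⁻ π L C∈)
∈-survivors⁻ π (D ∷ L) (here eq)  | false = here eq
∈-survivors⁻ π (D ∷ L) (there C∈) | false = there (∈-survivors⁻ π L C∈)

survivors-unhit : ∀ {n} (π : Partial n) L {C} → C ∈ survivors π L → hits C π ≡ false
survivors-unhit π (D ∷ L) C∈ with hits D π in eq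
survivors-unhit π (D ∷ L) C∈          | true  = survivors-unhit π L C∈
survivors-unhit π (D ∷ L) (here refl) | false = eq
survivors-unhit π (D ∷ L) (there C∈)  | false = survivors-unhit π L C∈

∈-survivors⁺ : ∀ {n} (π : Partial n) L {C} → C ∈ L → hits C π ≡ false → C ∈ survivors π L
∈-survivors⁺ π (D ∷ L) (here refl) h rewrite h = here refl
∈-survivors⁺ π (D ∷ L) (there C∈)  h with hits D π
... | true  = ∈-survivors⁺ π L C∈ h
... | false = there (∈-survivors⁺ π L C∈ h)

occursIn : ∀ {n} → List (Clause n) → Vec Bool n
occursIn = List.foldr (zipWith (λ x b → if is-just x then true else b)) (replicate _ false)

occursIn-just : ∀ {n} (L : List (Clause n)) {C} x {b} → C ∈ L → lookup C x ≡ just b → lookup (occursIn L) x ≡ true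
occursIn-just (D ∷ L) x C∈ eq rewrite Vec.lookup-zipWith (λ x b → if is-just x then true else b) x D (occursIn L)
  with C∈
... | here refl rewrite eq = refl
... | there C∈′ with is-just (lookup D x)
...   | true  = refl
...   | false = occursIn-just L x C∈′ eq

occursIn-any : ∀ {n} (L : List (Clause n)) x → lookup (occursIn L) x ≡ true → ∃[ C ] (C ∈ L × Is-just (lookup C x))
occursIn-any [] x h rewrite Vec.lookup-replicate x false with h
... | ()
occursIn-any (D ∷ L) x h rewrite Vec.lookup-zipWith (λ x b → if is-just x then true else b) x D (occursIn L)
  with lookup D x in eq
... | just b  = D , here refl , subst Is-just (sym eq) (Maybe.just tt)
... | nothing with occursIn-any L x h
...   | C , C∈ , j = C , there C∈ , j

liveOf : Maybe Bool → Bool → Bool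
liveOf nothing  b = b
liveOf (just _) b = false

-- A variable left open by π may vanish together with the satisfied clauses and is then no variable
-- of the restricted formula; hence both conditions.
live : ∀ {n} → Partial n → List (Clause n) → Vec Bool n
live π L = zipWith liveOf π (occursIn (survivors π L))

sameMaybe : Maybe Bool → Maybe Bool → Bool
sameMaybe nothing  nothing  = true
sameMaybe nothing  (just _) = false
sameMaybe (just _) nothing  = false
sameMaybe (just a) (just b) = sameBool a b

sameMaybe-sound : ∀ x y → sameMaybe x y ≡ true → x ≡ y
sameMaybe-sound nothing  nothing  _ = refl
sameMaybe-sound (just a) (just b) h = cong just (sameBool-sound a b h)

sameMaybe-refl : ∀ x → sameMaybe x x ≡ true
sameMaybe-refl nothing  = refl
sameMaybe-refl (just a) = sameBool-refl a

sameClause : ∀ {n} → Clause n → Clause n → Bool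
sameClause []      []      = true
sameClause (x ∷ C) (y ∷ D) = if sameMaybe x y then sameClause C D else false

sameClause-sound : ∀ {n} (C D : Clause n) → sameClause C D ≡ true → C ≡ D
sameClause-sound []      []      _ = refl
sameClause-sound (x ∷ C) (y ∷ D) h with sameMaybe x y in eq
... | true = cong₂ _∷_ (sameMaybe-sound x y eq) (sameClause-sound C D h)

sameClause-refl : ∀ {n} (C : Clause n) → sameClause C C ≡ true
sameClause-refl []      = refl
sameClause-refl (x ∷ C) rewrite sameMaybe-refl x = sameClause-refl C

member : ∀ {n} → Clause n → List (Clause n) → Bool
member C = List.foldr (λ D b → if sameClause C D then true else b) false

member-sound : ∀ {n} (C : Clause n) L → member C L ≡ true → C ∈ L
member-sound C (D ∷ L) h with sameClause C D in eq
... | true  = here (sameClause-sound C D eq)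
... | false = there (member-sound C L h)

member-complete : ∀ {n} (C : Clause n) L → C ∈ L → member C L ≡ true
member-complete C (D ∷ L) (here refl) rewrite sameClause-refl C = refl
member-complete C (D ∷ L) (there C∈) with sameClause C D
... | true  = refl
... | false = member-complete C L C∈

-- Clauses that differ only in literals falsified by π coincide after the projection, while the
-- clauses of a formula are distinct.
dedup : ∀ {n} → List (Clause n) → List (Clause n)
dedup = List.foldr (λ C s → if member C s then s else C ∷ s) []

∈-dedup⁺ : ∀ {n} (L : List (Clause n)) {C} → C ∈ L → C ∈ dedup L
∈-dedup⁺ (D ∷ L) (here refl) with member D (dedup L) in eq
... | true  = member-sound D (dedup L) eq
... | false = here refl
∈-dedup⁺ (D ∷ L) (there C∈) with member D (dedup L)
... | true  = ∈-dedup⁺ L C∈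
... | false = there (∈-dedup⁺ L C∈)

∈-dedup⁻ : ∀ {n} (L : List (Clause n)) {C} → C ∈ dedup L → C ∈ L
∈-dedup⁻ (D ∷ L) C∈ with member D (dedup L)
∈-dedup⁻ (D ∷ L) C∈         | true  = there (∈-dedup⁻ L C∈)
∈-dedup⁻ (D ∷ L) (here eq)  | false = here eq
∈-dedup⁻ (D ∷ L) (there C∈) | false = there (∈-dedup⁻ L C∈)

dedup-unique : ∀ {n} (L : List (Clause n)) → Unique (dedup L)
dedup-unique []      = []
dedup-unique (D ∷ L) with member D (dedup L) in eq
... | true  = dedup-unique L
... | false = All.tabulate (λ {C} C∈ D≡C → true≢false
                (trans (sym (member-complete D (dedup L) (subst (_∈ dedup L) (sym D≡C) C∈))) eq)) ∷ dedup-unique L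

module Restriction {n} (F : CNF n) (π : Partial n) where

  mask : Vec Bool n
  mask = live π (clauses F)

  residual : List (Clause (cnt mask))
  residual = List.map (project mask) (survivors π (clauses F))

  lookup-mask : ∀ x → lookup mask x ≡ liveOf (lookup π x) (lookup (occursIn (survivors π (clauses F))) x)
  lookup-mask x = Vec.lookup-zipWith liveOf x π _

  mask-unset : ∀ x → lookup mask x ≡ true → lookup π x ≡ nothing
  mask-unset x h with lookup π x | trans (sym (lookup-mask x)) h
  ... | nothing | _ = refl

  restrict : CNF (cnt mask)
  restrict = record
    { clauses  = dedup residual
    ; distinct = dedup-unique residual
    ; occurs   = occ
    }
    where
    occ : ∀ y → Any (λ C → Is-just (lookup C y)) (dedup residual)
    occ y with lookup π (pos mask y) | trans (sym (lookup-mask (pos mask y))) (lookup-pos mask y)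
    ... | nothing | h with occursIn-any (survivors π (clauses F)) (pos mask y) h
    ...   | C , C∈ , j = lose (∈-dedup⁺ residual (∈-map⁺ (project mask) C∈))
                              (subst Is-just (sym (lookup-project mask C y)) j)

  restrict-width : ∀ k → WidthAtMost k F → WidthAtMost k restrict
  restrict-width k w = All.tabulate λ {C} C∈ → case ∈-map⁻ (project mask) (∈-dedup⁻ residual C∈) of λ where
    (D , D∈ , refl) → ℕ.≤-trans (width-project mask D) (All.lookup w (∈-survivors⁻ π (clauses F) D∈))

  merge-extends : ∀ {γ β} → Extends π γ → Extends π (merge mask γ β)
  merge-extends {γ} {β} ext x with pos-or-false mask x
  ... | inj₂ x-false rewrite lookup-merge-false mask γ β x x-false = ext x
  ... | inj₁ (y , refl) rewrite mask-unset (pos mask y) (lookup-pos mask y) = tt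

  -- A clause hit by π stays satisfied because the merge still extends π: it overwrites only mask
  -- coordinates, which π leaves open. Every other clause survives, and β satisfies its projection.
  merge-sat : ∀ {γ β} → Extends π γ → β ⊨ restrict → merge mask γ β ⊨ F
  merge-sat {γ} {β} ext β⊨ = All.tabulate λ {C} C∈ → sat C C∈
    where
    sat : ∀ C → C ∈ clauses F → SatisfiesClause (merge mask γ β) C
    sat C C∈ with hits C π in eq
    ... | true with hits-sound C π eq
    ...   | x , b , p , q = x , trans p (cong just (b≡ (merge-extends {γ} {β} ext x)))
      where
      b≡ : Agrees (lookup π x) (lookup (merge mask γ β) x) → b ≡ lookup (merge mask γ β) x
      b≡ a rewrite q = a
    sat C C∈ | false with All.lookup β⊨ (∈-dedup⁺ residual (∈-map⁺ (project mask) (∈-survivors⁺ π (clauses F) C∈ eq)))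
    ...   | y , p = pos mask y , trans (sym (lookup-project mask C y)) (trans p (cong just (sym (lookup-merge mask γ β y))))

  -- The literal that α satisfies in a surviving clause lies in the mask: were its variable set by
  -- π, the clause would be hit; otherwise the variable is open and occurs in a survivor.
  project-sat : ∀ {α} → α ⊨ F → Extends π α → project mask α ⊨ restrict
  project-sat {α} α⊨ ext = All.tabulate λ {C} C∈ → case ∈-map⁻ (project mask) (∈-dedup⁻ residual C∈) of λ where
      (D , D∈ , refl) → sat D D∈ (All.lookup α⊨ (∈-survivors⁻ π (clauses F) D∈))
    where
    sat : ∀ D → D ∈ survivors π (clauses F) → SatisfiesClause α D → SatisfiesClause (project mask α) (project mask D)
    sat D D∈ (x , p) with pos-or-false mask x
    ... | inj₁ (y , refl) = y , trans (lookup-project mask D y) (trans p (cong just (sym (lookup-project mask α y))))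
    ... | inj₂ x-false with lookup π x in eq | ext x | trans (sym (lookup-mask x)) x-false
    ...   | just b  | refl | _ = ⊥-elim (true≢false
              (trans (sym (hits-complete D π x p eq)) (survivors-unhit π (clauses F) D∈)))
    ...   | nothing | _    | h = ⊥-elim (true≢false (trans (sym (occursIn-just (survivors π (clauses F)) x D∈ p)) h))

  satisfiable-restrict : Sat F π → Satisfiable restrict
  satisfiable-restrict (α , α⊨ , ext) = project mask α , project-sat {α} α⊨ ext

-- Assigning one variable, and the number of good choices

unset : ∀ {n} → Partial n → ℕ
unset []            = 0
unset (nothing ∷ π) = suc (unset π)
unset (just _ ∷ π)  = unset π

unset-blank : ∀ n → unset (blank n) ≡ n
unset-blank zero    = refl
unset-blank (suc n) = cong suc (unset-blank n)

cnt-live : ∀ {n} (π : Partial n) L → cnt (live π L) ℕ.≤ unset π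
cnt-live π L = go π (occursIn (survivors π L))
  where
  go : ∀ {n} (π : Partial n) o → cnt (zipWith liveOf π o) ℕ.≤ unset π
  go []            []          = ℕ.z≤n
  go (nothing ∷ π) (true ∷ o)  = ℕ.s≤s (go π o)
  go (nothing ∷ π) (false ∷ o) = ℕ.≤-trans (go π o) (ℕ.n≤1+n _)
  go (just _ ∷ π)  (_ ∷ o)     = go π o

pickStep : ∀ {n} → Bool → Maybe Bool → ℕ × Partial n → ℕ × Partial (suc n)
pickStep v (just b) (p , π)           = p , just b ∷ π
pickStep v nothing  (zero , π)        = zero , nothing ∷ π
pickStep v nothing  (suc zero , π)    = zero , just v ∷ π
pickStep v nothing  (suc (suc p) , π) = suc p , nothing ∷ π

-- Assigns v to the p-th unassigned variable, counted from 1 at the end of the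
-- vector; the first component is the number of positions still to go.
pick : ∀ {n} → Bool → ℕ → Partial n → ℕ × Partial n
pick v p []      = p , []
pick v p (y ∷ π) = pickStep v y (pick v p π)

pick-beyond : ∀ {n} v (π : Partial n) j → pick v (unset π ℕ.+ suc j) π ≡ (suc j , π)
pick-beyond v []            j = refl
pick-beyond v (just b ∷ π)  j rewrite pick-beyond v π j = refl
pick-beyond v (nothing ∷ π) j rewrite sym (ℕ.+-suc (unset π) (suc j)) | pick-beyond v π (suc j) = refl

pick-done : ∀ {n} v (π : Partial n) p → p ℕ.≤ unset π → proj₁ (pick v p π) ≡ 0
pick-done v []            zero p≤ = refl
pick-done v (just b ∷ π)  p p≤ = pick-done v π p p≤
pick-done v (nothing ∷ π) p p≤ with ℕ.m≤n⇒m<n∨m≡n p≤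
... | inj₂ refl rewrite ℕ.+-comm 1 (unset π) | pick-beyond v π 0 = refl
... | inj₁ (ℕ.s≤s p≤′) with pick v p π | pick-done v π p p≤′
...   | zero , _ | refl = refl

pick-within : ∀ {n} v (π : Partial n) p → p ℕ.≤ unset π → pick v p (nothing ∷ π) ≡ (0 , nothing ∷ proj₂ (pick v p π))
pick-within v π p p≤ with pick v p π | pick-done v π p p≤
... | zero , _ | refl = refl

pick-last : ∀ {n} v (π : Partial n) → pick v (suc (unset π)) (nothing ∷ π) ≡ (0 , just v ∷ π)
pick-last v π rewrite ℕ.+-comm 1 (unset π) | pick-beyond v π 0 = refl

choose : ∀ {n} → Partial n → ℕ → Bool → Partial n
choose π p v = proj₂ (pick v p π)

unset-choose : ∀ {n} v (π : Partial n) p → 1 ℕ.≤ p → p ℕ.≤ unset π → suc (unset (choose π p v)) ≡ unset π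
unset-choose v []            (suc p) 1≤p ()
unset-choose v (just b ∷ π)  p 1≤p p≤ = unset-choose v π p 1≤p p≤
unset-choose v (nothing ∷ π) p 1≤p p≤ with ℕ.m≤n⇒m<n∨m≡n p≤
... | inj₂ refl rewrite pick-last v π = refl
... | inj₁ (ℕ.s≤s p≤′) rewrite pick-within v π p p≤′ = cong suc (unset-choose v π p 1≤p p≤′)

sum₁ : ℕ → (ℕ → ℕ) → ℕ
sum₁ zero    f = 0
sum₁ (suc N) f = f (suc N) ℕ.+ sum₁ N f

sum₁-cong : ∀ N {f g} → (∀ L → L ℕ.≤ N → f L ≡ g L) → sum₁ N f ≡ sum₁ N g
sum₁-cong zero    h = refl
sum₁-cong (suc N) h = cong₂ ℕ._+_ (h (suc N) ℕ.≤-refl) (sum₁-cong N λ L L≤N → h L (ℕ.≤-trans L≤N (ℕ.n≤1+n N)))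

sumUnset : ∀ {n} → Partial n → (Fin n → ℕ) → ℕ
sumUnset []            h = 0
sumUnset (nothing ∷ π) h = h zero ℕ.+ sumUnset π (h ∘ suc)
sumUnset (just _ ∷ π)  h = sumUnset π (h ∘ suc)

sumUnset-mono : ∀ {n} (π : Partial n) {h h′ : Fin n → ℕ} → (∀ x → lookup π x ≡ nothing → h x ℕ.≤ h′ x) → sumUnset π h ℕ.≤ sumUnset π h′
sumUnset-mono []            le = ℕ.z≤n
sumUnset-mono (nothing ∷ π) le = ℕ.+-mono-≤ (le zero refl) (sumUnset-mono π (le ∘ suc))
sumUnset-mono (just _ ∷ π)  le = sumUnset-mono π (le ∘ suc)

sumUnset-+ : ∀ {n} (π : Partial n) (h h′ : Fin n → ℕ) → sumUnset π (λ x → h x ℕ.+ h′ x) ≡ sumUnset π h ℕ.+ sumUnset π h′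
sumUnset-+ []            h h′ = refl
sumUnset-+ (nothing ∷ π) h h′ rewrite sumUnset-+ π (h ∘ suc) (h′ ∘ suc) = lem (h zero) _ _ _
  where
  lem : ∀ a b c d → a ℕ.+ b ℕ.+ (c ℕ.+ d) ≡ a ℕ.+ c ℕ.+ (b ℕ.+ d)
  lem = solve-∀
sumUnset-+ (just _ ∷ π)  h h′ = sumUnset-+ π (h ∘ suc) (h′ ∘ suc)

sumUnset-2 : ∀ {n} (π : Partial n) → sumUnset π (λ _ → 2) ≡ 2 ℕ.* unset π
sumUnset-2 []            = refl
sumUnset-2 (nothing ∷ π) rewrite sumUnset-2 π = lem (unset π)
  where
  lem : ∀ a → 2 ℕ.+ 2 ℕ.* a ≡ 2 ℕ.* (1 ℕ.+ a)
  lem = solve-∀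
sumUnset-2 (just _ ∷ π)  = sumUnset-2 π

-- As L runs through 1, ..., `unset π`, `choose` reaches every unassigned variable exactly once.
sum-choose : ∀ {n} v (π : Partial n) (g : Partial n → ℕ) →
             sum₁ (unset π) (λ L → g (choose π L v)) ≡ sumUnset π (λ x → g (π [ x ]≔ just v))
sum-choose v []            g = refl
sum-choose v (just b ∷ π)  g = sum-choose v π (g ∘ (just b ∷_))
sum-choose v (nothing ∷ π) g = cong₂ ℕ._+_ (cong (g ∘ proj₂) (pick-last v π))
  (trans (sum₁-cong (unset π) λ L L≤ → cong (g ∘ proj₂) (pick-within v π L L≤)) (sum-choose v π (g ∘ (nothing ∷_))))

indicator : ∀ {p} {P : Set p} → Dec P → ℕ
indicator (yes _) = 1
indicator (no _)  = 0

indicator-yes : ∀ {p} {P : Set p} (P? : Dec P) → P → indicator P? ≡ 1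
indicator-yes (yes _) p = refl
indicator-yes (no ¬p) p = ⊥-elim (¬p p)

indicator-no : ∀ {p} {P : Set p} (P? : Dec P) → ¬ P → indicator P? ≡ 0
indicator-no (yes p) ¬p = ⊥-elim (¬p p)
indicator-no (no _)  ¬p = refl

sumFin : ∀ {n} → (Fin n → ℕ) → ℕ
sumFin {zero}  h = 0
sumFin {suc n} h = h zero ℕ.+ sumFin (h ∘ suc)

length-filter-tabulate : ∀ {a p} {A : Set a} {P : Pred A p} (P? : Decidable P) {n} (f : Fin n → A) →
                         length (filter P? (List.tabulate f)) ≡ sumFin (λ y → indicator (P? (f y)))
length-filter-tabulate P? {zero}  f = refl
length-filter-tabulate P? {suc n} f with P? (f zero)
... | yes _ = cong suc (length-filter-tabulate P? (f ∘ suc))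
... | no _  = length-filter-tabulate P? (f ∘ suc)

-- Extension by 0 outside the mask.
spread : ∀ {n} (m : Vec Bool n) → (Fin (cnt m) → ℕ) → Fin n → ℕ
spread (true ∷ m)  h zero    = h zero
spread (true ∷ m)  h (suc x) = spread m (h ∘ suc) x
spread (false ∷ m) h zero    = 0
spread (false ∷ m) h (suc x) = spread m h x

spread-pos : ∀ {n} (m : Vec Bool n) h y → spread m h (pos m y) ≡ h y
spread-pos (true ∷ m)  h zero    = refl
spread-pos (true ∷ m)  h (suc y) = spread-pos m (h ∘ suc) y
spread-pos (false ∷ m) h y       = spread-pos m h y

sum-spread : ∀ {n} (π : Partial n) m h → sumUnset π (spread m h) ℕ.≤ sumFin h
sum-spread []            []          h = ℕ.z≤n
sum-spread (nothing ∷ π) (true ∷ m)  h = ℕ.+-monoʳ-≤ (h zero) (sum-spread π m (h ∘ suc))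
sum-spread (nothing ∷ π) (false ∷ m) h = sum-spread π m h
sum-spread (just _ ∷ π)  (true ∷ m)  h = ℕ.≤-trans (sum-spread π m (h ∘ suc)) (ℕ.m≤n+m _ _)
sum-spread (just _ ∷ π)  (false ∷ m) h = sum-spread π m h

opaque
  good : ∀ {n} → CNF n → Partial n → ℕ
  good F π = indicator (sat? F π)

  good-yes : ∀ {n} (F : CNF n) {π} → Sat F π → good F π ≡ 1
  good-yes F {π} = indicator-yes (sat? F π)

  good-no : ∀ {n} (F : CNF n) {π} → ¬ Sat F π → good F π ≡ 0
  good-no F {π} = indicator-no (sat? F π)

  criticalFlag : ∀ {n} (F : CNF n) → Fin n → ℕ
  criticalFlag F y = indicator (critical? F y)

  criticalFlag-yes : ∀ {n} (F : CNF n) y → Critical F y → criticalFlag F y ≡ 1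
  criticalFlag-yes F y = indicator-yes (critical? F y)

  sum-criticalFlag : ∀ {n} (F : CNF n) → sumFin (criticalFlag F) ≡ #critical F
  sum-criticalFlag F = sym (length-filter-tabulate (critical? F) id)

module _ {n} (F : CNF n) (π : Partial n) where
  open Restriction F π

  goodValues : Fin n → ℕ
  goodValues x = good F (π [ x ]≔ just true) ℕ.+ good F (π [ x ]≔ just false)

  extends-unset : ∀ {α} x v → lookup π x ≡ nothing → Extends π α → Extends π (α [ x ]≔ v)
  extends-unset {α} x v x-unset ext y with x Fin.≟ y
  ... | yes refl rewrite x-unset = tt
  ... | no x≢y rewrite Vec.lookup∘updateAt′ y x {λ _ → v} (x≢y ∘ sym) α = ext y

  sat-merge : ∀ γ β x → Extends π γ → β ⊨ restrict → Sat F (π [ x ]≔ just (lookup (merge mask γ β) x))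
  sat-merge γ β x ext β⊨ = merge mask γ β , merge-sat {γ} {β} ext β⊨ , extends-≔ π {merge mask γ β} x (merge-extends {γ} {β} ext)

  -- A value that destroys satisfiability is avoided by all solutions of the restriction.
  sat-or-critical : Sat F π → ∀ y → (∀ v → Sat F (π [ pos mask y ]≔ just v)) ⊎
                    Critical restrict y × ∃[ v ] Sat F (π [ pos mask y ]≔ just v)
  sat-or-critical (α , α⊨ , ext) y with sat? F (π [ pos mask y ]≔ just true) | sat? F (π [ pos mask y ]≔ just false)
  ... | yes t | yes f = inj₁ λ { true → t ; false → f }
  ... | yes t | no ¬f = inj₂ ((λ β β′ β⊨ β′⊨ → trans (is-true β β⊨) (sym (is-true β′ β′⊨))) , true , t)
    where
    is-true : ∀ β → β ⊨ restrict → lookup β y ≡ true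
    is-true β β⊨ with lookup β y in eq
    ... | true  = refl
    ... | false = ⊥-elim (¬f (subst (λ v → Sat F (π [ pos mask y ]≔ just v)) (trans (lookup-merge mask α β y) eq) (sat-merge α β (pos mask y) ext β⊨)))
  ... | no ¬t | _ = inj₂ ((λ β β′ β⊨ β′⊨ → trans (is-false β β⊨) (sym (is-false β′ β′⊨))) , lookup α (pos mask y) ,
                          (α , α⊨ , extends-≔ π {α} (pos mask y) ext))
    where
    is-false : ∀ β → β ⊨ restrict → lookup β y ≡ false
    is-false β β⊨ with lookup β y in eq
    ... | false = refl
    ... | true  = ⊥-elim (¬t (subst (λ v → Sat F (π [ pos mask y ]≔ just v)) (trans (lookup-merge mask α β y) eq) (sat-merge α β (pos mask y) ext β⊨)))

  one-good : ∀ x v → Sat F (π [ x ]≔ just v) → 1 ℕ.≤ goodValues x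
  one-good x true  s = ℕ.m≤n⇒m≤n+o _ (ℕ.≤-reflexive (sym (good-yes F s)))
  one-good x false s = ℕ.m≤n⇒m≤o+n _ (ℕ.≤-reflexive (sym (good-yes F s)))

  both-good : ∀ x → (∀ v → Sat F (π [ x ]≔ just v)) → 2 ℕ.≤ goodValues x
  both-good x s = ℕ.≤-reflexive (sym (cong₂ ℕ._+_ (good-yes F (s true)) (good-yes F (s false))))

  criticalWeight : Fin n → ℕ
  criticalWeight = spread mask (criticalFlag restrict)

  -- An open variable outside the mask occurs in no surviving clause, so both its values are good. A
  -- variable of the restriction has two good values unless it is critical there, and then at least
  -- one.
  good-or-critical : Sat F π → ∀ x → lookup π x ≡ nothing → 2 ℕ.≤ goodValues x ℕ.+ criticalWeight x
  good-or-critical s@(α , α⊨ , ext) x x-unset with pos-or-false mask x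
  ... | inj₂ x-false = ℕ.m≤n⇒m≤n+o (criticalWeight x) (both-good x λ v →
        subst (λ w → Sat F (π [ x ]≔ just w))
          (trans (lookup-merge-false mask (α [ x ]≔ v) (project mask α) x x-false) (Vec.lookup∘updateAt x α))
          (sat-merge (α [ x ]≔ v) (project mask α) x (extends-unset {α} x v x-unset ext) (project-sat {α} α⊨ ext)))
  ... | inj₁ (y , refl) with sat-or-critical s y
  ...   | inj₁ both = ℕ.m≤n⇒m≤n+o (criticalWeight x) (both-good x both)
  ...   | inj₂ (crit , v , sv) = ℕ.+-mono-≤ (one-good x v sv) (ℕ.≤-reflexive (sym
            (trans (spread-pos mask (criticalFlag restrict) y) (criticalFlag-yes restrict y crit))))

  -- The combinatorial core: of the 2N assignments of one of N open variables, at most as many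
  -- destroy satisfiability as the restriction has critical variables.
  sum-good : Sat F π → 2 ℕ.* unset π ℕ.≤ sum₁ (unset π) (λ L → good F (choose π L true)) ℕ.+
                                         sum₁ (unset π) (λ L → good F (choose π L false)) ℕ.+ #critical restrict
  sum-good s = begin
    2 ℕ.* unset π                                                  ≡⟨ sumUnset-2 π ⟨
    sumUnset π (λ _ → 2)                                           ≤⟨ sumUnset-mono π (good-or-critical s) ⟩
    sumUnset π (λ x → goodValues x ℕ.+ criticalWeight x)           ≡⟨ sumUnset-+ π goodValues criticalWeight ⟩
    sumUnset π goodValues ℕ.+ sumUnset π criticalWeight            ≤⟨ ℕ.+-monoʳ-≤ (sumUnset π goodValues) (sum-spread π mask (criticalFlag restrict)) ⟩
    sumUnset π goodValues ℕ.+ sumFin (criticalFlag restrict)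
      ≡⟨ cong₂ ℕ._+_ (trans (sumUnset-+ π (λ x → good F (π [ x ]≔ just true)) (λ x → good F (π [ x ]≔ just false))) (sym (cong₂ ℕ._+_ (sum-choose true π (good F)) (sum-choose false π (good F)))))
                     (sum-criticalFlag restrict) ⟩
    _ ∎
    where open ℕ.≤-Reasoning

-- The number of clauses of bounded width

clausesUpTo : ∀ n → ℕ → List (Clause n)
clausesUpTo zero    k       = [] ∷ []
clausesUpTo (suc n) zero    = List.map (nothing ∷_) (clausesUpTo n zero)
clausesUpTo (suc n) (suc k) = List.map (nothing ∷_) (clausesUpTo n (suc k)) List.++
  (List.map (just true ∷_) (clausesUpTo n k) List.++ List.map (just false ∷_) (clausesUpTo n k))

∈-clausesUpTo : ∀ {n} k (C : Clause n) → width C ℕ.≤ k → C ∈ clausesUpTo n k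
∈-clausesUpTo k       []                 w = here refl
∈-clausesUpTo zero    (nothing ∷ C)      w = ∈-map⁺ _ (∈-clausesUpTo zero C w)
∈-clausesUpTo (suc k) (nothing ∷ C)      w = Mem.∈-++⁺ˡ (∈-map⁺ _ (∈-clausesUpTo (suc k) C w))
∈-clausesUpTo (suc k) (just true ∷ C)    (ℕ.s≤s w) =
  Mem.∈-++⁺ʳ (List.map (nothing ∷_) (clausesUpTo _ (suc k))) (Mem.∈-++⁺ˡ (∈-map⁺ _ (∈-clausesUpTo k C w)))
∈-clausesUpTo (suc k) (just false ∷ C)   (ℕ.s≤s w) =
  Mem.∈-++⁺ʳ (List.map (nothing ∷_) (clausesUpTo _ (suc k)))
    (Mem.∈-++⁺ʳ (List.map (just true ∷_) (clausesUpTo _ k)) (∈-map⁺ _ (∈-clausesUpTo k C w)))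

-- With N = 2n + 1 the recursion gives N^(k+1) + 2N^k = (N + 2) N^k, and N + 2 is the base for n +
-- 1.
length-clausesUpTo : ∀ n k → length (clausesUpTo n k) ℕ.≤ (2 ℕ.* n ℕ.+ 1) ℕ.^ k
length-clausesUpTo zero    k rewrite ℕ.^-zeroˡ k = ℕ.≤-refl
length-clausesUpTo (suc n) zero    = ℕ.≤-trans (ℕ.≤-reflexive (List.length-map (nothing ∷_) (clausesUpTo n zero))) (length-clausesUpTo n zero)
length-clausesUpTo (suc n) (suc k) = begin
  length (clausesUpTo (suc n) (suc k))
    ≡⟨ trans (List.length-++ (List.map (nothing ∷_) (clausesUpTo n (suc k))))
         (cong₂ ℕ._+_ (List.length-map (nothing ∷_) (clausesUpTo n (suc k)))
           (trans (List.length-++ (List.map (just true ∷_) (clausesUpTo n k)))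
             (cong₂ ℕ._+_ (List.length-map (just true ∷_) (clausesUpTo n k)) (List.length-map (just false ∷_) (clausesUpTo n k))))) ⟩
  length (clausesUpTo n (suc k)) ℕ.+ (l ℕ.+ l)       ≤⟨ ℕ.+-mono-≤ (length-clausesUpTo n (suc k)) (ℕ.+-mono-≤ (length-clausesUpTo n k) (length-clausesUpTo n k)) ⟩
  N ℕ.* N ℕ.^ k ℕ.+ (N ℕ.^ k ℕ.+ N ℕ.^ k)            ≡⟨ lem n (N ℕ.^ k) ⟩
  M ℕ.* N ℕ.^ k                                      ≤⟨ ℕ.*-monoʳ-≤ M (ℕ.^-monoˡ-≤ k (ℕ.+-monoˡ-≤ 1 (ℕ.*-monoʳ-≤ 2 (ℕ.n≤1+n n)))) ⟩
  M ℕ.* M ℕ.^ k                                      ∎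
  where
  open ℕ.≤-Reasoning
  l = length (clausesUpTo n k)
  N = 2 ℕ.* n ℕ.+ 1
  M = 2 ℕ.* suc n ℕ.+ 1
  lem : ∀ n a → (2 ℕ.* n ℕ.+ 1) ℕ.* a ℕ.+ (a ℕ.+ a) ≡ (2 ℕ.* (1 ℕ.+ n) ℕ.+ 1) ℕ.* a
  lem = solve-∀

unique-length-≤ : ∀ {a} {A : Set a} {xs ys : List A} → Unique xs → (∀ {x} → x ∈ xs → x ∈ ys) → length xs ℕ.≤ length ys
unique-length-≤ {xs = []}     []           sub = ℕ.z≤n
unique-length-≤ {xs = x ∷ xs} (x∉xs ∷ u)   sub with ∈-∃++ (sub (here refl))
... | as , bs , refl = ℕ.≤-trans (ℕ.s≤s (unique-length-≤ u sub′)) (ℕ.≤-reflexive eq)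
  where
  sub′ : ∀ {z} → z ∈ xs → z ∈ as List.++ bs
  sub′ z∈ with Mem.∈-++⁻ as (sub (there z∈))
  ... | inj₁ z∈as          = Mem.∈-++⁺ˡ z∈as
  ... | inj₂ (here refl)   = ⊥-elim (All.lookup x∉xs z∈ refl)
  ... | inj₂ (there z∈bs)  = Mem.∈-++⁺ʳ as z∈bs
  eq : suc (length (as List.++ bs)) ≡ length (as List.++ x ∷ bs)
  eq rewrite List.length-++ as {bs} | List.length-++ as {x ∷ bs} = sym (ℕ.+-suc (length as) (length bs))

#clauses≤ : ∀ {n} k (F : CNF n) → WidthAtMost k F → length (clauses F) ℕ.≤ (2 ℕ.* n ℕ.+ 1) ℕ.^ k
#clauses≤ {n} k F w = ℕ.≤-trans
  (unique-length-≤ (distinct F) (λ {C} C∈ → ∈-clausesUpTo k C (All.lookup w C∈))) (length-clausesUpTo n k)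

-- Functional programs on formulas

un : ℕ → Tree
un zero    = nil
un (suc n) = cons nil (un n)

size-un : ∀ n → size (un n) ≡ n
size-un zero    = refl
size-un (suc n) = cong suc (size-un n)

spine-un : ∀ n → spine (un n) ≡ n
spine-un zero    = refl
spine-un (suc n) = cong suc (spine-un n)

encodePartial : ∀ {n} → Partial n → Tree
encodePartial = encodeVec encodeMaybe

encodeClauses : ∀ {n} → List (Clause n) → Tree
encodeClauses L = encodeList (List.map encodePartial L)

-- The language folds from the left only. A right fold is the left fold of the reversed list, and a
-- right fold over two lists that of the zipped list, which is built in reversed order anyway.
foldrT : (Tree → Tree) → Tree → Tree → Tree → Tree
foldrT f nil        s e = s
foldrT f (cons x l) s e = f (cons x (cons (foldrT f l s e) e))

zipFoldrT : (Tree → Tree) → Tree → Tree → Tree → Tree → Tree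
zipFoldrT f nil         ys s e = s
zipFoldrT f (cons x xs) ys s e = f (cons (cons x (head ys)) (cons (zipFoldrT f xs (tail ys) s e) e))

revOnto : Tree → Tree → Tree
revOnto nil        acc = acc
revOnto (cons x l) acc = revOnto l (cons x acc)

foldT-revOnto : ∀ f l acc s e → foldT f (revOnto l acc) s e ≡ foldT f acc (foldrT f l s e) e
foldT-revOnto f nil        acc s e = refl
foldT-revOnto f (cons x l) acc s e = foldT-revOnto f l (cons x acc) s e

zipOnto : Tree → Tree → Tree → Tree
zipOnto nil         ys acc = acc
zipOnto (cons x xs) ys acc = zipOnto xs (tail ys) (cons (cons x (head ys)) acc)

foldT-zipOnto : ∀ f xs ys acc s e → foldT f (zipOnto xs ys acc) s e ≡ foldT f acc (zipFoldrT f xs ys s e) e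
foldT-zipOnto f nil         ys acc s e = refl
foldT-zipOnto f (cons x xs) ys acc s e = foldT-zipOnto f xs (tail ys) (cons (cons x (head ys)) acc) s e

module Programs {m : ℕ} (δ : Digits m) where
  open Language δ

  x₀ s₀ e₀ : Fn
  x₀ = hdᶠ idᶠ
  s₀ = hdᶠ (tlᶠ idᶠ)
  e₀ = tlᶠ (tlᶠ idᶠ)

  -- Results that exceed the measure μ of the accumulator by at most a polynomial;
  -- Linear is the case μ = size.
  Over : (Tree → ℕ) → Fn → Set
  Over μ f = ∃[ q ] (∀ x s e → size (⟦ f ⟧ᶠ (cons x (cons s e))) ℕ.≤ μ s ℕ.+ eval q (size x ℕ.+ size e))

  free-x : Free x₀
  free-x = X , λ x s e → ℕ.m≤m+n (size x) (size e)

  free-e : Free e₀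
  free-e = X , λ x s e → ℕ.m≤n+m (size e) (size x)

  free-nil : Free nilᶠ
  free-nil = con 0 , λ x s e → ℕ.z≤n

  free-cons : ∀ {f g} → Free f → Free g → Free (consᶠ f g)
  free-cons (p , f) (q , g) = con 1 ⊕ (p ⊕ q) , λ x s e → ℕ.s≤s (ℕ.+-mono-≤ (f x s e) (g x s e))

  free-hd : ∀ {f} → Free f → Free (hdᶠ f)
  free-hd (p , f) = p , λ x s e → ℕ.≤-trans (size-head _) (f x s e)

  free-tl : ∀ {f} → Free f → Free (tlᶠ f)
  free-tl (p , f) = p , λ x s e → ℕ.≤-trans (size-tail _) (f x s e)

  free-if : ∀ c {f g} → Free f → Free g → Free (ifᶠ c f g)
  free-if c {f} {g} (p , hf) (q , hg) = p ⊕ q , λ x s e → case (⟦ c ⟧ᶠ (cons x (cons s e))) (hf x s e) (hg x s e)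
    where
    case : ∀ t {a b k l} → size a ℕ.≤ k → size b ℕ.≤ l → size (caseT t a b) ℕ.≤ k ℕ.+ l
    case nil        h h′ = ℕ.m≤n⇒m≤n+o _ h
    case (cons _ _) h h′ = ℕ.m≤n⇒m≤o+n _ h′

  free-∘ : ∀ h {f} → Free f → Free (h ∘ᶠ f)
  free-∘ h (p , f) = sizePoly h ⊚ p , λ x s e → ℕ.≤-trans (size-⟦⟧ h _) (eval-⊚-≤ (sizePoly h) p _ (f x s e))

  free-true : Free (consᶠ nilᶠ nilᶠ)
  free-true = free-cons {nilᶠ} {nilᶠ} free-nil free-nil

  over-free : ∀ {μ f} → Free f → Over μ f
  over-free (p , f) = p , λ x s e → ℕ.m≤n⇒m≤o+n _ (f x s e)

  over-cons : ∀ {μ f g} → Free f → Over μ g → Over μ (consᶠ f g)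
  over-cons {μ} {f} {g} (p , hf) (q , hg) = con 1 ⊕ (p ⊕ q) , λ x s e →
    ℕ.≤-trans (ℕ.s≤s (ℕ.+-mono-≤ (hf x s e) (hg x s e))) (ℕ.≤-reflexive (lem (eval p (size x ℕ.+ size e)) (μ s) _))
    where
    lem : ∀ a b c → 1 ℕ.+ (a ℕ.+ (b ℕ.+ c)) ≡ b ℕ.+ (1 ℕ.+ (a ℕ.+ c))
    lem = solve-∀

  over-tl : ∀ {μ f} → Over μ f → Over μ (tlᶠ f)
  over-tl (p , f) = p , λ x s e → ℕ.≤-trans (size-tail _) (f x s e)

  over-if : ∀ {μ} c {f g} → Over μ f → Over μ g → Over μ (ifᶠ c f g)
  over-if {μ} c {f} {g} (p , hf) (q , hg) = p ⊕ q , λ x s e →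
      case (⟦ c ⟧ᶠ (cons x (cons s e))) (μ s) (hf x s e) (hg x s e)
    where
    case : ∀ t {a b k l} z → size a ℕ.≤ z ℕ.+ k → size b ℕ.≤ z ℕ.+ l → size (caseT t a b) ℕ.≤ z ℕ.+ (k ℕ.+ l)
    case nil        {k = k} {l} z h h′ = ℕ.≤-trans h (ℕ.+-monoʳ-≤ z (ℕ.m≤m+n k l))
    case (cons _ _) {k = k} {l} z h h′ = ℕ.≤-trans h′ (ℕ.+-monoʳ-≤ z (ℕ.m≤n+m l k))

  over-s : Over size s₀
  over-s = con 0 , λ x s e → ℕ.m≤m+n (size s) 0

  over-hd : Over (size ∘ head) (hdᶠ s₀)
  over-hd = con 0 , λ x s e → ℕ.m≤m+n (size (head s)) 0

  over-tail : Over (size ∘ tail) (tlᶠ s₀)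
  over-tail = con 0 , λ x s e → ℕ.m≤m+n (size (tail s)) 0

  -- An accumulator may be used only once, but its two halves may be used once each, as their sizes
  -- add up to at most that of the whole.
  over-pair : ∀ {f g} → Over (size ∘ head) f → Over (size ∘ tail) g → Over size (consᶠ f g)
  over-pair {f} {g} (p , hf) (q , hg) = con 1 ⊕ (p ⊕ q) , λ x s e → begin
    suc (size (⟦ f ⟧ᶠ (cons x (cons s e))) ℕ.+ size (⟦ g ⟧ᶠ (cons x (cons s e))))
      ≤⟨ ℕ.s≤s (ℕ.+-mono-≤ (hf x s e) (hg x s e)) ⟩
    suc (size (head s) ℕ.+ eval p (size x ℕ.+ size e) ℕ.+ (size (tail s) ℕ.+ eval q (size x ℕ.+ size e)))
      ≡⟨ lem (size (head s)) _ (size (tail s)) _ ⟩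
    size (head s) ℕ.+ size (tail s) ℕ.+ (1 ℕ.+ (eval p (size x ℕ.+ size e) ℕ.+ eval q (size x ℕ.+ size e)))
      ≤⟨ ℕ.+-monoˡ-≤ _ (head+tail≤ s) ⟩
    size s ℕ.+ (1 ℕ.+ (eval p (size x ℕ.+ size e) ℕ.+ eval q (size x ℕ.+ size e))) ∎
    where
    open ℕ.≤-Reasoning
    lem : ∀ a p b q → 1 ℕ.+ (a ℕ.+ p ℕ.+ (b ℕ.+ q)) ≡ a ℕ.+ b ℕ.+ (1 ℕ.+ (p ℕ.+ q))
    lem = solve-∀

  revᶠ : Fn → Fn
  revᶠ l = foldᶠ l nilᶠ (consᶠ x₀ s₀) (over-cons {size} {x₀} {s₀} free-x over-s)

  ⟦revᶠ⟧ : ∀ l t → ⟦ revᶠ l ⟧ᶠ t ≡ revOnto (⟦ l ⟧ᶠ t) nil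
  ⟦revᶠ⟧ l t = go (⟦ l ⟧ᶠ t) nil
    where
    go : ∀ xs acc → foldT ⟦ consᶠ x₀ s₀ ⟧ᶠ xs acc t ≡ revOnto xs acc
    go nil         acc = refl
    go (cons x xs) acc = go xs (cons x acc)

  foldrᶠ : (l s b : Fn) → Linear b → Fn
  foldrᶠ l s b lin = foldᶠ (revᶠ l) s b lin

  ⟦foldrᶠ⟧ : ∀ l s b lin t → ⟦ foldrᶠ l s b lin ⟧ᶠ t ≡ foldrT ⟦ b ⟧ᶠ (⟦ l ⟧ᶠ t) (⟦ s ⟧ᶠ t) t
  ⟦foldrᶠ⟧ l s b lin t = trans (cong (λ r → foldT ⟦ b ⟧ᶠ r (⟦ s ⟧ᶠ t) t) (⟦revᶠ⟧ l t))
    (foldT-revOnto ⟦ b ⟧ᶠ (⟦ l ⟧ᶠ t) nil (⟦ s ⟧ᶠ t) t)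

  -- The accumulator consists of the rest of the second list and the pairs collected so far.
  zipBody : Fn
  zipBody = consᶠ (tlᶠ (hdᶠ s₀)) (consᶠ (consᶠ x₀ (hdᶠ (hdᶠ s₀))) (tlᶠ s₀))

  zipBody-linear : Linear zipBody
  zipBody-linear = con 3 ⊕ X , λ x s e → begin
    suc (size (tail (head s)) ℕ.+ suc (suc (size x ℕ.+ size (head (head s))) ℕ.+ size (tail s)))
      ≡⟨ lem (size (tail (head s))) (size x) (size (head (head s))) (size (tail s)) ⟩
    size (head (head s)) ℕ.+ size (tail (head s)) ℕ.+ size (tail s) ℕ.+ (3 ℕ.+ size x)
      ≤⟨ ℕ.+-mono-≤ (ℕ.≤-trans (ℕ.+-monoˡ-≤ (size (tail s)) (head+tail≤ (head s))) (head+tail≤ s)) (ℕ.+-monoʳ-≤ 3 (ℕ.m≤m+n (size x) (size e))) ⟩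
    size s ℕ.+ (3 ℕ.+ (size x ℕ.+ size e)) ∎
    where
    open ℕ.≤-Reasoning
    lem : ∀ a x b c → 1 ℕ.+ (a ℕ.+ (1 ℕ.+ (1 ℕ.+ (x ℕ.+ b) ℕ.+ c))) ≡ b ℕ.+ a ℕ.+ c ℕ.+ (3 ℕ.+ x)
    lem = solve-∀

  zipᶠ : Fn → Fn → Fn
  zipᶠ xs ys = tlᶠ (foldᶠ xs (consᶠ ys nilᶠ) zipBody zipBody-linear)

  ⟦zipᶠ⟧ : ∀ xs ys t → ⟦ zipᶠ xs ys ⟧ᶠ t ≡ zipOnto (⟦ xs ⟧ᶠ t) (⟦ ys ⟧ᶠ t) nil
  ⟦zipᶠ⟧ xs ys t = go (⟦ xs ⟧ᶠ t) (⟦ ys ⟧ᶠ t) nil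
    where
    go : ∀ as bs acc → tail (foldT ⟦ zipBody ⟧ᶠ as (cons bs acc) t) ≡ zipOnto as bs acc
    go nil         bs acc = refl
    go (cons a as) bs acc = go as (tail bs) (cons (cons a (head bs)) acc)

  zipFoldrᶠ : (l r s b : Fn) → Linear b → Fn
  zipFoldrᶠ l r s b lin = foldᶠ (zipᶠ l r) s b lin

  ⟦zipFoldrᶠ⟧ : ∀ l r s b lin t → ⟦ zipFoldrᶠ l r s b lin ⟧ᶠ t ≡ zipFoldrT ⟦ b ⟧ᶠ (⟦ l ⟧ᶠ t) (⟦ r ⟧ᶠ t) (⟦ s ⟧ᶠ t) t
  ⟦zipFoldrᶠ⟧ l r s b lin t = trans (cong (λ z → foldT ⟦ b ⟧ᶠ z (⟦ s ⟧ᶠ t) t) (⟦zipᶠ⟧ l r t))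
    (foldT-zipOnto ⟦ b ⟧ᶠ (⟦ l ⟧ᶠ t) (⟦ r ⟧ᶠ t) nil (⟦ s ⟧ᶠ t) t)

  -- Induction along the fold: P relates the suffix already processed to the accumulator.
  foldr-list : ∀ {A : Set} (f : A → Tree) (P : List A → Tree → Set) l s b lin t xs → ⟦ l ⟧ᶠ t ≡ encodeList (List.map f xs) →
    P [] (⟦ s ⟧ᶠ t) → (∀ x xs z → P xs z → P (x ∷ xs) (⟦ b ⟧ᶠ (cons (f x) (cons z t)))) → P xs (⟦ foldrᶠ l s b lin ⟧ᶠ t)
  foldr-list f P l s b lin t xs l≡ base each = subst (P xs) (sym (trans (⟦foldrᶠ⟧ l s b lin t)
      (cong (λ r → foldrT ⟦ b ⟧ᶠ r (⟦ s ⟧ᶠ t) t) l≡))) (go xs)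
    where
    go : ∀ xs → P xs (foldrT ⟦ b ⟧ᶠ (encodeList (List.map f xs)) (⟦ s ⟧ᶠ t) t)
    go []       = base
    go (x ∷ xs) = each x xs _ (go xs)

  foldr-vec : ∀ {A : Set} (f : A → Tree) (P : ∀ {n} → Vec A n → Tree → Set) l s b lin t {n} (v : Vec A n) → ⟦ l ⟧ᶠ t ≡ encodeVec f v →
    P [] (⟦ s ⟧ᶠ t) → (∀ {n} x (v : Vec A n) z → P v z → P (x ∷ v) (⟦ b ⟧ᶠ (cons (f x) (cons z t)))) → P v (⟦ foldrᶠ l s b lin ⟧ᶠ t)
  foldr-vec {A} f P l s b lin t v l≡ base each = subst (P v) (sym (trans (⟦foldrᶠ⟧ l s b lin t)
      (cong (λ r → foldrT ⟦ b ⟧ᶠ r (⟦ s ⟧ᶠ t) t) l≡))) (go v)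
    where
    go : ∀ {n} (v : Vec A n) → P v (foldrT ⟦ b ⟧ᶠ (encodeVec f v) (⟦ s ⟧ᶠ t) t)
    go []      = base
    go (x ∷ v) = each x v _ (go v)

  zipFoldr-vec : ∀ {A B : Set} (f : A → Tree) (g : B → Tree) (P : ∀ {n} → Vec A n → Vec B n → Tree → Set)
    l r s b lin t {n} (v : Vec A n) (w : Vec B n) → ⟦ l ⟧ᶠ t ≡ encodeVec f v → ⟦ r ⟧ᶠ t ≡ encodeVec g w →
    P [] [] (⟦ s ⟧ᶠ t) →
    (∀ {n} x y (v : Vec A n) (w : Vec B n) z → P v w z → P (x ∷ v) (y ∷ w) (⟦ b ⟧ᶠ (cons (cons (f x) (g y)) (cons z t)))) →
    P v w (⟦ zipFoldrᶠ l r s b lin ⟧ᶠ t)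
  zipFoldr-vec {A} {B} f g P l r s b lin t v w l≡ r≡ base each = subst (P v w) (sym (trans (⟦zipFoldrᶠ⟧ l r s b lin t)
      (cong₂ (λ l r → zipFoldrT ⟦ b ⟧ᶠ l r (⟦ s ⟧ᶠ t) t) l≡ r≡))) (go v w)
    where
    go : ∀ {n} (v : Vec A n) (w : Vec B n) → P v w (zipFoldrT ⟦ b ⟧ᶠ (encodeVec f v) (encodeVec g w) (⟦ s ⟧ᶠ t) t)
    go []      []      = base
    go (x ∷ v) (y ∷ w) = each x y v w _ (go v w)

  trueᶠ : Fn
  trueᶠ = consᶠ nilᶠ nilᶠ

  -- The first branch of `ifᶠ` is the one for `nil`, which encodes both `false` and `nothing`.
  sameᶠ : Fn → Fn → Fn
  sameᶠ a b = ifᶠ a (ifᶠ b trueᶠ nilᶠ) (ifᶠ b nilᶠ trueᶠ)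

  meetsᶠ : Fn
  meetsᶠ = ifᶠ (hdᶠ x₀) nilᶠ (ifᶠ (tlᶠ x₀) nilᶠ (sameᶠ (tlᶠ (hdᶠ x₀)) (tlᶠ (tlᶠ x₀))))

  hitsBody : Fn
  hitsBody = ifᶠ meetsᶠ s₀ trueᶠ

  hitsBody-linear : Linear hitsBody
  hitsBody-linear = over-if {size} meetsᶠ {s₀} {trueᶠ} over-s (over-free {size} {trueᶠ} free-true)

  hitsᶠ : Fn → Fn → Fn
  hitsᶠ C π = zipFoldrᶠ C π nilᶠ hitsBody hitsBody-linear

  hitsᶠ-correct : ∀ c p t {n} (C : Clause n) π → ⟦ c ⟧ᶠ t ≡ encodePartial C → ⟦ p ⟧ᶠ t ≡ encodePartial π →
                  ⟦ hitsᶠ c p ⟧ᶠ t ≡ encodeBool (hits C π)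
  hitsᶠ-correct c p t C π c≡ p≡ = zipFoldr-vec encodeMaybe encodeMaybe (λ C π z → z ≡ encodeBool (hits C π))
      c p nilᶠ hitsBody hitsBody-linear t C π c≡ p≡ refl each
    where
    each : ∀ {n} x y (C : Clause n) π z → z ≡ encodeBool (hits C π) →
           ⟦ hitsBody ⟧ᶠ (cons (cons (encodeMaybe x) (encodeMaybe y)) (cons z t)) ≡ encodeBool (hits (x ∷ C) (y ∷ π))
    each nothing      y            C π z refl = refl
    each (just a)     nothing      C π z refl = refl
    each (just true)  (just true)  C π z refl = refl
    each (just true)  (just false) C π z refl = refl
    each (just false) (just true)  C π z refl = refl
    each (just false) (just false) C π z refl = refl

  -- Within a fold the outer environment is the third component, so a program p of that environment
  -- becomes `p ∘ᶠ e₀`.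
  survivorsBody : Fn → Fn
  survivorsBody p = ifᶠ (hitsᶠ x₀ (p ∘ᶠ e₀)) (consᶠ x₀ s₀) s₀

  survivorsBody-linear : ∀ p → Linear (survivorsBody p)
  survivorsBody-linear p = over-if {size} (hitsᶠ x₀ (p ∘ᶠ e₀)) {consᶠ x₀ s₀} {s₀} (over-cons {size} {x₀} {s₀} free-x over-s) over-s

  survivorsᶠ : Fn → Fn → Fn
  survivorsᶠ p l = foldrᶠ l nilᶠ (survivorsBody p) (survivorsBody-linear p)

  survivorsᶠ-correct : ∀ p l t {n} (π : Partial n) L → ⟦ p ⟧ᶠ t ≡ encodePartial π → ⟦ l ⟧ᶠ t ≡ encodeClauses L →
                       ⟦ survivorsᶠ p l ⟧ᶠ t ≡ encodeClauses (survivors π L)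
  survivorsᶠ-correct p l t π L p≡ l≡ = foldr-list encodePartial (λ L z → z ≡ encodeClauses (survivors π L))
      l nilᶠ (survivorsBody p) (survivorsBody-linear p) t L l≡ refl each
    where
    each : ∀ C L z → z ≡ encodeClauses (survivors π L) →
           ⟦ survivorsBody p ⟧ᶠ (cons (encodePartial C) (cons z t)) ≡ encodeClauses (survivors π (C ∷ L))
    each C L z refl rewrite hitsᶠ-correct x₀ (p ∘ᶠ e₀) (cons (encodePartial C) (cons z t)) C π refl p≡ with hits C π
    ... | true  = refl
    ... | false = refl

  unaryBody : Fn
  unaryBody = consᶠ nilᶠ s₀

  unaryBody-linear : Linear unaryBody
  unaryBody-linear = over-cons {size} {nilᶠ} {s₀} free-nil over-s

  unaryᶠ : Fn → Fn
  unaryᶠ l = foldrᶠ l nilᶠ unaryBody unaryBody-linear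

  ⟦unaryᶠ⟧ : ∀ l t → ⟦ unaryᶠ l ⟧ᶠ t ≡ un (spine (⟦ l ⟧ᶠ t))
  ⟦unaryᶠ⟧ l t = trans (⟦foldrᶠ⟧ l nilᶠ unaryBody unaryBody-linear t) (go (⟦ l ⟧ᶠ t))
    where
    go : ∀ xs → foldrT ⟦ unaryBody ⟧ᶠ xs nil t ≡ un (spine xs)
    go nil         = refl
    go (cons x xs) = cong (cons nil) (go xs)

  occursBody : Fn
  occursBody = consᶠ (ifᶠ (hdᶠ x₀) (ifᶠ (tlᶠ x₀) nilᶠ trueᶠ) trueᶠ) s₀

  occursBody-linear : Linear occursBody
  occursBody-linear = over-cons {size} {ifᶠ (hdᶠ x₀) (ifᶠ (tlᶠ x₀) nilᶠ trueᶠ) trueᶠ} {s₀}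
    (free-if (hdᶠ x₀) {ifᶠ (tlᶠ x₀) nilᶠ trueᶠ} {trueᶠ} (free-if (tlᶠ x₀) {nilᶠ} {trueᶠ} free-nil free-true) free-true) over-s

  occursStep : Fn
  occursStep = zipFoldrᶠ x₀ s₀ nilᶠ occursBody occursBody-linear

  -- The old accumulator is replaced by a new row of flags, one per entry of the clause.
  occursStep-linear : Linear occursStep
  occursStep-linear = con 2 ⊗ X , λ x s e → begin
    size (⟦ occursStep ⟧ᶠ (cons x (cons s e)))
      ≡⟨ cong size (⟦zipFoldrᶠ⟧ x₀ s₀ nilᶠ occursBody occursBody-linear (cons x (cons s e))) ⟩
    size (zipFoldrT ⟦ occursBody ⟧ᶠ x s nil (cons x (cons s e)))  ≤⟨ go x s (cons x (cons s e)) ⟩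
    2 ℕ.* spine x                                                 ≤⟨ ℕ.*-monoʳ-≤ 2 (ℕ.≤-trans (spine≤size x) (ℕ.m≤m+n (size x) (size e))) ⟩
    2 ℕ.* (size x ℕ.+ size e)                                     ≤⟨ ℕ.m≤n+m _ (size s) ⟩
    size s ℕ.+ 2 ℕ.* (size x ℕ.+ size e)                          ∎
    where
    open ℕ.≤-Reasoning
    flag≤1 : ∀ a b → size (caseT a (caseT b nil (cons nil nil)) (cons nil nil)) ℕ.≤ 1
    flag≤1 nil        nil        = ℕ.z≤n
    flag≤1 nil        (cons _ _) = ℕ.≤-refl
    flag≤1 (cons _ _) b          = ℕ.≤-refl
    go : ∀ xs ys t → size (zipFoldrT ⟦ occursBody ⟧ᶠ xs ys nil t) ℕ.≤ 2 ℕ.* spine xs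
    go nil         ys t = ℕ.z≤n
    go (cons a xs) ys t = ℕ.≤-trans (ℕ.s≤s (ℕ.+-mono-≤ (flag≤1 a (head ys)) (go xs (tail ys) t)))
      (ℕ.≤-reflexive (sym (lem (spine xs))))
      where
      lem : ∀ a → 2 ℕ.* (1 ℕ.+ a) ≡ 1 ℕ.+ (1 ℕ.+ 2 ℕ.* a)
      lem = solve-∀

  occursᶠ : Fn → Fn → Fn
  occursᶠ n l = foldrᶠ l (unaryᶠ n) occursStep occursStep-linear

  encodeFlags : ∀ {n} → Vec Bool n → Tree
  encodeFlags = encodeVec encodeBool

  -- Since `nil` encodes `false` as well as `nothing`, a unary number doubles as a row of false
  -- flags and as the empty partial assignment.
  un-flags : ∀ n → un n ≡ encodeFlags (replicate n false)
  un-flags zero    = refl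
  un-flags (suc n) = cong (cons nil) (un-flags n)

  un-blank : ∀ n → un n ≡ encodePartial (blank n)
  un-blank zero    = refl
  un-blank (suc n) = cong (cons nil) (un-blank n)

  spine-encodeVec : ∀ {A : Set} {n} (f : A → Tree) (v : Vec A n) → spine (encodeVec f v) ≡ n
  spine-encodeVec f []      = refl
  spine-encodeVec f (x ∷ v) = cong suc (spine-encodeVec f v)

  occursᶠ-correct : ∀ p l t {n} (π : Partial n) (L : List (Clause n)) → ⟦ p ⟧ᶠ t ≡ encodePartial π → ⟦ l ⟧ᶠ t ≡ encodeClauses L →
                    ⟦ occursᶠ p l ⟧ᶠ t ≡ encodeFlags (occursIn L)
  occursᶠ-correct p l t {n} π L p≡ l≡ = foldr-list encodePartial (λ L z → z ≡ encodeFlags (occursIn L))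
      l (unaryᶠ p) occursStep occursStep-linear t L l≡
      (trans (⟦unaryᶠ⟧ p t) (trans (cong (un ∘ spine) p≡) (trans (cong un (spine-encodeVec encodeMaybe π)) (un-flags n))))
      λ { C L z refl → zipFoldr-vec encodeMaybe encodeBool (λ C o z → z ≡ encodeFlags (zipWith (λ x b → if is-just x then true else b) C o))
            x₀ s₀ nilᶠ occursBody occursBody-linear (cons (encodePartial C) (cons z t)) C (occursIn L) refl refl refl (each {cons (encodePartial C) (cons z t)}) }
    where
    each : ∀ {e n} x b (C : Clause n) o z → z ≡ encodeFlags (zipWith (λ x b → if is-just x then true else b) C o) →
           ⟦ occursBody ⟧ᶠ (cons (cons (encodeMaybe x) (encodeBool b)) (cons z e)) ≡ encodeFlags (zipWith (λ x b → if is-just x then true else b) (x ∷ C) (b ∷ o))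
    each nothing  true  C o z refl = refl
    each nothing  false C o z refl = refl
    each (just _) _     C o z refl = refl

  liveBody : Fn
  liveBody = consᶠ (ifᶠ (hdᶠ x₀) (tlᶠ x₀) nilᶠ) s₀

  liveBody-linear : Linear liveBody
  liveBody-linear = over-cons {size} {ifᶠ (hdᶠ x₀) (tlᶠ x₀) nilᶠ} {s₀} (free-if (hdᶠ x₀) {tlᶠ x₀} {nilᶠ} (free-tl {x₀} free-x) free-nil) over-s

  liveᶠ : Fn → Fn → Fn
  liveᶠ p l = zipFoldrᶠ p (occursᶠ p (survivorsᶠ p l)) nilᶠ liveBody liveBody-linear

  liveᶠ-correct : ∀ p l t {n} (π : Partial n) L → ⟦ p ⟧ᶠ t ≡ encodePartial π → ⟦ l ⟧ᶠ t ≡ encodeClauses L →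
                  ⟦ liveᶠ p l ⟧ᶠ t ≡ encodeFlags (live π L)
  liveᶠ-correct p l t π L p≡ l≡ = zipFoldr-vec encodeMaybe encodeBool (λ π o z → z ≡ encodeFlags (zipWith liveOf π o))
      p (occursᶠ p (survivorsᶠ p l)) nilᶠ liveBody liveBody-linear t π (occursIn (survivors π L)) p≡
      (occursᶠ-correct p (survivorsᶠ p l) t π (survivors π L) p≡ (survivorsᶠ-correct p l t π L p≡ l≡)) refl each
    where
    each : ∀ {n} y b (π : Partial n) o z → z ≡ encodeFlags (zipWith liveOf π o) →
           ⟦ liveBody ⟧ᶠ (cons (cons (encodeMaybe y) (encodeBool b)) (cons z t)) ≡ encodeFlags (zipWith liveOf (y ∷ π) (b ∷ o))
    each nothing  b π o z refl = refl
    each (just _) b π o z refl = refl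

  projectBody : Fn
  projectBody = ifᶠ (hdᶠ x₀) s₀ (consᶠ (tlᶠ x₀) s₀)

  projectBody-linear : Linear projectBody
  projectBody-linear = over-if {size} (hdᶠ x₀) {s₀} {consᶠ (tlᶠ x₀) s₀} over-s (over-cons {size} {tlᶠ x₀} {s₀} (free-tl {x₀} free-x) over-s)

  projectᶠ : Fn → Fn → Fn
  projectᶠ k v = zipFoldrᶠ k v nilᶠ projectBody projectBody-linear

  projectᶠ-correct : ∀ {A : Set} (f : A → Tree) k r t {n} (m : Vec Bool n) (v : Vec A n) → ⟦ k ⟧ᶠ t ≡ encodeFlags m → ⟦ r ⟧ᶠ t ≡ encodeVec f v →
                     ⟦ projectᶠ k r ⟧ᶠ t ≡ encodeVec f (project m v)
  projectᶠ-correct f k r t m v k≡ r≡ = zipFoldr-vec encodeBool f (λ m v z → z ≡ encodeVec f (project m v))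
      k r nilᶠ projectBody projectBody-linear t m v k≡ r≡ refl each
    where
    each : ∀ {n} b x (m : Vec Bool n) v z → z ≡ encodeVec f (project m v) →
           ⟦ projectBody ⟧ᶠ (cons (cons (encodeBool b) (f x)) (cons z t)) ≡ encodeVec f (project (b ∷ m) (x ∷ v))
    each true  x m v z refl = refl
    each false x m v z refl = refl

  sameMaybeᶠ : Fn
  sameMaybeᶠ = ifᶠ (hdᶠ x₀) (ifᶠ (tlᶠ x₀) trueᶠ nilᶠ) (ifᶠ (tlᶠ x₀) nilᶠ (sameᶠ (tlᶠ (hdᶠ x₀)) (tlᶠ (tlᶠ x₀))))

  sameClauseBody : Fn
  sameClauseBody = ifᶠ sameMaybeᶠ nilᶠ s₀

  sameClauseBody-linear : Linear sameClauseBody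
  sameClauseBody-linear = over-if {size} sameMaybeᶠ {nilᶠ} {s₀} (over-free {size} {nilᶠ} free-nil) over-s

  sameClauseᶠ : Fn → Fn → Fn
  sameClauseᶠ c d = zipFoldrᶠ c d trueᶠ sameClauseBody sameClauseBody-linear

  sameClauseᶠ-correct : ∀ c d t {n} (C D : Clause n) → ⟦ c ⟧ᶠ t ≡ encodePartial C → ⟦ d ⟧ᶠ t ≡ encodePartial D →
                        ⟦ sameClauseᶠ c d ⟧ᶠ t ≡ encodeBool (sameClause C D)
  sameClauseᶠ-correct c d t C D c≡ d≡ = zipFoldr-vec encodeMaybe encodeMaybe (λ C D z → z ≡ encodeBool (sameClause C D))
      c d trueᶠ sameClauseBody sameClauseBody-linear t C D c≡ d≡ refl each
    where
    each : ∀ {n} x y (C D : Clause n) z → z ≡ encodeBool (sameClause C D) →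
           ⟦ sameClauseBody ⟧ᶠ (cons (cons (encodeMaybe x) (encodeMaybe y)) (cons z t)) ≡ encodeBool (sameClause (x ∷ C) (y ∷ D))
    each nothing      nothing      C D z refl = refl
    each nothing      (just _)     C D z refl = refl
    each (just a)     nothing      C D z refl = refl
    each (just true)  (just true)  C D z refl = refl
    each (just true)  (just false) C D z refl = refl
    each (just false) (just true)  C D z refl = refl
    each (just false) (just false) C D z refl = refl

  memberBody : Fn → Fn
  memberBody c = ifᶠ (sameClauseᶠ (c ∘ᶠ e₀) x₀) s₀ trueᶠ

  memberBody-linear : ∀ c → Linear (memberBody c)
  memberBody-linear c = over-if {size} (sameClauseᶠ (c ∘ᶠ e₀) x₀) {s₀} {trueᶠ} over-s (over-free {size} {trueᶠ} free-true)

  memberᶠ : Fn → Fn → Fn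
  memberᶠ c l = foldrᶠ l nilᶠ (memberBody c) (memberBody-linear c)

  memberᶠ-correct : ∀ c l t {n} (C : Clause n) L → ⟦ c ⟧ᶠ t ≡ encodePartial C → ⟦ l ⟧ᶠ t ≡ encodeClauses L →
                    ⟦ memberᶠ c l ⟧ᶠ t ≡ encodeBool (member C L)
  memberᶠ-correct c l t C L c≡ l≡ = foldr-list encodePartial (λ L z → z ≡ encodeBool (member C L))
      l nilᶠ (memberBody c) (memberBody-linear c) t L l≡ refl each
    where
    each : ∀ D L z → z ≡ encodeBool (member C L) →
           ⟦ memberBody c ⟧ᶠ (cons (encodePartial D) (cons z t)) ≡ encodeBool (member C (D ∷ L))
    each D L z refl rewrite sameClauseᶠ-correct (c ∘ᶠ e₀) x₀ (cons (encodePartial D) (cons z t)) C D c≡ refl with sameClause C D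
    ... | true  = refl
    ... | false = refl

  dedupBody : Fn
  dedupBody = ifᶠ (memberᶠ x₀ s₀) (consᶠ x₀ s₀) s₀

  dedupBody-linear : Linear dedupBody
  dedupBody-linear = over-if {size} (memberᶠ x₀ s₀) {consᶠ x₀ s₀} {s₀} (over-cons {size} {x₀} {s₀} free-x over-s) over-s

  dedupᶠ : Fn → Fn
  dedupᶠ l = foldrᶠ l nilᶠ dedupBody dedupBody-linear

  dedupᶠ-correct : ∀ l t {n} (L : List (Clause n)) → ⟦ l ⟧ᶠ t ≡ encodeClauses L → ⟦ dedupᶠ l ⟧ᶠ t ≡ encodeClauses (dedup L)
  dedupᶠ-correct l t L l≡ = foldr-list encodePartial (λ L z → z ≡ encodeClauses (dedup L)) l nilᶠ dedupBody dedupBody-linear t L l≡ refl each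
    where
    each : ∀ C L z → z ≡ encodeClauses (dedup L) → ⟦ dedupBody ⟧ᶠ (cons (encodePartial C) (cons z t)) ≡ encodeClauses (dedup (C ∷ L))
    each C L z refl rewrite memberᶠ-correct x₀ s₀ (cons (encodePartial C) (cons z t)) C (dedup L) refl refl with member C (dedup L)
    ... | true  = refl
    ... | false = refl

  -- The projection depends on the element and the environment only, which is made
  -- visible to Free by the change of environment.
  mapProjectBody : Fn → Fn
  mapProjectBody k = consᶠ (projectᶠ (k ∘ᶠ tlᶠ idᶠ) (hdᶠ idᶠ) ∘ᶠ consᶠ x₀ e₀) s₀

  mapProjectBody-linear : ∀ k → Linear (mapProjectBody k)
  mapProjectBody-linear k = over-cons {size} {projectᶠ (k ∘ᶠ tlᶠ idᶠ) (hdᶠ idᶠ) ∘ᶠ consᶠ x₀ e₀} {s₀}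
      (free-∘ (projectᶠ (k ∘ᶠ tlᶠ idᶠ) (hdᶠ idᶠ)) {consᶠ x₀ e₀} (free-cons {x₀} {e₀} free-x free-e)) over-s

  mapProjectᶠ : Fn → Fn → Fn
  mapProjectᶠ k l = foldrᶠ l nilᶠ (mapProjectBody k) (mapProjectBody-linear k)

  mapProjectᶠ-correct : ∀ k l t {n} (m : Vec Bool n) (L : List (Clause n)) → ⟦ k ⟧ᶠ t ≡ encodeFlags m → ⟦ l ⟧ᶠ t ≡ encodeClauses L →
                        ⟦ mapProjectᶠ k l ⟧ᶠ t ≡ encodeClauses (List.map (project m) L)
  mapProjectᶠ-correct k l t m L k≡ l≡ = foldr-list encodePartial (λ L z → z ≡ encodeClauses (List.map (project m) L))
    l nilᶠ (mapProjectBody k) (mapProjectBody-linear k) t L l≡ refl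
    λ C L z z≡ → cong₂ cons (projectᶠ-correct encodeMaybe (k ∘ᶠ tlᶠ idᶠ) (hdᶠ idᶠ) (cons (encodePartial C) t) m C k≡ refl) z≡

  restrictᶠ : Fn → Fn → Fn → Fn
  restrictᶠ k p l = dedupᶠ (mapProjectᶠ k (survivorsᶠ p l))

  restrictᶠ-correct : ∀ k p l t {n} (F : CNF n) π → ⟦ k ⟧ᶠ t ≡ encodeFlags (live π (clauses F)) →
                      ⟦ p ⟧ᶠ t ≡ encodePartial π → ⟦ l ⟧ᶠ t ≡ encodeCNF F →
                      ⟦ restrictᶠ k p l ⟧ᶠ t ≡ encodeCNF (Restriction.restrict F π)
  restrictᶠ-correct k p l t F π k≡ p≡ l≡ = dedupᶠ-correct (mapProjectᶠ k (survivorsᶠ p l)) t (Restriction.residual F π)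
    (mapProjectᶠ-correct k (survivorsᶠ p l) t (live π (clauses F)) (survivors π (clauses F)) k≡
      (survivorsᶠ-correct p l t π (clauses F) p≡ l≡))

-- The default `false` survives the later merge only at open variables that no surviving clause
-- mentions.
fill : ∀ {n} → Partial n → Assignment n
fill = Vec.map λ { nothing → false ; (just b) → b }

extends-fill : ∀ {n} (π : Partial n) → Extends π (fill π)
extends-fill (nothing ∷ π) zero    = _
extends-fill (just b ∷ π)  zero    = refl
extends-fill (_ ∷ π)       (suc x) = extends-fill π x

-- The last bit lies on top, which is the order in which a right fold over the variables pops the
-- bits.
stackOnto : ∀ {k} → Vec Bool k → Tree → Tree
stackOnto []      ts = ts
stackOnto (b ∷ β) ts = stackOnto β (cons (encodeBool b) ts)

size-stackOnto : ∀ {k} (β : Vec Bool k) ts → size (stackOnto β ts) ℕ.≤ 2 ℕ.* k ℕ.+ size ts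
size-stackOnto []      ts = ℕ.≤-refl
size-stackOnto {suc k} (b ∷ β) ts = begin
  size (stackOnto β (cons (encodeBool b) ts))            ≤⟨ size-stackOnto β _ ⟩
  2 ℕ.* k ℕ.+ suc (size (encodeBool b) ℕ.+ size ts)      ≤⟨ ℕ.+-monoʳ-≤ (2 ℕ.* k) (ℕ.s≤s (ℕ.+-monoˡ-≤ (size ts) (bit b))) ⟩
  2 ℕ.* k ℕ.+ (2 ℕ.+ size ts)                            ≡⟨ ℕ.+-assoc (2 ℕ.* k) 2 (size ts) ⟨
  2 ℕ.* k ℕ.+ 2 ℕ.+ size ts                              ≡⟨ cong (ℕ._+ size ts) (trans (ℕ.+-comm (2 ℕ.* k) 2) (sym (ℕ.*-suc 2 k))) ⟩
  2 ℕ.* suc k ℕ.+ size ts                                ∎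
  where
  open ℕ.≤-Reasoning
  bit : ∀ b → size (encodeBool b) ℕ.≤ 1
  bit true  = ℕ.≤-refl
  bit false = ℕ.z≤n

allHit : ∀ {n} → List (Clause n) → Partial n → Bool
allHit L π = List.foldr (λ C b → if hits C π then b else false) true L

allHit-sound : ∀ {n} (L : List (Clause n)) α → allHit L (total α) ≡ true → All (SatisfiesClause α) L
allHit-sound []      α h = []
allHit-sound (C ∷ L) α h with hits C (total α) in eq
... | true = hits-total C α eq ∷ allHit-sound L α h

allHit-complete : ∀ {n} (L : List (Clause n)) α → All (SatisfiesClause α) L → allHit L (total α) ≡ true
allHit-complete []      α []       = refl
allHit-complete (C ∷ L) α (s ∷ ss) rewrite total-hits C α s = allHit-complete L α ss

encodeFound : ∀ {n} → Maybe (Assignment n) → Tree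
encodeFound nothing  = nil
encodeFound (just α) = cons nil (encodePartial (total α))

-- The first solution is kept, and a candidate is checked before it counts, since 𝒜 may output
-- anything.
update : ∀ {n} → CNF n → Maybe (Assignment n) → Assignment n → Maybe (Assignment n)
update F (just α) α′ = just α
update F nothing  α′ = if allHit (clauses F) (total α′) then just α′ else nothing

-- The positions N, ..., 1 in descending cyclic order, so that r steps realise r modulo N without a
-- division; the value at 0 is a default.
nextPos : ℕ → ℕ → ℕ
nextPos N zero          = N
nextPos N (suc zero)    = N
nextPos N (suc (suc p)) = suc p

cycle : ℕ → ℕ → ℕ → ℕ
cycle N zero    p = p
cycle N (suc r) p = cycle N r (nextPos N p)

module Routines {m : ℕ} (δ : Digits m) where
  open Language δ
  open Programs δ

  mergeBody : Fn
  mergeBody = ifᶠ (hdᶠ x₀)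
    (consᶠ (hdᶠ s₀) (consᶠ (ifᶠ (tlᶠ x₀) trueᶠ (tlᶠ x₀)) (tlᶠ s₀)))
    (consᶠ (tlᶠ (hdᶠ s₀)) (consᶠ (consᶠ nilᶠ (ifᶠ (hdᶠ (hdᶠ s₀)) nilᶠ trueᶠ)) (tlᶠ s₀)))

  mergeBody-linear : Linear mergeBody
  mergeBody-linear = over-if {size} (hdᶠ x₀)
    {consᶠ (hdᶠ s₀) (consᶠ (ifᶠ (tlᶠ x₀) trueᶠ (tlᶠ x₀)) (tlᶠ s₀))}
    {consᶠ (tlᶠ (hdᶠ s₀)) (consᶠ (consᶠ nilᶠ (ifᶠ (hdᶠ (hdᶠ s₀)) nilᶠ trueᶠ)) (tlᶠ s₀))}
    (over-pair {hdᶠ s₀} {consᶠ (ifᶠ (tlᶠ x₀) trueᶠ (tlᶠ x₀)) (tlᶠ s₀)} over-hd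
      (over-cons {size ∘ tail} {ifᶠ (tlᶠ x₀) trueᶠ (tlᶠ x₀)} {tlᶠ s₀}
        (free-if (tlᶠ x₀) {trueᶠ} {tlᶠ x₀} free-true (free-tl {x₀} free-x)) over-tail))
    (over-pair {tlᶠ (hdᶠ s₀)} {consᶠ (consᶠ nilᶠ (ifᶠ (hdᶠ (hdᶠ s₀)) nilᶠ trueᶠ)) (tlᶠ s₀)} (over-tl {size ∘ head} {hdᶠ s₀} over-hd)
      (over-cons {size ∘ tail} {consᶠ nilᶠ (ifᶠ (hdᶠ (hdᶠ s₀)) nilᶠ trueᶠ)} {tlᶠ s₀}
        (free-cons {nilᶠ} {ifᶠ (hdᶠ (hdᶠ s₀)) nilᶠ trueᶠ} free-nil (free-if (hdᶠ (hdᶠ s₀)) {nilᶠ} {trueᶠ} free-nil free-true)) over-tail))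

  mergeᶠ : Fn → Fn → Fn → Fn
  mergeᶠ k p a = tlᶠ (zipFoldrᶠ k p (consᶠ a nilᶠ) mergeBody mergeBody-linear)

  mergeᶠ-correct : ∀ k p a t {n} (m : Vec Bool n) (π : Partial n) β → ⟦ k ⟧ᶠ t ≡ encodeFlags m → ⟦ p ⟧ᶠ t ≡ encodePartial π →
                   ⟦ a ⟧ᶠ t ≡ stackOnto β nil → ⟦ mergeᶠ k p a ⟧ᶠ t ≡ encodePartial (total (merge m (fill π) β))
  mergeᶠ-correct k p a t m π β k≡ p≡ a≡ = cong tail (zipFoldr-vec encodeBool encodeMaybe Popped k p (consᶠ a nilᶠ) mergeBody
      mergeBody-linear t m π k≡ p≡ (λ { [] ts eq → cong (λ z → cons z nil) eq }) each β nil a≡)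
    where
    -- Stated for any contents ts below the bits: the fold starts at the last variable, so on a
    -- suffix only the upper part of the stack has been consumed.
    Popped : ∀ {n} → Vec Bool n → Partial n → Tree → Set
    Popped m π z = ∀ β ts → ⟦ a ⟧ᶠ t ≡ stackOnto β ts → z ≡ cons ts (encodePartial (total (merge m (fill π) β)))
    each : ∀ {n} b y (m : Vec Bool n) π z → Popped m π z →
           Popped (b ∷ m) (y ∷ π) (⟦ mergeBody ⟧ᶠ (cons (cons (encodeBool b) (encodeMaybe y)) (cons z t)))
    each false nothing  m π z ih β ts eq rewrite ih β ts eq = refl
    each false (just b) m π z ih β ts eq rewrite ih β ts eq = refl
    each true  y m π z ih (true ∷ β)  ts eq rewrite ih β (cons (cons nil nil) ts) eq = refl
    each true  y m π z ih (false ∷ β) ts eq rewrite ih β (cons nil ts) eq = refl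

  checkBody : Fn → Fn
  checkBody a = ifᶠ (hitsᶠ x₀ (a ∘ᶠ e₀)) nilᶠ s₀

  checkBody-linear : ∀ a → Linear (checkBody a)
  checkBody-linear a = over-if {size} (hitsᶠ x₀ (a ∘ᶠ e₀)) {nilᶠ} {s₀} (over-free {size} {nilᶠ} free-nil) over-s

  checkᶠ : Fn → Fn → Fn
  checkᶠ l a = foldrᶠ l trueᶠ (checkBody a) (checkBody-linear a)

  checkᶠ-correct : ∀ l a t {n} (L : List (Clause n)) π → ⟦ l ⟧ᶠ t ≡ encodeClauses L → ⟦ a ⟧ᶠ t ≡ encodePartial π →
                   ⟦ checkᶠ l a ⟧ᶠ t ≡ encodeBool (allHit L π)
  checkᶠ-correct l a t L π l≡ a≡ = foldr-list encodePartial (λ L z → z ≡ encodeBool (allHit L π))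
      l trueᶠ (checkBody a) (checkBody-linear a) t L l≡ refl each
    where
    each : ∀ C L z → z ≡ encodeBool (allHit L π) → ⟦ checkBody a ⟧ᶠ (cons (encodePartial C) (cons z t)) ≡ encodeBool (allHit (C ∷ L) π)
    each C L z refl rewrite hitsᶠ-correct x₀ (a ∘ᶠ e₀) (cons (encodePartial C) (cons z t)) C π refl a≡ with hits C π
    ... | true  = refl
    ... | false = refl

  v₀ v₁ v₂ v₃ w₁ w₂ w₃ w₄ : Fn
  v₀ = hdᶠ idᶠ
  w₁ = tlᶠ idᶠ
  w₂ = tlᶠ w₁
  w₃ = tlᶠ w₂
  w₄ = tlᶠ w₃
  v₁ = hdᶠ w₁
  v₂ = hdᶠ w₂
  v₃ = hdᶠ w₃

  -- The environment of a trial: the solution found so far, the formula, a list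
  -- whose length is the number of random bits per choice, a list of length n,
  -- and a list whose length is the number of variables to be assigned.
  env : ∀ {n} → Maybe (Assignment n) → CNF n → ℕ → ℕ → Tree
  env {n} fd F s i = cons (encodeFound fd) (cons (encodeCNF F) (cons (un s) (cons (un n) (un i))))

  startTrialᶠ : Fn
  startTrialᶠ = consᶠ w₄ (consᶠ v₃ idᶠ)

  startTrialᶠ-correct : ∀ {n} fd (F : CNF n) s i →
    ⟦ startTrialᶠ ⟧ᶠ (env fd F s i) ≡ cons (un i) (cons (encodePartial (blank n)) (env fd F s i))
  startTrialᶠ-correct {n} fd F s i = cong (λ z → cons (un i) (cons z (env fd F s i))) (un-blank n)

  startWalkᶠ : Fn
  startWalkᶠ = consᶠ v₃ (consᶠ nilᶠ idᶠ)

  appendBitᶠ : Fn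
  appendBitᶠ = ifᶠ v₀ double (consᶠ nilᶠ double)
    where
    double : Fn
    double = foldᶠ w₁ w₁ unaryBody unaryBody-linear

  foldT-unary : ∀ a b t → foldT ⟦ unaryBody ⟧ᶠ (un a) (un b) t ≡ un (a ℕ.+ b)
  foldT-unary zero    b t = refl
  foldT-unary (suc a) b t = trans (foldT-unary a (suc b) t) (cong un (ℕ.+-suc a b))

  bitValue : Bool → ℕ
  bitValue true  = 1
  bitValue false = 0

  appendBitᶠ-correct : ∀ b r → ⟦ appendBitᶠ ⟧ᶠ (cons (encodeBool b) (un r)) ≡ un (bitValue b ℕ.+ (r ℕ.+ r))
  appendBitᶠ-correct true  r = cong (cons nil) (foldT-unary r r _)
  appendBitᶠ-correct false r = foldT-unary r r _

  countBody : Fn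
  countBody = ifᶠ x₀ (consᶠ nilᶠ s₀) s₀

  countBody-linear : Linear countBody
  countBody-linear = over-if {size} x₀ {consᶠ nilᶠ s₀} {s₀} (over-cons {size} {nilᶠ} {s₀} free-nil over-s) over-s

  unsetᶠ : Fn → Fn
  unsetᶠ p = foldrᶠ p nilᶠ countBody countBody-linear

  unsetᶠ-correct : ∀ p t {n} (π : Partial n) → ⟦ p ⟧ᶠ t ≡ encodePartial π → ⟦ unsetᶠ p ⟧ᶠ t ≡ un (unset π)
  unsetᶠ-correct p t π p≡ = foldr-vec encodeMaybe (λ π z → z ≡ un (unset π)) p nilᶠ countBody countBody-linear t π p≡ refl
    λ { nothing π z z≡ → cong (cons nil) z≡ ; (just b) π z z≡ → z≡ }

  cycleBody : Fn
  cycleBody = ifᶠ (tlᶠ s₀) (hdᶠ e₀) (tlᶠ s₀)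

  cycleBody-linear : Linear cycleBody
  cycleBody-linear = over-if {size} (tlᶠ s₀) {hdᶠ e₀} {tlᶠ s₀} (over-free {size} {hdᶠ e₀} (free-hd {e₀} free-e)) (over-tl {size} {s₀} over-s)

  -- On cons U (cons b (cons r …)): the position reached from U after r steps of nextPos.
  cycleᶠ : Fn
  cycleᶠ = foldᶠ v₂ v₀ cycleBody cycleBody-linear

  foldT-cycle : ∀ N r p e → head e ≡ un N → foldT ⟦ cycleBody ⟧ᶠ (un r) (un p) e ≡ un (cycle N r p)
  foldT-cycle N zero    p e e≡ = refl
  foldT-cycle N (suc r) p e e≡ = trans (cong (λ z → foldT ⟦ cycleBody ⟧ᶠ (un r) z e) (next p)) (foldT-cycle N r (nextPos N p) e e≡)
    where
    next : ∀ p → caseT (tail (un p)) (head e) (tail (un p)) ≡ un (nextPos N p)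
    next zero          = e≡
    next (suc zero)    = e≡
    next (suc (suc p)) = refl

  -- For the accumulator cons p π the environment is cons p₀ (cons U (cons b …)).
  pickBody : Fn
  pickBody = ifᶠ x₀
    (ifᶠ (hdᶠ s₀) (consᶠ (hdᶠ s₀) (consᶠ nilᶠ (tlᶠ s₀)))
      (consᶠ (tlᶠ (hdᶠ s₀)) (consᶠ (ifᶠ (tlᶠ (hdᶠ s₀)) (consᶠ nilᶠ (hdᶠ (tlᶠ (tlᶠ e₀)))) nilᶠ) (tlᶠ s₀))))
    (consᶠ (hdᶠ s₀) (consᶠ x₀ (tlᶠ s₀)))

  pickBody-linear : Linear pickBody
  pickBody-linear = over-if {size} x₀
    {ifᶠ (hdᶠ s₀) (consᶠ (hdᶠ s₀) (consᶠ nilᶠ (tlᶠ s₀)))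
      (consᶠ (tlᶠ (hdᶠ s₀)) (consᶠ (ifᶠ (tlᶠ (hdᶠ s₀)) (consᶠ nilᶠ (hdᶠ (tlᶠ (tlᶠ e₀)))) nilᶠ) (tlᶠ s₀)))}
    {consᶠ (hdᶠ s₀) (consᶠ x₀ (tlᶠ s₀))}
    (over-if {size} (hdᶠ s₀) {consᶠ (hdᶠ s₀) (consᶠ nilᶠ (tlᶠ s₀))}
      {consᶠ (tlᶠ (hdᶠ s₀)) (consᶠ (ifᶠ (tlᶠ (hdᶠ s₀)) (consᶠ nilᶠ (hdᶠ (tlᶠ (tlᶠ e₀)))) nilᶠ) (tlᶠ s₀))}
      (over-pair {hdᶠ s₀} {consᶠ nilᶠ (tlᶠ s₀)} over-hd (over-cons {size ∘ tail} {nilᶠ} {tlᶠ s₀} free-nil over-tail))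
      (over-pair {tlᶠ (hdᶠ s₀)} {consᶠ (ifᶠ (tlᶠ (hdᶠ s₀)) (consᶠ nilᶠ (hdᶠ (tlᶠ (tlᶠ e₀)))) nilᶠ) (tlᶠ s₀)}
        (over-tl {size ∘ head} {hdᶠ s₀} over-hd)
        (over-cons {size ∘ tail} {ifᶠ (tlᶠ (hdᶠ s₀)) (consᶠ nilᶠ (hdᶠ (tlᶠ (tlᶠ e₀)))) nilᶠ} {tlᶠ s₀}
          (free-if (tlᶠ (hdᶠ s₀)) {consᶠ nilᶠ (hdᶠ (tlᶠ (tlᶠ e₀)))} {nilᶠ}
            (free-cons {nilᶠ} {hdᶠ (tlᶠ (tlᶠ e₀))} free-nil (free-hd {tlᶠ (tlᶠ e₀)} (free-tl {tlᶠ e₀} (free-tl {e₀} free-e)))) free-nil) over-tail)))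
    (over-pair {hdᶠ s₀} {consᶠ x₀ (tlᶠ s₀)} over-hd (over-cons {size ∘ tail} {x₀} {tlᶠ s₀} free-x over-tail))

  -- On cons p (cons U (cons b (cons r (cons π E)))).
  pickᶠ : Fn
  pickᶠ = tlᶠ (foldrᶠ (hdᶠ w₄) (consᶠ v₀ nilᶠ) pickBody pickBody-linear)

  pickᶠ-correct : ∀ p u b r {n} (π : Partial n) E →
    ⟦ pickᶠ ⟧ᶠ (cons (un p) (cons u (cons (encodeBool b) (cons r (cons (encodePartial π) E))))) ≡ encodePartial (choose π p b)
  pickᶠ-correct p u b r π E = cong tail (foldr-vec encodeMaybe
      (λ π z → z ≡ cons (un (proj₁ (pick b p π))) (encodePartial (proj₂ (pick b p π))))
      (hdᶠ w₄) (consᶠ v₀ nilᶠ) pickBody pickBody-linear t π refl refl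
      λ { y π z refl → each y (pick b p π) })
    where
    t = cons (un p) (cons u (cons (encodeBool b) (cons r (cons (encodePartial π) E))))
    each : ∀ {n} y (s : ℕ × Partial n) →
      ⟦ pickBody ⟧ᶠ (cons (encodeMaybe y) (cons (cons (un (proj₁ s)) (encodePartial (proj₂ s))) t)) ≡
      cons (un (proj₁ (pickStep b y s))) (encodePartial (proj₂ (pickStep b y s)))
    each (just c) (q , π)           = refl
    each nothing  (zero , π)        = refl
    each nothing  (suc zero , π)    = refl
    each nothing  (suc (suc q) , π) = refl

  -- On cons b (cons r (cons π E)): assign b to the variable selected by r.
  assignᶠ : Fn
  assignᶠ = consᶠ pickᶠ (tlᶠ w₄) ∘ᶠ consᶠ cycleᶠ idᶠ ∘ᶠ consᶠ (unsetᶠ v₂) idᶠ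

  assign : ∀ {n} → Partial n → ℕ → Bool → Partial n
  assign π r = choose π (cycle (unset π) r (unset π))

  assignᶠ-correct : ∀ b r {n} (π : Partial n) E →
    ⟦ assignᶠ ⟧ᶠ (cons (encodeBool b) (cons (un r) (cons (encodePartial π) E))) ≡ cons (encodePartial (assign π r b)) E
  assignᶠ-correct b r π E = trans (cong (⟦ consᶠ pickᶠ (tlᶠ w₄) ⟧ᶠ ∘ ⟦ consᶠ cycleᶠ idᶠ ⟧ᶠ)
      (cong (λ z → cons z t) (unsetᶠ-correct v₂ t π refl)))
    (trans (cong ⟦ consᶠ pickᶠ (tlᶠ w₄) ⟧ᶠ (cong (λ z → cons z (cons (un (unset π)) t))
      (foldT-cycle (unset π) r (unset π) (cons (un (unset π)) t) refl)))
      (cong (λ z → cons z E) (pickᶠ-correct (cycle (unset π) r (unset π)) (un (unset π)) b (un r) π E)))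
    where
    t = cons (encodeBool b) (cons (un r) (cons (encodePartial π) E))

  -- The mask projected by itself is a list with one element for every variable of the restriction;
  -- it will count the bits to be read from the output of 𝒜.
  reduceᶠ : Fn
  reduceᶠ = consᶠ (restrictᶠ v₀ v₁ (hdᶠ w₃)) (consᶠ (projectᶠ v₀ v₀) idᶠ) ∘ᶠ consᶠ (liveᶠ v₀ v₂) idᶠ

  reduced : ∀ {n} → CNF n → Partial n → Tree → Tree
  reduced F π E = cons (encodeCNF (Restriction.restrict F π)) (cons (encodeFlags (project (live π (clauses F)) (live π (clauses F))))
                    (cons (encodeFlags (live π (clauses F))) (cons (encodePartial π) E)))

  reduceᶠ-correct : ∀ {n} (F : CNF n) π fd s i →
    ⟦ reduceᶠ ⟧ᶠ (cons (encodePartial π) (env fd F s i)) ≡ reduced F π (env fd F s i)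
  reduceᶠ-correct F π fd s i = trans (cong (⟦ consᶠ (restrictᶠ v₀ v₁ (hdᶠ w₃)) (consᶠ (projectᶠ v₀ v₀) idᶠ) ⟧ᶠ)
      (cong (λ z → cons z t) (liveᶠ-correct v₀ v₂ t π (clauses F) refl refl)))
    (cong₂ cons (restrictᶠ-correct v₀ v₁ (hdᶠ w₃) (cons M t) F π refl refl refl)
      (cong (λ z → cons z (cons M t)) (projectᶠ-correct encodeBool v₀ v₀ (cons M t) (live π (clauses F)) (live π (clauses F)) refl refl)))
    where
    t = cons (encodePartial π) (env fd F s i)
    M = encodeFlags (live π (clauses F))

  -- On cons stack (cons mask (cons π E)).
  finishTrialᶠ : Fn
  finishTrialᶠ = consᶠ (ifᶠ (hdᶠ w₄) (ifᶠ (checkᶠ (hdᶠ (tlᶠ w₄)) v₀) nilᶠ (consᶠ nilᶠ v₀)) (hdᶠ w₄)) (tlᶠ w₄) ∘ᶠ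
                 consᶠ (mergeᶠ v₁ v₂ v₀) idᶠ

  finishTrialᶠ-correct : ∀ {n} (F : CNF n) π fd s i β →
    ⟦ finishTrialᶠ ⟧ᶠ (cons (stackOnto β nil) (cons (encodeFlags (live π (clauses F))) (cons (encodePartial π) (env fd F s i)))) ≡
    env (update F fd (merge (live π (clauses F)) (fill π) β)) F s i
  finishTrialᶠ-correct F π fd s i β = trans (cong ⟦ last ⟧ᶠ (cong (λ z → cons z (t fd)) (mergeᶠ-correct v₁ v₂ v₀ (t fd) M π β refl refl refl))) (go fd)
    where
    M = live π (clauses F)
    α = merge M (fill π) β
    t : Maybe (Assignment _) → Tree
    t fd = cons (stackOnto β nil) (cons (encodeFlags M) (cons (encodePartial π) (env fd F s i)))
    last = consᶠ (ifᶠ (hdᶠ w₄) (ifᶠ (checkᶠ (hdᶠ (tlᶠ w₄)) v₀) nilᶠ (consᶠ nilᶠ v₀)) (hdᶠ w₄)) (tlᶠ w₄)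
    go : ∀ fd → ⟦ last ⟧ᶠ (cons (encodePartial (total α)) (t fd)) ≡ env (update F fd α) F s i
    go (just _) = refl
    go nothing rewrite checkᶠ-correct (hdᶠ (tlᶠ w₄)) v₀ (cons (encodePartial (total α)) (t nothing)) (clauses F) (total α) refl refl
      with allHit (clauses F) (total α)
    ... | true  = refl
    ... | false = refl

  outputBody : Fn
  outputBody = consᶠ (tlᶠ x₀) s₀

  outputBody-linear : Linear outputBody
  outputBody-linear = over-cons {size} {tlᶠ x₀} {s₀} (free-tl {x₀} free-x) over-s

  outputᶠ : Fn
  outputᶠ = foldrᶠ (tlᶠ v₀) nilᶠ outputBody outputBody-linear

  outputᶠ-correct : ∀ {n} (α : Assignment n) (F : CNF n) s i → ⟦ outputᶠ ⟧ᶠ (env (just α) F s i) ≡ encodeAssignment α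
  outputᶠ-correct α F s i = trans (⟦foldrᶠ⟧ (tlᶠ v₀) nilᶠ outputBody outputBody-linear (env (just α) F s i)) (go α)
    where
    go : ∀ {n} (α : Assignment n) {e} → foldrT ⟦ outputBody ⟧ᶠ (encodePartial (total α)) nil e ≡ encodeAssignment α
    go []      = refl
    go (b ∷ α) = cong (cons (encodeBool b)) (go α)

  -- The state of the initial loop: x is halved while s counts the halvings, D = 2ˢ
  -- and B is built from the digits of constant j.
  setupState : ℕ → ℕ → ℕ → ℕ → Tree
  setupState x D B s = cons (un x) (cons (un D) (cons (un B) (un s)))

  -- The head of the accumulator marks an element that still waits for a partner, the tail counts
  -- the complete pairs.
  halfBody : Fn
  halfBody = ifᶠ (hdᶠ s₀) (consᶠ trueᶠ (tlᶠ s₀)) (consᶠ nilᶠ (consᶠ nilᶠ (tlᶠ s₀)))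

  halfBody-linear : Linear halfBody
  halfBody-linear = over-if {size} (hdᶠ s₀) {consᶠ trueᶠ (tlᶠ s₀)} {consᶠ nilᶠ (consᶠ nilᶠ (tlᶠ s₀))}
    (over-pair {trueᶠ} {tlᶠ s₀} (over-free {size ∘ head} {trueᶠ} free-true) over-tail)
    (over-pair {nilᶠ} {consᶠ nilᶠ (tlᶠ s₀)} (over-free {size ∘ head} {nilᶠ} free-nil) (over-cons {size ∘ tail} {nilᶠ} {tlᶠ s₀} free-nil over-tail))

  halfᶠ : Fn → Fn
  halfᶠ l = tlᶠ (foldᶠ l nilᶠ halfBody halfBody-linear)

  halfᶠ-correct : ∀ l t x → ⟦ l ⟧ᶠ t ≡ un x → ⟦ halfᶠ l ⟧ᶠ t ≡ un ℕ.⌊ x /2⌋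
  halfᶠ-correct l t x l≡ = trans (cong (λ z → tail (foldT ⟦ halfBody ⟧ᶠ z nil t)) l≡) (start x)
    where
    go : ∀ x h → tail (foldT ⟦ halfBody ⟧ᶠ (un x) (cons nil (un h)) t) ≡ un (ℕ.⌊ x /2⌋ ℕ.+ h)
    go zero          h = refl
    go (suc zero)    h = refl
    go (suc (suc x)) h = trans (go x (suc h)) (cong un (ℕ.+-suc ℕ.⌊ x /2⌋ h))
    start : ∀ x → tail (foldT ⟦ halfBody ⟧ᶠ (un x) nil t) ≡ un ℕ.⌊ x /2⌋
    start zero          = refl
    start (suc zero)    = refl
    start (suc (suc x)) = trans (go x 1) (cong un (ℕ.+-comm ℕ.⌊ x /2⌋ 1))

  doubleᶠ : Fn → Fn
  doubleᶠ l = foldᶠ l l unaryBody unaryBody-linear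

  doubleᶠ-correct : ∀ l t x → ⟦ l ⟧ᶠ t ≡ un x → ⟦ doubleᶠ l ⟧ᶠ t ≡ un (x ℕ.+ x)
  doubleᶠ-correct l t x l≡ = trans (cong (λ z → foldT ⟦ unaryBody ⟧ᶠ z z t) l≡) (foldT-unary x x t)

  refineᶠ : Fin m → Fn
  refineᶠ j = ifᶠ v₀ idᶠ (consᶠ (halfᶠ v₀) (consᶠ (doubleᶠ v₁)
    (consᶠ (ifᶠ (digitᶠ j (consᶠ nilᶠ w₃)) (doubleᶠ v₂) (consᶠ nilᶠ (doubleᶠ v₂))) (consᶠ nilᶠ w₃))))

  refineᶠ-zero : ∀ j D B s → ⟦ refineᶠ j ⟧ᶠ (setupState 0 D B s) ≡ setupState 0 D B s
  refineᶠ-zero j D B s = refl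

  refineᶠ-suc : ∀ j x D B s → ⟦ refineᶠ j ⟧ᶠ (setupState (suc x) D B s) ≡
    setupState ℕ.⌊ suc x /2⌋ (D ℕ.+ D) (bitValue (δ j (suc s)) ℕ.+ (B ℕ.+ B)) (suc s)
  refineᶠ-suc j x D B s = cong₂ cons (halfᶠ-correct v₀ t (suc x) refl) (cong₂ cons (doubleᶠ-correct v₁ t D refl)
      (cong (λ z → cons z (un (suc s))) bits))
    where
    t = setupState (suc x) D B s
    bits : caseT (encodeBool (δ j (suc (spine (un s))))) (⟦ doubleᶠ v₂ ⟧ᶠ t) (cons nil (⟦ doubleᶠ v₂ ⟧ᶠ t)) ≡
           un (bitValue (δ j (suc s)) ℕ.+ (B ℕ.+ B))
    bits rewrite spine-un s | doubleᶠ-correct v₂ t B refl with δ j (suc s)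
    ... | true  = refl
    ... | false = refl

  constᶠ : ℕ → Fn
  constᶠ zero    = nilᶠ
  constᶠ (suc n) = consᶠ nilᶠ (constᶠ n)

  ⟦constᶠ⟧ : ∀ n t → ⟦ constᶠ n ⟧ᶠ t ≡ un n
  ⟦constᶠ⟧ zero    t = refl
  ⟦constᶠ⟧ (suc n) t = cong (cons nil) (⟦constᶠ⟧ n t)

  startᶠ : ℕ → Fn
  startᶠ b = consᶠ v₀ (consᶠ (consᶠ v₀ (consᶠ (constᶠ 2) (consᶠ (constᶠ b) (constᶠ 1)))) idᶠ) ∘ᶠ consᶠ (unaryᶠ v₀) idᶠ

  -- Any clause has n entries; if there is no clause, then n = 0, because every variable occurs.
  firstLength : ∀ {n} (F : CNF n) → spine (head (encodeCNF F)) ≡ n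
  firstLength {n} F = go n (clauses F) (occurs F)
    where
    go : ∀ n L → (∀ x → Any (λ C → Is-just (lookup C x)) L) → spine (head (encodeClauses {n} L)) ≡ n
    go zero    []      h = refl
    go (suc n) []      h with h zero
    ... | ()
    go n       (C ∷ L) h = spine-encodeVec encodeMaybe C

  startᶠ-correct : ∀ b {n} (F : CNF n) → ⟦ startᶠ b ⟧ᶠ (encodeCNF F) ≡ cons (un n) (cons (setupState n 2 b 1) (cons (un n) (encodeCNF F)))
  startᶠ-correct b {n} F = trans (cong ⟦ consᶠ v₀ (consᶠ (consᶠ v₀ (consᶠ (constᶠ 2) (consᶠ (constᶠ b) (constᶠ 1)))) idᶠ) ⟧ᶠ
      (cong (λ z → cons z (encodeCNF F)) (trans (⟦unaryᶠ⟧ v₀ (encodeCNF F)) (cong un (firstLength F)))))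
    (cong (λ z → cons (un n) (cons (cons (un n) (cons (un 2) (cons z (un 1)))) (cons (un n) (encodeCNF F)))) (⟦constᶠ⟧ b _))

  -- There are n + 1 phases, one trial in the first of them, and one element is added to ⌊bD⌋ so
  -- that B ≥ bD. The list of random bits is twice as long as the number of binary places of B, so
  -- the random numbers range up to D².
  readyᶠ : Fn
  readyᶠ = consᶠ (consᶠ nilᶠ (hdᶠ w₁)) (consᶠ (constᶠ 1)
    (consᶠ (consᶠ nilᶠ (consᶠ (tlᶠ w₁) (consᶠ (doubleᶠ (tlᶠ (tlᶠ (tlᶠ v₀)))) (consᶠ v₁ nilᶠ))))
      (consᶠ (hdᶠ (tlᶠ v₀)) (consᶠ nilᶠ (hdᶠ (tlᶠ (tlᶠ v₀)))))))

  readyᶠ-correct : ∀ x D B s {n} (F : CNF n) →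
    ⟦ readyᶠ ⟧ᶠ (cons (setupState x D B s) (cons (un n) (encodeCNF F))) ≡
    cons (un (suc n)) (cons (un 1) (cons (env nothing F (s ℕ.+ s) 0) (cons (un D) (un (suc B)))))
  readyᶠ-correct x D B s {n} F = cong (λ z → cons (un (suc n)) (cons (un 1)
      (cons (cons nil (cons (encodeCNF F) (cons z (cons (un n) nil)))) (cons (un D) (un (suc B))))))
    (doubleᶠ-correct (tlᶠ (tlᶠ (tlᶠ v₀))) (cons (setupState x D B s) (cons (un n) (encodeCNF F))) s refl)

-- The algorithm

module Algorithm {m : ℕ} (δ : Digits m) (A : Program m) (j : Fin m) where
  open Language δ
  open Programs δ
  open Routines δ
  open Machine δ A

  -- cons (cons x t) rest ↦ cons t rest
  drop : Ex
  drop = consˣ (tlˣ (hdˣ var)) (tlˣ var)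

  -- cons (cons x t) rest ↦ cons x (cons t rest)
  open₁ : Ex
  open₁ = consˣ (hdˣ (hdˣ var)) (consˣ (tlˣ (hdˣ var)) (tlˣ var))

  -- cons (cons x (cons y t)) rest ↦ cons x (cons y (cons t rest))
  open₂ : Ex
  open₂ = consˣ (hdˣ (hdˣ var)) (consˣ (hdˣ (tlˣ (hdˣ var))) (consˣ (tlˣ (tlˣ (hdˣ var))) (tlˣ var)))

  -- cons x (cons t rest) ↦ cons (cons x t) rest
  close₁ : Ex
  close₁ = consˣ (consˣ (hdˣ var) (hdˣ (tlˣ var))) (tlˣ (tlˣ var))

  -- cons x (cons y (cons t rest)) ↦ cons (cons x (cons y t)) rest
  close₂ : Ex
  close₂ = consˣ (consˣ (hdˣ var) (consˣ (hdˣ (tlˣ var)) (hdˣ (tlˣ (tlˣ var))))) (tlˣ (tlˣ (tlˣ var)))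

  bit : Program m
  bit = set drop ⨾ coin ⨾ set close₁ ⨾ code appendBitᶠ

  walk : Program m
  walk = set drop ⨾ code startWalkᶠ ⨾ set open₂ ⨾ loop bit ⨾ coin ⨾ set close₂ ⨾ code assignᶠ

  -- cons (cons x (cons out acc)) rest ↦ cons (cons (tail out) (cons b acc)) rest,
  -- where b tells whether the head of out is a cons.
  read : Program m
  read = ifnil (exprˣ S (hdˣ (hdˣ (tlˣ (hdˣ var))))) (set (readˣ nilˣ)) (set (readˣ (consˣ nilˣ nilˣ)))
    where
    readˣ : Ex → Ex
    readˣ b = consˣ (consˣ (tlˣ (hdˣ (tlˣ (hdˣ var)))) (consˣ b (tlˣ (tlˣ (hdˣ var))))) (tlˣ var)

  -- Nothing is tested before the call: whether the restriction is satisfiable or has enough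
  -- critical variables is unknown to the program and enters only the analysis.
  trial : Program m
  trial = set drop ⨾ code startTrialᶠ ⨾ set open₁ ⨾ loop walk ⨾ code reduceᶠ ⨾ set open₁ ⨾ call ⨾
          set (consˣ (hdˣ (hdˣ (tlˣ var))) (consˣ (consˣ (hdˣ var) nilˣ) (consˣ (tlˣ (hdˣ (tlˣ var))) (tlˣ (tlˣ var))))) ⨾
          loop read ⨾ set (consˣ (consˣ (tlˣ (hdˣ var)) (hdˣ (tlˣ var))) (tlˣ (tlˣ var))) ⨾ code finishTrialᶠ

  -- On cons X (cons Y (cons E (cons (cons D B) rest))): as long as X is not empty,
  -- take D elements from X and put B elements on Y.
  grow : Program m
  grow = while (exprˣ S (hdˣ var))
    (set (consˣ (hdˣ (hdˣ (tlˣ (tlˣ (tlˣ var))))) var) ⨾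
     loop (set (consˣ (tlˣ (tlˣ (hdˣ var))) (tlˣ var))) ⨾
     set (consˣ (tlˣ (hdˣ (tlˣ (tlˣ (tlˣ var))))) (consˣ (hdˣ (tlˣ var)) (consˣ (hdˣ var) (tlˣ (tlˣ var))))) ⨾
     loop (set (consˣ (consˣ nilˣ (tlˣ (hdˣ var))) (tlˣ var))) ⨾
     set (consˣ (hdˣ (tlˣ var)) (consˣ (hdˣ var) (tlˣ (tlˣ var)))))

  -- From cons E (cons X rest), with the last list of E one element longer.
  nextPhaseˣ : Ex
  nextPhaseˣ = consˣ (hdˣ (tlˣ var)) (consˣ nilˣ (consˣ
      (consˣ (hdˣ E) (consˣ (hdˣ (tlˣ E)) (consˣ (hdˣ (tlˣ (tlˣ E))) (consˣ (hdˣ (tlˣ (tlˣ (tlˣ E)))) (consˣ nilˣ (tlˣ (tlˣ (tlˣ (tlˣ E)))))))))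
      (tlˣ (tlˣ var))))
    where
    E = hdˣ var

  -- The state of the phases is cons X (cons E (cons D B)).
  phase : Program m
  phase = set (consˣ tokens (consˣ (hdˣ (tlˣ t)) (consˣ tokens (consˣ (tlˣ (tlˣ t)) (tlˣ var))))) ⨾
          loop trial ⨾ set nextPhaseˣ ⨾ grow ⨾
          set (consˣ (consˣ (hdˣ (tlˣ var)) (consˣ (hdˣ (tlˣ (tlˣ var))) (hdˣ (tlˣ (tlˣ (tlˣ var)))))) (tlˣ (tlˣ (tlˣ (tlˣ var)))))
    where
    t tokens : Ex
    t = tlˣ (hdˣ var)
    tokens = hdˣ t

  -- Digit access reveals only the parity of the integer part of the constant, so the floor of twice
  -- the constant is built into the program as the argument. The refinement therefore starts with D
  -- = 2 and one binary place.
  body : ℕ → Program m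
  body b = code (startᶠ b) ⨾ set open₂ ⨾ loop (set drop ⨾ code (refineᶠ j)) ⨾ set close₁ ⨾
           code readyᶠ ⨾ set open₁ ⨾ loop phase ⨾ set (consˣ (hdˣ (tlˣ (hdˣ var))) (tlˣ var)) ⨾ code outputᶠ

  main : ℕ → Program m
  main b = (S ≔ consᵉ (reg 0) nilᵉ) ⨾ (0 ≔ nilᵉ) ⨾ body b ⨾ (0 ≔ exprˣ S (hdˣ var))

  opaque
    routineTime : Poly
    routineTime = timeBound appendBitᶠ ⊕ (timeBound startWalkᶠ ⊕ (timeBound assignᶠ ⊕ (timeBound startTrialᶠ ⊕
                  (timeBound reduceᶠ ⊕ timeBound finishTrialᶠ))))

    appendBit-time : ∀ k → eval (timeBound appendBitᶠ) k ℕ.≤ eval routineTime k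
    appendBit-time k = ℕ.m≤m+n _ _

    startWalk-time : ∀ k → eval (timeBound startWalkᶠ) k ℕ.≤ eval routineTime k
    startWalk-time k = ℕ.m≤n⇒m≤o+n (eval (timeBound appendBitᶠ) k) (ℕ.m≤m+n _ _)

    assign-time : ∀ k → eval (timeBound assignᶠ) k ℕ.≤ eval routineTime k
    assign-time k = ℕ.m≤n⇒m≤o+n (eval (timeBound appendBitᶠ) k) (ℕ.m≤n⇒m≤o+n (eval (timeBound startWalkᶠ) k) (ℕ.m≤m+n _ _))

    startTrial-time : ∀ k → eval (timeBound startTrialᶠ) k ℕ.≤ eval routineTime k
    startTrial-time k = ℕ.m≤n⇒m≤o+n (eval (timeBound appendBitᶠ) k) (ℕ.m≤n⇒m≤o+n (eval (timeBound startWalkᶠ) k) (ℕ.m≤n⇒m≤o+n (eval (timeBound assignᶠ) k) (ℕ.m≤m+n _ _)))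

    reduce-time : ∀ k → eval (timeBound reduceᶠ) k ℕ.≤ eval routineTime k
    reduce-time k = ℕ.m≤n⇒m≤o+n (eval (timeBound appendBitᶠ) k) (ℕ.m≤n⇒m≤o+n (eval (timeBound startWalkᶠ) k) (ℕ.m≤n⇒m≤o+n (eval (timeBound assignᶠ) k) (ℕ.m≤n⇒m≤o+n (eval (timeBound startTrialᶠ) k) (ℕ.m≤m+n _ _))))

    finishTrial-time : ∀ k → eval (timeBound finishTrialᶠ) k ℕ.≤ eval routineTime k
    finishTrial-time k = ℕ.m≤n⇒m≤o+n (eval (timeBound appendBitᶠ) k) (ℕ.m≤n⇒m≤o+n (eval (timeBound startWalkᶠ) k) (ℕ.m≤n⇒m≤o+n (eval (timeBound assignᶠ) k) (ℕ.m≤n⇒m≤o+n (eval (timeBound startTrialᶠ) k) (ℕ.m≤n⇒m≤o+n (eval (timeBound reduceᶠ) k) (ℕ.≤-refl)))))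

  opaque
    setupTime : ℕ → Poly
    setupTime b = timeBound (startᶠ b) ⊕ (timeBound (refineᶠ j) ⊕ (timeBound readyᶠ ⊕ timeBound outputᶠ))

    start-time : ∀ b k → eval (timeBound (startᶠ b)) k ℕ.≤ eval (setupTime b) k
    start-time b k = ℕ.m≤m+n _ _

    refine-time : ∀ b k → eval (timeBound (refineᶠ j)) k ℕ.≤ eval (setupTime b) k
    refine-time b k = ℕ.m≤n⇒m≤o+n (eval (timeBound (startᶠ b)) k) (ℕ.m≤m+n _ _)

    ready-time : ∀ b k → eval (timeBound readyᶠ) k ℕ.≤ eval (setupTime b) k
    ready-time b k = ℕ.m≤n⇒m≤o+n (eval (timeBound (startᶠ b)) k) (ℕ.m≤n⇒m≤o+n (eval (timeBound (refineᶠ j)) k) (ℕ.m≤m+n _ _))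

    output-time : ∀ b k → eval (timeBound outputᶠ) k ℕ.≤ eval (setupTime b) k
    output-time b k = ℕ.m≤n⇒m≤o+n (eval (timeBound (startᶠ b)) k) (ℕ.m≤n⇒m≤o+n (eval (timeBound (refineᶠ j)) k) (ℕ.m≤n+m _ _))

isCons : Tree → Bool
isCons nil        = false
isCons (cons _ _) = true

readBits : ∀ k → Tree → Vec Bool k
readBits zero    t = []
readBits (suc k) t = isCons (head t) ∷ readBits k (tail t)

readBits-encode : ∀ {k} (β : Vec Bool k) → readBits k (encodeAssignment β) ≡ β
readBits-encode []          = refl
readBits-encode (true ∷ β)  = cong (true ∷_) (readBits-encode β)
readBits-encode (false ∷ β) = cong (false ∷_) (readBits-encode β)

size-encodePartial : ∀ {n} (π : Partial n) → size (encodePartial π) ℕ.≤ 3 ℕ.* n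
size-encodePartial [] = ℕ.z≤n
size-encodePartial {suc n} (y ∷ π) = ℕ.≤-trans (ℕ.s≤s (ℕ.+-mono-≤ (entry y) (size-encodePartial π))) (ℕ.≤-reflexive (sym (ℕ.*-suc 3 n)))
  where
  entry : ∀ y → size (encodeMaybe y) ℕ.≤ 2
  entry nothing      = ℕ.z≤n
  entry (just true)  = ℕ.≤-refl
  entry (just false) = ℕ.s≤s ℕ.z≤n

size-encodeFlags : ∀ {n} (o : Vec Bool n) → size (encodeVec encodeBool o) ℕ.≤ 2 ℕ.* n
size-encodeFlags [] = ℕ.z≤n
size-encodeFlags {suc n} (b ∷ o) = ℕ.≤-trans (ℕ.s≤s (ℕ.+-mono-≤ (entry b) (size-encodeFlags o))) (ℕ.≤-reflexive (sym (ℕ.*-suc 2 n)))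
  where
  entry : ∀ b → size (encodeBool b) ℕ.≤ 1
  entry true  = ℕ.≤-refl
  entry false = ℕ.z≤n

cycle-range : ∀ N r p → 1 ℕ.≤ N → 1 ℕ.≤ p → p ℕ.≤ N → 1 ℕ.≤ cycle N r p × cycle N r p ℕ.≤ N
cycle-range N zero    p             1≤N 1≤p p≤N = 1≤p , p≤N
cycle-range N (suc r) (suc zero)    1≤N 1≤p p≤N = cycle-range N r N 1≤N 1≤N ℕ.≤-refl
cycle-range N (suc r) (suc (suc p)) 1≤N 1≤p p≤N = cycle-range N r (suc p) 1≤N (ℕ.s≤s ℕ.z≤n) (ℕ.≤-trans (ℕ.n≤1+n _) p≤N)

-- Expected values of the random walk

module WalkValue {c ℓ₁ ℓ₂} (R : ArchimedeanOrderedField c ℓ₁ ℓ₂) {m : ℕ} (δ : Digits m) where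
  open FieldProperties R
  open Mean R
  open Routines δ

  -- The expectation of φ at a number whose last s binary digits are random.
  bitsMean : ℕ → ℕ → (ℕ → Carrier) → Carrier
  bitsMean zero    r φ = φ r
  bitsMean (suc s) r φ = mid (bitsMean s (bitValue true ℕ.+ (r ℕ.+ r)) φ) (bitsMean s (bitValue false ℕ.+ (r ℕ.+ r)) φ)

  assignMean : ∀ {n} → ℕ → Partial n → (Partial n → Carrier) → Carrier
  assignMean s π g = bitsMean s 0 (λ r → mid (g (assign π r true)) (g (assign π r false)))

  walkMean : ∀ {n} → ℕ → ℕ → (Partial n → Carrier) → Partial n → Carrier
  walkMean s zero    g π = g π
  walkMean s (suc i) g π = assignMean s π (walkMean s i g)

  bitsMean-affine : ∀ s r θ ψ φ → bitsMean s r (λ r → θ + ψ * φ r) ≈ θ + ψ * bitsMean s r φ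
  bitsMean-affine zero    r θ ψ φ = ≈-refl
  bitsMean-affine (suc s) r θ ψ φ = ≈-trans (*-congˡ (+-cong (bitsMean-affine s _ θ ψ φ) (bitsMean-affine s _ θ ψ φ)))
    (mid-affine θ ψ _ _)

  bitsMean-cong : ∀ s r {φ φ′} → (∀ r → φ r ≈ φ′ r) → bitsMean s r φ ≈ bitsMean s r φ′
  bitsMean-cong zero    r h = h r
  bitsMean-cong (suc s) r h = *-congˡ (+-cong (bitsMean-cong s _ h) (bitsMean-cong s _ h))

  bitsMean-mono : ∀ s r {φ φ′} → (∀ r → φ r ≤ φ′ r) → bitsMean s r φ ≤ bitsMean s r φ′
  bitsMean-mono zero    r h = h r
  bitsMean-mono (suc s) r h = mid-mono (bitsMean-mono s _ h) (bitsMean-mono s _ h)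

  assignMean-affine : ∀ {n} s (π : Partial n) θ ψ g → assignMean s π (λ π → θ + ψ * g π) ≈ θ + ψ * assignMean s π g
  assignMean-affine s π θ ψ g = ≈-trans (bitsMean-cong s 0 (λ r → mid-affine θ ψ (g (assign π r true)) (g (assign π r false))))
    (bitsMean-affine s 0 θ ψ (λ r → mid (g (assign π r true)) (g (assign π r false))))

  assignMean-cong : ∀ {n} s (π : Partial n) {g g′} → (∀ π → g π ≈ g′ π) → assignMean s π g ≈ assignMean s π g′
  assignMean-cong s π h = bitsMean-cong s 0 (λ r → *-congˡ (+-cong (h _) (h _)))

  walkMean-affine : ∀ {n} s i θ ψ (g : Partial n → Carrier) π → walkMean s i (λ π → θ + ψ * g π) π ≈ θ + ψ * walkMean s i g π
  walkMean-affine s zero    θ ψ g π = ≈-refl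
  walkMean-affine s (suc i) θ ψ g π = ≈-trans (assignMean-cong s π (walkMean-affine s i θ ψ g))
    (assignMean-affine s π θ ψ (walkMean s i g))

  bitsMean-≤ : ∀ s r {φ v} → (∀ r → φ r ≤ v) → bitsMean s r φ ≤ v
  bitsMean-≤ zero    r h = h r
  bitsMean-≤ (suc s) r h = ≤-trans (mid-mono (bitsMean-≤ s _ h) (bitsMean-≤ s _ h)) (≤-reflexive (½*[x+x] _))

  ≤-bitsMean : ∀ s r {φ v} → (∀ r → v ≤ φ r) → v ≤ bitsMean s r φ
  ≤-bitsMean zero    r h = h r
  ≤-bitsMean (suc s) r h = ≤-trans (≤-reflexive (≈-sym (½*[x+x] _))) (mid-mono (≤-bitsMean s _ h) (≤-bitsMean s _ h))

  walkMean-≤ : ∀ {n} s i {g : Partial n → Carrier} {v} π → (∀ π → g π ≤ v) → walkMean s i g π ≤ v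
  walkMean-≤ s zero    π h = h π
  walkMean-≤ s (suc i) {g} {v} π h = bitsMean-≤ s 0 λ r →
    ≤-trans (mid-mono (walkMean-≤ s i {g} _ h) (walkMean-≤ s i {g} _ h)) (≤-reflexive (½*[x+x] v))

  ≤-walkMean : ∀ {n} s i {g : Partial n → Carrier} {v} π → (∀ π → v ≤ g π) → v ≤ walkMean s i g π
  ≤-walkMean s zero    π h = h π
  ≤-walkMean s (suc i) {g} {v} π h = ≤-bitsMean s 0 λ r →
    ≤-trans (≤-reflexive (≈-sym (½*[x+x] v))) (mid-mono (≤-walkMean s i {g} _ h) (≤-walkMean s i {g} _ h))

-- Correctness and cost of a trial

module Correctness {c ℓ₁ ℓ₂} (R : ArchimedeanOrderedField c ℓ₁ ℓ₂) {m : ℕ} (δ : Digits m) (A : Program m) (j : Fin m)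
                   (χ : Tree → ArchimedeanOrderedField.Carrier R) where
  open FieldProperties R
  open Mean R
  open Language δ
  open Programs δ
  open Routines δ
  open Machine δ A
  open Algorithm δ A j
  open Execution R δ A χ
  open WalkValue R δ

  module Trials {n : ℕ} (F : CNF n) (s Z : ℕ)
    (size-env : ∀ fd i → i ℕ.≤ suc n → size (env fd F s i) ℕ.≤ Z)
    (3n≤Z : 3 ℕ.* n ℕ.≤ Z) (2^s≤Z : 2 ℕ.^ s ℕ.≤ Z)
    (τ : ℕ) (routineTime≤τ : eval routineTime (4 ℕ.+ 4 ℕ.* Z) ℕ.≤ τ) where

    -- Each routine is applied to at most four trees of size at most Z, joined by at most four
    -- further nodes.
    Z′ : ℕ
    Z′ = 4 ℕ.+ 4 ℕ.* Z

    code-τ : ∀ f t t′ rest → eval (timeBound f) Z′ ℕ.≤ τ → size t ℕ.≤ Z′ → ⟦ f ⟧ᶠ t ≡ t′ → Det (code f) (cons t rest) τ (cons t′ rest)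
    code-τ f t t′ rest f≤ t≤ refl = det-weaken (ℕ.≤-trans (eval-mono (timeBound f) t≤) f≤) (code-run f t rest)

    appendBit≤ : eval (timeBound appendBitᶠ) Z′ ℕ.≤ τ
    appendBit≤ = ℕ.≤-trans (appendBit-time Z′) routineTime≤τ

    startWalk≤ : eval (timeBound startWalkᶠ) Z′ ℕ.≤ τ
    startWalk≤ = ℕ.≤-trans (startWalk-time Z′) routineTime≤τ

    assign≤ : eval (timeBound assignᶠ) Z′ ℕ.≤ τ
    assign≤ = ℕ.≤-trans (assign-time Z′) routineTime≤τ

    startTrial≤ : eval (timeBound startTrialᶠ) Z′ ℕ.≤ τ
    startTrial≤ = ℕ.≤-trans (startTrial-time Z′) routineTime≤τ

    reduce≤ : eval (timeBound reduceᶠ) Z′ ℕ.≤ τ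
    reduce≤ = ℕ.≤-trans (reduce-time Z′) routineTime≤τ

    finishTrial≤ : eval (timeBound finishTrialᶠ) Z′ ℕ.≤ τ
    finishTrial≤ = ℕ.≤-trans (finishTrial-time Z′) routineTime≤τ

    size-π : ∀ (π : Partial n) → size (encodePartial π) ℕ.≤ Z
    size-π π = ℕ.≤-trans (size-encodePartial π) 3n≤Z

    size-bits : ∀ b r → suc r ℕ.≤ 2 ℕ.^ s → size (cons (encodeBool b) (un r)) ℕ.≤ 2 ℕ.+ Z
    size-bits b r r< = ℕ.s≤s (ℕ.+-mono-≤ (entry b) (ℕ.≤-trans (ℕ.≤-reflexive (size-un r)) (ℕ.≤-trans (ℕ.n≤1+n r) (ℕ.≤-trans r< 2^s≤Z))))
      where
      entry : ∀ b → size (encodeBool b) ℕ.≤ 1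
      entry true  = ℕ.≤-refl
      entry false = ℕ.z≤n

    Z-bounds : ∀ a b → a ℕ.≤ 4 → b ℕ.≤ 4 → a ℕ.+ b ℕ.* Z ℕ.≤ Z′
    Z-bounds a b a≤4 b≤4 = ℕ.+-mono-≤ a≤4 (ℕ.*-monoˡ-≤ Z b≤4)

    bitTime walkTime : ℕ
    bitTime  = 10 ℕ.+ τ
    walkTime = suc (1 ℕ.+ suc (τ ℕ.+ suc (1 ℕ.+ suc ((s ℕ.* (5 ℕ.+ bitTime) ℕ.+ 3) ℕ.+ suc (5 ℕ.+ suc (1 ℕ.+ τ))))))

    -- With k bits to come, r + 1 ≤ 2^(s-k). This bounds the unary number r throughout and gives r <
    -- 2ˢ at the end.
    BitInv : (ℕ → Carrier) → Tree → Tree → Carrier → Set c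
    BitInv φ l t u = ∃[ k ] ∃[ r ] (l ≡ un k × t ≡ un r × suc r ℕ.* 2 ℕ.^ k ℕ.≤ 2 ℕ.^ s × u ≡ bitsMean k r φ)

    bit-tri : ∀ φ x l t u rest → BitInv φ (cons x l) t u →
              Tri bit (cons (cons x t) (cons l rest)) bitTime u (λ t′ w → ∃[ s′ ] (t′ ≡ cons s′ (cons l rest) × BitInv φ l s′ w))
    bit-tri φ x l t u rest (suc k , r , refl , refl , r≤ , refl) =
      set-det _ _ ⟫ᵈ
      coin-tri {Q = λ t′ w → ∃[ b ] (t′ ≡ cons (encodeBool b) (cons (un r) (cons (un k) rest)) × w ≡ next b)}
        next ≤-refl (λ b → b , refl , refl) ⟫
      λ { _ _ (b , refl , refl) → set-det _ _ ⟫ᵈ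
          weaken ℕ.≤-refl ≤-refl (λ { _ _ (refl , refl) → _ , refl , k , _ , refl , refl , fits b , refl })
            (code-τ appendBitᶠ _ _ (cons (un k) rest) appendBit≤
              (ℕ.≤-trans (size-bits b r small) (ℕ.≤-trans (ℕ.≤-reflexive (cong (2 ℕ.+_) (sym (ℕ.*-identityˡ Z)))) (Z-bounds 2 1 (ℕ.s≤s (ℕ.s≤s ℕ.z≤n)) (ℕ.s≤s ℕ.z≤n))))
              (appendBitᶠ-correct b r) (next b)) }
      where
      next : Bool → Carrier
      next b = bitsMean k (bitValue b ℕ.+ (r ℕ.+ r)) φ
      small : suc r ℕ.≤ 2 ℕ.^ s
      small = ℕ.≤-trans (ℕ.m≤m*n (suc r) (2 ℕ.^ suc k) {{ℕ.>-nonZero (ℕ.m^n>0 2 (suc k))}}) r≤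
      lem : ∀ r a → (2 ℕ.+ (r ℕ.+ r)) ℕ.* a ≡ (1 ℕ.+ r) ℕ.* (2 ℕ.* a)
      lem = solve-∀
      bitValue≤1 : ∀ b → bitValue b ℕ.≤ 1
      bitValue≤1 true  = ℕ.≤-refl
      bitValue≤1 false = ℕ.z≤n
      fits : ∀ b → suc (bitValue b ℕ.+ (r ℕ.+ r)) ℕ.* 2 ℕ.^ k ℕ.≤ 2 ℕ.^ s
      fits b = ℕ.≤-trans (ℕ.*-monoˡ-≤ (2 ℕ.^ k) (ℕ.s≤s (ℕ.+-monoˡ-≤ (r ℕ.+ r) (bitValue≤1 b))))
        (ℕ.≤-trans (ℕ.≤-reflexive (lem r (2 ℕ.^ k))) r≤)

    walk-tri : ∀ (φ : Partial n → Carrier) π fd i x rest → i ℕ.≤ suc n →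
      Tri walk (cons (cons x (cons (encodePartial π) (env fd F s i))) rest) walkTime (assignMean s π φ)
        (λ t w → ∃[ r ] ∃[ b ] (t ≡ cons (cons (encodePartial (assign π r b)) (env fd F s i)) rest × w ≡ φ (assign π r b)))
    walk-tri φ π fd i x rest i≤ =
      set-det _ _ ⟫ᵈ code-τ startWalkᶠ (cons (encodePartial π) E) _ rest startWalk≤ size₁ refl ⟫ᵈ set-det _ _ ⟫ᵈ
      weaken (ℕ.≤-reflexive (cong (λ k → k ℕ.* (5 ℕ.+ bitTime) ℕ.+ 3) (spine-un s))) ≤-refl (λ _ _ q → q)
        (loop-tri (BitInv after) (bit-tri after) (un s) nil _ (cons (cons (encodePartial π) E) rest)
          (s , 0 , refl , refl , ℕ.≤-reflexive (ℕ.*-identityˡ (2 ℕ.^ s)) , refl)) ⟫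
      λ { _ _ (_ , refl , zero , r , _ , refl , r≤ , refl) →
          coin-tri {Q = λ t′ w → ∃[ b ] (t′ ≡ cons (encodeBool b) (cons (un r) (cons (cons (encodePartial π) E) rest)) × w ≡ φ (assign π r b))}
            (λ b → φ (assign π r b)) ≤-refl (λ b → b , refl , refl) ⟫
          λ { _ _ (b , refl , refl) → set-det _ _ ⟫ᵈ
              weaken ℕ.≤-refl ≤-refl (λ { _ _ (refl , refl) → r , b , refl , refl })
                (code-τ assignᶠ _ _ rest assign≤ (size₂ b r (ℕ.≤-trans (ℕ.≤-reflexive (sym (ℕ.*-identityʳ (suc r)))) r≤)) (assignᶠ-correct b r π E) (φ (assign π r b))) } }
      where
      E = env fd F s i
      after : ℕ → Carrier
      after r = mid (φ (assign π r true)) (φ (assign π r false))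
      size₁ : size (cons (encodePartial π) E) ℕ.≤ Z′
      size₁ = ℕ.≤-trans (ℕ.s≤s (ℕ.+-mono-≤ (size-π π) (size-env fd i i≤)))
        (ℕ.≤-trans (ℕ.≤-reflexive (cong (λ z → suc (Z ℕ.+ z)) (sym (ℕ.+-identityʳ Z)))) (Z-bounds 1 2 (ℕ.s≤s ℕ.z≤n) (ℕ.s≤s (ℕ.s≤s ℕ.z≤n))))
      lem : ∀ Z → 1 ℕ.+ (1 ℕ.+ (1 ℕ.+ (Z ℕ.+ (1 ℕ.+ (Z ℕ.+ Z))))) ≡ 4 ℕ.+ 3 ℕ.* Z
      lem = solve-∀
      size₂ : ∀ b r → suc r ℕ.≤ 2 ℕ.^ s → size (cons (encodeBool b) (cons (un r) (cons (encodePartial π) E))) ℕ.≤ Z′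
      size₂ b r r< = ℕ.≤-trans (ℕ.s≤s (ℕ.+-mono-≤ (entry b) (ℕ.s≤s (ℕ.+-mono-≤
            (ℕ.≤-trans (ℕ.≤-reflexive (size-un r)) (ℕ.≤-trans (ℕ.n≤1+n r) (ℕ.≤-trans r< 2^s≤Z)))
            (ℕ.s≤s (ℕ.+-mono-≤ (size-π π) (size-env fd i i≤)))))))
          (ℕ.≤-trans (ℕ.≤-reflexive (lem Z)) (Z-bounds 4 3 ℕ.≤-refl (ℕ.s≤s (ℕ.s≤s (ℕ.s≤s ℕ.z≤n)))))
        where
        entry : ∀ b → size (encodeBool b) ℕ.≤ 1
        entry true  = ℕ.≤-refl
        entry false = ℕ.z≤n

    read-tri : ∀ v x out acc l rest → Tri read (cons (cons x (cons out acc)) (cons l rest)) 2 v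
      (λ t w → t ≡ cons (cons (tail out) (cons (encodeBool (isCons (head out))) acc)) (cons l rest) × w ≡ v)
    read-tri v x out acc l rest = ifnil-tri (hdˣ (hdˣ (tlˣ (hdˣ var))))
      (λ eq → weaken ℕ.≤-refl ≤-refl (λ { _ _ (refl , refl) → cong result (sym (cong (encodeBool ∘ isCons) eq)) , refl }) (set-det _ _ v))
      (λ eq → weaken ℕ.≤-refl ≤-refl (λ { _ _ (refl , refl) → cong result (sym (cong (encodeBool ∘ isCons) eq)) , refl }) (set-det _ _ v))
      where
      result : Tree → Tree
      result b = cons (cons (tail out) (cons b acc)) (cons l rest)

    -- The bits already stacked, followed by those still to be read, always make up the same stack.
    ReadInv : ∀ {k} → Vec Bool k → Carrier → Tree → Tree → Carrier → Set c
    ReadInv β v l t u = ∃[ out ] ∃[ acc ] (t ≡ cons out acc × stackOnto (readBits (spine l) out) acc ≡ stackOnto β nil × u ≡ v)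

    reads-tri : ∀ v k l out rest → spine l ≡ k → Tri (loop read) (cons l (cons (cons out nil) rest)) (k ℕ.* 7 ℕ.+ 3) v
      (λ t w → ∃[ out′ ] (t ≡ cons (cons out′ (stackOnto (readBits k out) nil)) rest × w ≡ v))
    reads-tri v k l out rest refl = weaken ℕ.≤-refl ≤-refl
      (λ { _ _ (_ , refl , out′ , _ , refl , refl , refl) → out′ , refl , refl })
      (loop-tri (ReadInv (readBits k out) v)
        (λ { x l _ _ rest (out , acc , refl , eq , refl) → weaken ℕ.≤-refl ≤-refl
             (λ { _ _ (refl , refl) → _ , refl , _ , _ , refl , eq , refl }) (read-tri v x out acc l rest) })
        l (cons out nil) v rest (out , nil , refl , refl , refl))

    WalkInv : ∀ fd i → (Partial n → Carrier) → Tree → Tree → Carrier → Set c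
    WalkInv fd i g l t u = ∃[ k ] ∃[ π ] (l ≡ un k × t ≡ cons (encodePartial π) (env fd F s i) × unset π ℕ.+ i ≡ n ℕ.+ k × u ≡ walkMean s k g π)

    walks-tri : ∀ fd i (g : Partial n → Carrier) rest → i ℕ.≤ n →
      Tri (loop walk) (cons (un i) (cons (cons (encodePartial (blank n)) (env fd F s i)) rest)) (n ℕ.* (5 ℕ.+ walkTime) ℕ.+ 3)
        (walkMean s i g (blank n))
        (λ t w → ∃[ π ] (t ≡ cons (cons (encodePartial π) (env fd F s i)) rest × unset π ℕ.+ i ≡ n × w ≡ g π))
    walks-tri fd i g rest i≤n = weaken
      (ℕ.+-monoˡ-≤ 3 (ℕ.*-monoˡ-≤ (5 ℕ.+ walkTime) (ℕ.≤-trans (ℕ.≤-reflexive (spine-un i)) i≤n))) ≤-refl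
      (λ { _ _ (_ , refl , zero , π , _ , refl , eq , refl) → π , refl , trans eq (ℕ.+-identityʳ n) , refl })
      (loop-tri (WalkInv fd i g) each (un i) _ _ rest (i , blank n , refl , refl , cong (ℕ._+ i) (unset-blank n) , refl))
      where
      each : ∀ x l t u rest → WalkInv fd i g (cons x l) t u → Tri walk (cons (cons x t) (cons l rest)) walkTime u
        (λ t w → ∃[ s′ ] (t ≡ cons s′ (cons l rest) × WalkInv fd i g l s′ w))
      each x l t u rest (suc k , π , refl , refl , eq , refl) = weaken ℕ.≤-refl ≤-refl
        (λ { _ _ (r , b , refl , refl) → _ , refl , k , _ , refl , refl , fewer r b , refl })
        (walk-tri (walkMean s k g) π fd i x (cons (un k) rest) (ℕ.≤-trans i≤n (ℕ.n≤1+n n)))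
        where
        -- The number of open variables is n - i + k + 1, and i ≤ n: a walk never runs out of
        -- variables.
        1≤N : 1 ℕ.≤ unset π
        1≤N = ℕ.+-cancelʳ-≤ i 1 (unset π) (ℕ.≤-trans (ℕ.s≤s i≤n)
          (ℕ.≤-trans (ℕ.≤-reflexive (ℕ.+-comm 1 n)) (ℕ.≤-trans (ℕ.+-monoʳ-≤ n (ℕ.s≤s ℕ.z≤n)) (ℕ.≤-reflexive (sym eq)))))
        fewer : ∀ r b → unset (assign π r b) ℕ.+ i ≡ n ℕ.+ k
        fewer r b = ℕ.suc-injective (trans
          (cong (ℕ._+ i) (unset-choose b π (cycle (unset π) r (unset π)) (proj₁ range) (proj₂ range))) (trans eq (ℕ.+-suc n k)))
          where range = cycle-range (unset π) r (unset π) 1≤N 1≤N ℕ.≤-refl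

    candidate : Partial n → Tree → Assignment n
    candidate π out = merge (live π (clauses F)) (fill π) (readBits (cnt (live π (clauses F))) out)

    output : ∀ {T} → Partial n → Vec Bool T → Tree
    output π ω = proj₂ (run δ ω (initial A (encodeCNF (Restriction.restrict F π)))) 0

    HaltsOn : Partial n → ℕ → Set
    HaltsOn π T = ∀ (ω : Vec Bool T) → Halted (run δ ω (initial A (encodeCNF (Restriction.restrict F π))))

    trialTime : ℕ → ℕ
    trialTime U = suc (1 ℕ.+ suc (τ ℕ.+ suc (1 ℕ.+ suc ((n ℕ.* (5 ℕ.+ walkTime) ℕ.+ 3) ℕ.+ suc (τ ℕ.+ suc (1 ℕ.+
      suc ((U ℕ.+ callOverhead) ℕ.+ suc (1 ℕ.+ suc ((n ℕ.* 7 ℕ.+ 3) ℕ.+ suc (1 ℕ.+ τ))))))))))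

    -- If the call on the restriction by π achieves g π in expectation, for every π that a walk can
    -- reach, then the trial achieves the mean of g over the walks. All sizes and times are uniform
    -- in π.
    trial-tri : ∀ fd i x rest U (g : Partial n → Carrier) (val : Maybe (Assignment n) → Carrier) → i ℕ.≤ n →
      (∀ π → unset π ℕ.+ i ≡ n → ∃[ T ] (HaltsOn π T × T ℕ.≤ U × g π ≤ mean T (λ ω → val (update F fd (candidate π (output π ω)))))) →
      Tri trial (cons (cons x (env fd F s i)) rest) (trialTime U) (walkMean s i g (blank n))
        (λ t w → ∃[ α ] (t ≡ cons (env (update F fd α) F s i) rest × w ≡ val (update F fd α)))
    trial-tri fd i x rest U g val i≤n spec =
      set-det _ _ ⟫ᵈ code-τ startTrialᶠ E _ rest startTrial≤ size₀ (startTrialᶠ-correct fd F s i) ⟫ᵈ set-det _ _ ⟫ᵈ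
      walks-tri fd i g rest i≤n ⟫
      λ { _ _ (π , refl , eq , refl) →
          code-τ reduceᶠ _ _ rest reduce≤ (size₁ π) (reduceᶠ-correct F π fd s i) ⟫ᵈ set-det _ _ ⟫ᵈ
          calls π (spec π eq) ⟫
          λ { _ _ (out , refl , refl) → set-det _ _ ⟫ᵈ
              weaken (ℕ.+-monoˡ-≤ 3 (ℕ.*-monoˡ-≤ 7 (cnt≤n π))) ≤-refl (λ _ _ q → q)
                (reads-tri (val (update F fd (candidate π out))) (cnt (live π (clauses F))) (encodeFlags (project (live π (clauses F)) (live π (clauses F)))) out _
                  (spine-encodeVec encodeBool (project (live π (clauses F)) (live π (clauses F))))) ⟫
              λ { _ _ (_ , refl , refl) → set-det _ _ ⟫ᵈ
                  weaken ℕ.≤-refl ≤-refl (λ { _ _ (refl , refl) → candidate π out , refl , refl })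
                    (code-τ finishTrialᶠ _ _ rest finishTrial≤ (size₂ π (readBits (cnt (live π (clauses F))) out) {cnt≤n π}) (finishTrialᶠ-correct F π fd s i (readBits (cnt (live π (clauses F))) out)) _) } } }
      where
      E = env fd F s i
      i≤ : i ℕ.≤ suc n
      i≤ = ℕ.≤-trans i≤n (ℕ.n≤1+n n)
      calls : ∀ π → ∃[ T ] (HaltsOn π T × T ℕ.≤ U × g π ≤ mean T (λ ω → val (update F fd (candidate π (output π ω))))) → ∀ {rest′} →
        Tri call (cons (encodeCNF (Restriction.restrict F π)) rest′) (U ℕ.+ callOverhead) (g π)
          (λ t w → ∃[ out ] (t ≡ cons out rest′ × w ≡ val (update F fd (candidate π out))))
      calls π (T , h , T≤U , g≤) = call-tri (λ out → val (update F fd (candidate π out))) h T≤U g≤ (λ out → out , refl , refl)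
      unset≤n : ∀ {k} (π : Partial k) → unset π ℕ.≤ k
      unset≤n []            = ℕ.z≤n
      unset≤n (nothing ∷ π) = ℕ.s≤s (unset≤n π)
      unset≤n (just _ ∷ π)  = ℕ.≤-trans (unset≤n π) (ℕ.n≤1+n _)
      cnt≤n : ∀ π → cnt (live π (clauses F)) ℕ.≤ n
      cnt≤n π = ℕ.≤-trans (cnt-live π (clauses F)) (unset≤n π)
      size₀ : size E ℕ.≤ Z′
      size₀ = ℕ.≤-trans (size-env fd i i≤) (ℕ.≤-trans (ℕ.≤-reflexive (sym (ℕ.*-identityˡ Z))) (Z-bounds 0 1 ℕ.z≤n (ℕ.s≤s ℕ.z≤n)))
      size₁ : ∀ π → size (cons (encodePartial π) E) ℕ.≤ Z′
      size₁ π = ℕ.≤-trans (ℕ.s≤s (ℕ.+-mono-≤ (size-π π) (size-env fd i i≤)))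
        (ℕ.≤-trans (ℕ.≤-reflexive (cong (λ z → suc (Z ℕ.+ z)) (sym (ℕ.+-identityʳ Z)))) (Z-bounds 1 2 (ℕ.s≤s ℕ.z≤n) (ℕ.s≤s (ℕ.s≤s ℕ.z≤n))))
      2n≤Z : ∀ {k} → k ℕ.≤ n → 2 ℕ.* k ℕ.≤ Z
      2n≤Z k≤n = ℕ.≤-trans (ℕ.*-mono-≤ (ℕ.n≤1+n 2) k≤n) 3n≤Z
      lem : ∀ Z → 1 ℕ.+ (Z ℕ.+ (1 ℕ.+ (Z ℕ.+ (1 ℕ.+ (Z ℕ.+ Z))))) ≡ 3 ℕ.+ 4 ℕ.* Z
      lem = solve-∀
      size₂ : ∀ π {k} (β : Vec Bool k) → {k ℕ.≤ n} →
        size (cons (stackOnto β nil) (cons (encodeFlags (live π (clauses F))) (cons (encodePartial π) E))) ℕ.≤ Z′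
      size₂ π {k} β {k≤n} = ℕ.≤-trans (ℕ.s≤s (ℕ.+-mono-≤
          (ℕ.≤-trans (size-stackOnto β nil) (ℕ.≤-trans (ℕ.≤-reflexive (ℕ.+-identityʳ (2 ℕ.* k))) (2n≤Z k≤n)))
          (ℕ.s≤s (ℕ.+-mono-≤ (ℕ.≤-trans (size-encodeFlags (live π (clauses F))) (2n≤Z ℕ.≤-refl))
            (ℕ.s≤s (ℕ.+-mono-≤ (size-π π) (size-env fd i i≤)))))))
        (ℕ.≤-trans (ℕ.≤-reflexive (lem Z)) (Z-bounds 3 4 (ℕ.s≤s (ℕ.s≤s (ℕ.s≤s ℕ.z≤n))) ℕ.≤-refl))

    walkTime-linear : walkTime ≡ s ℕ.* (15 ℕ.+ τ) ℕ.+ (17 ℕ.+ 2 ℕ.* τ)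
    walkTime-linear = lem s τ
      where
      lem : ∀ s τ → 1 ℕ.+ (1 ℕ.+ (1 ℕ.+ (τ ℕ.+ (1 ℕ.+ (1 ℕ.+ (1 ℕ.+ ((s ℕ.* (5 ℕ.+ (10 ℕ.+ τ)) ℕ.+ 3) ℕ.+ (1 ℕ.+ (5 ℕ.+ (1 ℕ.+ (1 ℕ.+ τ)))))))))))
            ≡ s ℕ.* (15 ℕ.+ τ) ℕ.+ (17 ℕ.+ 2 ℕ.* τ)
      lem = solve-∀

    trialTime-linear : ∀ U → trialTime U ≡ U ℕ.+ (n ℕ.* (5 ℕ.+ walkTime) ℕ.+ (21 ℕ.+ 3 ℕ.* τ ℕ.+ callOverhead ℕ.+ n ℕ.* 7))
    trialTime-linear U = lem U n walkTime τ callOverhead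
      where
      lem : ∀ U n w τ o → 1 ℕ.+ (1 ℕ.+ (1 ℕ.+ (τ ℕ.+ (1 ℕ.+ (1 ℕ.+ (1 ℕ.+ ((n ℕ.* (5 ℕ.+ w) ℕ.+ 3) ℕ.+ (1 ℕ.+ (τ ℕ.+ (1 ℕ.+ (1 ℕ.+
              (1 ℕ.+ ((U ℕ.+ o) ℕ.+ (1 ℕ.+ (1 ℕ.+ (1 ℕ.+ ((n ℕ.* 7 ℕ.+ 3) ℕ.+ (1 ℕ.+ (1 ℕ.+ τ)))))))))))))))))))
            ≡ U ℕ.+ (n ℕ.* (5 ℕ.+ w) ℕ.+ (21 ℕ.+ 3 ℕ.* τ ℕ.+ o ℕ.+ n ℕ.* 7))
      lem = solve-∀

-- B · ⌈M / (1 + d)⌉, for f ≥ M.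
growTokens : ℕ → ℕ → ℕ → ℕ → ℕ
growTokens d B zero    M       = 0
growTokens d B (suc f) zero    = 0
growTokens d B (suc f) (suc M) = B ℕ.+ growTokens d B f (M ℕ.∸ d)

tokens : ℕ → ℕ → ℕ → ℕ
tokens d B zero    = 1
tokens d B (suc i) = growTokens d B (tokens d B i) (tokens d B i)

Valid : ∀ {n} → CNF n → Maybe (Assignment n) → Set
Valid F fd = ∀ α → fd ≡ just α → α ⊨ F

valid-update : ∀ {n} (F : CNF n) fd α → Valid F fd → Valid F (update F fd α)
valid-update F (just β) α v = v
valid-update F nothing  α v with allHit (clauses F) (total α) in eq
... | true  = λ { _ refl → allHit-sound (clauses F) α eq }
... | false = v

module Failure {c ℓ₁ ℓ₂} (R : ArchimedeanOrderedField c ℓ₁ ℓ₂) where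
  open FieldProperties R

  -- ψ fᵏ, where f is the failure probability of one trial and ψ that of everything that follows.
  failAll : Carrier → Carrier → ℕ → Carrier
  failAll ψ f zero    = ψ
  failAll ψ f (suc k) = failAll ψ f k * f

  0≤failAll : ∀ {ψ f} → 0# ≤ ψ → 0# ≤ f → ∀ k → 0# ≤ failAll ψ f k
  0≤failAll 0≤ψ 0≤f zero    = 0≤ψ
  0≤failAll 0≤ψ 0≤f (suc k) = *-nonNegative (0≤failAll 0≤ψ 0≤f k) 0≤f

  -- The product of f(i′) to the power M(i′) over the k phases i′ = i, i + 1, ....
  failChain : (ℕ → Carrier) → (ℕ → ℕ) → ℕ → ℕ → Carrier
  failChain f M zero    i = 1#
  failChain f M (suc k) i = failAll (failChain f M k (suc i)) (f i) (M i)

  0≤failChain : ∀ {f} → (∀ i → 0# ≤ f i) → ∀ M k i → 0# ≤ failChain f M k i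
  0≤failChain 0≤f M zero    i = 0≤1
  0≤failChain 0≤f M (suc k) i = 0≤failAll (0≤failChain 0≤f M k (suc i)) (0≤f i) (M i)

-- The phases and the whole program

module Main {c ℓ₁ ℓ₂} (R : ArchimedeanOrderedField c ℓ₁ ℓ₂) {m : ℕ} (δ : Digits m) (A : Program m) (j : Fin m)
            (χ : Tree → ArchimedeanOrderedField.Carrier R) where
  open FieldProperties R
  open Mean R
  open Failure R
  open Language δ
  open Programs δ
  open Routines δ
  open Machine δ A
  open Algorithm δ A j
  open Execution R δ A χ
  open WalkValue R δ
  open Correctness R δ A j χ
  module ≤R where
    open PosetReasoning poset public

  1-[1-x]≈x : ∀ {x y} → x + y ≈ 1# → 1# - y ≈ x
  1-[1-x]≈x {x} {y} x+y≈1 = ≈-trans (+-congʳ (≈-sym x+y≈1)) (+-cancelʳ x y)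

  1-x+x : ∀ x → 1# - x + x ≈ 1#
  1-x+x x = -‿cancelʳ 1# x

  -- ψ is the probability that the remaining trials fail.
  valueOf : ∀ {n} → Carrier → Maybe (Assignment n) → Carrier
  valueOf ψ nothing  = 1# - ψ
  valueOf ψ (just _) = 1#

  -- The right-hand side is affine in x and therefore commutes with expectations.
  fail-expand : ∀ ψ x → 1# - ψ * (1# - x) ≈ 1# - ψ + ψ * x
  fail-expand ψ x = 1-[1-x]≈x (begin-equality
    1# - ψ + ψ * x + ψ * (1# - x)     ≈⟨ +-assoc (1# - ψ) (ψ * x) (ψ * (1# - x)) ⟩
    1# - ψ + (ψ * x + ψ * (1# - x))   ≈⟨ +-congˡ (distribˡ ψ x (1# - x)) ⟨
    1# - ψ + ψ * (x + (1# - x))       ≈⟨ +-congˡ (*-congˡ (≈-trans (+-comm x _) (1-x+x x))) ⟩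
    1# - ψ + ψ * 1#                   ≈⟨ +-congˡ (*-identityʳ ψ) ⟩
    1# - ψ + ψ                        ≈⟨ 1-x+x ψ ⟩
    1#                                ∎)
    where open ≤R

  hit-value : ∀ {n} (F : CNF n) ψ α → 1# - ψ + ψ * (if allHit (clauses F) (total α) then 1# else 0#) ≤ valueOf ψ (update F nothing α)
  hit-value F ψ α with allHit (clauses F) (total α)
  ... | true  = ≤-reflexive (≈-trans (+-congˡ (*-identityʳ ψ)) (1-x+x ψ))
  ... | false = ≤-reflexive (≈-trans (+-congˡ (zeroʳ ψ)) (+-identityʳ _))

  -- A round takes d + 1 ≥ 1 elements from the first list, so M rounds suffice; for the same reason
  -- M is enough fuel for `growTokens`.
  grow-tri : ∀ v d B M Y E rest → Tri grow (cons (un M) (cons (un Y) (cons E (cons (cons (un (suc d)) (un B)) rest))))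
    (M ℕ.* (14 ℕ.+ (suc d ℕ.* 6 ℕ.+ B ℕ.* 6)) ℕ.+ 1) v
    (λ t w → t ≡ cons nil (cons (un (Y ℕ.+ growTokens d B M M)) (cons E (cons (cons (un (suc d)) (un B)) rest))) × w ≡ v)
  grow-tri v d B M₀ Y₀ E rest K σ k at cont = reach-weaken (ℕ.≤-reflexive (sym (ℕ.+-assoc (M₀ ℕ.* round) 1 k))) ≤-refl
    (go M₀ M₀ Y₀ ℕ.≤-refl refl σ at)
    where
    round = 14 ℕ.+ (suc d ℕ.* 6 ℕ.+ B ℕ.* 6)
    stack : ℕ → ℕ → Tree
    stack M Y = cons (un M) (cons (un Y) (cons E (cons (cons (un (suc d)) (un B)) rest)))
    DropInv : ℕ → Tree → Tree → Carrier → Set c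
    DropInv M l t u = ∃[ k ] ∃[ m ] (l ≡ un k × t ≡ un m × m ℕ.∸ k ≡ M ℕ.∸ suc d × u ≡ v)
    PushInv : ℕ → Tree → Tree → Carrier → Set c
    PushInv Y l t u = ∃[ k ] ∃[ y ] (l ≡ un k × t ≡ un y × k ℕ.+ y ≡ B ℕ.+ Y × u ≡ v)
    pred-∸ : ∀ m k → ∃[ m′ ] (tail (un m) ≡ un m′ × m′ ℕ.∸ k ≡ m ℕ.∸ suc k)
    pred-∸ zero    k = 0 , refl , ℕ.0∸n≡0 k
    pred-∸ (suc m) k = m , refl , refl
    drops : ∀ M rest → Tri (loop (set (consˣ (tlˣ (tlˣ (hdˣ var))) (tlˣ var)))) (cons (un (suc d)) (cons (un M) rest)) (suc d ℕ.* 6 ℕ.+ 3) v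
            (λ t w → t ≡ cons (un (M ℕ.∸ suc d)) rest × w ≡ v)
    drops M rest = weaken (ℕ.≤-reflexive (cong (λ k → k ℕ.* 6 ℕ.+ 3) (spine-un (suc d)))) ≤-refl
      (λ { _ _ (_ , refl , zero , m , _ , refl , eq , refl) → cong (λ z → cons (un z) rest) eq , refl })
      (loop-tri (DropInv M) (λ { x l _ _ rest (suc k , m , refl , refl , eq , refl) → weaken ℕ.≤-refl ≤-refl
         (λ { _ _ (refl , refl) → _ , refl , k , proj₁ (pred-∸ m k) , refl , proj₁ (proj₂ (pred-∸ m k)) , trans (proj₂ (proj₂ (pred-∸ m k))) eq , refl })
         (set-det _ _ v) })
        (un (suc d)) (un M) v rest (suc d , M , refl , refl , refl , refl))
    pushes : ∀ Y rest → Tri (loop (set (consˣ (consˣ nilˣ (tlˣ (hdˣ var))) (tlˣ var)))) (cons (un B) (cons (un Y) rest)) (B ℕ.* 6 ℕ.+ 3) v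
             (λ t w → t ≡ cons (un (B ℕ.+ Y)) rest × w ≡ v)
    pushes Y rest = weaken (ℕ.≤-reflexive (cong (λ k → k ℕ.* 6 ℕ.+ 3) (spine-un B))) ≤-refl
      (λ { _ _ (_ , refl , zero , y , _ , refl , eq , refl) → cong (λ z → cons (un z) rest) eq , refl })
      (loop-tri (PushInv Y) (λ { x l _ _ rest (suc k , y , refl , refl , eq , refl) → weaken ℕ.≤-refl ≤-refl
         (λ { _ _ (refl , refl) → _ , refl , k , suc y , refl , refl , trans (ℕ.+-suc k y) eq , refl })
         (set-det _ _ v) })
        (un B) (un Y) v rest (B , Y , refl , refl , refl , refl))
    lem : ∀ a b r → 3 ℕ.+ (1 ℕ.+ (a ℕ.+ 3 ℕ.+ (2 ℕ.+ (1 ℕ.+ (b ℕ.+ 3 ℕ.+ (1 ℕ.+ r)))))) ≡ 14 ℕ.+ (a ℕ.+ b) ℕ.+ r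
    lem = solve-∀
    go : ∀ f M Y → M ℕ.≤ f → Y ℕ.+ growTokens d B f M ≡ Y₀ ℕ.+ growTokens d B M₀ M₀ → ∀ σ → At σ (stack M Y) →
         Reach (f ℕ.* round ℕ.+ (1 ℕ.+ k)) (grow ∷ K , σ) v
    exit : ∀ f Y → Y ≡ Y₀ ℕ.+ growTokens d B M₀ M₀ → ∀ σ → At σ (stack 0 Y) → Reach (f ℕ.* round ℕ.+ (1 ℕ.+ k)) (grow ∷ K , σ) v
    exit f Y eq σ at = reach-weaken (ℕ.m≤n+m (1 ℕ.+ k) (f ℕ.* round)) ≤-refl (reach-step λ _ →
      subst (λ h → Reach k (branch (head h) _ _ , σ) v) (sym (proj₁ at))
        (cont _ v σ (cong (λ z → cons nil (cons (un z) (cons E (cons (cons (un (suc d)) (un B)) rest)))) eq , refl) at))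
    go zero    zero    Y M≤f eq σ at = exit zero Y (trans (sym (ℕ.+-identityʳ Y)) eq) σ at
    go (suc f) zero    Y M≤f eq σ at = exit (suc f) Y (trans (sym (ℕ.+-identityʳ Y)) eq) σ at
    go (suc f) (suc M) Y (ℕ.s≤s M≤f) eq σ at =
      reach-weaken (ℕ.≤-reflexive (trans (lem (suc d ℕ.* 6) (B ℕ.* 6) (f ℕ.* round ℕ.+ (1 ℕ.+ k))) (sym (ℕ.+-assoc round (f ℕ.* round) (1 ℕ.+ k))))) ≤-refl
      (reach-step λ _ → subst (λ h → Reach _ (branch (head h) _ _ , σ) v) (sym (proj₁ at))
        (reach-step λ _ → set-det _ _ v _ σ _ at λ { _ _ σ₁ (refl , refl) at₁ → reach-step λ _ →
         drops (suc M) _ _ σ₁ _ at₁ λ { _ _ σ₂ (refl , refl) at₂ → reach-step λ _ →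
         set-det _ _ v _ σ₂ _ at₂ λ { _ _ σ₃ (refl , refl) at₃ → reach-step λ _ →
         pushes Y _ _ σ₃ _ at₃ λ { _ _ σ₄ (refl , refl) at₄ →
         set-det _ _ v _ σ₄ _ at₄ λ { _ _ σ₅ (refl , refl) at₅ →
         go f (M ℕ.∸ d) (B ℕ.+ Y) (ℕ.≤-trans (ℕ.m∸n≤m M d) M≤f) (trans (lem₂ B Y _) eq) σ₅ at₅ }}}}}))
      where
      lem₂ : ∀ B Y g → B ℕ.+ Y ℕ.+ g ≡ Y ℕ.+ (B ℕ.+ g)
      lem₂ = solve-∀

  module Phases {n : ℕ} (F : CNF n) (s Z : ℕ)
    (size-env : ∀ fd i → i ℕ.≤ suc n → size (env fd F s i) ℕ.≤ Z)
    (3n≤Z : 3 ℕ.* n ℕ.≤ Z) (2^s≤Z : 2 ℕ.^ s ℕ.≤ Z)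
    (τ : ℕ) (routineTime≤τ : eval routineTime (4 ℕ.+ 4 ℕ.* Z) ℕ.≤ τ) (d B : ℕ) where

    open Trials F s Z size-env 3n≤Z 2^s≤Z τ routineTime≤τ

    hitValue : Partial n → Tree → Carrier
    hitValue π out = if allHit (clauses F) (total (candidate π out)) then 1# else 0#

    phaseTime : ℕ → ℕ → ℕ
    phaseTime U M = suc (1 ℕ.+ suc ((M ℕ.* (5 ℕ.+ trialTime U) ℕ.+ 3) ℕ.+
      suc (1 ℕ.+ suc ((M ℕ.* (14 ℕ.+ (suc d ℕ.* 6 ℕ.+ B ℕ.* 6)) ℕ.+ 1) ℕ.+ 1))))

    trialOverhead phaseOverhead : ℕ
    trialOverhead = n ℕ.* (5 ℕ.+ (s ℕ.* (15 ℕ.+ τ) ℕ.+ (17 ℕ.+ 2 ℕ.* τ))) ℕ.+ (21 ℕ.+ 3 ℕ.* τ ℕ.+ callOverhead ℕ.+ n ℕ.* 7)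
    phaseOverhead = 30 ℕ.+ trialOverhead ℕ.+ (suc d ℕ.* 6 ℕ.+ B ℕ.* 6)

    phaseTime-bound : ∀ U M → 1 ℕ.≤ M → phaseTime U M ℕ.≤ M ℕ.* (U ℕ.+ phaseOverhead)
    phaseTime-bound U M 1≤M = begin
      phaseTime U M
        ≡⟨ cong (λ t → 1 ℕ.+ (1 ℕ.+ (1 ℕ.+ ((M ℕ.* (5 ℕ.+ t) ℕ.+ 3) ℕ.+ (1 ℕ.+ (1 ℕ.+ (1 ℕ.+ ((M ℕ.* (14 ℕ.+ (suc d ℕ.* 6 ℕ.+ B ℕ.* 6)) ℕ.+ 1) ℕ.+ 1))))))))
             (trans (trialTime-linear U) (cong (λ w → U ℕ.+ (n ℕ.* (5 ℕ.+ w) ℕ.+ (21 ℕ.+ 3 ℕ.* τ ℕ.+ callOverhead ℕ.+ n ℕ.* 7))) walkTime-linear)) ⟩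
      1 ℕ.+ (1 ℕ.+ (1 ℕ.+ ((M ℕ.* (5 ℕ.+ (U ℕ.+ trialOverhead)) ℕ.+ 3) ℕ.+ (1 ℕ.+ (1 ℕ.+ (1 ℕ.+ ((M ℕ.* (14 ℕ.+ g) ℕ.+ 1) ℕ.+ 1)))))))
        ≡⟨ lem M U trialOverhead g ⟩
      11 ℕ.+ M ℕ.* (19 ℕ.+ (U ℕ.+ trialOverhead) ℕ.+ g)                 ≤⟨ ℕ.+-monoˡ-≤ _ (ℕ.≤-trans (ℕ.≤-reflexive (sym (ℕ.*-identityˡ 11))) (ℕ.*-monoˡ-≤ 11 1≤M)) ⟩
      M ℕ.* 11 ℕ.+ M ℕ.* (19 ℕ.+ (U ℕ.+ trialOverhead) ℕ.+ g)           ≡⟨ lem₂ M U trialOverhead g ⟩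
      M ℕ.* (U ℕ.+ (30 ℕ.+ trialOverhead ℕ.+ g))                       ∎
      where
      open ℕ.≤-Reasoning
      g = suc d ℕ.* 6 ℕ.+ B ℕ.* 6
      lem : ∀ M U t g → 1 ℕ.+ (1 ℕ.+ (1 ℕ.+ ((M ℕ.* (5 ℕ.+ (U ℕ.+ t)) ℕ.+ 3) ℕ.+ (1 ℕ.+ (1 ℕ.+ (1 ℕ.+ ((M ℕ.* (14 ℕ.+ g) ℕ.+ 1) ℕ.+ 1)))))))
            ≡ 11 ℕ.+ M ℕ.* (19 ℕ.+ (U ℕ.+ t) ℕ.+ g)
      lem = solve-∀
      lem₂ : ∀ M U t g → M ℕ.* 11 ℕ.+ M ℕ.* (19 ℕ.+ (U ℕ.+ t) ℕ.+ g) ≡ M ℕ.* (U ℕ.+ (30 ℕ.+ t ℕ.+ g))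
      lem₂ = solve-∀

    phaseState : Maybe (Assignment n) → ℕ → ℕ → Tree
    phaseState fd i M = cons (un M) (cons (env fd F s i) (cons (un (suc d)) (un B)))

    module _ (x : Partial n → Carrier) (x≤1 : ∀ π → x π ≤ 1#) (U : ℕ → ℕ)
      (spec : ∀ π i → unset π ℕ.+ i ≡ n → ∃[ T ] (HaltsOn π T × T ℕ.≤ U i × x π ≤ mean T (λ ω → hitValue π (output π ω)))) where

      trialValue : ℕ → Carrier
      trialValue i = walkMean s i x (blank n)

      missValue : ℕ → Carrier
      missValue i = 1# - trialValue i

      0≤missValue : ∀ i → 0# ≤ missValue i
      0≤missValue i = 0≤y-x (walkMean-≤ s i {x} (blank n) x≤1)

      -- A solution once found is kept, which has value 1. Without one, a success turns the value 1
      -- - ψ of the later trials into 1, which gives 1 - ψ(1 - x) in expectation.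
      one-trial : ∀ ψ → 0# ≤ ψ → ∀ fd → Valid F fd → ∀ i → i ℕ.≤ n → ∀ y rest →
        Tri trial (cons (cons y (env fd F s i)) rest) (trialTime (U i)) (valueOf (ψ * missValue i) fd)
          (λ t w → ∃[ fd′ ] (t ≡ cons (env fd′ F s i) rest × Valid F fd′ × w ≡ valueOf ψ fd′))
      one-trial ψ 0≤ψ (just α) valid i i≤n y rest = weaken ℕ.≤-refl (≤-walkMean s i {λ _ → 1#} (blank n) (λ _ → ≤-refl))
        (λ { _ _ (β , refl , refl) → just α , refl , valid , refl })
        (trial-tri (just α) i y rest (U i) (λ _ → 1#) (valueOf ψ) i≤n λ π eq →
          proj₁ (spec π i eq) , proj₁ (proj₂ (spec π i eq)) , proj₁ (proj₂ (proj₂ (spec π i eq))) ,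
          ≤-mean (proj₁ (spec π i eq)) (λ ω → ≤-refl))
      one-trial ψ 0≤ψ nothing valid i i≤n y rest = weaken ℕ.≤-refl
        (≤-reflexive (≈-trans (fail-expand ψ (trialValue i)) (≈-sym (walkMean-affine s i (1# - ψ) ψ x (blank n)))))
        (λ { _ _ (β , refl , refl) → update F nothing β , refl , valid-update F nothing β valid , refl })
        (trial-tri nothing i y rest (U i) (λ π → 1# - ψ + ψ * x π) (valueOf ψ) i≤n λ π eq →
          proj₁ (spec π i eq) , proj₁ (proj₂ (spec π i eq)) , proj₁ (proj₂ (proj₂ (spec π i eq))) ,
          gain π (proj₁ (spec π i eq)) (proj₂ (proj₂ (proj₂ (spec π i eq)))))
        where
        gain : ∀ π T → x π ≤ mean T (λ ω → hitValue π (output π ω)) →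
               1# - ψ + ψ * x π ≤ mean T (λ ω → valueOf ψ (update F nothing (candidate π (output π ω))))
        gain π T h = begin
          1# - ψ + ψ * x π                                           ≤⟨ +-monoʳ-≤ (1# - ψ) (*-monoʳ-≤ 0≤ψ h) ⟩
          1# - ψ + ψ * mean T (λ ω → hitValue π (output π ω))        ≈⟨ mean-affine T (1# - ψ) ψ (λ ω → hitValue π (output π ω)) ⟨
          mean T (λ ω → 1# - ψ + ψ * hitValue π (output π ω))        ≤⟨ mean-mono T (λ ω → hit-value F ψ (candidate π (output π ω))) ⟩
          mean T (λ ω → valueOf ψ (update F nothing (candidate π (output π ω)))) ∎
          where open ≤R

      TrialInv : Carrier → ℕ → Tree → Tree → Carrier → Set c
      TrialInv ψ i l t u = ∃[ k ] ∃[ fd ] (l ≡ un k × t ≡ env fd F s i × Valid F fd × u ≡ valueOf (failAll ψ (missValue i) k) fd)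

      many-trials : ∀ ψ → 0# ≤ ψ → ∀ fd → Valid F fd → ∀ i → i ℕ.≤ n → ∀ M rest →
        Tri (loop trial) (cons (un M) (cons (env fd F s i) rest)) (M ℕ.* (5 ℕ.+ trialTime (U i)) ℕ.+ 3) (valueOf (failAll ψ (missValue i) M) fd)
          (λ t w → ∃[ fd′ ] (t ≡ cons (env fd′ F s i) rest × Valid F fd′ × w ≡ valueOf ψ fd′))
      many-trials ψ 0≤ψ fd valid i i≤n M rest = weaken
        (ℕ.≤-reflexive (cong (λ k → k ℕ.* (5 ℕ.+ trialTime (U i)) ℕ.+ 3) (spine-un M))) ≤-refl
        (λ { _ _ (_ , refl , zero , fd′ , _ , refl , valid′ , refl) → fd′ , refl , valid′ , refl })
        (loop-tri (TrialInv ψ i) (λ { y l _ _ rest (suc k , fd , refl , refl , valid , refl) →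
            weaken ℕ.≤-refl ≤-refl
              (λ { _ _ (fd′ , refl , valid′ , refl) → _ , refl , k , fd′ , refl , refl , valid′ , refl })
              (one-trial (failAll ψ (missValue i) k) (0≤failAll 0≤ψ (0≤missValue i) k) fd valid i i≤n y (cons (un k) rest)) })
          (un M) (env fd F s i) _ rest (M , fd , refl , refl , valid , refl))

      one-phase : ∀ ψ → 0# ≤ ψ → ∀ fd → Valid F fd → ∀ i → i ℕ.≤ n → ∀ M y rest →
        Tri phase (cons (cons y (phaseState fd i M)) rest) (phaseTime (U i) M) (valueOf (failAll ψ (missValue i) M) fd)
          (λ t w → ∃[ fd′ ] (t ≡ cons (phaseState fd′ (suc i) (growTokens d B M M)) rest × Valid F fd′ × w ≡ valueOf ψ fd′))
      one-phase ψ 0≤ψ fd valid i i≤n M y rest =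
        set-det _ _ ⟫ᵈ many-trials ψ 0≤ψ fd valid i i≤n M _ ⟫
        λ { _ _ (fd′ , refl , valid′ , refl) → set-det _ _ ⟫ᵈ
            grow-tri (valueOf ψ fd′) d B M 0 (env fd′ F s (suc i)) rest ⟫
            λ { _ _ (refl , refl) → weaken ℕ.≤-refl ≤-refl (λ { _ _ (refl , refl) → fd′ , refl , valid′ , refl }) (set-det _ _ (valueOf ψ fd′)) } }

      failure : ℕ → ℕ → Carrier
      failure = failChain missValue (tokens d B)

      module _ (P : ℕ) (phaseTime≤P : ∀ i → i ℕ.≤ n → phaseTime (U i) (tokens d B i) ℕ.≤ P) where

        PhaseInv : Tree → Tree → Carrier → Set c
        PhaseInv l t u = ∃[ k ] ∃[ i ] ∃[ fd ] (l ≡ un k × i ℕ.+ k ≡ suc n × t ≡ phaseState fd i (tokens d B i) × Valid F fd × u ≡ valueOf (failure k i) fd)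

        all-phases : ∀ rest → Tri (loop phase) (cons (un (suc n)) (cons (phaseState nothing 0 1) rest)) (suc n ℕ.* (5 ℕ.+ P) ℕ.+ 3)
          (valueOf {n} (failure (suc n) 0) nothing)
          (λ t w → ∃[ fd ] ∃[ M ] (t ≡ cons (phaseState fd (suc n) M) rest × Valid F fd × w ≡ valueOf 1# fd))
        all-phases rest = weaken (ℕ.≤-reflexive (cong (λ k → k ℕ.* (5 ℕ.+ P) ℕ.+ 3) (spine-un (suc n)))) ≤-refl
          (λ { _ _ (_ , refl , zero , i , fd , _ , eq , refl , valid , refl) →
               fd , tokens d B i , cong (λ k → cons (phaseState fd k (tokens d B i)) rest) (trans (sym (ℕ.+-identityʳ i)) eq) , valid , refl })
          (loop-tri PhaseInv (λ { y l _ _ rest (suc k , i , fd , refl , eq , refl , valid , refl) →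
              weaken (phaseTime≤P i (ℕ.≤-pred (ℕ.≤-trans (ℕ.m≤m+n (suc i) k) (ℕ.≤-reflexive (trans (sym (ℕ.+-suc i k)) eq)))))
                ≤-refl
                (λ { _ _ (fd′ , refl , valid′ , refl) → _ , refl , k , suc i , fd′ , refl , trans (sym (ℕ.+-suc i k)) eq , refl , valid′ , refl })
                (one-phase (failure k (suc i)) (0≤failChain 0≤missValue (tokens d B) k (suc i)) fd valid i
                  (ℕ.≤-pred (ℕ.≤-trans (ℕ.m≤m+n (suc i) k) (ℕ.≤-reflexive (trans (sym (ℕ.+-suc i k)) eq)))) (tokens d B i) y (cons (un k) rest)) })
            (un (suc n)) (phaseState nothing 0 1) _ rest (suc n , 0 , nothing , refl , refl , refl , (λ _ ()) , refl))

  halvings-zero : ∀ k → halvings k 0 ≡ 0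
  halvings-zero zero    = refl
  halvings-zero (suc k) = refl

  module Body {n : ℕ} (F : CNF n) (b Z τ d P τ₂ Z₂ : ℕ) (digitsTo : ℕ → ℕ)
    (digitsTo-1 : digitsTo 1 ≡ b)
    (digitsTo-suc : ∀ s → digitsTo (suc s) ≡ bitValue (δ j (suc s)) ℕ.+ (digitsTo s ℕ.+ digitsTo s)) where

    s₁ : ℕ
    s₁ = bitLength n ℕ.+ 1

    bodyTime : ℕ
    bodyTime = suc (τ₂ ℕ.+ suc (1 ℕ.+ suc ((n ℕ.* (5 ℕ.+ suc (1 ℕ.+ τ₂)) ℕ.+ 3) ℕ.+ suc (1 ℕ.+ suc (τ₂ ℕ.+ suc (1 ℕ.+
      suc ((suc n ℕ.* (5 ℕ.+ P) ℕ.+ 3) ℕ.+ suc (1 ℕ.+ τ₂))))))))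

    bodyTime-linear : 6 ℕ.+ bodyTime ≡ suc n ℕ.* P ℕ.+ (24 ℕ.+ n ℕ.* (7 ℕ.+ τ₂) ℕ.+ suc n ℕ.* 5 ℕ.+ 3 ℕ.* τ₂)
    bodyTime-linear = lem n P τ₂
      where
      lem : ∀ n P t → 6 ℕ.+ (1 ℕ.+ (t ℕ.+ (1 ℕ.+ (1 ℕ.+ (1 ℕ.+ ((n ℕ.* (5 ℕ.+ (1 ℕ.+ (1 ℕ.+ t))) ℕ.+ 3) ℕ.+ (1 ℕ.+ (1 ℕ.+ (1 ℕ.+ (t ℕ.+ (1 ℕ.+ (1 ℕ.+
              (1 ℕ.+ (((1 ℕ.+ n) ℕ.* (5 ℕ.+ P) ℕ.+ 3) ℕ.+ (1 ℕ.+ (1 ℕ.+ t)))))))))))))))) ≡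
            (1 ℕ.+ n) ℕ.* P ℕ.+ (24 ℕ.+ n ℕ.* (7 ℕ.+ t) ℕ.+ (1 ℕ.+ n) ℕ.* 5 ℕ.+ 3 ℕ.* t)
      lem = solve-∀

    module _
      (size-env : ∀ fd i → i ℕ.≤ suc n → size (env fd F (s₁ ℕ.+ s₁) i) ℕ.≤ Z)
      (3n≤Z : 3 ℕ.* n ℕ.≤ Z) (2^s≤Z : 2 ℕ.^ (s₁ ℕ.+ s₁) ℕ.≤ Z)
      (routineTime≤τ : eval routineTime (4 ℕ.+ 4 ℕ.* Z) ℕ.≤ τ)
      (1+d≡ : suc d ≡ 2 ℕ.^ s₁)
      (size-setup : ∀ x k → x ℕ.≤ n → k ℕ.≤ s₁ → 2 ℕ.+ size (setupState x (2 ℕ.^ k) (digitsTo k) k) ℕ.+ n ℕ.+ Z ℕ.≤ Z₂)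
      (setupTime≤τ₂ : eval (setupTime b) Z₂ ℕ.≤ τ₂) where

      open Phases F (s₁ ℕ.+ s₁) Z size-env 3n≤Z 2^s≤Z τ routineTime≤τ d (suc (digitsTo s₁))
      open Trials F (s₁ ℕ.+ s₁) Z size-env 3n≤Z 2^s≤Z τ routineTime≤τ using (HaltsOn; output)

      module _ (x : Partial n → Carrier) (x≤1 : ∀ π → x π ≤ 1#) (U : ℕ → ℕ)
        (spec : ∀ π i → unset π ℕ.+ i ≡ n → ∃[ T ] (HaltsOn π T × T ℕ.≤ U i × x π ≤ mean T (λ ω → hitValue π (output π ω))))
        (phaseTime≤P : ∀ i → i ℕ.≤ n → phaseTime (U i) (tokens d (suc (digitsTo s₁)) i) ℕ.≤ P) where

        success : Carrier
        success = valueOf {n} (failure x x≤1 U spec (suc n) 0) nothing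

        code-τ₂ : ∀ f t t′ rest → eval (timeBound f) Z₂ ℕ.≤ eval (setupTime b) Z₂ → size t ℕ.≤ Z₂ → ⟦ f ⟧ᶠ t ≡ t′ → Det (code f) (cons t rest) τ₂ (cons t′ rest)
        code-τ₂ f t t′ rest f≤ t≤ refl = det-weaken (ℕ.≤-trans (eval-mono (timeBound f) t≤) (ℕ.≤-trans f≤ setupTime≤τ₂)) (code-run f t rest)

        size-setup′ : ∀ x k → x ℕ.≤ n → k ℕ.≤ s₁ → size (setupState x (2 ℕ.^ k) (digitsTo k) k) ℕ.≤ Z₂
        size-setup′ x k x≤ k≤ = ℕ.≤-trans (ℕ.m≤n⇒m≤n+o Z (ℕ.m≤n⇒m≤n+o n (ℕ.m≤n+m _ 2))) (size-setup x k x≤ k≤)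

        Z≤Z₂ : Z ℕ.≤ Z₂
        Z≤Z₂ = ℕ.≤-trans (ℕ.m≤n+m Z _) (size-setup 0 0 ℕ.z≤n ℕ.z≤n)

        size-F : size (encodeCNF F) ℕ.≤ Z
        size-F = ℕ.≤-trans (ℕ.≤-trans (ℕ.m≤m+n _ _) (ℕ.n≤1+n _)) (ℕ.≤-trans (ℕ.n≤1+n _) (size-env nothing 0 ℕ.z≤n))

        -- Of the k rounds left, only those before x becomes 0 take effect; s counts the effective
        -- rounds, starting from 1, so the sum of halvings to come and s is constant.
        RefineInv : Carrier → Tree → Tree → Carrier → Set c
        RefineInv v l t u = ∃[ k ] ∃[ x ] ∃[ s ] (l ≡ un k × x ℕ.≤ k × x ℕ.≤ n × halvings k x ℕ.+ s ≡ s₁ ×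
                            t ≡ setupState x (2 ℕ.^ s) (digitsTo s) s × u ≡ v)

        refine-tri : ∀ v y l t u rest → RefineInv v (cons y l) t u →
          Tri (set drop ⨾ code (refineᶠ j)) (cons (cons y t) (cons l rest)) (suc (1 ℕ.+ τ₂)) u
            (λ t′ w → ∃[ s′ ] (t′ ≡ cons s′ (cons l rest) × RefineInv v l s′ w))
        refine-tri v y l t u rest (suc k , zero , s , refl , _ , x≤n , eq , refl , refl) =
          set-det _ _ ⟫ᵈ weaken ℕ.≤-refl ≤-refl
            (λ { _ _ (refl , refl) → _ , refl , k , 0 , s , refl , ℕ.z≤n , x≤n , trans (cong (ℕ._+ s) (halvings-zero k)) eq , refl , refl })
            (code-τ₂ (refineᶠ j) _ _ (cons (un k) rest) (refine-time b Z₂) (size-setup′ 0 s x≤n (ℕ.≤-reflexive eq))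
              (refineᶠ-zero j (2 ℕ.^ s) (digitsTo s) s) v)
        refine-tri v y l t u rest (suc k , suc x , s , refl , ℕ.s≤s x≤k , x≤n , eq , refl , refl) =
          set-det _ _ ⟫ᵈ weaken ℕ.≤-refl ≤-refl
            (λ { _ _ (refl , refl) → _ , refl , k , ℕ.⌊ suc x /2⌋ , suc s , refl , ℕ.≤-trans (⌊1+x/2⌋≤x x) x≤k ,
                 ℕ.≤-trans (⌊1+x/2⌋≤x x) (ℕ.≤-trans (ℕ.n≤1+n x) x≤n) , trans (ℕ.+-suc (halvings k ℕ.⌊ suc x /2⌋) s) eq , doubled , refl })
            (code-τ₂ (refineᶠ j) _ _ (cons (un k) rest) (refine-time b Z₂)
              (size-setup′ (suc x) s x≤n (ℕ.≤-trans (ℕ.m≤n+m s (halvings (suc k) (suc x))) (ℕ.≤-reflexive eq)))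
              (refineᶠ-suc j x (2 ℕ.^ s) (digitsTo s) s) v)
          where
          doubled : setupState ℕ.⌊ suc x /2⌋ (2 ℕ.^ s ℕ.+ 2 ℕ.^ s) (bitValue (δ j (suc s)) ℕ.+ (digitsTo s ℕ.+ digitsTo s)) (suc s) ≡
                    setupState ℕ.⌊ suc x /2⌋ (2 ℕ.^ suc s) (digitsTo (suc s)) (suc s)
          doubled = cong₂ (λ D B → setupState ℕ.⌊ suc x /2⌋ D B (suc s)) (cong (2 ℕ.^ s ℕ.+_) (sym (ℕ.+-identityʳ (2 ℕ.^ s)))) (sym (digitsTo-suc s))

        refines-tri : ∀ v rest → Tri (loop (set drop ⨾ code (refineᶠ j))) (cons (un n) (cons (setupState n 2 b 1) rest))
          (n ℕ.* (5 ℕ.+ suc (1 ℕ.+ τ₂)) ℕ.+ 3) v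
          (λ t w → t ≡ cons (setupState 0 (2 ℕ.^ s₁) (digitsTo s₁) s₁) rest × w ≡ v)
        refines-tri v rest = weaken (ℕ.≤-reflexive (cong (λ k → k ℕ.* (5 ℕ.+ suc (1 ℕ.+ τ₂)) ℕ.+ 3) (spine-un n))) ≤-refl
          (λ { _ _ (_ , refl , zero , zero , s , _ , _ , _ , eq , refl , refl) →
               cong (λ s → cons (setupState 0 (2 ℕ.^ s) (digitsTo s) s) rest) eq , refl })
          (loop-tri (RefineInv v) (refine-tri v) (un n) (setupState n 2 b 1) v rest
            (n , n , 1 , refl , ℕ.≤-refl , ℕ.≤-refl , refl , cong (λ b → setupState n 2 b 1) (sym digitsTo-1) , refl))

        body-tri : Tri (body b) (cons (encodeCNF F) nil) bodyTime success
          (λ t w → ∃[ fd ] (t ≡ cons (⟦ outputᶠ ⟧ᶠ (env fd F (s₁ ℕ.+ s₁) (suc n))) nil × Valid F fd × w ≡ valueOf 1# fd))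
        body-tri =
          code-τ₂ (startᶠ b) (encodeCNF F) _ nil (start-time b Z₂) (ℕ.≤-trans size-F Z≤Z₂) (startᶠ-correct b F) ⟫ᵈ set-det _ _ ⟫ᵈ
          refines-tri success _ ⟫
          λ { _ _ (refl , refl) → set-det _ _ ⟫ᵈ
              code-τ₂ readyᶠ _ _ nil (ready-time b Z₂) size-ready ready ⟫ᵈ set-det _ _ ⟫ᵈ
              all-phases x x≤1 U spec P phaseTime≤P nil ⟫
              λ { _ _ (fd , M , refl , valid , refl) → set-det _ _ ⟫ᵈ
                  weaken ℕ.≤-refl ≤-refl (λ { _ _ (refl , refl) → fd , refl , valid , refl })
                    (code-τ₂ outputᶠ _ _ nil (output-time b Z₂) (ℕ.≤-trans (size-env fd (suc n) ℕ.≤-refl) Z≤Z₂) refl (valueOf 1# fd)) } }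
          where
          q = setupState 0 (2 ℕ.^ s₁) (digitsTo s₁) s₁
          ready : ⟦ readyᶠ ⟧ᶠ (cons q (cons (un n) (encodeCNF F))) ≡ cons (un (suc n)) (phaseState nothing 0 1)
          ready = trans (readyᶠ-correct 0 (2 ℕ.^ s₁) (digitsTo s₁) s₁ F)
            (cong (λ D → cons (un (suc n)) (cons (un 1) (cons (env nothing F (s₁ ℕ.+ s₁) 0) (cons (un D) (un (suc (digitsTo s₁))))))) (sym 1+d≡))
          lem : ∀ q n Z → 1 ℕ.+ (q ℕ.+ (1 ℕ.+ (n ℕ.+ Z))) ≡ 2 ℕ.+ q ℕ.+ n ℕ.+ Z
          lem = solve-∀
          size-ready : size (cons q (cons (un n) (encodeCNF F))) ℕ.≤ Z₂
          size-ready = ℕ.≤-trans (ℕ.s≤s (ℕ.+-monoʳ-≤ (size q) (ℕ.s≤s (ℕ.+-mono-≤ (ℕ.≤-reflexive (size-un n)) size-F))))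
            (ℕ.≤-trans (ℕ.≤-reflexive (lem (size q) n Z)) (size-setup 0 s₁ ℕ.z≤n ℕ.≤-refl))

        main-reach : (∀ t → 0# ≤ χ t) → (∀ α → α ⊨ F → 1# ≤ χ (encodeAssignment α)) →
                     Reach (6 ℕ.+ bodyTime) (initial (main b) (encodeCNF F)) success
        main-reach 0≤χ 1≤χ = reach-weaken (ℕ.≤-reflexive (cong (5 ℕ.+_) (ℕ.+-comm bodyTime 1))) ≤-refl
          (reach-step λ _ → reach-step λ _ → reach-step λ _ → reach-step λ _ → reach-step λ _ →
           body-tri _ _ 1 (trans (lookup-update-≢ σ₁ {0} {S} nil (λ ())) (lookup-update σ₀ S _) , low)
             λ { _ _ σ (fd , refl , valid , refl) at → reach-step λ _ → reach-halted 0
                 (subst (λ t → valueOf 1# fd ≤ χ t) (sym (⟦exprˣ⟧ S (hdˣ var) σ (proj₁ at))) (final fd valid)) })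
          where
          σ₀ σ₁ : Store
          σ₀ = proj₂ (initial (main b) (encodeCNF F))
          σ₁ = σ₀ [ S ↦ cons (encodeCNF F) nil ]
          low : ∀ r → r ℕ.< S → (σ₁ [ 0 ↦ nil ]) r ≡ nil
          low zero    r<S = refl
          low (suc r) r<S = lookup-update-≢ σ₀ {S} {suc r} _ (ℕ.>⇒≢ r<S)
          final : ∀ fd → Valid F fd → valueOf 1# fd ≤ χ (⟦ outputᶠ ⟧ᶠ (env fd F (s₁ ℕ.+ s₁) (suc n)))
          final nothing  valid = ≤-trans (≤-reflexive (-‿inverseʳ 1#)) (0≤χ _)
          final (just α) valid = subst (λ t → 1# ≤ χ t) (sym (outputᶠ-correct α F (s₁ ℕ.+ s₁) (suc n))) (1≤χ α (valid α refl))

-- Counting and probability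

orbitSum : ℕ → (ℕ → ℕ) → ℕ → ℕ → ℕ
orbitSum N g zero    p = 0
orbitSum N g (suc w) p = g p ℕ.+ orbitSum N g w (nextPos N p)

orbitSum-round : ∀ N g p w → orbitSum N g (suc p ℕ.+ w) (suc p) ≡ sum₁ (suc p) g ℕ.+ orbitSum N g w N
orbitSum-round N g zero    w = cong (ℕ._+ orbitSum N g w N) (sym (ℕ.+-identityʳ (g 1)))
orbitSum-round N g (suc p) w = trans (cong (g (suc (suc p)) ℕ.+_) (orbitSum-round N g p w))
  (sym (ℕ.+-assoc (g (suc (suc p))) (sum₁ (suc p) g) _))

-- Each of the m complete rounds visits every position once; the r steps of the last round are
-- dropped.
orbitSum-rounds : ∀ N g m r → m ℕ.* sum₁ (suc N) g ℕ.≤ orbitSum (suc N) g (m ℕ.* suc N ℕ.+ r) (suc N)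
orbitSum-rounds N g zero    r = ℕ.z≤n
orbitSum-rounds N g (suc m) r = begin
  sum₁ (suc N) g ℕ.+ m ℕ.* sum₁ (suc N) g                                    ≤⟨ ℕ.+-monoʳ-≤ (sum₁ (suc N) g) (orbitSum-rounds N g m r) ⟩
  sum₁ (suc N) g ℕ.+ orbitSum (suc N) g (m ℕ.* suc N ℕ.+ r) (suc N)          ≡⟨ orbitSum-round (suc N) g N _ ⟨
  orbitSum (suc N) g (suc N ℕ.+ (m ℕ.* suc N ℕ.+ r)) (suc N)                 ≡⟨ cong (λ k → orbitSum (suc N) g k (suc N)) (ℕ.+-assoc (suc N) (m ℕ.* suc N) r) ⟨
  orbitSum (suc N) g (suc m ℕ.* suc N ℕ.+ r) (suc N)                         ∎
  where open ℕ.≤-Reasoning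

orbitSum-+ : ∀ N g u w p → orbitSum N g (u ℕ.+ w) p ≡ orbitSum N g u p ℕ.+ orbitSum N g w (cycle N u p)
orbitSum-+ N g zero    w p = refl
orbitSum-+ N g (suc u) w p = trans (cong (g p ℕ.+_) (orbitSum-+ N g u w (nextPos N p))) (sym (ℕ.+-assoc (g p) _ _))

cycle-+ : ∀ N u w p → cycle N (u ℕ.+ w) p ≡ cycle N w (cycle N u p)
cycle-+ N zero    w p = refl
cycle-+ N (suc u) w p = cycle-+ N u w (nextPos N p)

sum₁-+ : ∀ N f g → sum₁ N (λ L → f L ℕ.+ g L) ≡ sum₁ N f ℕ.+ sum₁ N g
sum₁-+ zero    f g = refl
sum₁-+ (suc N) f g rewrite sum₁-+ N f g = lem (f (suc N)) (g (suc N)) (sum₁ N f) (sum₁ N g)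
  where
  lem : ∀ a b c d → a ℕ.+ b ℕ.+ (c ℕ.+ d) ≡ a ℕ.+ c ℕ.+ (b ℕ.+ d)
  lem = solve-∀

-- D⌈M/D⌉ ≥ M for D = d + 1, with truncated subtraction making the last round count in full.
grow-lower : ∀ d B f M → M ℕ.≤ f → B ℕ.* M ℕ.≤ suc d ℕ.* growTokens d B f M
grow-lower d B zero    zero    _ = ℕ.≤-reflexive (trans (ℕ.*-zeroʳ B) (sym (ℕ.*-zeroʳ (suc d))))
grow-lower d B (suc f) zero    _ = ℕ.≤-reflexive (trans (ℕ.*-zeroʳ B) (sym (ℕ.*-zeroʳ (suc d))))
grow-lower d B (suc f) (suc M) (ℕ.s≤s M≤f) = begin
  B ℕ.* suc M                                                      ≤⟨ ℕ.*-monoʳ-≤ B (ℕ.s≤s (ℕ.m≤n+m∸n M d)) ⟩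
  B ℕ.* (suc d ℕ.+ (M ℕ.∸ d))                                      ≡⟨ lem B d (M ℕ.∸ d) ⟩
  suc d ℕ.* B ℕ.+ B ℕ.* (M ℕ.∸ d)                                  ≤⟨ ℕ.+-monoʳ-≤ (suc d ℕ.* B) (grow-lower d B f (M ℕ.∸ d) (ℕ.≤-trans (ℕ.m∸n≤m M d) M≤f)) ⟩
  suc d ℕ.* B ℕ.+ suc d ℕ.* growTokens d B f (M ℕ.∸ d)             ≡⟨ ℕ.*-distribˡ-+ (suc d) B _ ⟨
  suc d ℕ.* growTokens d B (suc f) (suc M)                         ∎
  where
  open ℕ.≤-Reasoning
  lem : ∀ B d x → B ℕ.* (1 ℕ.+ d ℕ.+ x) ≡ (1 ℕ.+ d) ℕ.* B ℕ.+ B ℕ.* x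
  lem = solve-∀

growTokens-0 : ∀ d B f → growTokens d B f 0 ≡ 0
growTokens-0 d B zero    = refl
growTokens-0 d B (suc f) = refl

-- D⌈M/D⌉ ≤ M + D. The case M ≤ d is the last round, after which nothing is left.
grow-upper : ∀ d B f M → suc d ℕ.* growTokens d B f M ℕ.≤ B ℕ.* (M ℕ.+ suc d)
grow-upper d B zero    M       = ℕ.≤-trans (ℕ.≤-reflexive (ℕ.*-zeroʳ (suc d))) ℕ.z≤n
grow-upper d B (suc f) zero    = ℕ.≤-trans (ℕ.≤-reflexive (ℕ.*-zeroʳ (suc d))) ℕ.z≤n
grow-upper d B (suc f) (suc M) with ℕ.≤-total d M
... | inj₁ d≤M = begin
  suc d ℕ.* (B ℕ.+ growTokens d B f (M ℕ.∸ d))                ≡⟨ ℕ.*-distribˡ-+ (suc d) B _ ⟩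
  suc d ℕ.* B ℕ.+ suc d ℕ.* growTokens d B f (M ℕ.∸ d)        ≤⟨ ℕ.+-monoʳ-≤ (suc d ℕ.* B) (grow-upper d B f (M ℕ.∸ d)) ⟩
  suc d ℕ.* B ℕ.+ B ℕ.* (M ℕ.∸ d ℕ.+ suc d)                   ≡⟨ lem d B (M ℕ.∸ d) ⟩
  B ℕ.* (suc (M ℕ.∸ d ℕ.+ d) ℕ.+ suc d)                       ≡⟨ cong (λ z → B ℕ.* (suc z ℕ.+ suc d)) (ℕ.m∸n+n≡m d≤M) ⟩
  B ℕ.* (suc M ℕ.+ suc d)                                     ∎
  where
  open ℕ.≤-Reasoning
  lem : ∀ d B x → (1 ℕ.+ d) ℕ.* B ℕ.+ B ℕ.* (x ℕ.+ (1 ℕ.+ d)) ≡ B ℕ.* (1 ℕ.+ (x ℕ.+ d) ℕ.+ (1 ℕ.+ d))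
  lem = solve-∀
... | inj₂ M≤d rewrite ℕ.m≤n⇒m∸n≡0 M≤d | growTokens-0 d B f = begin
  suc d ℕ.* (B ℕ.+ 0)                                         ≡⟨ cong (suc d ℕ.*_) (ℕ.+-identityʳ B) ⟩
  suc d ℕ.* B                                                 ≡⟨ ℕ.*-comm (suc d) B ⟩
  B ℕ.* suc d                                                 ≤⟨ ℕ.*-monoʳ-≤ B (ℕ.m≤n+m (suc d) (suc M)) ⟩
  B ℕ.* (suc M ℕ.+ suc d)                                     ∎
  where
  open ℕ.≤-Reasoning

1≤grow : ∀ d B f M → 1 ℕ.≤ B → 1 ℕ.≤ M → M ℕ.≤ f → 1 ℕ.≤ growTokens d B f M
1≤grow d B (suc f) (suc M) 1≤B _ _ = ℕ.≤-trans 1≤B (ℕ.m≤m+n B _)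

1≤tokens : ∀ d B i → 1 ℕ.≤ B → 1 ℕ.≤ tokens d B i
1≤tokens d B zero    1≤B = ℕ.≤-refl
1≤tokens d B (suc i) 1≤B = 1≤grow d B (tokens d B i) (tokens d B i) 1≤B (1≤tokens d B i 1≤B) ℕ.≤-refl

module Probability {c ℓ₁ ℓ₂} (R : ArchimedeanOrderedField c ℓ₁ ℓ₂) where
  open FieldProperties R
  open Mean R
  open Quantities R
  open PosetReasoning poset

  flag : ∀ {p} {P : Set p} → Dec P → Carrier
  flag P? = if ⌊ P? ⌋ then 1# else 0#

  count-++ : ∀ {a p} {A : Set a} {P : Pred A p} (P? : Decidable P) xs ys →
             length (filter P? (xs ++ ys)) ≡ length (filter P? xs) ℕ.+ length (filter P? ys)
  count-++ P? xs ys = trans (cong length (List.filter-++ P? xs ys)) (List.length-++ (filter P? xs))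

  count-map : ∀ {a b p} {A : Set a} {B : Set b} {P : Pred B p} (P? : Decidable P) (f : A → B) xs →
              length (filter P? (List.map f xs)) ≡ length (filter (P? ∘ f) xs)
  count-map P? f []       = refl
  count-map P? f (x ∷ xs) with P? (f x)
  ... | yes _ = cong suc (count-map P? f xs)
  ... | no  _ = count-map P? f xs

  count-mean : ∀ T {p} {E : Pred (Vec Bool T) p} (E? : Decidable E) →
               fromℕ (length (filter E? (bitVectors T))) ≈ 2# ^ T * mean T (λ ω → flag (E? ω))
  count-mean zero E? with E? []
  ... | yes _ = ≈-trans fromℕ-1 (≈-sym (*-identityˡ 1#))
  ... | no  _ = ≈-sym (zeroʳ 1#)
  count-mean (suc T) E? = begin-equality
    fromℕ (length (filter E? (bitVectors (suc T))))
      ≡⟨ cong fromℕ (trans (count-++ E? (List.map (true ∷_) (bitVectors T)) _)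
           (cong₂ ℕ._+_ (count-map E? (true ∷_) (bitVectors T))
             (trans (count-++ E? (List.map (false ∷_) (bitVectors T)) []) (trans (ℕ.+-identityʳ _) (count-map E? (false ∷_) (bitVectors T)))))) ⟩
    fromℕ (length (filter (E? ∘ (true ∷_)) (bitVectors T)) ℕ.+ length (filter (E? ∘ (false ∷_)) (bitVectors T)))
      ≈⟨ fromℕ-+ (length (filter (E? ∘ (true ∷_)) (bitVectors T))) (length (filter (E? ∘ (false ∷_)) (bitVectors T))) ⟩
    fromℕ (length (filter (E? ∘ (true ∷_)) (bitVectors T))) + fromℕ (length (filter (E? ∘ (false ∷_)) (bitVectors T)))
      ≈⟨ +-cong (count-mean T (E? ∘ (true ∷_))) (count-mean T (E? ∘ (false ∷_))) ⟩
    2# ^ T * x + 2# ^ T * y                ≈⟨ distribˡ (2# ^ T) x y ⟨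
    2# ^ T * (x + y)                       ≈⟨ *-identityˡ _ ⟨
    1# * (2# ^ T * (x + y))                ≈⟨ *-congʳ ½*2 ⟨
    ½ * 2# * (2# ^ T * (x + y))            ≈⟨ solve 4 (λ h t w z → h :* t :* (w :* z) := t :* w :* (h :* z)) ≈-refl ½ 2# (2# ^ T) (x + y) ⟩
    2# * 2# ^ T * mid x y                  ∎
    where
    x = mean T (λ ω → flag (E? (true ∷ ω)))
    y = mean T (λ ω → flag (E? (false ∷ ω)))

  Pr≈mean : ∀ {T p} {E : Pred (Vec Bool T) p} (E? : Decidable E) → Pr E? ≈ mean T (λ ω → flag (E? ω))
  Pr≈mean {T} E? = begin-equality
    fromℕ (length (filter E? (bitVectors T))) / 2# ^ T           ≈⟨ *-congʳ (≈-trans (count-mean T E?) (*-comm _ _)) ⟩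
    mean T (λ ω → flag (E? ω)) * 2# ^ T * (2# ^ T) ⁻¹            ≈⟨ *-assoc _ _ _ ⟩
    mean T (λ ω → flag (E? ω)) * (2# ^ T * (2# ^ T) ⁻¹)          ≈⟨ *-congˡ (⁻¹-inverse (2^-nonZero T)) ⟩
    mean T (λ ω → flag (E? ω)) * 1#                              ≈⟨ *-identityʳ _ ⟩
    mean T (λ ω → flag (E? ω))                                   ∎

  0≤flag : ∀ {p} {P : Set p} (P? : Dec P) → 0# ≤ flag P?
  0≤flag (yes _) = 0≤1
  0≤flag (no _)  = ≤-refl

  flag-≤ : ∀ {p} {P : Set p} (P? : Dec P) {v} → 0# ≤ v → (P → 1# ≤ v) → flag P? ≤ v
  flag-≤ (yes p) 0≤v h = h p
  flag-≤ (no _)  0≤v h = 0≤v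

  1≤flag : ∀ {p} {P : Set p} (P? : Dec P) → P → 1# ≤ flag P?
  1≤flag (yes _) p = ≤-refl
  1≤flag (no ¬p) p = ⊥-elim (¬p p)

  solution? : ∀ {n} (F : CNF n) t → Dec (∃[ α ] (α ⊨ F × t ≡ encodeAssignment α))
  solution? F t = anySubset? λ α → (α ⊨? F) ×-dec (t ≟ᵀ encodeAssignment α)

  solved : ∀ {n} → CNF n → Tree → Carrier
  solved F t = flag (solution? F t)

  solved≤Pr : ∀ {m n T} (δ : Digits m) P (F : CNF n) → HaltsWithin δ P F T →
              mean T (λ ω → solved F (proj₂ (execute δ P F ω) 0)) ≤ Pr (findsSolution? {T = T} δ P F)
  solved≤Pr {T = T} δ P F h = ≤-trans
    (mean-mono T λ ω → flag-≤ (solution? F (proj₂ (execute δ P F ω) 0)) (0≤flag (findsSolution? δ P F ω))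
      λ found → 1≤flag (findsSolution? δ P F ω) (h ω , found))
    (≤-reflexive (≈-sym (Pr≈mean (findsSolution? {T = T} δ P F))))

  -- The doubled number is a separate variable z because consecutive scalings of a constant agree
  -- with it only up to `_≈_`.
  floor-double : ∀ y → 0# ≤ y → ∀ z → z ≈ 2# * y → floor y ℕ.+ floor y ℕ.≤ floor z × floor z ℕ.≤ suc (floor y ℕ.+ floor y)
  floor-double y 0≤y z z≈2y = ≤-floor z (f ℕ.+ f) (begin
      fromℕ (f ℕ.+ f)      ≈⟨ ≈-trans (fromℕ-+ f f) (x+x≈2x (fromℕ f)) ⟩
      2# * fromℕ f         ≤⟨ *-monoʳ-≤ 0≤2 (floor-≤ y 0≤y) ⟩
      2# * y               ≈⟨ z≈2y ⟨
      z                    ∎)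
    , upper (ℕ.≤-total (floor z) (suc (f ℕ.+ f)))
    where
    f = floor y
    0≤z : 0# ≤ z
    0≤z = ≤-trans (*-nonNegative 0≤2 0≤y) (≤-reflexive (≈-sym z≈2y))
    impossible : suc (suc (f ℕ.+ f)) ℕ.≤ floor z → suc f ℕ.≤ f
    impossible h = ≤-floor y (suc f) (*-cancelʳ-≤ 0≤2 2≉0 (begin
      fromℕ (suc f) * 2#                    ≈⟨ *-comm _ _ ⟩
      2# * fromℕ (suc f)                    ≈⟨ ≈-trans (fromℕ-+ (suc f) (suc f)) (x+x≈2x (fromℕ (suc f))) ⟨
      fromℕ (suc f ℕ.+ suc f)               ≡⟨ cong (fromℕ ∘ suc) (ℕ.+-suc f f) ⟩
      fromℕ (suc (suc (f ℕ.+ f)))           ≤⟨ fromℕ-mono h ⟩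
      fromℕ (floor z)                       ≤⟨ floor-≤ z 0≤z ⟩
      z                                     ≈⟨ ≈-trans z≈2y (*-comm 2# y) ⟩
      y * 2#                                ∎))
    upper : floor z ℕ.≤ suc (f ℕ.+ f) ⊎ suc (f ℕ.+ f) ℕ.≤ floor z → floor z ℕ.≤ suc (f ℕ.+ f)
    upper (inj₁ h) = h
    upper (inj₂ h) with ℕ.m≤n⇒m<n∨m≡n h
    ... | inj₁ lt = ⊥-elim (ℕ.1+n≰n (impossible lt))
    ... | inj₂ eq = ℕ.≤-reflexive (sym eq)

  -- A number that is 2f or 2f + 1 is determined by f and its parity. For the floor of 2^(i+1) b
  -- this parity is the binary digit that the program can read.
  parity : ∀ f g → f ℕ.+ f ℕ.≤ g → g ℕ.≤ suc (f ℕ.+ f) → g ≡ (if (g ℕ.% 2) ℕ.≡ᵇ 1 then 1 else 0) ℕ.+ (f ℕ.+ f)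
  parity f g lo hi with ℕ.m≤n⇒m<n∨m≡n lo
  ... | inj₂ refl = cong (λ z → (if z ℕ.≡ᵇ 1 then 1 else 0) ℕ.+ (f ℕ.+ f)) (sym (trans (cong (ℕ._% 2) (lem f)) (ℕ.m*n%n≡0 f 2)))
    where
    lem : ∀ f → f ℕ.+ f ≡ f ℕ.* 2
    lem = solve-∀
  ... | inj₁ lt with ℕ.≤-antisym hi lt
  ...   | refl = cong (λ z → (if z ℕ.≡ᵇ 1 then 1 else 0) ℕ.+ (f ℕ.+ f)) (sym (trans (cong (ℕ._% 2) (lem f)) (ℕ.[m+kn]%n≡m%n 1 f 2)))
    where
    lem : ∀ f → 1 ℕ.+ (f ℕ.+ f) ≡ 1 ℕ.+ f ℕ.* 2
    lem = solve-∀

-- Success probability of a random walk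

module Potential {c ℓ₁ ℓ₂} (R : ArchimedeanOrderedField c ℓ₁ ℓ₂) {m : ℕ} (δ : Digits m) where
  open FieldProperties R
  open Mean R
  open Quantities R
  open Routines δ
  open WalkValue R δ
  open PosetReasoning poset

  2^-fromℕ : ∀ s → fromℕ (2 ℕ.^ s) ≈ 2# ^ s
  2^-fromℕ s = fromℕ-^ 2 s

  2*mid : ∀ w x y → 2# * w * mid x y ≈ w * x + w * y
  2*mid w x y = begin-equality
    2# * w * (½ * (x + y))   ≈⟨ solve 4 (λ t w h z → t :* w :* (h :* z) := h :* t :* (w :* z)) ≈-refl 2# w ½ (x + y) ⟩
    ½ * 2# * (w * (x + y))   ≈⟨ *-congʳ ½*2 ⟩
    1# * (w * (x + y))       ≈⟨ *-identityˡ _ ⟩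
    w * (x + y)              ≈⟨ distribˡ w x y ⟩
    w * x + w * y            ∎

  -- Appending s random bits to r gives the 2ˢ consecutive numbers from 2ˢr on, hence consecutive
  -- positions of the cyclic order; the mean becomes a sum along the orbit.
  bitsMean-orbit : ∀ N G p s r → 2# ^ s * bitsMean s r (λ r → fromℕ (G (cycle N r p))) ≈ fromℕ (orbitSum N G (2 ℕ.^ s) (cycle N (2 ℕ.^ s ℕ.* r) p))
  bitsMean-orbit N G p zero    r = ≈-trans (*-identityˡ _) (≈-reflexive (cong fromℕ
    (trans (sym (ℕ.+-identityʳ (G (cycle N r p)))) (cong (λ k → G (cycle N k p) ℕ.+ 0) (sym (ℕ.*-identityˡ r))))))
  bitsMean-orbit N G p (suc s) r = begin-equality
    2# * 2# ^ s * mid (bitsMean s (1 ℕ.+ (r ℕ.+ r)) φ) (bitsMean s (r ℕ.+ r) φ)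
      ≈⟨ 2*mid (2# ^ s) (bitsMean s (1 ℕ.+ (r ℕ.+ r)) φ) (bitsMean s (r ℕ.+ r) φ) ⟩
    2# ^ s * bitsMean s (1 ℕ.+ (r ℕ.+ r)) φ + 2# ^ s * bitsMean s (r ℕ.+ r) φ
      ≈⟨ +-cong (bitsMean-orbit N G p s (1 ℕ.+ (r ℕ.+ r))) (bitsMean-orbit N G p s (r ℕ.+ r)) ⟩
    fromℕ (orbitSum N G w (cycle N (w ℕ.* (1 ℕ.+ (r ℕ.+ r))) p)) + fromℕ (orbitSum N G w (cycle N (w ℕ.* (r ℕ.+ r)) p))
      ≈⟨ fromℕ-+ (orbitSum N G w (cycle N (w ℕ.* (1 ℕ.+ (r ℕ.+ r))) p)) (orbitSum N G w (cycle N (w ℕ.* (r ℕ.+ r)) p)) ⟨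
    fromℕ (orbitSum N G w (cycle N (w ℕ.* (1 ℕ.+ (r ℕ.+ r))) p) ℕ.+ orbitSum N G w (cycle N (w ℕ.* (r ℕ.+ r)) p))
      ≡⟨ cong fromℕ (sym split) ⟩
    fromℕ (orbitSum N G (2 ℕ.^ suc s) (cycle N (2 ℕ.^ suc s ℕ.* r) p)) ∎
    where
    φ = λ r → fromℕ (G (cycle N r p))
    w = 2 ℕ.^ s
    lem₁ : ∀ w r → 2 ℕ.* w ℕ.* r ≡ w ℕ.* (r ℕ.+ r)
    lem₁ = solve-∀
    lem₂ : ∀ w r → w ℕ.* (r ℕ.+ r) ℕ.+ w ≡ w ℕ.* (1 ℕ.+ (r ℕ.+ r))
    lem₂ = solve-∀
    split : orbitSum N G (2 ℕ.^ suc s) (cycle N (2 ℕ.^ suc s ℕ.* r) p) ≡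
            orbitSum N G w (cycle N (w ℕ.* (1 ℕ.+ (r ℕ.+ r))) p) ℕ.+ orbitSum N G w (cycle N (w ℕ.* (r ℕ.+ r)) p)
    split = trans (cong₂ (λ k l → orbitSum N G (w ℕ.+ k) (cycle N l p)) (ℕ.+-identityʳ w) (lem₁ w r))
      (trans (orbitSum-+ N G w w (cycle N (w ℕ.* (r ℕ.+ r)) p))
        (trans (ℕ.+-comm (orbitSum N G w (cycle N (w ℕ.* (r ℕ.+ r)) p)) _)
          (cong (λ q → orbitSum N G w q ℕ.+ orbitSum N G w (cycle N (w ℕ.* (r ℕ.+ r)) p))
            (trans (sym (cycle-+ N (w ℕ.* (r ℕ.+ r)) w p)) (cong (λ l → cycle N l p) (lem₂ w r))))))

  -- For n > 0 the negated inequality is turned around by totality; for n = 0 the fraction is 1,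
  -- which is at least c*.
  critical-bound : ∀ {c*} → c* ≤ 1# → ∀ {n} (G : CNF n) → ¬ (c* ≤ criticalFraction G) → fromℕ (#critical G) ≤ c* * fromℕ n
  critical-bound {c*} c*≤1 {zero}  G h = ⊥-elim (h c*≤1)
  critical-bound {c*} c*≤1 {suc n} G h = compare (≤-total c* (criticalFraction G))
    where
    suc≉0 : ¬ (fromℕ (suc n) ≈ 0#)
    suc≉0 = 1≤⇒≉0 (1≤fromℕ {suc n} (ℕ.s≤s ℕ.z≤n))
    compare : c* ≤ criticalFraction G ⊎ criticalFraction G ≤ c* → fromℕ (#critical G) ≤ c* * fromℕ (suc n)
    compare (inj₁ c*≤) = ⊥-elim (h c*≤)
    compare (inj₂ ≤c*) = ≤-trans (≤-reflexive (≈-sym (x/y*y (fromℕ (#critical G)) suc≉0))) (*-monoˡ-≤ (0≤fromℕ (suc n)) ≤c*)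

  -- Σ_{i ≤ N} bⁱ · (expectation of x after i assignments)
  potential : ∀ {n} → ℕ → Carrier → (Partial n → Carrier) → ℕ → Partial n → Carrier
  potential s b x zero    π = x π
  potential s b x (suc N) π = x π + b * assignMean s π (potential s b x N)

  module _ {n : ℕ} (F : CNF n) (s : ℕ) {c* ρ κ : Carrier} (0≤c* : 0# ≤ c*) (c*≤1 : c* ≤ 1#)
    (0≤ρ : 0# ≤ ρ) (ρ-def : ρ + c* / 2# ≈ 1#) (κ-def : κ * 2# ^ s + fromℕ n ≈ 2# ^ s) where

    -- A random assignment to a random variable preserves satisfiability with probability
    -- at least κρ: of the 2N possible assignments at most #critical are bad, and κ
    -- accounts for the deviation from the uniform distribution.
    assignMean-good : ∀ (π : Partial n) N → unset π ≡ suc N → suc N ℕ.≤ n → Sat F π →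
      ¬ (c* ≤ criticalFraction (Restriction.restrict F π)) → ρ * κ ≤ assignMean s π (λ π′ → fromℕ (good F π′))
    assignMean-good π N′ unset≡ N≤n sat nonstop = begin
      ρ * κ                                         ≈⟨ *-identityˡ _ ⟨
      1# * (ρ * κ)                                  ≈⟨ *-congʳ ½*2 ⟨
      ½ * 2# * (ρ * κ)                              ≈⟨ *-assoc ½ 2# (ρ * κ) ⟩
      ½ * (2# * (ρ * κ))                            ≤⟨ *-monoʳ-≤ 0≤½ scaled ⟩
      ½ * bm                                        ≈⟨ +-identityˡ _ ⟨
      0# + ½ * bm                                   ≈⟨ bitsMean-affine s 0 0# ½ φ ⟨
      bitsMean s 0 (λ r → 0# + ½ * φ r)             ≈⟨ bitsMean-cong s 0 (λ r → ≈-trans (+-identityˡ _) (*-congˡ (fromℕ-+ (good F (assign π r true)) (good F (assign π r false))))) ⟩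
      assignMean s π (λ π′ → fromℕ (good F π′))     ∎
      where
      N = unset π
      G : ℕ → ℕ
      G L = good F (choose π L true) ℕ.+ good F (choose π L false)
      φ : ℕ → Carrier
      φ r = fromℕ (G (cycle N r N))
      bm = bitsMean s 0 φ
      w = 2 ℕ.^ s
      q = w ℕ./ suc N′
      Sg = fromℕ (sum₁ N G)
      N₂ : 2# * (fromℕ N * ρ) + c* * fromℕ N ≈ 2# * fromℕ N
      N₂ = begin-equality
        2# * (fromℕ N * ρ) + c* * fromℕ N                    ≈⟨ +-congˡ (≈-trans (*-congʳ (≈-sym (x/y*y c* 2≉0))) (solve 3 (λ x t k → x :* t :* k := t :* (k :* x)) ≈-refl (c* / 2#) 2# (fromℕ N))) ⟩
        2# * (fromℕ N * ρ) + 2# * (fromℕ N * (c* / 2#))      ≈⟨ solve 4 (λ t k x y → t :* (k :* x) :+ t :* (k :* y) := t :* (k :* (x :+ y))) ≈-refl 2# (fromℕ N) ρ (c* / 2#) ⟩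
        2# * (fromℕ N * (ρ + c* / 2#))                       ≈⟨ *-congˡ (≈-trans (*-congˡ ρ-def) (*-identityʳ _)) ⟩
        2# * fromℕ N                                         ∎
      crit = #critical (Restriction.restrict F π)
      Sg-bound : 2# * (fromℕ N * ρ) ≤ Sg
      -- 2N is at most the number of good choices plus the number of critical variables, the latter
      -- is at most c*N, and 2N = 2Nρ + c*N.
      Sg-bound = +-cancelʳ-≤ (c* * fromℕ N) (begin
        2# * (fromℕ N * ρ) + c* * fromℕ N                    ≈⟨ N₂ ⟩
        2# * fromℕ N                                         ≈⟨ fromℕ-* 2 N ⟨
        fromℕ (2 ℕ.* N)                                      ≤⟨ fromℕ-mono {2 ℕ.* N} {sum₁ N G ℕ.+ crit} (ℕ.≤-trans (sum-good F π sat) (ℕ.≤-reflexive (cong (ℕ._+ crit) (sym (sum₁-+ N _ _))))) ⟩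
        fromℕ (sum₁ N G ℕ.+ crit)                            ≈⟨ fromℕ-+ (sum₁ N G) crit ⟩
        Sg + fromℕ crit                                      ≤⟨ +-monoʳ-≤ Sg (critical-bound c*≤1 (Restriction.restrict F π) nonstop) ⟩
        Sg + c* * fromℕ (cnt (live π (clauses F)))           ≤⟨ +-monoʳ-≤ Sg (*-monoʳ-≤ 0≤c* (fromℕ-mono {cnt (live π (clauses F))} {N} (cnt-live π (clauses F)))) ⟩
        Sg + c* * fromℕ N                                    ∎)
      -- The incomplete last round through the N positions is given up. It accounts for fewer than N
      -- ≤ n of the 2ˢ outcomes, the loss that κ allows for.
      w≤ : w ℕ.≤ q ℕ.* suc N′ ℕ.+ n
      w≤ = ℕ.≤-trans (ℕ.≤-reflexive (trans (ℕ.m≡m%n+[m/n]*n w (suc N′)) (ℕ.+-comm (w ℕ.% suc N′) _)))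
        (ℕ.+-monoʳ-≤ (q ℕ.* suc N′) (ℕ.≤-trans (ℕ.<⇒≤ (ℕ.m%n<n w (suc N′))) N≤n))
      qN-bound : κ * 2# ^ s ≤ fromℕ q * fromℕ N
      qN-bound = +-cancelʳ-≤ (fromℕ n) (begin
        κ * 2# ^ s + fromℕ n                 ≈⟨ κ-def ⟩
        2# ^ s                               ≈⟨ 2^-fromℕ s ⟨
        fromℕ w                              ≤⟨ fromℕ-mono w≤ ⟩
        fromℕ (q ℕ.* suc N′ ℕ.+ n)           ≈⟨ ≈-trans (fromℕ-+ (q ℕ.* suc N′) n) (+-congʳ (fromℕ-* q (suc N′))) ⟩
        fromℕ q * fromℕ (suc N′) + fromℕ n   ≡⟨ cong (λ k → fromℕ q * fromℕ k + fromℕ n) unset≡ ⟨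
        fromℕ q * fromℕ N + fromℕ n          ∎)
      orbit-bound : q ℕ.* sum₁ N G ℕ.≤ orbitSum N G w N
      orbit-bound = subst (λ k → q ℕ.* sum₁ k G ℕ.≤ orbitSum k G w k) (sym unset≡)
        (ℕ.≤-trans (orbitSum-rounds N′ G q (w ℕ.% suc N′)) (ℕ.≤-reflexive (cong (λ k → orbitSum (suc N′) G k (suc N′))
          (trans (ℕ.+-comm (q ℕ.* suc N′) _) (sym (ℕ.m≡m%n+[m/n]*n w (suc N′)))))))
      scaled : 2# * (ρ * κ) ≤ bm
      scaled = *-cancelʳ-≤ (≤-trans 0≤1 (1≤^ s 1≤2)) (2^-nonZero s) (begin
        2# * (ρ * κ) * 2# ^ s                ≈⟨ solve 4 (λ t r k v → t :* (r :* k) :* v := t :* r :* (k :* v)) ≈-refl 2# ρ κ (2# ^ s) ⟩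
        2# * ρ * (κ * 2# ^ s)                ≤⟨ *-monoʳ-≤ (*-nonNegative 0≤2 0≤ρ) qN-bound ⟩
        2# * ρ * (fromℕ q * fromℕ N)         ≈⟨ solve 4 (λ t r k v → t :* r :* (k :* v) := k :* (t :* (v :* r))) ≈-refl 2# ρ (fromℕ q) (fromℕ N) ⟩
        fromℕ q * (2# * (fromℕ N * ρ))       ≤⟨ *-monoʳ-≤ (0≤fromℕ q) Sg-bound ⟩
        fromℕ q * Sg                         ≈⟨ fromℕ-* q (sum₁ N G) ⟨
        fromℕ (q ℕ.* sum₁ N G)               ≤⟨ fromℕ-mono orbit-bound ⟩
        fromℕ (orbitSum N G w N)             ≡⟨ cong (λ k → fromℕ (orbitSum N G w (cycle N k N))) (ℕ.*-zeroʳ w) ⟨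
        fromℕ (orbitSum N G w (cycle N (w ℕ.* 0) N)) ≈⟨ bitsMean-orbit N G N s 0 ⟨
        2# ^ s * bm                          ≈⟨ *-comm _ _ ⟩
        bm * 2# ^ s                          ∎)

    module _ {b μ h : Carrier} (0≤b : 0# ≤ b) (0≤μ : 0# ≤ μ) (0≤h : 0# ≤ h) (0≤κ : 0# ≤ κ) (κ≤1 : κ ≤ 1#) (μ≤bρ : μ ≤ b * ρ)
      (x : Partial n → Carrier) (0≤x : ∀ π → 0# ≤ x π)
      (stop : ∀ π → Sat F π → c* ≤ criticalFraction (Restriction.restrict F π) → h * μ ^ unset π ≤ x π) where

      0≤potential : ∀ N π → 0# ≤ potential s b x N π
      0≤potential zero    π = 0≤x π
      0≤potential (suc N) π = +-nonNegative (0≤x π) (*-nonNegative 0≤b (≤-bitsMean s 0 λ r →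
        ≤-trans (≤-reflexive (≈-sym (½*[x+x] 0#))) (mid-mono (0≤potential N _) (0≤potential N _))))

      x≤potential : ∀ N π → x π ≤ potential s b x N π
      x≤potential zero    π = ≤-refl
      x≤potential (suc N) π = x≤x+y (*-nonNegative 0≤b (≤-bitsMean s 0 λ r →
        ≤-trans (≤-reflexive (≈-sym (½*[x+x] 0#))) (mid-mono (0≤potential N _) (0≤potential N _))))

      0≤κμ^ : ∀ N → 0# ≤ (κ * μ) ^ N
      0≤κμ^ N = ^-nonNegative N (*-nonNegative 0≤κ 0≤μ)

      -- Where the walk may stop, the first summand alone suffices, as κ ≤ 1. Elsewhere one step
      -- keeps satisfiability with probability at least ρκ and has weight b, which gains the factor
      -- bρκ ≥ κμ; unsatisfiable outcomes contribute at least 0.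
      potential-bound : ∀ N π → unset π ≡ N → N ℕ.≤ n → Sat F π → h * (κ * μ) ^ N ≤ potential s b x N π
      continue : ∀ N π → unset π ≡ N → N ℕ.≤ n → Sat F π → ¬ (c* ≤ criticalFraction (Restriction.restrict F π)) →
                 h * (κ * μ) ^ N ≤ potential s b x N π
      potential-bound N π unset≡ N≤n sat = decide (c* ≤? criticalFraction (Restriction.restrict F π))
        where
        decide : Dec (c* ≤ criticalFraction (Restriction.restrict F π)) → h * (κ * μ) ^ N ≤ potential s b x N π
        decide (no ¬stop) = continue N π unset≡ N≤n sat ¬stop
        decide (yes c*≤) = begin
          h * (κ * μ) ^ N          ≤⟨ *-monoʳ-≤ 0≤h (^-mono-≤ N (*-nonNegative 0≤κ 0≤μ) (≤-trans (*-monoˡ-≤ 0≤μ κ≤1) (≤-reflexive (*-identityˡ μ)))) ⟩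
          h * μ ^ N                ≡⟨ cong (λ k → h * μ ^ k) unset≡ ⟨
          h * μ ^ unset π          ≤⟨ stop π sat c*≤ ⟩
          x π                      ≤⟨ x≤potential N π ⟩
          potential s b x N π        ∎
      -- With no variable left the critical fraction is 1 by convention and hence at least c*, so
      -- the walk could have stopped.
      continue zero    π unset≡ N≤n sat ¬stop = ⊥-elim (no-variables (Restriction.restrict F π)
          (ℕ.n≤0⇒n≡0 (ℕ.≤-trans (cnt-live π (clauses F)) (ℕ.≤-reflexive unset≡))) ¬stop)
        where
        no-variables : ∀ {k} (G : CNF k) → k ≡ 0 → ¬ ¬ (c* ≤ criticalFraction G)
        no-variables {zero} G refl h = h c*≤1
      continue (suc N) π unset≡ N≤n sat ¬stop = begin
        h * (κ * μ * y)                                          ≈⟨ solve 4 (λ h k m y → h :* (k :* m :* y) := m :* (k :* (h :* y))) ≈-refl h κ μ y ⟩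
        μ * (κ * (h * y))                                        ≤⟨ *-monoˡ-≤ (*-nonNegative 0≤κ (*-nonNegative 0≤h (0≤κμ^ N))) μ≤bρ ⟩
        b * ρ * (κ * (h * y))                                    ≈⟨ solve 4 (λ b r k z → b :* r :* (k :* z) := b :* (z :* (r :* k))) ≈-refl b ρ κ (h * y) ⟩
        b * (h * y * (ρ * κ))                                    ≤⟨ *-monoʳ-≤ 0≤b (*-monoʳ-≤ (*-nonNegative 0≤h (0≤κμ^ N)) (assignMean-good π N unset≡ N≤n sat ¬stop)) ⟩
        b * (h * y * assignMean s π (λ π′ → fromℕ (good F π′)))  ≈⟨ *-congˡ (≈-trans (≈-sym (+-identityˡ _)) (≈-sym (assignMean-affine s π 0# (h * y) (λ π′ → fromℕ (good F π′))))) ⟩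
        b * assignMean s π (λ π′ → 0# + h * y * fromℕ (good F π′)) ≤⟨ *-monoʳ-≤ 0≤b (bitsMean-mono s 0 λ r → mid-mono (child r true) (child r false)) ⟩
        b * assignMean s π (potential s b x N)                     ≤⟨ x≤y+x (0≤x π) ⟩
        x π + b * assignMean s π (potential s b x N)               ∎
        where
        y = (κ * μ) ^ N
        range : ∀ r → 1 ℕ.≤ cycle (unset π) r (unset π) × cycle (unset π) r (unset π) ℕ.≤ unset π
        range r = cycle-range (unset π) r (unset π) 1≤ 1≤ ℕ.≤-refl
          where
          1≤ : 1 ℕ.≤ unset π
          1≤ = ℕ.≤-trans (ℕ.s≤s ℕ.z≤n) (ℕ.≤-reflexive (sym unset≡))
        fewer : ∀ r v → unset (assign π r v) ≡ N
        fewer r v = ℕ.suc-injective (trans (unset-choose v π (cycle (unset π) r (unset π)) (proj₁ (range r)) (proj₂ (range r))) unset≡)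
        by-good : ∀ π′ → unset π′ ≡ N → Dec (Sat F π′) → 0# + h * y * fromℕ (good F π′) ≤ potential s b x N π′
        by-good π′ eq (yes sat′) = begin
          0# + h * y * fromℕ (good F π′)   ≈⟨ ≈-trans (+-identityˡ _) (*-congˡ (≈-trans (≈-reflexive (cong fromℕ (good-yes F sat′))) fromℕ-1)) ⟩
          h * y * 1#                       ≈⟨ *-identityʳ _ ⟩
          h * y                            ≤⟨ potential-bound N π′ eq (ℕ.≤-trans (ℕ.n≤1+n N) N≤n) sat′ ⟩
          potential s b x N π′               ∎
        by-good π′ eq (no ¬sat′) = ≤-trans (≤-reflexive (≈-trans (+-identityˡ _)
          (≈-trans (*-congˡ (≈-reflexive (cong fromℕ (good-no F ¬sat′)))) (zeroʳ _)))) (0≤potential N π′)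
        child : ∀ r v → 0# + h * y * fromℕ (good F (assign π r v)) ≤ potential s b x N (assign π r v)
        child r v = by-good (assign π r v) (fewer r v) (sat? F (assign π r v))

-- Repetition

module Series {c ℓ₁ ℓ₂} (R : ArchimedeanOrderedField c ℓ₁ ℓ₂) where
  open FieldProperties R
  open Mean R
  open Failure R
  open PosetReasoning poset

  sumFrom : (ℕ → Carrier) → ℕ → ℕ → Carrier
  sumFrom g zero    i = 0#
  sumFrom g (suc k) i = sumFrom g k (suc i) + g i

  0≤sumFrom : ∀ {g} → (∀ i → 0# ≤ g i) → ∀ k i → 0# ≤ sumFrom g k i
  0≤sumFrom 0≤g zero    i = ≤-refl
  0≤sumFrom 0≤g (suc k) i = +-nonNegative (0≤sumFrom 0≤g k (suc i)) (0≤g i)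

  sumFrom-mono : ∀ {g g′} → (∀ i → g i ≤ g′ i) → ∀ k i → sumFrom g k i ≤ sumFrom g′ k i
  sumFrom-mono h zero    i = ≤-refl
  sumFrom-mono h (suc k) i = +-mono-≤ (sumFrom-mono h k (suc i)) (h i)

  sumFrom-cong : ∀ {g g′} → (∀ i → g i ≈ g′ i) → ∀ k i → sumFrom g k i ≈ sumFrom g′ k i
  sumFrom-cong h zero    i = ≈-refl
  sumFrom-cong h (suc k) i = +-cong (sumFrom-cong h k (suc i)) (h i)

  sumFrom-shift : ∀ g k i → sumFrom (λ i → g (suc i)) k i ≈ sumFrom g k (suc i)
  sumFrom-shift g zero    i = ≈-refl
  sumFrom-shift g (suc k) i = +-congʳ (sumFrom-shift g k (suc i))

  sumFrom-scale : ∀ b g k i → b * sumFrom g k i ≈ sumFrom (λ i → b * g i) k i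
  sumFrom-scale b g zero    i = zeroʳ b
  sumFrom-scale b g (suc k) i = ≈-trans (distribˡ b _ _) (+-congʳ (sumFrom-scale b g k (suc i)))

  -- With f = 1 - x one has f(1 + z + x) = 1 + z - xz - x² ≤ 1 + z, so each trial adds its success
  -- probability x to the denominator; y is the contribution of the later phases.
  failAll-bound : ∀ {ψ f x y} → 0# ≤ ψ → 0# ≤ f → 0# ≤ x → 0# ≤ y → f + x ≈ 1# → ψ * (1# + y) ≤ 1# →
                  ∀ M → failAll ψ f M * (1# + (y + fromℕ M * x)) ≤ 1#
  failAll-bound {ψ} {f} {x} {y} 0≤ψ 0≤f 0≤x 0≤y f+x≈1 h zero    = ≤-trans
    (≤-reflexive (*-congˡ (+-congˡ (≈-trans (+-congˡ (zeroˡ x)) (+-identityʳ y))))) h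
  failAll-bound {ψ} {f} {x} {y} 0≤ψ 0≤f 0≤x 0≤y f+x≈1 h (suc M) = begin
    failAll ψ f M * f * (1# + (y + fromℕ (suc M) * x))  ≈⟨ *-congˡ (+-congˡ (≈-trans (+-congˡ (≈-trans (distribʳ x 1# (fromℕ M)) (≈-trans (+-congʳ (*-identityˡ x)) (+-comm x _)))) (≈-sym (+-assoc y _ x)))) ⟩
    failAll ψ f M * f * (1# + (z + x))                  ≈⟨ *-congˡ (+-assoc 1# z x) ⟨
    failAll ψ f M * f * (1# + z + x)                    ≈⟨ *-assoc _ f _ ⟩
    failAll ψ f M * (f * (1# + z + x))                  ≤⟨ *-monoʳ-≤ (0≤failAll 0≤ψ 0≤f M) less ⟩
    failAll ψ f M * (1# + z)                            ≤⟨ failAll-bound 0≤ψ 0≤f 0≤x 0≤y f+x≈1 h M ⟩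
    1#                                                  ∎
    where
    z = y + fromℕ M * x
    0≤z : 0# ≤ z
    0≤z = +-nonNegative 0≤y (*-nonNegative (0≤fromℕ M) 0≤x)
    f≤1+z : f ≤ 1# + z
    f≤1+z = ≤-trans (x≤x+y 0≤x) (≤-trans (≤-reflexive f+x≈1) (x≤x+y 0≤z))
    less : f * (1# + z + x) ≤ 1# + z
    less = begin
      f * (1# + z + x)               ≈⟨ distribˡ f (1# + z) x ⟩
      f * (1# + z) + f * x           ≤⟨ +-monoʳ-≤ _ (*-monoˡ-≤ 0≤x f≤1+z) ⟩
      f * (1# + z) + (1# + z) * x    ≈⟨ solve 3 (λ f u x → f :* u :+ u :* x := (f :+ x) :* u) ≈-refl f (1# + z) x ⟩
      (f + x) * (1# + z)             ≈⟨ ≈-trans (*-congʳ f+x≈1) (*-identityˡ _) ⟩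
      1# + z                         ∎

  failChain-bound : ∀ {f x : ℕ → Carrier} → (∀ i → 0# ≤ f i) → (∀ i → 0# ≤ x i) → (∀ i → f i + x i ≈ 1#) → ∀ M k i →
                    failChain f M k i * (1# + sumFrom (λ i → fromℕ (M i) * x i) k i) ≤ 1#
  failChain-bound 0≤f 0≤x f+x≈1 M zero    i = ≤-reflexive (≈-trans (*-identityˡ _) (+-identityʳ 1#))
  failChain-bound 0≤f 0≤x f+x≈1 M (suc k) i = failAll-bound (0≤failChain 0≤f M k (suc i)) (0≤f i) (0≤x i)
    (0≤sumFrom (λ i → *-nonNegative (0≤fromℕ (M i)) (0≤x i)) k (suc i)) (f+x≈1 i) (failChain-bound 0≤f 0≤x f+x≈1 M k (suc i)) (M i)

  -- A failure probability ψ ≤ 1 / (1 + Y) means success with probability at least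
  -- Y / (1 + Y), hence at least y / 2 for every y ≤ min(1, Y).
  success-bound : ∀ {ψ Y y} → 0# ≤ ψ → ψ * (1# + Y) ≤ 1# → 0# ≤ y → y ≤ 1# → y ≤ Y → ½ * y ≤ 1# - ψ
  success-bound {ψ} {Y} {y} 0≤ψ h 0≤y y≤1 y≤Y = *-cancelʳ-≤ 0≤2 2≉0 (+-cancelʳ-≤ (ψ * (1# + y)) (begin
    ½ * y * 2# + ψ * (1# + y)             ≈⟨ +-congʳ (≈-trans (solve 3 (λ h y t → h :* y :* t := h :* t :* y) ≈-refl ½ y 2#) (≈-trans (*-congʳ ½*2) (*-identityˡ y))) ⟩
    y + ψ * (1# + y)                      ≤⟨ +-monoʳ-≤ y (≤-trans (*-monoʳ-≤ 0≤ψ (+-monoʳ-≤ 1# y≤Y)) h) ⟩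
    y + 1#                                ≈⟨ +-comm y 1# ⟩
    1# + y                                ≈⟨ ≈-trans (*-congʳ (-‿cancelʳ 1# ψ)) (*-identityˡ _) ⟨
    (1# - ψ + ψ) * (1# + y)               ≈⟨ distribʳ (1# + y) (1# - ψ) ψ ⟩
    (1# - ψ) * (1# + y) + ψ * (1# + y)    ≤⟨ +-monoˡ-≤ _ (*-monoʳ-≤ 0≤1-ψ 1+y≤2) ⟩
    (1# - ψ) * 2# + ψ * (1# + y)          ∎))
    where
    1+y≤2 : 1# + y ≤ 2#
    1+y≤2 = +-monoʳ-≤ 1# (≤-trans y≤1 (≤-reflexive (≈-sym fromℕ-1)))
    0≤1-ψ : 0# ≤ 1# - ψ
    0≤1-ψ = 0≤y-x (begin
      ψ                ≈⟨ *-identityʳ ψ ⟨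
      ψ * 1#           ≤⟨ *-monoʳ-≤ 0≤ψ (x≤x+y (≤-trans 0≤y y≤Y)) ⟩
      ψ * (1# + Y)     ≤⟨ h ⟩
      1#               ∎)

  module _ {b : Carrier} (1≤b : 1# ≤ b) (d B : ℕ) (bD≤B : b * fromℕ (suc d) ≤ fromℕ B) (B≤bD+1 : fromℕ B ≤ b * fromℕ (suc d) + 1#) where
    private
      D = fromℕ (suc d)
      β = fromℕ B / D

      0≤b : 0# ≤ b
      0≤b = ≤-trans 0≤1 1≤b

      0≤D : 0# ≤ D
      0≤D = 0≤fromℕ (suc d)

      1≤D : 1# ≤ D
      1≤D = 1≤fromℕ {suc d} (ℕ.s≤s ℕ.z≤n)

      D≉0 : ¬ (D ≈ 0#)
      D≉0 = 1≤⇒≉0 1≤D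

      b≤β : b ≤ β
      b≤β = ≤-/ 0≤D D≉0 bD≤B

      1≤β : 1# ≤ β
      1≤β = ≤-trans 1≤b b≤β

      0≤β : 0# ≤ β
      0≤β = ≤-trans 0≤1 1≤β

      tok : ℕ → Carrier
      tok i = fromℕ (tokens d B i)

    tokens-lower : ∀ i → b ^ i ≤ tok i
    tokens-lower zero    = ≤-reflexive (≈-sym fromℕ-1)
    tokens-lower (suc i) = *-cancelʳ-≤ 0≤D D≉0 (begin
      b * b ^ i * D                           ≈⟨ solve 3 (λ b p D → b :* p :* D := b :* D :* p) ≈-refl b (b ^ i) D ⟩
      b * D * b ^ i                           ≤⟨ *-mono-≤ (*-nonNegative 0≤b 0≤D) (0≤fromℕ (tokens d B i)) bD≤B (tokens-lower i) ⟩
      fromℕ B * tok i                         ≈⟨ fromℕ-* B (tokens d B i) ⟨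
      fromℕ (B ℕ.* tokens d B i)              ≤⟨ fromℕ-mono (grow-lower d B (tokens d B i) (tokens d B i) ℕ.≤-refl) ⟩
      fromℕ (suc d ℕ.* tokens d B (suc i))    ≈⟨ ≈-trans (fromℕ-* (suc d) (tokens d B (suc i))) (*-comm _ _) ⟩
      tok (suc i) * D                         ∎)

    private
      tokens-step : ∀ i → tok (suc i) ≤ β * tok i + fromℕ B
      tokens-step i = *-cancelʳ-≤ 0≤D D≉0 (begin
        tok (suc i) * D                        ≈⟨ ≈-trans (fromℕ-* (suc d) (tokens d B (suc i))) (*-comm _ _) ⟨
        fromℕ (suc d ℕ.* tokens d B (suc i))   ≤⟨ fromℕ-mono (grow-upper d B (tokens d B i) (tokens d B i)) ⟩
        fromℕ (B ℕ.* (tokens d B i ℕ.+ suc d)) ≈⟨ ≈-trans (fromℕ-* B (tokens d B i ℕ.+ suc d)) (*-congˡ (fromℕ-+ (tokens d B i) (suc d))) ⟩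
        fromℕ B * (tok i + D)                  ≈⟨ distribˡ _ _ _ ⟩
        fromℕ B * tok i + fromℕ B * D          ≈⟨ +-congʳ (*-congʳ (x/y*y (fromℕ B) D≉0)) ⟨
        β * D * tok i + fromℕ B * D            ≈⟨ solve 4 (λ e D t B → e :* D :* t :+ B :* D := (e :* t :+ B) :* D) ≈-refl β D (tok i) (fromℕ B) ⟩
        (β * tok i + fromℕ B) * D              ∎)

      -- Unrolls the recursion t ↦ βt + B; every additive B is at most B times the current power of
      -- β, because β ≥ 1.
      tokens-upper-β : ∀ i → tok i ≤ β ^ i * fromℕ (suc (i ℕ.* B))
      tokens-upper-β zero    = ≤-reflexive (≈-sym (*-identityˡ _))
      tokens-upper-β (suc i) = begin
        tok (suc i)                                              ≤⟨ tokens-step i ⟩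
        β * tok i + fromℕ B                                      ≤⟨ +-mono-≤ (*-monoʳ-≤ 0≤β (tokens-upper-β i)) (≤-trans (≤-reflexive (≈-sym (*-identityˡ _))) (*-monoˡ-≤ (0≤fromℕ B) (1≤^ (suc i) 1≤β))) ⟩
        β * (β ^ i * fromℕ (suc (i ℕ.* B))) + β ^ suc i * fromℕ B ≈⟨ solve 4 (λ e p n B → e :* (p :* n) :+ e :* p :* B := e :* p :* (n :+ B)) ≈-refl β (β ^ i) (fromℕ (suc (i ℕ.* B))) (fromℕ B) ⟩
        β ^ suc i * (fromℕ (suc (i ℕ.* B)) + fromℕ B)            ≈⟨ *-congˡ (fromℕ-+ (suc (i ℕ.* B)) B) ⟨
        β ^ suc i * fromℕ (suc (i ℕ.* B) ℕ.+ B)                  ≡⟨ cong (λ k → β ^ suc i * fromℕ (suc k)) (ℕ.+-comm (i ℕ.* B) B) ⟩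
        β ^ suc i * fromℕ (suc (suc i ℕ.* B))                    ∎

      E = fromℕ (suc (suc d))
      E≉0 : ¬ (E ≈ 0#)
      E≉0 = 1≤⇒≉0 (1≤fromℕ {suc (suc d)} (ℕ.s≤s ℕ.z≤n))
      γ = E / D

      γD : γ * D ≈ E
      γD = x/y*y E D≉0

      1≤γ : 1# ≤ γ
      1≤γ = ≤-/ 0≤D D≉0 (≤-trans (≤-reflexive (*-identityˡ D)) (x≤y+x 0≤1))

      -- Rounding up adds at most 1 ≤ b to bD, so B ≤ b(D + 1): the additive error becomes the
      -- factor γ = 1 + 1/D.
      β≤bγ : β ≤ b * γ
      β≤bγ = /-mono 0≤D D≉0 (begin
        fromℕ B           ≤⟨ B≤bD+1 ⟩
        b * D + 1#        ≤⟨ +-monoʳ-≤ _ 1≤b ⟩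
        b * D + b         ≈⟨ ≈-trans (+-comm _ _) (+-congʳ (≈-sym (*-identityʳ b))) ⟩
        b * 1# + b * D    ≈⟨ distribˡ b 1# D ⟨
        b * E             ≈⟨ *-congˡ γD ⟨
        b * (γ * D)       ≈⟨ *-assoc b γ D ⟨
        b * γ * D         ∎)

      -- Bernoulli for the inverse 1/γ = 1 - 1/(D + 1): its n-th power is at least 1 - n/(D + 1) ≥
      -- 1/2.
      γ^n≤2 : ∀ n → 2 ℕ.* n ℕ.≤ suc (suc d) → γ ^ n ≤ 2#
      γ^n≤2 n 2n≤ = *-cancelʳ-≤ 0≤½ ½≉0 (begin
        γ ^ n * ½              ≤⟨ *-monoʳ-≤ (≤-trans 0≤1 (1≤^ n 1≤γ)) ½≤z^n ⟩
        γ ^ n * z ^ n          ≈⟨ ^-distrib-* γ z n ⟨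
        (γ * z) ^ n            ≈⟨ ≈-trans (^-congˡ n γz≈1) (1^n≈1 n) ⟩
        1#                     ≈⟨ ≈-trans (*-comm 2# ½) ½*2 ⟨
        2# * ½                 ∎)
        where
        z y : Carrier
        z = D / E
        y = 1# / E
        0≤E⁻¹ : 0# ≤ E ⁻¹
        0≤E⁻¹ = ⁻¹-nonNegative (0≤fromℕ (suc (suc d))) E≉0
        ½≉0 : ¬ (½ ≈ 0#)
        ½≉0 h = 0≉1 (≈-trans (≈-sym (zeroˡ 2#)) (≈-trans (*-congʳ (≈-sym h)) ½*2))
        γz≈1 : γ * z ≈ 1#
        γz≈1 = begin-equality
          γ * (D * E ⁻¹)     ≈⟨ *-assoc γ D (E ⁻¹) ⟨
          γ * D * E ⁻¹       ≈⟨ *-congʳ γD ⟩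
          E * E ⁻¹           ≈⟨ ⁻¹-inverse E≉0 ⟩
          1#                 ∎
        z+y≈1 : z + y ≈ 1#
        z+y≈1 = ≈-trans (≈-sym (distribʳ (E ⁻¹) D 1#)) (≈-trans (*-congʳ (+-comm D 1#)) (⁻¹-inverse E≉0))
        ny≤½ : fromℕ n * y ≤ ½
        ny≤½ = *-cancelʳ-≤ (0≤fromℕ (suc (suc d))) E≉0 (*-cancelʳ-≤ 0≤2 2≉0 (begin
          fromℕ n * y * E * 2#       ≈⟨ *-congʳ (≈-trans (*-assoc _ _ _) (≈-trans (*-congˡ (x/y*y 1# E≉0)) (*-identityʳ _))) ⟩
          fromℕ n * 2#               ≈⟨ ≈-trans (fromℕ-* 2 n) (*-comm _ _) ⟨
          fromℕ (2 ℕ.* n)            ≤⟨ fromℕ-mono 2n≤ ⟩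
          E                          ≈⟨ *-identityˡ E ⟨
          1# * E                     ≈⟨ *-congʳ ½*2 ⟨
          ½ * 2# * E                 ≈⟨ solve 3 (λ h t E → h :* t :* E := h :* E :* t) ≈-refl ½ 2# E ⟩
          ½ * E * 2#                 ∎))
        ½≤z^n : ½ ≤ z ^ n
        ½≤z^n = +-cancelʳ-≤ ½ (begin
          ½ + ½                      ≈⟨ ≈-trans (x+x≈2x ½) (≈-trans (*-comm 2# ½) ½*2) ⟩
          1#                         ≤⟨ bernoulli n (*-nonNegative 0≤D 0≤E⁻¹) (*-nonNegative 0≤1 0≤E⁻¹) z+y≈1 ⟩
          z ^ n + fromℕ n * y        ≤⟨ +-monoʳ-≤ _ ny≤½ ⟩
          z ^ n + ½                  ∎)

    tokens-upper : ∀ n i → i ℕ.≤ n → 2 ℕ.* n ℕ.≤ suc (suc d) → tok i ≤ b ^ i * fromℕ (2 ℕ.* suc (n ℕ.* B))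
    tokens-upper n i i≤n 2n≤ = begin
      tok i                                          ≤⟨ tokens-upper-β i ⟩
      β ^ i * fromℕ (suc (i ℕ.* B))                  ≤⟨ *-mono-≤ (^-nonNegative i 0≤β) (0≤fromℕ (suc (n ℕ.* B))) (^-mono-≤ i 0≤β β≤bγ) (fromℕ-mono (ℕ.s≤s (ℕ.*-monoˡ-≤ B i≤n))) ⟩
      (b * γ) ^ i * fromℕ (suc (n ℕ.* B))            ≈⟨ *-congʳ (^-distrib-* b γ i) ⟩
      b ^ i * γ ^ i * fromℕ (suc (n ℕ.* B))          ≤⟨ *-monoˡ-≤ (0≤fromℕ (suc (n ℕ.* B))) (*-monoʳ-≤ (^-nonNegative i 0≤b) (≤-trans (^-monoʳ-≤ 1≤γ i≤n) (γ^n≤2 n 2n≤))) ⟩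
      b ^ i * 2# * fromℕ (suc (n ℕ.* B))             ≈⟨ ≈-trans (*-assoc _ _ _) (*-congˡ (≈-sym (fromℕ-* 2 (suc (n ℕ.* B))))) ⟩
      b ^ i * fromℕ (2 ℕ.* suc (n ℕ.* B))            ∎

module PotentialSeries {c ℓ₁ ℓ₂} (R : ArchimedeanOrderedField c ℓ₁ ℓ₂) {m : ℕ} (δ : Digits m) where
  open FieldProperties R
  open Mean R
  open Series R
  open WalkValue R δ
  open Potential R δ
  open Routines δ
  open PosetReasoning poset

  mid-+ : ∀ x y u v → mid (x + u) (y + v) ≈ mid x y + mid u v
  mid-+ x y u v = solve 5 (λ h x y u v → h :* (x :+ u :+ (y :+ v)) := h :* (x :+ y) :+ h :* (u :+ v)) ≈-refl ½ x y u v

  bitsMean-+ : ∀ s r φ φ′ → bitsMean s r (λ r → φ r + φ′ r) ≈ bitsMean s r φ + bitsMean s r φ′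
  bitsMean-+ zero    r φ φ′ = ≈-refl
  bitsMean-+ (suc s) r φ φ′ = ≈-trans (*-congˡ (+-cong (bitsMean-+ s _ φ φ′) (bitsMean-+ s _ φ φ′))) (mid-+ _ _ _ _)

  assignMean-+ : ∀ {n} s (π : Partial n) g g′ → assignMean s π (λ π → g π + g′ π) ≈ assignMean s π g + assignMean s π g′
  assignMean-+ s π g g′ = ≈-trans (bitsMean-cong s 0 (λ r → mid-+ _ _ _ _))
    (bitsMean-+ s 0 (λ r → mid (g (assign π r true)) (g (assign π r false))) (λ r → mid (g′ (assign π r true)) (g′ (assign π r false))))

  assignMean-scale : ∀ {n} s (π : Partial n) a g → assignMean s π (λ π → a * g π) ≈ a * assignMean s π g
  assignMean-scale s π a g = ≈-trans (assignMean-cong s π (λ π → ≈-sym (+-identityˡ (a * g π))))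
    (≈-trans (assignMean-affine s π 0# a g) (+-identityˡ _))

  assignMean-sum : ∀ {n} s (π : Partial n) (a : ℕ → Carrier) (g : ℕ → Partial n → Carrier) k i →
    assignMean s π (λ π → sumFrom (λ i → a i * g i π) k i) ≈ sumFrom (λ i → a i * assignMean s π (g i)) k i
  assignMean-sum s π a g zero    i = ≈-trans (assignMean-cong s π {λ _ → 0#} {λ _ → 0# * 0#} (λ _ → ≈-sym (zeroʳ 0#)))
    (≈-trans (assignMean-scale s π 0# (λ _ → 0#)) (zeroˡ _))
  assignMean-sum s π a g (suc k) i = ≈-trans (assignMean-+ s π (λ π → sumFrom (λ i → a i * g i π) k (suc i)) (λ π → a i * g i π))
    (+-cong (assignMean-sum s π a g k (suc i)) (assignMean-scale s π (a i) (g i)))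

  -- Identifies the recursively defined potential with the expected number of successes when phase i
  -- has bⁱ trials.
  potential-sum : ∀ {n} s b (x : Partial n → Carrier) N π →
    potential s b x N π ≈ sumFrom (λ i → b ^ i * walkMean s i x π) (suc N) 0
  potential-sum s b x zero    π = ≈-sym (≈-trans (+-identityˡ _) (*-identityˡ _))
  potential-sum s b x (suc N) π = begin-equality
    x π + b * assignMean s π (potential s b x N)
      ≈⟨ +-congˡ (*-congˡ (≈-trans (assignMean-cong s π (potential-sum s b x N)) (assignMean-sum s π (b ^_) (λ i → walkMean s i x) (suc N) 0))) ⟩
    x π + b * sumFrom (λ i → b ^ i * walkMean s (suc i) x π) (suc N) 0
      ≈⟨ +-congˡ (sumFrom-scale b _ (suc N) 0) ⟩
    x π + sumFrom (λ i → b * (b ^ i * walkMean s (suc i) x π)) (suc N) 0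
      ≈⟨ +-congˡ (sumFrom-cong (λ i → ≈-sym (*-assoc b (b ^ i) (walkMean s (suc i) x π))) (suc N) 0) ⟩
    x π + sumFrom (λ i → b ^ suc i * walkMean s (suc i) x π) (suc N) 0
      ≈⟨ +-comm _ _ ⟩
    sumFrom (λ i → b ^ suc i * walkMean s (suc i) x π) (suc N) 0 + x π
      ≈⟨ +-cong (sumFrom-shift (λ i → b ^ i * walkMean s i x π) (suc N) 0) (≈-sym (*-identityˡ (x π))) ⟩
    sumFrom (λ i → b ^ i * walkMean s i x π) (suc N) 1 + 1# * x π ∎

-- Resource bounds

size-clauses : ∀ {n} (L : List (Clause n)) → size (encodeClauses L) ℕ.≤ length L ℕ.* suc (3 ℕ.* n)
size-clauses []      = ℕ.z≤n
size-clauses (C ∷ L) = ℕ.s≤s (ℕ.+-mono-≤ (size-encodePartial C) (size-clauses L))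

-- The extra place makes D, the power of 2 with this exponent, at least 2n. This keeps the rounding
-- of the trial numbers within a factor 2, and D² ≥ 2n² keeps the deviation from uniform choices
-- within a factor 1/2.
precision : ℕ → ℕ
precision n = bitLength n ℕ.+ 1

module Sizes (k v : ℕ) where

  -- Bounds for D, the encoded formula, the environment of a trial, the arguments of the set-up
  -- routines, and B; v is a natural number above the constant b.
  Dp Fp Zp Z₂p Bp : Poly
  Dp  = con 2 ⊗ (con 2 ⊗ X ⊕ con 1)
  Fp  = power k (con 2 ⊗ X ⊕ con 1) ⊗ (con 1 ⊕ con 3 ⊗ X)
  Zp  = con 4 ⊕ (con 1 ⊕ con 3 ⊗ X) ⊕ Fp ⊕ (con 2 ⊗ X ⊕ con 2) ⊕ X ⊕ (X ⊕ con 1) ⊕ Dp ⊗ Dp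
  Z₂p = con 5 ⊕ X ⊕ Dp ⊕ Dp ⊗ con v ⊕ (X ⊕ con 1) ⊕ X ⊕ Zp
  Bp  = con 1 ⊕ Dp ⊗ con v

  precision≤ : ∀ n → precision n ℕ.≤ n ℕ.+ 1
  precision≤ n = ℕ.+-monoˡ-≤ 1 (bitLength≤ n)

  2precision≤ : ∀ n → precision n ℕ.+ precision n ℕ.≤ 2 ℕ.* n ℕ.+ 2
  2precision≤ n = ℕ.≤-trans (ℕ.+-mono-≤ (precision≤ n) (precision≤ n)) (ℕ.≤-reflexive (lem n))
    where
    lem : ∀ n → n ℕ.+ 1 ℕ.+ (n ℕ.+ 1) ≡ 2 ℕ.* n ℕ.+ 2
    lem = solve-∀

  2^precision : ∀ n → 2 ℕ.^ precision n ≡ 2 ℕ.* 2 ℕ.^ bitLength n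
  2^precision n = cong (2 ℕ.^_) (ℕ.+-comm (bitLength n) 1)

  2^precision≤ : ∀ n → 2 ℕ.^ precision n ℕ.≤ eval Dp n
  2^precision≤ n = ℕ.≤-trans (ℕ.≤-reflexive (2^precision n)) (ℕ.*-monoʳ-≤ 2 (2^bitLength≤ n))

  2n≤2^precision : ∀ n → 2 ℕ.* n ℕ.≤ 2 ℕ.^ precision n
  2n≤2^precision n = ℕ.≤-trans (ℕ.*-monoʳ-≤ 2 (ℕ.<⇒≤ (n<2^bitLength n))) (ℕ.≤-reflexive (sym (2^precision n)))

  4^precision : ∀ n → 2 ℕ.^ (precision n ℕ.+ precision n) ≡ 2 ℕ.^ precision n ℕ.* 2 ℕ.^ precision n
  4^precision n = ℕ.^-distribˡ-+-* 2 (precision n) (precision n)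

  4^precision≤Z : ∀ n → 2 ℕ.^ (precision n ℕ.+ precision n) ℕ.≤ eval Zp n
  4^precision≤Z n = ℕ.≤-trans (ℕ.≤-reflexive (4^precision n))
    (ℕ.≤-trans (ℕ.*-mono-≤ (2^precision≤ n) (2^precision≤ n)) (ℕ.m≤n+m (eval (Dp ⊗ Dp) n) _))

  2n²≤4^precision : ∀ n → n ℕ.* n ℕ.* 2 ℕ.≤ 2 ℕ.^ (precision n ℕ.+ precision n)
  2n²≤4^precision n = begin
    n ℕ.* n ℕ.* 2                                  ≤⟨ ℕ.m≤m+n _ (n ℕ.* n ℕ.* 2) ⟩
    n ℕ.* n ℕ.* 2 ℕ.+ n ℕ.* n ℕ.* 2                ≡⟨ lem n ⟩
    2 ℕ.* n ℕ.* (2 ℕ.* n)                          ≤⟨ ℕ.*-mono-≤ (2n≤2^precision n) (2n≤2^precision n) ⟩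
    2 ℕ.^ precision n ℕ.* 2 ℕ.^ precision n        ≡⟨ 4^precision n ⟨
    2 ℕ.^ (precision n ℕ.+ precision n)            ∎
    where
    open ℕ.≤-Reasoning
    lem : ∀ n → n ℕ.* n ℕ.* 2 ℕ.+ n ℕ.* n ℕ.* 2 ≡ 2 ℕ.* n ℕ.* (2 ℕ.* n)
    lem = solve-∀

  n≤4^precision : ∀ n → n ℕ.≤ 2 ℕ.^ (precision n ℕ.+ precision n)
  n≤4^precision n = ℕ.≤-trans (ℕ.≤-trans (ℕ.<⇒≤ (n<2^bitLength n)) (ℕ.^-monoʳ-≤ 2 (ℕ.m≤m+n (bitLength n) 1)))
    (ℕ.^-monoʳ-≤ 2 (ℕ.m≤m+n (precision n) (precision n)))

  3n≤Z : ∀ n → 3 ℕ.* n ℕ.≤ eval Zp n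
  3n≤Z n = ℕ.≤-trans (ℕ.m≤n+m (3 ℕ.* n) 1) (ℕ.≤-trans (ℕ.m≤n+m (1 ℕ.+ 3 ℕ.* n) 4)
    (ℕ.m≤n⇒m≤n+o (eval (Dp ⊗ Dp) n) (ℕ.m≤n⇒m≤n+o (n ℕ.+ 1) (ℕ.m≤n⇒m≤n+o n (ℕ.m≤n⇒m≤n+o (2 ℕ.* n ℕ.+ 2) (ℕ.m≤m+n _ (eval Fp n)))))))

  module _ {m : ℕ} (δ : Digits m) where
    open Programs δ
    open Routines δ

    size-env : ∀ {n} (F : CNF n) → WidthAtMost k F → ∀ fd i → i ℕ.≤ suc n → size (env fd F (precision n ℕ.+ precision n) i) ℕ.≤ eval Zp n
    size-env {n} F w fd i i≤ = begin
      size (env fd F s i)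
        ≡⟨ cong₂ (λ x y → suc (size (encodeFound fd) ℕ.+ suc (size (encodeCNF F) ℕ.+ suc (x ℕ.+ suc y)))) (size-un s) (cong₂ ℕ._+_ (size-un n) (size-un i)) ⟩
      suc (size (encodeFound fd) ℕ.+ suc (size (encodeCNF F) ℕ.+ suc (s ℕ.+ suc (n ℕ.+ i))))
        ≡⟨ lem (size (encodeFound fd)) (size (encodeCNF F)) s n i ⟩
      4 ℕ.+ size (encodeFound fd) ℕ.+ size (encodeCNF F) ℕ.+ s ℕ.+ n ℕ.+ i
        ≤⟨ ℕ.+-mono-≤ (ℕ.+-monoˡ-≤ n (ℕ.+-mono-≤ (ℕ.+-mono-≤ (ℕ.+-monoʳ-≤ 4 (found fd)) formula) (2precision≤ n))) (ℕ.≤-trans i≤ (ℕ.≤-reflexive (ℕ.+-comm 1 n))) ⟩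
      4 ℕ.+ (1 ℕ.+ 3 ℕ.* n) ℕ.+ eval Fp n ℕ.+ (2 ℕ.* n ℕ.+ 2) ℕ.+ n ℕ.+ (n ℕ.+ 1)
        ≤⟨ ℕ.m≤m+n _ (eval (Dp ⊗ Dp) n) ⟩
      eval Zp n ∎
      where
      open ℕ.≤-Reasoning
      s = precision n ℕ.+ precision n
      lem : ∀ a b s n i → 1 ℕ.+ (a ℕ.+ (1 ℕ.+ (b ℕ.+ (1 ℕ.+ (s ℕ.+ (1 ℕ.+ (n ℕ.+ i))))))) ≡ 4 ℕ.+ a ℕ.+ b ℕ.+ s ℕ.+ n ℕ.+ i
      lem = solve-∀
      found : ∀ fd → size (encodeFound fd) ℕ.≤ 1 ℕ.+ 3 ℕ.* n
      found nothing  = ℕ.z≤n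
      found (just α) = ℕ.s≤s (size-encodePartial (total α))
      formula : size (encodeCNF F) ℕ.≤ eval Fp n
      formula = ℕ.≤-trans (size-clauses (clauses F)) (ℕ.*-monoˡ-≤ (suc (3 ℕ.* n))
        (ℕ.≤-trans (#clauses≤ k F w) (ℕ.≤-reflexive (sym (eval-power k (con 2 ⊗ X ⊕ con 1) n)))))

    size-setup : ∀ n (digitsTo : ℕ → ℕ) → (∀ i → digitsTo i ℕ.≤ 2 ℕ.^ i ℕ.* v) → ∀ x i → x ℕ.≤ n → i ℕ.≤ precision n →
      2 ℕ.+ size (setupState x (2 ℕ.^ i) (digitsTo i) i) ℕ.+ n ℕ.+ eval Zp n ℕ.≤ eval Z₂p n
    size-setup n digitsTo digits≤ x i x≤n i≤ = begin
      2 ℕ.+ size (setupState x (2 ℕ.^ i) (digitsTo i) i) ℕ.+ n ℕ.+ eval Zp n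
        ≡⟨ cong (λ z → 2 ℕ.+ z ℕ.+ n ℕ.+ eval Zp n) (cong₂ (λ y z → suc (y ℕ.+ suc z)) (size-un x)
             (cong₂ (λ y z → y ℕ.+ suc z) (size-un (2 ℕ.^ i)) (cong₂ ℕ._+_ (size-un (digitsTo i)) (size-un i)))) ⟩
      2 ℕ.+ suc (x ℕ.+ suc (2 ℕ.^ i ℕ.+ suc (digitsTo i ℕ.+ i))) ℕ.+ n ℕ.+ eval Zp n
        ≡⟨ lem x (2 ℕ.^ i) (digitsTo i) i n (eval Zp n) ⟩
      5 ℕ.+ x ℕ.+ 2 ℕ.^ i ℕ.+ digitsTo i ℕ.+ i ℕ.+ n ℕ.+ eval Zp n
        ≤⟨ ℕ.+-monoˡ-≤ (eval Zp n) (ℕ.+-monoˡ-≤ n (ℕ.+-mono-≤ (ℕ.+-mono-≤ (ℕ.+-mono-≤ (ℕ.+-monoʳ-≤ 5 x≤n) 2^i≤)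
             (ℕ.≤-trans (digits≤ i) (ℕ.*-monoˡ-≤ v 2^i≤))) (ℕ.≤-trans i≤ (precision≤ n)))) ⟩
      eval Z₂p n ∎
      where
      open ℕ.≤-Reasoning
      2^i≤ : 2 ℕ.^ i ℕ.≤ eval Dp n
      2^i≤ = ℕ.≤-trans (ℕ.^-monoʳ-≤ 2 i≤) (2^precision≤ n)
      lem : ∀ x a b i n z → 2 ℕ.+ (1 ℕ.+ (x ℕ.+ (1 ℕ.+ (a ℕ.+ (1 ℕ.+ (b ℕ.+ i)))))) ℕ.+ n ℕ.+ z ≡ 5 ℕ.+ x ℕ.+ a ℕ.+ b ℕ.+ i ℕ.+ n ℕ.+ z
      lem = solve-∀

-- Assembly of the bounds

module Final {c ℓ₁ ℓ₂} (R : ArchimedeanOrderedField c ℓ₁ ℓ₂) (k : ℕ)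
  (p q c* a b : ArchimedeanOrderedField.Carrier R) where
  open FieldProperties R
  open Mean R
  open Quantities R
  open Failure R
  open Series R
  open Probability R
  open Min totalOrder using (x⊓y≤x; x⊓y≤y; ⊓-glb)
  open Max totalOrder using (x≤x⊔y; x≤y⊔x)
  open PosetReasoning poset

  params : Vec Carrier 5
  params = p ∷ q ∷ c* ∷ a ∷ b ∷ []

  δ : Digits 5
  δ = digitsOf params

  j : Fin 5
  j = suc (suc (suc (suc zero)))

  open Programs δ
  open Routines δ
  open WalkValue R δ
  open Potential R δ
  open PotentialSeries R δ

  digitsTo : ℕ → ℕ
  digitsTo i = floor (2# ^ i * b)

  bN : ℕ
  bN = proj₁ (archimedean b)

  open Sizes k bN

  μ M : Carrier
  μ = min p q
  M = max a b

  module Hypotheses (0≤p : 0# ≤ p) (p≤1 : p ≤ 1#) (0≤q : 0# ≤ q) (q≤1 : q ≤ 1#) (0≤c* : 0# ≤ c*) (c*≤1 : c* ≤ 1#)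
    (1≤a : 1# ≤ a) (1≤b : 1# ≤ b) (q/b : q / b ≈ 1# - c* / 2#) where

    0≤b : 0# ≤ b
    0≤b = ≤-trans 0≤1 1≤b

    0≤2^b : ∀ i → 0# ≤ 2# ^ i * b
    0≤2^b i = *-nonNegative (≤-trans 0≤1 (1≤^ i 1≤2)) 0≤b

    digitsTo-suc : ∀ i → digitsTo (suc i) ≡ bitValue (δ j (suc i)) ℕ.+ (digitsTo i ℕ.+ digitsTo i)
    digitsTo-suc i = trans (parity (digitsTo i) (digitsTo (suc i)) (proj₁ bounds) (proj₂ bounds))
        (cong (ℕ._+ (digitsTo i ℕ.+ digitsTo i)) (value (δ j (suc i))))
      where
      bounds = floor-double (2# ^ i * b) (0≤2^b i) (2# ^ suc i * b) (*-assoc 2# (2# ^ i) b)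
      value : ∀ d → (if d then 1 else 0) ≡ bitValue d
      value true  = refl
      value false = refl

    digitsTo≤ : ∀ i → digitsTo i ℕ.≤ 2 ℕ.^ i ℕ.* bN
    digitsTo≤ i = fromℕ-cancel-≤ (digitsTo i) (2 ℕ.^ i ℕ.* bN) (begin
      fromℕ (digitsTo i)               ≤⟨ floor-≤ (2# ^ i * b) (0≤2^b i) ⟩
      2# ^ i * b                       ≤⟨ *-monoʳ-≤ (≤-trans 0≤1 (1≤^ i 1≤2)) (proj₂ (archimedean b)) ⟩
      2# ^ i * fromℕ bN                ≈⟨ *-congʳ (2^-fromℕ i) ⟨
      fromℕ (2 ℕ.^ i) * fromℕ bN       ≈⟨ fromℕ-* (2 ℕ.^ i) bN ⟨
      fromℕ (2 ℕ.^ i ℕ.* bN)           ∎)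

    0≤μ : 0# ≤ μ
    0≤μ = ⊓-glb 0≤p 0≤q

    μ≤p : μ ≤ p
    μ≤p = x⊓y≤x p q

    μ≤1 : μ ≤ 1#
    μ≤1 = ≤-trans μ≤p p≤1

    ρ : Carrier
    ρ = q / b

    ρ-def : ρ + c* / 2# ≈ 1#
    ρ-def = ≈-trans (+-congʳ q/b) (-‿cancelʳ 1# (c* / 2#))

    b≉0 : ¬ (b ≈ 0#)
    b≉0 = 1≤⇒≉0 1≤b

    0≤ρ : 0# ≤ ρ
    0≤ρ = *-nonNegative 0≤q (⁻¹-nonNegative 0≤b b≉0)

    μ≤bρ : μ ≤ b * ρ
    μ≤bρ = ≤-trans (x⊓y≤y p q) (≤-reflexive (≈-sym (≈-trans (*-comm b ρ) (x/y*y q b≉0))))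

    0≤a : 0# ≤ a
    0≤a = ≤-trans 0≤1 1≤a

    0≤M : 0# ≤ M
    0≤M = ≤-trans 0≤a (x≤x⊔y a b)

    -- n / 2ˢ bounds the deviation of the random choices from the uniform distribution.
    module Deviation (n : ℕ) where
      s = precision n ℕ.+ precision n
      w = 2# ^ s
      y κ : Carrier
      y = fromℕ n / w
      κ = 1# - y

      w≉0 : ¬ (w ≈ 0#)
      w≉0 = 2^-nonZero s

      0≤w : 0# ≤ w
      0≤w = ≤-trans 0≤1 (1≤^ s 1≤2)

      0≤y : 0# ≤ y
      0≤y = *-nonNegative (0≤fromℕ n) (⁻¹-nonNegative 0≤w w≉0)

      κ+y : κ + y ≈ 1#
      κ+y = -‿cancelʳ 1# y

      κ-def : κ * w + fromℕ n ≈ w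
      κ-def = ≈-trans (+-congˡ (≈-sym (x/y*y (fromℕ n) w≉0))) (≈-trans (≈-sym (distribʳ w κ y)) (≈-trans (*-congʳ κ+y) (*-identityˡ w)))

      0≤κ : 0# ≤ κ
      0≤κ = 0≤y-x (/-mono 0≤w w≉0 (≤-trans (fromℕ-mono (n≤4^precision n)) (≤-reflexive (≈-trans (2^-fromℕ s) (≈-sym (*-identityˡ w))))))

      κ≤1 : κ ≤ 1#
      κ≤1 = ≤-trans (x≤x+y 0≤y) (≤-reflexive κ+y)

      ny≤½ : fromℕ n * y ≤ ½
      ny≤½ = *-cancelʳ-≤ 0≤w w≉0 (*-cancelʳ-≤ 0≤2 2≉0 (begin
        fromℕ n * y * w * 2#            ≈⟨ *-congʳ (≈-trans (*-assoc _ _ _) (*-congˡ (x/y*y (fromℕ n) w≉0))) ⟩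
        fromℕ n * fromℕ n * 2#          ≈⟨ ≈-trans (fromℕ-* (n ℕ.* n) 2) (*-congʳ (fromℕ-* n n)) ⟨
        fromℕ (n ℕ.* n ℕ.* 2)           ≤⟨ fromℕ-mono (2n²≤4^precision n) ⟩
        fromℕ (2 ℕ.^ s)                 ≈⟨ 2^-fromℕ s ⟩
        w                               ≈⟨ *-identityˡ w ⟨
        1# * w                          ≈⟨ *-congʳ ½*2 ⟨
        ½ * 2# * w                      ≈⟨ solve 3 (λ h t w → h :* t :* w := h :* w :* t) ≈-refl ½ 2# w ⟩
        ½ * w * 2#                      ∎))

      ½≤κ^n : ½ ≤ κ ^ n
      ½≤κ^n = +-cancelʳ-≤ ½ (begin
        ½ + ½                      ≈⟨ ≈-trans (x+x≈2x ½) (≈-trans (*-comm 2# ½) ½*2) ⟩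
        1#                         ≤⟨ bernoulli n 0≤κ 0≤y κ+y ⟩
        κ ^ n + fromℕ n * y        ≤⟨ +-monoʳ-≤ _ ny≤½ ⟩
        κ ^ n + ½                  ∎)

    module Combined (A : Program 5) (fA : ℕ → ℕ)
      (timeA : ∀ {n} (F : CNF n) → WidthAtMost k F → ∃[ T ] (HaltsWithin δ A F T × fromℕ T ≤ a ^ n * 2# ^ fA n))
      (gA : ℕ → ℕ)
      (probA : ∀ {n} (F : CNF n) → WidthAtMost k F → Satisfiable F → c* ≤ criticalFraction F →
               ∀ T → HaltsWithin δ A F T → p ^ n * ½ ^ gA n ≤ Pr (findsSolution? {T = T} δ A F)) where

      open Machine δ A using (S; callOverhead)
      open Algorithm δ A j

      A′ : Program 5
      A′ = main (digitsTo 1)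

      f̃ g̃ : ℕ → ℕ
      f̃ = runningMax fA
      g̃ = runningMax gA

      -- The times of the trial routines and of the set-up routines, the overhead of a trial within
      -- a phase, the overhead outside the phase bodies, and the product of all polynomial factors
      -- in the running time.
      τp τ₂p Wp Vp Tp : Poly
      τp  = routineTime ⊚ (con 4 ⊕ con 4 ⊗ Zp)
      τ₂p = setupTime (digitsTo 1) ⊚ Z₂p
      Wp  = con 30 ⊕ (X ⊗ (con 5 ⊕ ((con 2 ⊗ X ⊕ con 2) ⊗ (con 15 ⊕ τp) ⊕ (con 17 ⊕ con 2 ⊗ τp))) ⊕
                      (con 21 ⊕ con 3 ⊗ τp ⊕ con callOverhead ⊕ X ⊗ con 7)) ⊕ (Dp ⊗ con 6 ⊕ Bp ⊗ con 6)
      Vp  = con 24 ⊕ X ⊗ (con 7 ⊕ τ₂p) ⊕ (con 1 ⊕ X) ⊗ con 5 ⊕ con 3 ⊗ τ₂p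
      Tp  = con 2 ⊗ (con 1 ⊕ X ⊗ Bp) ⊗ (con 1 ⊕ Wp) ⊗ (con 1 ⊕ X ⊕ Vp)

      module PerFormula {n : ℕ} (F : CNF n) (width≤k : WidthAtMost k F) where
        s Z τ d B τ₂ Z₂ : ℕ
        s  = precision n ℕ.+ precision n
        Z  = eval Zp n
        τ  = eval τp n
        d  = ℕ.pred (2 ℕ.^ precision n)
        B  = suc (digitsTo (precision n))
        τ₂ = eval τ₂p n
        Z₂ = eval Z₂p n

        1+d≡ : suc d ≡ 2 ℕ.^ precision n
        1+d≡ = ℕ.suc-pred (2 ℕ.^ precision n) {{ℕ.>-nonZero (ℕ.m^n>0 2 (precision n))}}

        routine≤ : eval routineTime (4 ℕ.+ 4 ℕ.* Z) ℕ.≤ τ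
        routine≤ = ℕ.≤-reflexive (sym (eval-⊚ routineTime (con 4 ⊕ con 4 ⊗ Zp) n))

        setup≤ : eval (setupTime (digitsTo 1)) Z₂ ℕ.≤ τ₂
        setup≤ = ℕ.≤-reflexive (sym (eval-⊚ (setupTime (digitsTo 1)) Z₂p n))

        -- After i steps at most n - i variables are left, and a ≥ 1. This saving is what balances
        -- the bⁱ trials of phase i.
        U : ℕ → ℕ
        U i = floor (a ^ (n ℕ.∸ i) * 2# ^ f̃ n)

        open Main R δ A j (solved F)
        open Phases F s Z (size-env δ F width≤k) (3n≤Z n) (4^precision≤Z n) τ routine≤ d B using (hitValue; phaseTime; phaseOverhead; phaseTime-bound)
        open Correctness.Trials R δ A j (solved F) F s Z (size-env δ F width≤k) (3n≤Z n) (4^precision≤Z n) τ routine≤ using (HaltsOn; output; candidate)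

        P : ℕ
        P = runningMax (λ i → phaseTime (U i) (tokens d B i)) n

        open Body F (digitsTo 1) Z τ d P τ₂ Z₂ digitsTo refl digitsTo-suc

        Good : Partial n → Set ℓ₂
        Good π = Sat F π × c* ≤ criticalFraction (Restriction.restrict F π)

        good? : ∀ π → Dec (Good π)
        good? π = sat? F π ×-dec (c* ≤? criticalFraction (Restriction.restrict F π))

        vars : Partial n → ℕ
        vars π = cnt (live π (clauses F))

        goodValue : Partial n → Carrier
        goodValue π = p ^ vars π * ½ ^ gA (vars π)

        -- The guaranteed part of the success probability of the call, set to 0 where the hypothesis
        -- on 𝒜 gives no guarantee.
        x : Partial n → Carrier
        x π = flag (good? π) * goodValue π

        flag-*-≤ : ∀ {ℓ} {Q : Set ℓ} (Q? : Dec Q) {u v} → 0# ≤ u → (Q → v ≤ u) → flag Q? * v ≤ u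
        flag-*-≤ (yes h) 0≤u v≤u = ≤-trans (≤-reflexive (*-identityˡ _)) (v≤u h)
        flag-*-≤ (no _)  0≤u v≤u = ≤-trans (≤-reflexive (zeroˡ _)) 0≤u

        ≤-flag-* : ∀ {ℓ} {Q : Set ℓ} (Q? : Dec Q) {v} → Q → v ≤ flag Q? * v
        ≤-flag-* (yes _) h = ≤-reflexive (≈-sym (*-identityˡ _))
        ≤-flag-* (no ¬h) h = ⊥-elim (¬h h)

        0≤goodValue : ∀ π → 0# ≤ goodValue π
        0≤goodValue π = *-nonNegative (^-nonNegative (vars π) 0≤p) (^-nonNegative (gA (vars π)) 0≤½)

        goodValue≤1 : ∀ π → goodValue π ≤ 1#
        goodValue≤1 π = ≤-trans (*-mono-≤ (^-nonNegative (vars π) 0≤p) 0≤1 (^≤1 (vars π) 0≤p p≤1) (^≤1 (gA (vars π)) 0≤½ ½≤1)) (≤-reflexive (*-identityˡ 1#))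

        0≤x : ∀ π → 0# ≤ x π
        0≤x π = *-nonNegative (0≤flag (good? π)) (0≤goodValue π)

        x≤1 : ∀ π → x π ≤ 1#
        x≤1 π = flag-*-≤ (good? π) 0≤1 (λ _ → goodValue≤1 π)

        0≤hit : ∀ h → 0# ≤ (if h then 1# else 0#)
        0≤hit true  = 0≤1
        0≤hit false = ≤-refl

        -- A solution of the restriction, merged with the values fixed by π, satisfies F and
        -- therefore passes the check of the trial.
        hit-solution : ∀ π out β → β ⊨ Restriction.restrict F π → out ≡ encodeAssignment β → 1# ≤ hitValue π out
        hit-solution π out β β⊨ out≡ = ≤-reflexive (≈-reflexive (sym (cong (λ h → if h then 1# else 0#) hit)))
          where
          candidate≡ : candidate π out ≡ merge (live π (clauses F)) (fill π) β
          candidate≡ = cong (merge (live π (clauses F)) (fill π)) (trans (cong (readBits (vars π)) out≡) (readBits-encode β))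
          hit : allHit (clauses F) (total (candidate π out)) ≡ true
          hit = trans (cong (λ α → allHit (clauses F) (total α)) candidate≡)
            (allHit-complete (clauses F) (merge (live π (clauses F)) (fill π) β) (Restriction.merge-sat F π {fill π} {β} (extends-fill π) β⊨))

        vars≤ : ∀ π → vars π ℕ.≤ unset π
        vars≤ π = cnt-live π (clauses F)

        spec : ∀ π i → unset π ℕ.+ i ≡ n → ∃[ T ] (HaltsOn π T × T ℕ.≤ U i × x π ≤ mean T (λ ω → hitValue π (output π ω)))
        spec π i eq = T , halting , T≤U , x≤
          where
          G = Restriction.restrict F π
          widthG = Restriction.restrict-width F π k width≤k
          T = proj₁ (timeA G widthG)
          halting = proj₁ (proj₂ (timeA G widthG))
          vars≤n-i : vars π ℕ.≤ n ℕ.∸ i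
          vars≤n-i = ℕ.≤-trans (vars≤ π) (ℕ.≤-reflexive (trans (sym (ℕ.m+n∸n≡m (unset π) i)) (cong (ℕ._∸ i) eq)))
          T≤U : T ℕ.≤ U i
          T≤U = ≤-floor _ T (≤-trans (proj₂ (proj₂ (timeA G widthG)))
            (*-mono-≤ (^-nonNegative (vars π) 0≤a) (^-nonNegative (f̃ n) 0≤2) (^-monoʳ-≤ 1≤a vars≤n-i)
              (^-monoʳ-≤ 1≤2 (≤-runningMax fA (ℕ.≤-trans vars≤n-i (ℕ.m∸n≤m n i))))))
          x≤ : x π ≤ mean T (λ ω → hitValue π (output π ω))
          x≤ = flag-*-≤ (good? π) (≤-mean T (λ ω → 0≤hit _)) λ (sat , c*≤) → begin
            goodValue π                                          ≤⟨ probA G widthG (Restriction.satisfiable-restrict F π sat) c*≤ T halting ⟩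
            Pr (findsSolution? {T = T} δ A G)                    ≈⟨ Pr≈mean (findsSolution? {T = T} δ A G) ⟩
            mean T (λ ω → flag (findsSolution? δ A G ω))         ≤⟨ mean-mono T (λ ω → flag-≤ (findsSolution? δ A G ω) (0≤hit _)
                                                                      (λ (_ , β , β⊨ , out≡) → hit-solution π (output π ω) β β⊨ out≡)) ⟩
            mean T (λ ω → hitValue π (output π ω))               ∎

        phaseTime≤P : ∀ i → i ℕ.≤ n → phaseTime (U i) (tokens d B i) ℕ.≤ P
        phaseTime≤P i i≤n = ≤-runningMax (λ i → phaseTime (U i) (tokens d B i)) i≤n

        successValue : Carrier
        successValue = success (size-env δ F width≤k) (3n≤Z n) (4^precision≤Z n) routine≤ 1+d≡
          (size-setup δ n digitsTo digitsTo≤) setup≤ x x≤1 U spec phaseTime≤P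

        reach : Execution.Reach R δ A (solved F) (6 ℕ.+ bodyTime) (initial A′ (encodeCNF F)) successValue
        reach = main-reach (size-env δ F width≤k) (3n≤Z n) (4^precision≤Z n) routine≤ 1+d≡
          (size-setup δ n digitsTo digitsTo≤) setup≤ x x≤1 U spec phaseTime≤P
          (λ t → 0≤flag (solution? F t)) (λ α α⊨ → 1≤flag (solution? F (encodeAssignment α)) (α , α⊨ , refl))

        open Deviation n hiding (s; w; y; κ)
        private
          κ : Carrier
          κ = Deviation.κ n

          D : Carrier
          D = fromℕ (suc d)

          D≈ : D ≈ 2# ^ precision n
          D≈ = ≈-trans (≈-reflexive (cong fromℕ 1+d≡)) (2^-fromℕ (precision n))

          bD≤B : b * D ≤ fromℕ B
          bD≤B = ≤-trans (≤-reflexive (≈-trans (*-congˡ D≈) (*-comm _ _))) (<-1+floor (2# ^ precision n * b))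

          B≤bD+1 : fromℕ B ≤ b * D + 1#
          B≤bD+1 = ≤-trans (+-monoʳ-≤ 1# (floor-≤ (2# ^ precision n * b) (0≤2^b (precision n))))
            (≤-reflexive (≈-trans (+-comm 1# _) (+-congʳ (≈-trans (*-comm _ _) (*-congˡ (≈-sym D≈))))))

          h : Carrier
          h = ½ ^ g̃ n

          0≤h : 0# ≤ h
          0≤h = ^-nonNegative (g̃ n) 0≤½

        -- The restriction may have fewer variables than π leaves open; since p ≤ 1, a smaller
        -- exponent only increases the guarantee. The bound on the open variables lets the running
        -- maximum at n take over the error term.
        x-lower : ∀ π → Sat F π → c* ≤ criticalFraction (Restriction.restrict F π) → unset π ℕ.≤ n → h * μ ^ unset π ≤ x π
        x-lower π sat c*≤ unset≤n = ≤-trans (begin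
          h * μ ^ unset π                          ≈⟨ *-comm _ _ ⟩
          μ ^ unset π * h                          ≤⟨ *-mono-≤ (^-nonNegative (unset π) 0≤μ) (^-nonNegative (gA (vars π)) 0≤½)
                                                       (≤-trans (^-mono-≤ (unset π) 0≤μ μ≤p) (^-antiʳ-≤ 0≤p p≤1 (vars≤ π)))
                                                       (^-antiʳ-≤ 0≤½ ½≤1 (≤-runningMax gA (ℕ.≤-trans (vars≤ π) unset≤n))) ⟩
          goodValue π                              ∎) (≤-flag-* (good? π) (sat , c*≤))

        trialMean : ℕ → Carrier
        trialMean i = walkMean s i x (blank n)

        y : Carrier
        y = h * (κ * μ) ^ n

        -- The potential counts bⁱ trials in phase i, and the actual number is at least that.
        y≤sum : Satisfiable F → y ≤ sumFrom (λ i → fromℕ (tokens d B i) * trialMean i) (suc n) 0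
        y≤sum (α , α⊨) = begin
          y
            ≤⟨ potential-bound F s 0≤c* c*≤1 0≤ρ ρ-def κ-def 0≤b 0≤μ 0≤h 0≤κ κ≤1 μ≤bρ x 0≤x
                 (λ π sat c*≤ → x-lower π sat c*≤ (unset≤ π)) n (blank n) (unset-blank n) ℕ.≤-refl (α , α⊨ , extends-blank α) ⟩
          potential s b x n (blank n)
            ≈⟨ potential-sum s b x n (blank n) ⟩
          sumFrom (λ i → b ^ i * trialMean i) (suc n) 0
            ≤⟨ sumFrom-mono (λ i → *-monoˡ-≤ (≤-walkMean s i {x} (blank n) 0≤x) (tokens-lower 1≤b d B bD≤B B≤bD+1 i)) (suc n) 0 ⟩
          sumFrom (λ i → fromℕ (tokens d B i) * trialMean i) (suc n) 0 ∎
          where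
          unset≤ : ∀ {k} (π : Partial k) → unset π ℕ.≤ k
          unset≤ []            = ℕ.z≤n
          unset≤ (nothing ∷ π) = ℕ.s≤s (unset≤ π)
          unset≤ (just _ ∷ π)  = ℕ.≤-trans (unset≤ π) (ℕ.n≤1+n _)

        0≤miss : ∀ i → 0# ≤ 1# - trialMean i
        0≤miss i = 0≤y-x (walkMean-≤ s i {x} (blank n) x≤1)

        y≤success : Satisfiable F → ½ * y ≤ successValue
        y≤success sat = success-bound (0≤failChain 0≤miss (tokens d B) (suc n) 0)
          (failChain-bound 0≤miss (λ i → ≤-walkMean s i {x} (blank n) 0≤x) (λ i → -‿cancelʳ 1# (trialMean i)) (tokens d B) (suc n) 0)
          (*-nonNegative 0≤h (^-nonNegative n 0≤κμ))
          (≤-trans (*-mono-≤ 0≤h 0≤1 (^≤1 (g̃ n) 0≤½ ½≤1) (^≤1 n 0≤κμ (≤-trans (*-mono-≤ 0≤κ 0≤1 κ≤1 μ≤1) (≤-reflexive (*-identityˡ 1#))))) (≤-reflexive (*-identityˡ 1#)))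
          (y≤sum sat)
          where
          0≤κμ : 0# ≤ κ * μ
          0≤κμ = *-nonNegative 0≤κ 0≤μ

        -- The two additional factors 1/2 come from turning the expected number of successes into a
        -- probability and from κⁿ ≥ 1/2.
        success-lower : Satisfiable F → μ ^ n * ½ ^ (2 ℕ.+ g̃ n) ≤ successValue
        success-lower sat = ≤-trans (begin
          μ ^ n * (½ * (½ * h))            ≈⟨ solve 3 (λ m g h → m :* (g :* (g :* h)) := g :* (h :* (g :* m))) ≈-refl (μ ^ n) ½ h ⟩
          ½ * (h * (½ * μ ^ n))            ≤⟨ *-monoʳ-≤ 0≤½ (*-monoʳ-≤ 0≤h (*-monoˡ-≤ (^-nonNegative n 0≤μ) ½≤κ^n)) ⟩
          ½ * (h * (κ ^ n * μ ^ n))        ≈⟨ *-congˡ (*-congˡ (^-distrib-* κ μ n)) ⟨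
          ½ * y                            ∎) (y≤success sat)

        private
          Q V : ℕ
          Q = 2 ℕ.* suc (n ℕ.* B) ℕ.* (1 ℕ.+ phaseOverhead)
          V = 24 ℕ.+ n ℕ.* (7 ℕ.+ τ₂) ℕ.+ suc n ℕ.* 5 ℕ.+ 3 ℕ.* τ₂

          E v : Carrier
          E = 2# ^ f̃ n
          v = M ^ n * E * fromℕ Q

          1≤E : 1# ≤ E
          1≤E = 1≤^ (f̃ n) 1≤2

          0≤E : 0# ≤ E
          0≤E = ≤-trans 0≤1 1≤E

          1≤v : 1# ≤ v
          1≤v = ≤-trans (≤-reflexive (≈-sym (≈-trans (*-identityʳ _) (*-identityˡ 1#)))) (*-mono-≤ (≤-trans 0≤1 (≤-reflexive (≈-sym (*-identityˡ 1#)))) (0≤fromℕ Q)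
            (*-mono-≤ 0≤1 0≤E (1≤^ n (≤-trans 1≤a (x≤x⊔y a b))) 1≤E)
            (1≤fromℕ {Q} (ℕ.*-mono-≤ {1} {2 ℕ.* suc (n ℕ.* B)} {1} (ℕ.s≤s ℕ.z≤n) (ℕ.s≤s ℕ.z≤n))))

          2n≤ : 2 ℕ.* n ℕ.≤ suc (suc d)
          2n≤ = ℕ.≤-trans (2n≤2^precision n) (ℕ.≤-trans (ℕ.≤-reflexive (sym 1+d≡)) (ℕ.n≤1+n _))

        -- Phase i makes about bⁱ trials, each costing about a^(n-i); the product is at most the
        -- n-th power of the larger base.
        one-phase-bound : ∀ i → i ℕ.≤ n → fromℕ (phaseTime (U i) (tokens d B i)) ≤ v
        one-phase-bound i i≤n = begin
          fromℕ (phaseTime (U i) t)                              ≤⟨ fromℕ-mono (phaseTime-bound (U i) t (1≤tokens d B i (ℕ.s≤s ℕ.z≤n))) ⟩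
          fromℕ (t ℕ.* (U i ℕ.+ W))                              ≈⟨ ≈-trans (fromℕ-* t (U i ℕ.+ W)) (*-congˡ (fromℕ-+ (U i) W)) ⟩
          fromℕ t * (fromℕ (U i) + fromℕ W)                      ≤⟨ *-monoʳ-≤ (0≤fromℕ t) (+-mono-≤ (floor-≤ aE 0≤aE) (≤-trans (≤-reflexive (≈-sym (*-identityˡ _))) (*-monoˡ-≤ (0≤fromℕ W) 1≤aE))) ⟩
          fromℕ t * (aE + aE * fromℕ W)                          ≈⟨ *-congˡ (≈-trans (+-congʳ (≈-sym (*-identityʳ aE))) (≈-sym (distribˡ aE 1# (fromℕ W)))) ⟩
          fromℕ t * (aE * fromℕ (1 ℕ.+ W))                       ≤⟨ *-monoˡ-≤ (*-nonNegative 0≤aE (0≤fromℕ (1 ℕ.+ W))) (tokens-upper 1≤b d B bD≤B B≤bD+1 n i i≤n 2n≤) ⟩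
          b ^ i * C * (a ^ (n ℕ.∸ i) * E * fromℕ (1 ℕ.+ W))      ≈⟨ solve 5 (λ x c y e w → x :* c :* (y :* e :* w) := x :* y :* e :* (c :* w)) ≈-refl (b ^ i) C (a ^ (n ℕ.∸ i)) E (fromℕ (1 ℕ.+ W)) ⟩
          b ^ i * a ^ (n ℕ.∸ i) * E * (C * fromℕ (1 ℕ.+ W))      ≈⟨ *-congˡ (fromℕ-* (2 ℕ.* suc (n ℕ.* B)) (1 ℕ.+ W)) ⟨
          b ^ i * a ^ (n ℕ.∸ i) * E * fromℕ Q                    ≤⟨ *-monoˡ-≤ (0≤fromℕ Q) (*-monoˡ-≤ 0≤E (*-mono-≤ (^-nonNegative i 0≤b) (^-nonNegative (n ℕ.∸ i) 0≤M)
                                                                      (^-mono-≤ i 0≤b (x≤y⊔x a b)) (^-mono-≤ (n ℕ.∸ i) 0≤a (x≤x⊔y a b)))) ⟩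
          M ^ i * M ^ (n ℕ.∸ i) * E * fromℕ Q                    ≈⟨ *-congʳ (*-congʳ (^-homo-* M i (n ℕ.∸ i))) ⟨
          M ^ (i ℕ.+ (n ℕ.∸ i)) * E * fromℕ Q                    ≡⟨ cong (λ l → M ^ l * E * fromℕ Q) (ℕ.m+[n∸m]≡n i≤n) ⟩
          v                                                      ∎
          where
          t = tokens d B i
          W = phaseOverhead
          aE = a ^ (n ℕ.∸ i) * E
          C = fromℕ (2 ℕ.* suc (n ℕ.* B))
          1≤aE : 1# ≤ aE
          1≤aE = ≤-trans (≤-reflexive (≈-sym (*-identityˡ 1#))) (*-mono-≤ 0≤1 0≤E (1≤^ (n ℕ.∸ i) 1≤a) 1≤E)
          0≤aE : 0# ≤ aE
          0≤aE = ≤-trans 0≤1 1≤aE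

        fromℕ-runningMax : ∀ f N {u} → (∀ i → i ℕ.≤ N → fromℕ (f i) ≤ u) → fromℕ (runningMax f N) ≤ u
        fromℕ-runningMax f zero    h = h 0 ℕ.z≤n
        fromℕ-runningMax f (suc N) {u} h with ℕ.⊔-sel (f (suc N)) (runningMax f N)
        ... | inj₁ eq = ≤-trans (≤-reflexive (≈-reflexive (cong fromℕ eq))) (h (suc N) ℕ.≤-refl)
        ... | inj₂ eq = ≤-trans (≤-reflexive (≈-reflexive (cong fromℕ eq))) (fromℕ-runningMax f N (λ i i≤ → h i (ℕ.≤-trans i≤ (ℕ.n≤1+n N))))

        time-poly : Q ℕ.* (suc n ℕ.+ V) ℕ.≤ eval Tp n
        time-poly = ℕ.*-monoˡ-≤ (suc n ℕ.+ V) (ℕ.*-mono-≤ (ℕ.*-monoʳ-≤ 2 (ℕ.s≤s (ℕ.*-monoʳ-≤ n B≤))) (ℕ.s≤s W≤))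
          where
          B≤ : B ℕ.≤ eval Bp n
          B≤ = ℕ.s≤s (ℕ.≤-trans (digitsTo≤ (precision n)) (ℕ.*-monoˡ-≤ bN (2^precision≤ n)))
          W≤ : phaseOverhead ℕ.≤ eval Wp n
          W≤ = ℕ.+-mono-≤
            (ℕ.+-monoʳ-≤ 30 (ℕ.+-monoˡ-≤ _ (ℕ.*-monoʳ-≤ n (ℕ.+-monoʳ-≤ 5 (ℕ.+-monoˡ-≤ (17 ℕ.+ 2 ℕ.* τ) (ℕ.*-monoˡ-≤ (15 ℕ.+ τ) (2precision≤ n)))))))
            (ℕ.+-mono-≤ (ℕ.*-monoˡ-≤ 6 (ℕ.≤-trans (ℕ.≤-reflexive 1+d≡) (2^precision≤ n))) (ℕ.*-monoˡ-≤ 6 B≤))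

        time-bound : fromℕ (6 ℕ.+ bodyTime) ≤ M ^ n * E * fromℕ (eval Tp n)
        time-bound = begin
          fromℕ (6 ℕ.+ bodyTime)                                 ≡⟨ cong fromℕ bodyTime-linear ⟩
          fromℕ (suc n ℕ.* P ℕ.+ V)                              ≈⟨ ≈-trans (fromℕ-+ (suc n ℕ.* P) V) (+-congʳ (fromℕ-* (suc n) P)) ⟩
          fromℕ (suc n) * fromℕ P + fromℕ V                      ≤⟨ +-mono-≤ (*-monoʳ-≤ (0≤fromℕ (suc n)) (fromℕ-runningMax _ n one-phase-bound))
                                                                      (≤-trans (≤-reflexive (≈-sym (*-identityˡ _))) (*-monoˡ-≤ (0≤fromℕ V) 1≤v)) ⟩
          fromℕ (suc n) * v + v * fromℕ V                        ≈⟨ ≈-trans (+-congʳ (*-comm _ v)) (≈-sym (distribˡ v _ _)) ⟩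
          v * (fromℕ (suc n) + fromℕ V)                          ≈⟨ *-congˡ (fromℕ-+ (suc n) V) ⟨
          M ^ n * E * fromℕ Q * fromℕ (suc n ℕ.+ V)              ≈⟨ ≈-trans (*-assoc (M ^ n * E) _ _) (*-congˡ (≈-sym (fromℕ-* Q (suc n ℕ.+ V)))) ⟩
          M ^ n * E * fromℕ (Q ℕ.* (suc n ℕ.+ V))                ≤⟨ *-monoʳ-≤ (*-nonNegative (^-nonNegative n 0≤M) 0≤E) (fromℕ-mono time-poly) ⟩
          M ^ n * E * fromℕ (eval Tp n)                          ∎

theorem1 : ∀ {c ℓ₁ ℓ₂} (R : ArchimedeanOrderedField c ℓ₁ ℓ₂) →
    let open ArchimedeanOrderedField R
        open Quantities R
    in
    (k : ℕ) → 1 ℕ.≤ k →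
    (p q c* a b : Carrier) →
    0# ≤ p → p ≤ 1# →
    0# ≤ q → q ≤ 1# →
    0# ≤ c* → c* ≤ 1# →
    1# ≤ a → 1# ≤ b →
    q / b ≈ 1# - c* / 2# →
    let params = p ∷ q ∷ c* ∷ a ∷ b ∷ []
    in
    ∃[ A ] (RunsInTime params k A a ×
            SucceedsWithProbability params k A (λ F → c* ≤ criticalFraction F) p) →
    ∃[ A′ ] (RunsInTime params k A′ (max a b) ×
             SucceedsWithProbability params k A′ (λ _ → ⊤) (min p q))
theorem1 R k _ p q c* a b 0≤p p≤1 0≤q q≤1 0≤c* c*≤1 1≤a 1≤b q/b (A , (fA , fA-little , timeA) , (gA , gA-little , probA)) =
  A″ , (time , time-little , runs) , (λ n → 2 ℕ.+ g̃ n) , littleO-+ (littleO-const 2) (littleO-runningMax gA-little) , succeeds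
  where
  open FieldProperties R
  open Quantities R
  open Mean R
  open Probability R
  open Final R k p q c* a b using (params; δ)
  open Final.Hypotheses.Combined R k p q c* a b 0≤p p≤1 0≤q q≤1 0≤c* c*≤1 1≤a 1≤b q/b A fA timeA gA probA
    renaming (A′ to A″)
  open PosetReasoning poset

  polynomial : ∃[ g ] (LittleO g × ∀ n → eval Tp n ℕ.≤ 2 ℕ.^ g n)
  polynomial = poly-subexponential Tp

  time : ℕ → ℕ
  time n = f̃ n ℕ.+ proj₁ polynomial n

  time-little : LittleO time
  time-little = littleO-+ (littleO-runningMax fA-little) (proj₁ (proj₂ polynomial))

  runs : ∀ {n} (F : CNF n) → WidthAtMost k F → ∃[ T ] (HaltsWithin δ A″ F T × fromℕ T ≤ max a b ^ n * 2# ^ time n)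
  runs {n} F w = _ , Execution.Reach.halts reach ℕ.≤-refl , (begin
      _                                                           ≤⟨ time-bound ⟩
      max a b ^ n * 2# ^ f̃ n * fromℕ (eval Tp n)                  ≤⟨ *-monoʳ-≤ (*-nonNegative (^-nonNegative n 0≤max) (^-nonNegative (f̃ n) 0≤2)) (fromℕ-mono (proj₂ (proj₂ polynomial) n)) ⟩
      max a b ^ n * 2# ^ f̃ n * fromℕ (2 ℕ.^ proj₁ polynomial n)   ≈⟨ ≈-trans (*-assoc _ _ _) (*-congˡ (*-congˡ (fromℕ-^ 2 (proj₁ polynomial n)))) ⟩
      max a b ^ n * (2# ^ f̃ n * 2# ^ proj₁ polynomial n)          ≈⟨ *-congˡ (^-homo-* 2# (f̃ n) (proj₁ polynomial n)) ⟨
      max a b ^ n * 2# ^ time n                                   ∎)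
    where
    open PerFormula F w
    0≤max : 0# ≤ max a b
    0≤max = ≤-trans (≤-trans 0≤1 1≤a) (Max.x≤x⊔y totalOrder a b)

  succeeds : ∀ {n} (F : CNF n) → WidthAtMost k F → Satisfiable F → ⊤ → ∀ T → HaltsWithin δ A″ F T →
             min p q ^ n * ½ ^ (2 ℕ.+ g̃ n) ≤ Pr (findsSolution? {T = T} δ A″ F)
  succeeds F w sat _ T halting = ≤-trans (success-lower sat) (≤-trans (Execution.Reach.payoff reach T halting) (solved≤Pr δ A″ F halting))
    where open PerFormula F w
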